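{- For all partitions $\lambda_1,\lambda_2,\mu_1,\mu_2$, the product of Remmel–Whitney basis elements expands in the Remmel–Whitney basis as \[ w_{\lambda_1,\lambda_2}\, w_{\mu_1,\mu_2}=\sum_{\gamma_1,\gamma_2} c^{\gamma_1}_{\lambda_1\mu_1}\, c^{\gamma_2}_{\lambda_2\mu_2}\, w_{\gamma_1,\gamma_2}, \] the sum running over all pairs of partitions $(\gamma_1,\gamma_2)$. That is, the structure constants of the Remmel–Whitney basis coincide with those of the basis $\{s_{\alpha_1,\alpha_2}\}$.
   Context: Partitions are identified with Young diagrams in English notation (rows numbered $1,2,\dots$ from top to bottom, columns from left to right). For partitions $\beta\subseteq\alpha$, $\alpha/\beta$ is the skew shape; a standard tableau of shape $\alpha/\beta$ is a bijective filling of its boxes by $1,\dots,|\alpha|-|\beta|$ increasing along rows and down columns. $c^{\lambda}_{\mu\nu}$ denotes the Littlewood–Richardson coefficient (coefficient of $s_\lambda$ in $s_\mu s_\nu$). For a skew shape $\alpha/\beta$, the reverse lexicographic filling $\mathrm{rl}(\alpha/\beta)$ writes $1,\dots,|\alpha|-|\beta|$ into the boxes of $\alpha/\beta$ from right to left along each row, rows taken from top to bottom. For skew shapes $\gamma/\delta$, $\alpha/\beta$, the Remmel–Whitney set $\mathrm{RW}_{\gamma/\delta}(\alpha/\beta)$ is the set of standard tableaux $T$ of shape $\gamma/\delta$ such that: (i) whenever $i,i+1$ lie in the same row of $\mathrm{rl}(\alpha/\beta)$, the entry $i+1$ of $T$ lies strictly to the right of and weakly above the entry $i$; (ii) whenever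 $i$ lies directly above $j$ in the same column of $\mathrm{rl}(\alpha/\beta)$, the entry $j$ of $T$ lies strictly below and weakly to the left of the entry $i$. Let $\Lambda_1,\Lambda_2$ be the rings of symmetric functions in $x_1,x_2,\dots$ and $y_1,y_2,\dots$, and $s_{\alpha_1,\alpha_2}=s_{\alpha_1}(x)s_{\alpha_2}(y)\in\Lambda_1\otimes_{\mathbb Z}\Lambda_2$. The Remmel–Whitney quiver has as vertices all pairs of partitions; for distinct pairs $(\alpha_1,\alpha_2)\neq(\beta_1,\beta_2)$ with $\alpha_1\subseteq\beta_1$, $\beta_2\subseteq\alpha_2$ there is one arrow $a_T:(\alpha_1,\alpha_2)\to(\beta_1,\beta_2)$ for each $T\in\mathrm{RW}_{\beta_1/\alpha_1}(\alpha_2/\beta_2)$. Let $t(a)$ be the target of $a$ and $\mathrm{Arr}_{(\alpha_1,\alpha_2)}$ the set of arrows with source $(\alpha_1,\alpha_2)$. The Remmel–Whitney basis is defined recursively on $|\alpha_2|$ (arrows strictly decrease the size of the second partition) by $w_{\alpha_1,\alpha_2}=s_{\alpha_1,\alpha_2}-\sum_{a\in\mathrm{Arr}_{(\alpha_1,\alpha_2)}} w_{t(a)}$. -}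

module Defs where

open import Data.Nat using (ℕ; zero; suc; _+_; _∸_; _≡ᵇ_; _≤ᵇ_; _<ᵇ_; _⊓_; _<_; _≥_)
open import Data.Integer as ℤ using (ℤ)
open import Data.List using (List; []; _∷_; map; concatMap; filterᵇ; length; upTo; reverse; foldr; zip; applyUpTo; any)
open import Data.List.Relation.Unary.All using (All)
open import Data.Nat.ListAction using (sum)
open import Data.List.Relation.Unary.Linked using (Linked)
open import Data.Bool using (Bool; true; false; _∧_; _∨_; not; if_then_else_)
open import Relation.Binary.PropositionalEquality using (_≡_)
open import Data.Product using (_×_; _,_; proj₁; proj₂)

all : {A : Set} → (A → Bool) → List A → Bool
all p = foldr (λ x r → p x ∧ r) true

IsPartition : List ℕ → Set
IsPartition p = All (λ x → 0 < x) p × Linked _≥_ p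

part : List ℕ → ℕ → ℕ
part []       _       = 0
part (x ∷ _)  zero    = x
part (_ ∷ xs) (suc i) = part xs i

size : List ℕ → ℕ
size = sum

range : ℕ → ℕ → List ℕ
range m n = applyUpTo (m +_) (n ∸ m)

partsB : ℕ → ℕ → ℕ → List (List ℕ)
partsB _       zero    _ = [] ∷ []
partsB zero    (suc _) _ = []
partsB (suc f) (suc n) m =
  concatMap (λ k → map (k ∷_) (partsB f (suc n ∸ k) k)) (range 1 (suc (m ⊓ suc n)))

partitions : ℕ → List (List ℕ)
partitions n = partsB n n n

contained : List ℕ → List ℕ → Bool
contained β α = all (λ i → part β i ≤ᵇ part α i) (upTo (length β))

eqList : List ℕ → List ℕ → Bool
eqList []       []       = true
eqList (x ∷ xs) (y ∷ ys) = (x ≡ᵇ y) ∧ eqList xs ys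
eqList _        _        = false

-- Cells (row, column), 0-based, English notation

Cell : Set
Cell = ℕ × ℕ

rowCells : List ℕ → List ℕ → ℕ → List Cell
rowCells α β i = map (i ,_) (range (part β i) (part α i))

skewCells : List ℕ → List ℕ → List Cell
skewCells α β = concatMap (rowCells α β) (upTo (length α))

-- boxes of α/β in the order of the reverse lexicographic filling rl(α/β):
-- the k-th element (k = 0,1,..) is the box containing k+1
rlCells : List ℕ → List ℕ → List Cell
rlCells α β = concatMap (λ i → reverse (rowCells α β i)) (upTo (length α))

eqCell : Cell → Cell → Bool
eqCell (a , b) (c , d) = (a ≡ᵇ c) ∧ (b ≡ᵇ d)

Filling : Set
Filling = List (Cell × ℕ)

words : ℕ → List ℕ → List (List ℕ)
words zero    vs = [] ∷ []
words (suc k) vs = concatMap (λ v → map (v ∷_) (words k vs)) vs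

fillings : List Cell → List ℕ → List Filling
fillings cs vs = map (zip cs) (words (length cs) vs)

count : ℕ → Filling → ℕ
count v F = length (filterᵇ (λ e → proj₂ e ≡ᵇ v) F)

rowColOK : Bool → Filling → Bool
rowColOK strict F =
  all (λ e → all (λ f → check e f) F) F
  where
  check : Cell × ℕ → Cell × ℕ → Bool
  check ((r , c) , v) ((r' , c') , v') =
    (if (r ≡ᵇ r') ∧ (c' ≡ᵇ suc c)
       then (if strict then v <ᵇ v' else v ≤ᵇ v') else true)
    ∧ (if (c ≡ᵇ c') ∧ (r' ≡ᵇ suc r) then v <ᵇ v' else true)

ssyt : List ℕ → List ℕ → List ℕ → List Filling
ssyt α β a =
  if contained β α
    then filterᵇ (λ F → rowColOK false F ∧ all (λ i → count (suc i) F ≡ᵇ part a i) (upTo (length a)))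
                 (fillings (skewCells α β) (range 1 (suc (length a))))
    else []

standard : List ℕ → List ℕ → List Filling
standard α β =
  if contained β α
    then filterᵇ (λ F → rowColOK true F ∧ all (λ v → count v F ≡ᵇ 1) (range 1 (suc n)))
                 (fillings (skewCells α β) (range 1 (suc n)))
    else []
  where n = length (skewCells α β)

-- Littlewood–Richardson coefficients (Littlewood–Richardson rule):
-- c^γ_{λμ} = number of SSYT of shape γ/λ and content μ whose reverse
-- reading word (rows right to left, top to bottom) is a lattice word.

readingWord : List ℕ → List ℕ → Filling → List ℕ
readingWord γ ν F = map (λ c → entryAt c F) (rlCells γ ν)
  where
  entryAt : Cell → Filling → ℕ
  entryAt c []            = 0
  entryAt c ((d , v) ∷ G) = if eqCell c d then v else entryAt c G

cnt : ℕ → List ℕ → ℕ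
cnt v w = length (filterᵇ (v ≡ᵇ_) w)

prefixes : List ℕ → List (List ℕ)
prefixes []       = [] ∷ []
prefixes (x ∷ xs) = [] ∷ map (x ∷_) (prefixes xs)

lattice : ℕ → List ℕ → Bool
lattice k w = all (λ p → all (λ i → cnt (suc (suc i)) p ≤ᵇ cnt (suc i) p) (upTo k)) (prefixes w)

LR : List ℕ → List ℕ → List ℕ → ℕ
LR γ ν μ = length (filterᵇ (λ F → lattice (length μ) (readingWord γ ν F)) (ssyt γ ν μ))

posOf : ℕ → Filling → Cell
posOf k []            = (0 , 0)
posOf k ((c , v) ∷ F) = if v ≡ᵇ k then c else posOf k F

-- box of rl(α/β) containing entry k (1-based)
rlPos : List ℕ → List ℕ → ℕ → Cell
rlPos α β k = go k (rlCells α β)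
  where
  go : ℕ → List Cell → Cell
  go _             []       = (0 , 0)
  go zero          _        = (0 , 0)
  go (suc zero)    (c ∷ _)  = c
  go (suc (suc j)) (_ ∷ cs) = go (suc j) cs

rwCond : List ℕ → List ℕ → Filling → Bool
rwCond α β T = condI ∧ condII
  where
  n = length (skewCells α β)
  es = range 1 (suc n)
  condI = all (λ i →
            if proj₁ (rlPos α β i) ≡ᵇ proj₁ (rlPos α β (suc i))
              then (proj₂ (posOf i T) <ᵇ proj₂ (posOf (suc i) T))
                   ∧ (proj₁ (posOf (suc i) T) ≤ᵇ proj₁ (posOf i T))
              else true)
          (range 1 n)
  condII = all (λ i → all (λ j →
             if (proj₂ (rlPos α β i) ≡ᵇ proj₂ (rlPos α β j))
                ∧ (proj₁ (rlPos α β j) ≡ᵇ suc (proj₁ (rlPos α β i)))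
               then (proj₁ (posOf i T) <ᵇ proj₁ (posOf j T))
                    ∧ (proj₂ (posOf j T) ≤ᵇ proj₂ (posOf i T))
               else true) es) es

RW : List ℕ → List ℕ → List ℕ → List ℕ → List Filling
RW γ δ α β =
  if (length (skewCells γ δ) ≡ᵇ length (skewCells α β)) ∧ contained β α
    then filterᵇ (rwCond α β) (standard γ δ)
    else []

-- Remmel–Whitney quiver: targets of the arrows out of (α₁, α₂),
-- listed once per arrow (i.e. once per tableau in the RW set).
-- Targets (β₁,β₂): β₂ ⊆ α₂, α₁ ⊆ β₁, (β₁,β₂) ≠ (α₁,α₂); a nonempty RW set
-- forces |β₁| = |α₁| + |α₂| - |β₂|, so only these β₁ are listed.

subpartitions : List ℕ → List (List ℕ)
subpartitions α = concatMap (λ k → filterᵇ (λ β → contained β α) (partitions k)) (upTo (suc (size α)))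

arrowTargets : List ℕ → List ℕ → List (List ℕ × List ℕ)
arrowTargets α₁ α₂ =
  concatMap (λ β₂ →
    concatMap (λ β₁ →
      if contained α₁ β₁ ∧ not (eqList β₁ α₁ ∧ eqList β₂ α₂)
        then map (λ _ → (β₁ , β₂)) (RW β₁ α₁ α₂ β₂)
        else [])
      (partitions (size α₁ + (size α₂ ∸ size β₂))))
    (subpartitions α₂)

-- Λ₁ ⊗ Λ₂ realised inside formal power series in x₁,x₂,… and y₁,y₂,…:
-- an element is its coefficient function; f a b = coefficient of
-- x^a y^b, where a, b are finite exponent vectors.

Sym2 : Set
Sym2 = List ℕ → List ℕ → ℤ

_≈S_ : Sym2 → Sym2 → Set
f ≈S g = ∀ a b → f a b ≡ g a b

infix 4 _≈S_

zeroS : Sym2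
zeroS _ _ = ℤ.0ℤ

_+S_ : Sym2 → Sym2 → Sym2
(f +S g) a b = f a b ℤ.+ g a b

_-S_ : Sym2 → Sym2 → Sym2
(f -S g) a b = f a b ℤ.- g a b

_·S_ : ℤ → Sym2 → Sym2
(k ·S f) a b = k ℤ.* f a b

sumS : List Sym2 → Sym2
sumS = foldr _+S_ zeroS

splits : List ℕ → List (List ℕ)
splits []       = [] ∷ []
splits (x ∷ xs) = concatMap (λ k → map (k ∷_) (splits xs)) (upTo (suc x))

minus : List ℕ → List ℕ → List ℕ
minus (x ∷ xs) (y ∷ ys) = (x ∸ y) ∷ minus xs ys
minus xs       []       = xs
minus []       _        = []

sumℤ : List ℤ → ℤ
sumℤ = foldr ℤ._+_ ℤ.0ℤ

_*S_ : Sym2 → Sym2 → Sym2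
(f *S g) a b =
  sumℤ (concatMap (λ a' → map (λ b' → f a' b' ℤ.* g (minus a a') (minus b b')) (splits b)) (splits a))

schurCoeff : List ℕ → List ℕ → ℕ
schurCoeff α a = length (ssyt α [] a)

s : List ℕ → List ℕ → Sym2
s α₁ α₂ a b = ℤ.+ (schurCoeff α₁ a) ℤ.* ℤ.+ (schurCoeff α₂ b)

wF : ℕ → List ℕ → List ℕ → Sym2
wF zero    α₁ α₂ = s α₁ α₂
wF (suc k) α₁ α₂ = s α₁ α₂ -S sumS (map (λ t → wF k (proj₁ t) (proj₂ t)) (arrowTargets α₁ α₂))

w : List ℕ → List ℕ → Sym2
w α₁ α₂ = wF (size α₂) α₁ α₂

{-# OPTIONS --safe #-}

-- Let Φ be the substitution (Φ f)(x; y) = f(x; x, y). It is multiplicative, and injective on the series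
-- that do not change when variables y of exponent 0 are dropped. Expanding s_{α₂}(x, y) along skew shapes,
-- the product rule s_{α₁} s_{α₂/β₂} = ∑_{β₁} #RW_{β₁/α₁}(α₂/β₂) s_{β₁} says that Φ s_α is the sum of s_α and
-- of the s_{t(a)} over all arrows a out of α. By induction Φ w_α = s_α, so the w_α multiply like the s_α,
-- and these multiply by the Littlewood–Richardson rule.
--
-- Both product rules are instances of s_ν s_{α/β} = ∑_γ L(γ/ν, α/β) s_γ, where L counts the semistandard
-- tableaux of shape γ/ν and content α − β whose reading word stays a partition when counted from β. In terms
-- of the matrix of multiplicities (row, letter) the two conditions on such a tableau are exchanged by
-- transposition. For the transposed count the rule is Stembridge's argument: multiply by ∏_{i<j} (xᵢ − xⱼ),
-- extract the coefficient of x^{γ+ρ}, and cancel the tableaux whose reading leaves the set of partitions by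
-- a Bender–Knuth involution applied to the part of the tableau that is still to be read.

module Submission where

open import Defs
open import Data.Bool using (Bool; true; false; T; _∧_; not; if_then_else_)
open import Data.Bool.Properties using (T?; ∧-zeroʳ)
open import Data.Empty using (⊥-elim)
open import Data.Integer as ℤ using (ℤ; _*_; 0ℤ; 1ℤ) renaming (_+_ to _⊕_; +_ to pos)
import Data.Integer.Properties as ℤₚ
import Data.Integer.Tactic.RingSolver as ℤ-solver
open import Data.List using (List; []; _∷_; _++_; map; concatMap; filter; filterᵇ; length; upTo; applyUpTo; replicate; reverse; zip)
import Data.List as L
import Data.List.Properties as Lₚ
open import Data.List.Membership.Propositional using (_∈_)
import Data.List.Membership.Propositional.Properties as ∈ₚ
open import Data.List.Membership.Propositional.Properties.WithK using (unique∧set⇒bag)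
open import Data.List.Relation.Binary.BagAndSetEquality using (∼bag⇒↭)
open import Data.List.Relation.Binary.Permutation.Propositional using (_↭_)
import Data.List.Relation.Binary.Permutation.Propositional as Perm
import Data.List.Relation.Binary.Permutation.Propositional.Properties as Permₚ
open import Data.List.Relation.Unary.All using (All; []; _∷_)
import Data.List.Relation.Unary.All as All
import Data.List.Relation.Unary.All.Properties as Allₚ
open import Data.List.Relation.Unary.AllPairs using ([]; _∷_)
open import Data.List.Relation.Unary.Any using (here; there)
import Data.List.Relation.Unary.Any.Properties as Anyₚ
open import Data.List.Relation.Unary.Linked using (Linked; []; [-]; _∷_)
open import Data.List.Relation.Unary.Unique.Propositional using (Unique)
import Data.List.Relation.Unary.Unique.Propositional.Properties as Uₚ
open import Data.Nat using (ℕ; zero; suc; _+_; _∸_; _≤_; _<_; _≥_; z≤n; s≤s; _⊔_; _⊓_; _≡ᵇ_; _≤ᵇ_; _<ᵇ_; _≟_; _≤?_; _<?_; pred)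
import Data.Nat as ℕ
open import Data.Nat.Properties
  using (*-monoˡ-≤; +-assoc; +-cancelʳ-≡; +-cancelʳ-≤; +-cancelˡ-<; +-cancelˡ-≡; +-cancelˡ-≤; +-comm; +-identityʳ;
    +-mono-≤; +-monoʳ-<; +-monoʳ-≤; +-monoˡ-<; +-monoˡ-≤; +-suc; +-∸-assoc; +-∸-comm; 0∸n≡0; 1+n≢0; <-asym; <-cmp;
    <-irrefl; <-trans; <-≤-trans; <ᵇ⇒<; <⇒<ᵇ; <⇒≢; <⇒≤; <⇒≱; [m+n]∸[m+o]≡n∸o; allUpTo?; m+[n∸m]≡n; m+n∸m≡n; m+n∸n≡m;
    m+n≡0⇒n≡0; m+n≤o⇒m≤o∸n; m<m+n; m<n⇒m<1+n; m∸[m∸n]≡n; m∸n+n≡m; m∸n≡0⇒m≤n; m∸n≤m; m≤m+n; m≤m⊔n; m≤n+m; m≤n+m∸n;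
    m≤n+o⇒m∸n≤o; m≤n⇒m<n∨m≡n; m≤n⇒m∸n≡0; m≤n⇒m≤1+n; m≤n⇒m⊓n≡m; m≤n⇒m⊔n≡n; m≤n⊔m; m≥n⇒m⊓n≡n; m≥n⇒m⊔n≡m; m⊓n≤m; m⊓n≤n;
    n<1+n; n∸n≡0; n≤0⇒n≡0; n≤1+n; n≮0; suc-injective; ∸-+-assoc; ∸-monoʳ-<; ∸-monoˡ-<; ∸-monoˡ-≤; ≡ᵇ⇒≡; ≡⇒≡ᵇ;
    ≤-<-trans; ≤-antisym; ≤-pred; ≤-refl; ≤-reflexive; ≤-total; ≤-trans; ≤ᵇ⇒≤; ≤⇒≤ᵇ; ≤⇒≯; ≤∧≢⇒<; ≮⇒≥; ≰⇒>; ⊓-comm;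
    ⊓-glb; ⊔-lub)
import Data.Nat.Tactic.RingSolver as ℕ-solver
open import Data.Product using (∃; _×_; _,_; proj₁; proj₂)
open import Data.Sum using (_⊎_; inj₁; inj₂)
open import Data.Unit using (tt)
open import Function using (_∘_; id)
open import Function.Bundles using (mk⇔)
open import Relation.Binary.PropositionalEquality using (_≡_; _≢_; refl; sym; trans; cong; cong₂; subst; subst₂)
open import Relation.Binary.Definitions using (tri<; tri≈; tri>)
open import Relation.Nullary using (¬_; Dec; yes; no; does; ¬?; _×-dec_)
open import Relation.Nullary.Decidable using (map′; dec-true; dec-false)

-- The extraction runs over the tableaux of the skew factor, so it produces fillings of α/β counted
-- from ν, whereas `LR` and `RW` both fill γ/ν; this mismatch is the reason for exchanging rows and
-- letters.
--
-- The extraction asks little of its first factor: symmetry, and the coefficients at ζ + ρ, for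
-- dominant ζ, of its product with the differences. It is therefore run twice. With the series 1 it
-- shows that s_ν has just one such coefficient, at ν + ρ, equal to 1; with s_ν in place of 1 it
-- then yields the product rule.
--
-- Antisymmetry needs a fixed number n of variables, while the exponent lists in `Sym2` have any
-- length. The expansion is proved for n large compared with all shapes involved, and shorter lists
-- are reached by adding exponents 0.
--
-- On the Schur basis Φ is unitriangular with the arrows as its off-diagonal entries, and the
-- recursion for w is the inversion of this matrix.

-- Finite integer sums, and bijections between duplicate-free enumerations

module Sums where

  ∑ : {A : Set} → List A → (A → ℤ) → ℤ
  ∑ []       f = 0ℤ
  ∑ (x ∷ xs) f = f x ⊕ ∑ xs f

  ∑-cong : {A : Set} (xs : List A) {f g : A → ℤ} → (∀ x → x ∈ xs → f x ≡ g x) → ∑ xs f ≡ ∑ xs g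
  ∑-cong []       e = refl
  ∑-cong (x ∷ xs) e = cong₂ _⊕_ (e x (here refl)) (∑-cong xs (λ y y∈ → e y (there y∈)))

  ∑-cong′ : {A : Set} (xs : List A) {f g : A → ℤ} → (∀ x → f x ≡ g x) → ∑ xs f ≡ ∑ xs g
  ∑-cong′ xs e = ∑-cong xs (λ x _ → e x)

  ∑-++ : {A : Set} (xs ys : List A) (f : A → ℤ) → ∑ (xs ++ ys) f ≡ ∑ xs f ⊕ ∑ ys f
  ∑-++ []       ys f = sym (ℤₚ.+-identityˡ _)
  ∑-++ (x ∷ xs) ys f = trans (cong (f x ⊕_) (∑-++ xs ys f)) (sym (ℤₚ.+-assoc (f x) _ _))

  ∑-map : {A B : Set} (k : A → B) (xs : List A) (f : B → ℤ) → ∑ (map k xs) f ≡ ∑ xs (f ∘ k)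
  ∑-map k []       f = refl
  ∑-map k (x ∷ xs) f = cong (f (k x) ⊕_) (∑-map k xs f)

  ∑-concatMap : {A B : Set} (k : A → List B) (xs : List A) (f : B → ℤ) →
    ∑ (concatMap k xs) f ≡ ∑ xs (λ x → ∑ (k x) f)
  ∑-concatMap k []       f = refl
  ∑-concatMap k (x ∷ xs) f = trans (∑-++ (k x) _ f) (cong (∑ (k x) f ⊕_) (∑-concatMap k xs f))

  ∑-zero : {A : Set} (xs : List A) {f : A → ℤ} → (∀ x → x ∈ xs → f x ≡ 0ℤ) → ∑ xs f ≡ 0ℤ
  ∑-zero []       e = refl
  ∑-zero (x ∷ xs) e = cong₂ _⊕_ (e x (here refl)) (∑-zero xs (λ y y∈ → e y (there y∈)))

  ∑-+ : {A : Set} (xs : List A) (f g : A → ℤ) → ∑ xs (λ x → f x ⊕ g x) ≡ ∑ xs f ⊕ ∑ xs g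
  ∑-+ []       f g = refl
  ∑-+ (x ∷ xs) f g = trans (cong ((f x ⊕ g x) ⊕_) (∑-+ xs f g)) (lem (f x) (g x) (∑ xs f) (∑ xs g))
    where
    lem : ∀ a b c d → (a ⊕ b) ⊕ (c ⊕ d) ≡ (a ⊕ c) ⊕ (b ⊕ d)
    lem = ℤ-solver.solve-∀

  ∑-*ˡ : {A : Set} (xs : List A) (c : ℤ) (f : A → ℤ) → ∑ xs (λ x → c * f x) ≡ c * ∑ xs f
  ∑-*ˡ []       c f = sym (ℤₚ.*-zeroʳ c)
  ∑-*ˡ (x ∷ xs) c f = trans (cong (c * f x ⊕_) (∑-*ˡ xs c f)) (sym (ℤₚ.*-distribˡ-+ c (f x) _))

  ∑-*ʳ : {A : Set} (xs : List A) (c : ℤ) (f : A → ℤ) → ∑ xs (λ x → f x * c) ≡ ∑ xs f * c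
  ∑-*ʳ xs c f = trans (∑-cong′ xs (λ x → ℤₚ.*-comm (f x) c)) (trans (∑-*ˡ xs c f) (ℤₚ.*-comm c _))

  ∑-neg : {A : Set} (xs : List A) (f : A → ℤ) → ∑ xs (λ x → ℤ.- f x) ≡ ℤ.- ∑ xs f
  ∑-neg []       f = refl
  ∑-neg (x ∷ xs) f = trans (cong (ℤ.- f x ⊕_) (∑-neg xs f)) (sym (ℤₚ.neg-distrib-+ (f x) _))

  ∑-swap : {A B : Set} (xs : List A) (ys : List B) (f : A → B → ℤ) →
    ∑ xs (λ x → ∑ ys (f x)) ≡ ∑ ys (λ y → ∑ xs (λ x → f x y))
  ∑-swap []       ys f = sym (∑-zero ys (λ _ _ → refl))
  ∑-swap (x ∷ xs) ys f = trans (cong (∑ ys (f x) ⊕_) (∑-swap xs ys f)) (sym (∑-+ ys (f x) _))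

  ∑-↭ : {A : Set} {xs ys : List A} (f : A → ℤ) → xs ↭ ys → ∑ xs f ≡ ∑ ys f
  ∑-↭ f Perm.refl         = refl
  ∑-↭ f (Perm.prep x p)   = cong (f x ⊕_) (∑-↭ f p)
  ∑-↭ f (Perm.swap x y p) = trans (cong (λ z → f x ⊕ (f y ⊕ z)) (∑-↭ f p)) (lem (f x) (f y) _)
    where
    lem : ∀ a b c → a ⊕ (b ⊕ c) ≡ b ⊕ (a ⊕ c)
    lem = ℤ-solver.solve-∀
  ∑-↭ f (Perm.trans p q)  = trans (∑-↭ f p) (∑-↭ f q)

  𝟙 : Bool → ℤ
  𝟙 true  = 1ℤ
  𝟙 false = 0ℤ

  [_]ᵈ : {P : Set} → Dec P → ℤ
  [ d ]ᵈ = 𝟙 (does d)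

  [yes] : {P : Set} (d : Dec P) → P → [ d ]ᵈ ≡ 1ℤ
  [yes] (yes _) p = refl
  [yes] (no ¬p) p = ⊥-elim (¬p p)

  [no] : {P : Set} (d : Dec P) → ¬ P → [ d ]ᵈ ≡ 0ℤ
  [no] (yes p) ¬p = ⊥-elim (¬p p)
  [no] (no _)  ¬p = refl

  [⇔] : {P Q : Set} (d : Dec P) (e : Dec Q) → (P → Q) → (Q → P) → [ d ]ᵈ ≡ [ e ]ᵈ
  [⇔] d (yes q) f g = [yes] d (g q)
  [⇔] d (no ¬q) f g = [no] d (¬q ∘ f)

  ∑-filter : {A : Set} {P : A → Set} (P? : ∀ x → Dec (P x)) (xs : List A) (f : A → ℤ) →
    ∑ (filter P? xs) f ≡ ∑ xs (λ x → [ P? x ]ᵈ * f x)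
  ∑-filter P? []       f = refl
  ∑-filter P? (x ∷ xs) f with P? x
  ... | yes _ = cong₂ _⊕_ (sym (ℤₚ.*-identityˡ (f x))) (∑-filter P? xs f)
  ... | no  _ = trans (∑-filter P? xs f) (sym (ℤₚ.+-identityˡ _))

  ∑-partition : {A : Set} {P : A → Set} (P? : ∀ x → Dec (P x)) (xs : List A) (f : A → ℤ) →
    ∑ xs f ≡ ∑ (filter P? xs) f ⊕ ∑ (filter (¬? ∘ P?) xs) f
  ∑-partition P? []       f = refl
  ∑-partition P? (x ∷ xs) f with P? x
  ... | yes _ = trans (cong (f x ⊕_) (∑-partition P? xs f)) (sym (ℤₚ.+-assoc (f x) _ _))
  ... | no  _ = trans (cong (f x ⊕_) (∑-partition P? xs f)) (lem (f x) (∑ (filter P? xs) f) (∑ (filter (¬? ∘ P?) xs) f))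
    where
    lem : ∀ a b c → a ⊕ (b ⊕ c) ≡ b ⊕ (a ⊕ c)
    lem = ℤ-solver.solve-∀

  ∑-length : {A : Set} (xs : List A) → pos (length xs) ≡ ∑ xs (λ _ → 1ℤ)
  ∑-length []       = refl
  ∑-length (x ∷ xs) = trans (ℤₚ.pos-+ 1 (length xs)) (cong (1ℤ ⊕_) (∑-length xs))

  -- A finite set as a duplicate-free list of the elements with P. Bijections can then be given by
  -- maps on all of A that are controlled only where P holds.
  record Enum {A : Set} (P : A → Set) : Set where
    field
      elems    : List A
      unique   : Unique elems
      sound    : ∀ {x} → x ∈ elems → P x
      complete : ∀ {x} → P x → x ∈ elems
  open Enum

  Unique-map : {A B : Set} (f : A → B) (xs : List A) →
    (∀ {x y} → x ∈ xs → y ∈ xs → f x ≡ f y → x ≡ y) → Unique xs → Unique (map f xs)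
  Unique-map f []       inj _       = []
  Unique-map f (x ∷ xs) inj (p ∷ u) =
    Allₚ.map⁺ (All.tabulate (λ y∈ e → All.lookup p y∈ (inj (here refl) (there y∈) e)))
    ∷ Unique-map f xs (λ a b → inj (there a) (there b)) u

  ∈-concatMap⁻ : {A B : Set} (k : A → List B) (xs : List A) {z : B} → z ∈ concatMap k xs → ∃ λ x → x ∈ xs × z ∈ k x
  ∈-concatMap⁻ k (y ∷ ys) z∈ with ∈ₚ.∈-++⁻ (k y) z∈
  ... | inj₁ p = y , here refl , p
  ... | inj₂ q = let (y′ , a , b) = ∈-concatMap⁻ k ys q in y′ , there a , b

  Unique-concatMap : {A B : Set} (k : A → List B) (xs : List A) → Unique xs → (∀ x → x ∈ xs → Unique (k x)) →
    (∀ {x y z} → x ∈ xs → y ∈ xs → z ∈ k x → z ∈ k y → x ≡ y) → Unique (concatMap k xs)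
  Unique-concatMap k []       _       _  _   = []
  Unique-concatMap k (x ∷ xs) (p ∷ u) uk inj =
    Uₚ.++⁺ (uk x (here refl)) (Unique-concatMap k xs u (λ y y∈ → uk y (there y∈)) (λ a b → inj (there a) (there b)))
      λ (z∈ , z∈′) → let (y , y∈ , z∈y) = ∈-concatMap⁻ k xs z∈′ in All.lookup p y∈ (inj (here refl) (there y∈) z∈ z∈y)

  ∈-concatMap⁺ : {A B : Set} (k : A → List B) (xs : List A) {z : B} {x : A} → x ∈ xs → z ∈ k x → z ∈ concatMap k xs
  ∈-concatMap⁺ k (x ∷ xs) (here refl) z∈ = ∈ₚ.∈-++⁺ˡ z∈
  ∈-concatMap⁺ k (y ∷ xs) (there x∈)  z∈ = ∈ₚ.∈-++⁺ʳ (k y) (∈-concatMap⁺ k xs x∈ z∈)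

  -- Duplicate-free lists with the same members are permutations of each other. Every bijective
  -- argument below, involutions included, ends in this lemma.
  ∑-bij : {A B : Set} {P : A → Set} {Q : B → Set} (d : Enum P) (e : Enum Q) (f : A → B) (g : B → A) →
    (∀ x → P x → Q (f x)) → (∀ y → Q y → P (g y)) →
    (∀ x → P x → g (f x) ≡ x) → (∀ y → Q y → f (g y) ≡ y) →
    (h : A → ℤ) (k : B → ℤ) → (∀ x → P x → h x ≡ k (f x)) →
    ∑ (elems d) h ≡ ∑ (elems e) k
  ∑-bij d e f g pf pg gf fg h k hk =
    trans (∑-cong (elems d) (λ x x∈ → hk x (sound d x∈)))
    (trans (sym (∑-map f (elems d) k))
      (∑-↭ k (∼bag⇒↭ (unique∧set⇒bag
        (Unique-map f (elems d) (λ {x} {y} x∈ y∈ q → trans (sym (gf x (sound d x∈))) (trans (cong g q) (gf y (sound d y∈)))) (unique d))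
        (unique e) (mk⇔ to from)))))
    where
    to : ∀ {y} → y ∈ map f (elems d) → y ∈ elems e
    to y∈ with x , x∈ , refl ← ∈ₚ.∈-map⁻ f y∈ = complete e (pf x (sound d x∈))
    from : ∀ {y} → y ∈ elems e → y ∈ map f (elems d)
    from {y} y∈ = subst (_∈ map f (elems d)) (fg y (sound e y∈)) (∈ₚ.∈-map⁺ f (complete d (pg y (sound e y∈))))

  ∑-same : {A : Set} {P Q : A → Set} (d : Enum P) (e : Enum Q) → (∀ x → P x → Q x) → (∀ x → Q x → P x) →
    (h : A → ℤ) → ∑ (elems d) h ≡ ∑ (elems e) h
  ∑-same d e f g h = ∑-bij d e id id f g (λ _ _ → refl) (λ _ _ → refl) h h (λ _ _ → refl)

  ∑-single : {A : Set} {P : A → Set} (d : Enum P) (a : A) → P a → (f : A → ℤ) →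
    (∀ x → P x → x ≢ a → f x ≡ 0ℤ) → ∑ (elems d) f ≡ f a
  ∑-single {P = P} d a pa f z = go (elems d) (unique d) (λ x∈ → sound d x∈) (complete d pa)
    where
    go : ∀ xs → Unique xs → (∀ {x} → x ∈ xs → P x) → a ∈ xs → ∑ xs f ≡ f a
    go (x ∷ xs) (p ∷ u) s (here refl) =
      trans (cong (f x ⊕_) (∑-zero xs (λ y y∈ → z y (s (there y∈)) (λ e → All.lookup p y∈ (sym e))))) (ℤₚ.+-identityʳ _)
    go (x ∷ xs) (p ∷ u) s (there a∈) =
      trans (cong₂ _⊕_ (z x (s (here refl)) (λ e → All.lookup p a∈ e)) (go xs u (s ∘ there) a∈)) (ℤₚ.+-identityˡ _)

  filterE : {A : Set} {P Q : A → Set} → Enum P → (∀ x → Dec (Q x)) → Enum (λ x → P x × Q x)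
  filterE d Q? = record
    { elems    = filter Q? (elems d)
    ; unique   = Uₚ.filter⁺ Q? (unique d)
    ; sound    = λ x∈ → let (a , b) = ∈ₚ.∈-filter⁻ Q? {xs = elems d} x∈ in sound d a , b
    ; complete = λ (p , q) → ∈ₚ.∈-filter⁺ Q? (complete d p) q
    }

  mapE : {A : Set} {P Q : A → Set} → Enum P → (∀ {x} → P x → Q x) → (∀ {x} → Q x → P x) → Enum Q
  mapE d f g = record { elems = elems d ; unique = unique d ; sound = f ∘ sound d ; complete = complete d ∘ g }

  pairE : {A B : Set} {P : A → Set} {Q : B → Set} → Enum P → Enum Q → Enum (λ (x : A × B) → P (proj₁ x) × Q (proj₂ x))
  pairE {P = P} {Q = Q} d e = record
    { elems    = concatMap (λ x → map (x ,_) (elems e)) (elems d)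
    ; unique   = Unique-concatMap _ (elems d) (unique d) (λ x _ → Uₚ.map⁺ (cong proj₂) (unique e))
        (λ {x} {y} _ _ z∈ z∈′ → let (_ , _ , p) = ∈ₚ.∈-map⁻ (x ,_) z∈ ; (_ , _ , q) = ∈ₚ.∈-map⁻ (y ,_) z∈′ in
          trans (sym (cong proj₁ p)) (cong proj₁ q))
    ; sound    = λ z∈ → let (x , x∈ , p) = ∈-concatMap⁻ _ (elems d) z∈ ; (y , y∈ , q) = ∈ₚ.∈-map⁻ (x ,_) p in
        subst P (sym (cong proj₁ q)) (sound d x∈) , subst Q (sym (cong proj₂ q)) (sound e y∈)
    ; complete = λ {(x , y)} (p , q) → ∈-concatMap⁺ _ (elems d) (complete d p) (∈ₚ.∈-map⁺ (x ,_) (complete e q))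
    }

  ∑-pair : {A B : Set} {P : A → Set} {Q : B → Set} (d : Enum P) (e : Enum Q) (f : A × B → ℤ) →
    ∑ (elems (pairE d e)) f ≡ ∑ (elems d) (λ x → ∑ (elems e) (λ y → f (x , y)))
  ∑-pair d e f = trans (∑-concatMap _ (elems d) f) (∑-cong′ (elems d) (λ x → ∑-map (x ,_) (elems e) f))

  ∑-cons : {A : Set} (vs : List A) (W : A → List (List A)) (f : List A → ℤ) →
    ∑ (concatMap (λ v → map (v ∷_) (W v)) vs) f ≡ ∑ vs (λ v → ∑ (W v) (λ u → f (v ∷ u)))
  ∑-cons vs W f = trans (∑-concatMap _ vs f) (∑-cong′ vs (λ v → ∑-map (v ∷_) (W v) f))

  Unique-cons : {A : Set} (vs : List A) (W : A → List (List A)) → Unique vs → (∀ v → Unique (W v)) →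
    Unique (concatMap (λ v → map (v ∷_) (W v)) vs)
  Unique-cons vs W u uW = Unique-concatMap _ vs u (λ v _ → Uₚ.map⁺ (λ { refl → refl }) (uW v))
    λ {x} {y} _ _ z∈ z∈′ → heads (∈ₚ.∈-map⁻ (x ∷_) z∈) (∈ₚ.∈-map⁻ (y ∷_) z∈′)
    where
    heads : ∀ {x y z} → (∃ λ l → l ∈ W x × z ≡ x ∷ l) → (∃ λ l → l ∈ W y × z ≡ y ∷ l) → x ≡ y
    heads (_ , _ , refl) (_ , _ , refl) = refl

  ∈-cons⁺ : {A : Set} (vs : List A) (W : A → List (List A)) {v : A} {u : List A} → v ∈ vs → u ∈ W v →
    v ∷ u ∈ concatMap (λ v → map (v ∷_) (W v)) vs
  ∈-cons⁺ vs W {v} v∈ u∈ = ∈-concatMap⁺ _ vs v∈ (∈ₚ.∈-map⁺ (v ∷_) u∈)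

  ∈-cons⁻ : {A : Set} (vs : List A) (W : A → List (List A)) {z : List A} →
    z ∈ concatMap (λ v → map (v ∷_) (W v)) vs → ∃ λ v → ∃ λ u → z ≡ v ∷ u × v ∈ vs × u ∈ W v
  ∈-cons⁻ vs W z∈ = let (v , v∈ , p) = ∈-concatMap⁻ _ vs z∈ ; (u , u∈ , q) = ∈ₚ.∈-map⁻ (v ∷_) p in v , u , q , v∈ , u∈

  -- `words` over an arbitrary alphabet: a table is a sequence of rows, and each row is a sequence
  -- of numbers.
  seqs : {A : Set} → ℕ → List A → List (List A)
  seqs zero    vs = [] ∷ []
  seqs (suc k) vs = concatMap (λ v → map (v ∷_) (seqs k vs)) vs

  words≡seqs : ∀ k vs → words k vs ≡ seqs k vs
  words≡seqs zero    vs = refl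
  words≡seqs (suc k) vs = cong (λ W → concatMap (λ v → map (v ∷_) W) vs) (words≡seqs k vs)

  seqsE : {A : Set} (k : ℕ) (vs : List A) → Unique vs → Enum (λ u → length u ≡ k × All (_∈ vs) u)
  seqsE k vs u = record
    { elems = seqs k vs ; unique = unique-seqs k ; sound = sound-seqs k ; complete = λ (l , a) → complete-seqs k l a }
    where
    unique-seqs : ∀ k → Unique (seqs k vs)
    unique-seqs zero    = [] ∷ []
    unique-seqs (suc k) = Unique-cons vs (λ _ → seqs k vs) u (λ _ → unique-seqs k)
    sound-seqs : ∀ k {z} → z ∈ seqs k vs → length z ≡ k × All (_∈ vs) z
    sound-seqs zero (here refl) = refl , []
    sound-seqs (suc k) z∈ with ∈-cons⁻ vs (λ _ → seqs k vs) z∈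
    ... | v , w , refl , v∈ , w∈ = let (l , a) = sound-seqs k w∈ in cong suc l , v∈ ∷ a
    complete-seqs : ∀ k {z} → length z ≡ k → All (_∈ vs) z → z ∈ seqs k vs
    complete-seqs zero    {[]}    l a       = here refl
    complete-seqs (suc k) {x ∷ z} l (p ∷ a) = ∈-cons⁺ vs (λ _ → seqs k vs) p (complete-seqs k (suc-injective l) a)

open Sums
open Enum

-- Semistandard tableaux as skew Gelfand-Tsetlin patterns, and skew Kostka numbers

module Patterns where

  sumTo : ℕ → (ℕ → ℕ) → ℕ
  sumTo zero    f = 0
  sumTo (suc n) f = sumTo n f + f n

  sumTo-cong : ∀ n {f g} → (∀ i → i < n → f i ≡ g i) → sumTo n f ≡ sumTo n g
  sumTo-cong zero    e = refl
  sumTo-cong (suc n) e = cong₂ _+_ (sumTo-cong n (λ i i< → e i (m<n⇒m<1+n i<))) (e n ≤-refl)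

  sumTo-+ : ∀ n f g → sumTo n (λ i → f i + g i) ≡ sumTo n f + sumTo n g
  sumTo-+ zero    f g = refl
  sumTo-+ (suc n) f g = trans (cong (_+ (f n + g n)) (sumTo-+ n f g)) (lem (sumTo n f) (sumTo n g) (f n) (g n))
    where
    lem : ∀ a b c d → (a + b) + (c + d) ≡ (a + c) + (b + d)
    lem = ℕ-solver.solve-∀

  sumTo-zero : ∀ n {f} → (∀ i → i < n → f i ≡ 0) → sumTo n f ≡ 0
  sumTo-zero zero    e = refl
  sumTo-zero (suc n) e = cong₂ _+_ (sumTo-zero n (λ i i< → e i (m<n⇒m<1+n i<))) (e n ≤-refl)

  sumTo-mono : ∀ n {f g} → (∀ i → i < n → f i ≤ g i) → sumTo n f ≤ sumTo n g
  sumTo-mono zero    e = z≤n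
  sumTo-mono (suc n) e = +-mono-≤ (sumTo-mono n (λ i i< → e i (m<n⇒m<1+n i<))) (e n ≤-refl)

  sumTo-≤ : ∀ {m n} f → m ≤ n → sumTo m f ≤ sumTo n f
  sumTo-≤ {m} {zero}  f z≤n = z≤n
  sumTo-≤ {m} {suc n} f m≤ with m≤n⇒m<n∨m≡n m≤
  ... | inj₁ (s≤s q) = ≤-trans (sumTo-≤ f q) (m≤m+n _ _)
  ... | inj₂ refl    = ≤-refl

  sumTo-extend : ∀ {m n} f → m ≤ n → (∀ i → m ≤ i → f i ≡ 0) → sumTo n f ≡ sumTo m f
  sumTo-extend {m} {zero}  f z≤n z = refl
  sumTo-extend {m} {suc n} f m≤  z with m≤n⇒m<n∨m≡n m≤
  ... | inj₁ (s≤s q) = trans (cong₂ _+_ (sumTo-extend f q z) (z n q)) (+-identityʳ _)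
  ... | inj₂ refl    = refl

  sumTo-first : ∀ n f → sumTo (suc n) f ≡ f 0 + sumTo n (f ∘ suc)
  sumTo-first zero    f = +-comm 0 (f 0)
  sumTo-first (suc n) f = trans (cong (_+ f (suc n)) (sumTo-first n f)) (+-assoc (f 0) _ _)

  sumTo-swap : ∀ m n (f : ℕ → ℕ → ℕ) → sumTo m (λ i → sumTo n (f i)) ≡ sumTo n (λ j → sumTo m (λ i → f i j))
  sumTo-swap zero    n f = sym (sumTo-zero n (λ _ _ → refl))
  sumTo-swap (suc m) n f = trans (cong (_+ sumTo n (f m)) (sumTo-swap m n f)) (sym (sumTo-+ n _ (f m)))

  -- The sum of f over i ≤ j < R, by recursion instead of as a difference of two `sumTo`, so that no
  -- truncated subtraction enters.
  tailTo : ℕ → (ℕ → ℕ) → ℕ → ℕ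
  tailTo zero    f i       = 0
  tailTo (suc R) f zero    = f 0 + tailTo R (f ∘ suc) 0
  tailTo (suc R) f (suc i) = tailTo R (f ∘ suc) i

  tailTo-step : ∀ R f i → i < R → tailTo R f i ≡ f i + tailTo R f (suc i)
  tailTo-step (suc R) f zero    i<       = refl
  tailTo-step (suc R) f (suc i) (s≤s i<) = tailTo-step R (f ∘ suc) i i<

  tailTo-end : ∀ R f i → R ≤ i → tailTo R f i ≡ 0
  tailTo-end zero    f i       R≤       = refl
  tailTo-end (suc R) f (suc i) (s≤s R≤) = tailTo-end R (f ∘ suc) i R≤

  tailTo-cong : ∀ R {f g} i → (∀ j → i ≤ j → f j ≡ g j) → tailTo R f i ≡ tailTo R g i
  tailTo-cong zero    i       e = refl
  tailTo-cong (suc R) zero    e = cong₂ _+_ (e 0 z≤n) (tailTo-cong R 0 (λ j _ → e (suc j) z≤n))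
  tailTo-cong (suc R) (suc i) e = tailTo-cong R i (λ j i≤ → e (suc j) (s≤s i≤))

  sumTo+tailTo : ∀ R f i → i ≤ R → sumTo i f + tailTo R f i ≡ sumTo R f
  sumTo+tailTo R f i i≤ = trans (up i i≤) (trans (sym (up R ≤-refl)) (trans (cong (sumTo R f +_) (tailTo-end R f R ≤-refl)) (+-identityʳ _)))
    where
    up : ∀ i → i ≤ R → sumTo i f + tailTo R f i ≡ tailTo R f 0
    up zero    i≤ = refl
    up (suc i) i≤ = trans (trans (+-assoc (sumTo i f) (f i) _) (cong (sumTo i f +_) (sym (tailTo-step R f i i≤))))
      (up i (≤-trans (n≤1+n i) i≤))

  row : List (List ℕ) → ℕ → List ℕ
  row []      _       = []
  row (r ∷ T) zero    = r
  row (r ∷ T) (suc i) = row T i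

  -- Reads 0 outside the table. This default matters: the conditions in `GT` range over all rows,
  -- and beyond the table they compare zeros.
  get : List (List ℕ) → ℕ → ℕ → ℕ
  get T i = part (row T i)

  tab : ℕ → ℕ → (ℕ → ℕ → ℕ) → List (List ℕ)
  tab R C f = applyUpTo (λ i → applyUpTo (f i) C) R

  part-≥ : ∀ l i → length l ≤ i → part l i ≡ 0
  part-≥ []      i       _       = refl
  part-≥ (x ∷ l) (suc i) (s≤s p) = part-≥ l i p

  part-applyUpTo : ∀ (g : ℕ → ℕ) C {j} → j < C → part (applyUpTo g C) j ≡ g j
  part-applyUpTo g (suc C) {zero}  _       = refl
  part-applyUpTo g (suc C) {suc j} (s≤s p) = part-applyUpTo (g ∘ suc) C p

  applyUpTo-part : ∀ l → applyUpTo (part l) (length l) ≡ l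
  applyUpTo-part []      = refl
  applyUpTo-part (x ∷ l) = cong (x ∷_) (applyUpTo-part l)

  applyUpTo-cong : {A : Set} {f g : ℕ → A} → ∀ C → (∀ j → j < C → f j ≡ g j) → applyUpTo f C ≡ applyUpTo g C
  applyUpTo-cong zero    e = refl
  applyUpTo-cong (suc C) e = cong₂ _∷_ (e 0 (s≤s z≤n)) (applyUpTo-cong C (λ j j< → e (suc j) (s≤s j<)))

  applyUpTo-++ : {A : Set} (f : ℕ → A) (a b : ℕ) → applyUpTo f (a + b) ≡ applyUpTo f a ++ applyUpTo (λ j → f (a + j)) b
  applyUpTo-++ f zero    b = refl
  applyUpTo-++ f (suc a) b = cong (f 0 ∷_) (applyUpTo-++ (f ∘ suc) a b)

  All-applyUpTo : {A : Set} {P : A → Set} (f : ℕ → A) → ∀ n → (∀ i → i < n → P (f i)) → All P (applyUpTo f n)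
  All-applyUpTo f zero    h = []
  All-applyUpTo f (suc n) h = h 0 (s≤s z≤n) ∷ All-applyUpTo (f ∘ suc) n (λ i i< → h (suc i) (s≤s i<))

  part-ext : ∀ {l l′} → length l ≡ length l′ → (∀ i → i < length l → part l i ≡ part l′ i) → l ≡ l′
  part-ext {[]}    {[]}     _ _ = refl
  part-ext {x ∷ l} {y ∷ l′} q e = cong₂ _∷_ (e 0 (s≤s z≤n)) (part-ext (suc-injective q) (λ i i< → e (suc i) (s≤s i<)))

  part≤size : ∀ l i → part l i ≤ size l
  part≤size []      i       = z≤n
  part≤size (x ∷ l) zero    = m≤m+n x _
  part≤size (x ∷ l) (suc i) = ≤-trans (part≤size l i) (m≤n+m _ x)

  size≡sumTo : ∀ l n → length l ≤ n → size l ≡ sumTo n (part l)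
  size≡sumTo []      n       _       = sym (sumTo-zero n (λ _ _ → refl))
  size≡sumTo (x ∷ l) (suc n) (s≤s p) = trans (cong (_+_ x) (size≡sumTo l n p)) (sym (sumTo-first n (part (x ∷ l))))

  row-applyUpTo : ∀ (f : ℕ → List ℕ) R {i} → i < R → row (applyUpTo f R) i ≡ f i
  row-applyUpTo f (suc R) {zero}  _       = refl
  row-applyUpTo f (suc R) {suc i} (s≤s p) = row-applyUpTo (f ∘ suc) R p

  row-≥ : ∀ T i → length T ≤ i → row T i ≡ []
  row-≥ []      i       _       = refl
  row-≥ (r ∷ T) (suc i) (s≤s p) = row-≥ T i p

  get-tab : ∀ R C f {i j} → i < R → j < C → get (tab R C f) i j ≡ f i j
  get-tab R C f {i} {j} i< j< = trans (cong (λ r → part r j) (row-applyUpTo (λ i → applyUpTo (f i) C) R i<)) (part-applyUpTo (f i) C j<)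

  IsTab : ℕ → ℕ → List (List ℕ) → Set
  IsTab R C T = length T ≡ R × All (λ r → length r ≡ C) T

  tab-isTab : ∀ R C f → IsTab R C (tab R C f)
  tab-isTab R C f = Lₚ.length-applyUpTo _ R , All-applyUpTo _ R (λ i _ → Lₚ.length-applyUpTo (f i) C)

  get-≥ : ∀ {R C T} → IsTab R C T → ∀ {i} j → R ≤ i → get T i j ≡ 0
  get-≥ {T = T} (l , _) {i} j R≤ = cong (λ r → part r j) (row-≥ T i (subst (_≤ i) (sym l) R≤))

  tab-get : ∀ {R C T} → IsTab R C T → tab R C (get T) ≡ T
  tab-get {T = []}    (refl , _)       = refl
  tab-get {T = r ∷ T} (refl , p ∷ all) = cong₂ _∷_ (trans (cong (applyUpTo (part r)) (sym p)) (applyUpTo-part r)) (tab-get (refl , all))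

  tab-cong : ∀ R C {f g} → (∀ i j → i < R → j < C → f i j ≡ g i j) → tab R C f ≡ tab R C g
  tab-cong R C e = applyUpTo-cong R (λ i i< → applyUpTo-cong C (λ j j< → e i j i< j<))

  tab-ext : ∀ {R C T T′} → IsTab R C T → IsTab R C T′ → (∀ i j → i < R → j < C → get T i j ≡ get T′ i j) → T ≡ T′
  tab-ext {R} {C} t t′ e = trans (sym (tab-get t)) (trans (tab-cong R C e) (tab-get t′))

  -- p i j is the length of row i of the shape formed by the entries ≤ j of a semistandard tableau
  -- of shape α/β with entries in 1,…,n (a skew Gelfand–Tsetlin pattern).
  record GT (n : ℕ) (α β : ℕ → ℕ) (p : ℕ → ℕ → ℕ) : Set where
    constructor gt
    field
      start  : ∀ i → p i 0 ≡ β i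
      end    : ∀ i → p i n ≡ α i
      mono   : ∀ i j → j < n → p i j ≤ p i (suc j)
      strict : ∀ i j → j < n → p (suc i) (suc j) ≤ p i j
  open GT

  GT-mono : ∀ {n α β p} → GT n α β p → ∀ i {j k} → j ≤ k → k ≤ n → p i j ≤ p i k
  GT-mono {p = p} g i {j} {zero}  z≤n k≤ = ≤-refl
  GT-mono {p = p} g i {j} {suc k} j≤  k≤ with m≤n⇒m<n∨m≡n j≤
  ... | inj₁ (s≤s q) = ≤-trans (GT-mono g i q (<⇒≤ k≤)) (mono g i k k≤)
  ... | inj₂ refl    = ≤-refl

  GT-≤end : ∀ {n α β p} → GT n α β p → ∀ i {j} → j ≤ n → p i j ≤ α i
  GT-≤end g i j≤ = ≤-trans (GT-mono g i j≤ ≤-refl) (≤-reflexive (end g i))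

  GT-≥start : ∀ {n α β p} → GT n α β p → ∀ i {j} → j ≤ n → β i ≤ p i j
  GT-≥start g i j≤ = ≤-trans (≤-reflexive (sym (start g i))) (GT-mono g i z≤n j≤)

  GT-cong : ∀ {n α β p q} → (∀ i j → j ≤ n → q i j ≡ p i j) → GT n α β p → GT n α β q
  GT-cong {n} e g = gt
    (λ i → trans (e i 0 z≤n) (start g i))
    (λ i → trans (e i n ≤-refl) (end g i))
    (λ i j j< → subst₂≤ (sym (e i j (<⇒≤ j<))) (sym (e i (suc j) j<)) (mono g i j j<))
    (λ i j j< → subst₂≤ (sym (e (suc i) (suc j) j<)) (sym (e i j (<⇒≤ j<))) (strict g i j j<))
    where
    subst₂≤ : ∀ {a b c d} → a ≡ c → b ≡ d → a ≤ b → c ≤ d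
    subst₂≤ refl refl x = x

  -- Patterns are stored as tables with R rows and n + 1 columns: tables with equal entries are
  -- equal, which functions would not be, so they can be enumerated and matched under bijections.
  Arr : ℕ → ℕ → List ℕ → List ℕ → List (List ℕ) → Set
  Arr R n α β T = IsTab R (suc n) T × GT n (part α) (part β) (get T)

  -- Rows from R on vanish because α does, so storing a pattern loses nothing in the columns up to
  -- n.
  get-tab-GT : ∀ {R n} α {β : ℕ → ℕ} {p} → length α ≤ R → GT n (part α) β p → ∀ i j → j ≤ n → get (tab R (suc n) p) i j ≡ p i j
  get-tab-GT {R} {n} α {p = p} α≤ g i j j≤ with i <? R
  ... | yes i< = get-tab R (suc n) p i< (s≤s j≤)
  ... | no ¬i< = trans (get-≥ (tab-isTab R (suc n) p) j R≤)
      (sym (n≤0⇒n≡0 (≤-trans (GT-≤end g i j≤) (≤-reflexive (part-≥ α i (≤-trans α≤ R≤))))))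
    where R≤ = ≮⇒≥ ¬i<

  Arr-tab : ∀ {R n α β p} → length α ≤ R → GT n (part α) (part β) p → Arr R n α β (tab R (suc n) p)
  Arr-tab {R} {n} {α} {β} {p} α≤ g = tab-isTab R (suc n) p , GT-cong (get-tab-GT α α≤ g) g

  GT? : ∀ R n α β T → IsTab R (suc n) T → Dec (GT n (part α) (part β) (get T))
  GT? R n α β T t = map′ to from
    ((allUpTo? (λ i → get T i 0 ≟ part β i) M ×-dec allUpTo? (λ i → get T i n ≟ part α i) M)
    ×-dec (allUpTo? (λ i → allUpTo? (λ j → get T i j ≤? get T i (suc j)) n) M
    ×-dec allUpTo? (λ i → allUpTo? (λ j → get T (suc i) (suc j) ≤? get T i j) n) M))
    where
    -- From row M on the table, α and β are all 0, which makes the conditions on all rows a finite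
    -- test.
    M = R + (length α + length β)
    big : ∀ {i} → ¬ i < M → R ≤ i × (length α ≤ i × length β ≤ i)
    big ¬i< = ≤-trans (m≤m+n R _) q , ≤-trans (m≤m+n _ (length β)) q′ , ≤-trans (m≤n+m _ (length α)) q′
      where
      q = ≮⇒≥ ¬i<
      q′ = ≤-trans (m≤n+m _ R) q
    zero≤ : ∀ {a b} → a ≡ 0 → a ≤ b
    zero≤ refl = z≤n
    to : _ → GT n (part α) (part β) (get T)
    to ((a , b) , (c , d)) = gt
      (λ i → case₁ i)
      (λ i → case₂ i)
      (λ i j j< → case₃ i j j<)
      (λ i j j< → case₄ i j j<)
      where
      case₁ : ∀ i → get T i 0 ≡ part β i
      case₁ i with i <? M
      ... | yes p = a p
      ... | no ¬p = let (x , _ , z) = big ¬p in trans (get-≥ t 0 x) (sym (part-≥ β i z))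
      case₂ : ∀ i → get T i n ≡ part α i
      case₂ i with i <? M
      ... | yes p = b p
      ... | no ¬p = let (x , y , _) = big ¬p in trans (get-≥ t n x) (sym (part-≥ α i y))
      case₃ : ∀ i j → j < n → get T i j ≤ get T i (suc j)
      case₃ i j j< with i <? M
      ... | yes p = c p j<
      ... | no ¬p = zero≤ (get-≥ t j (proj₁ (big ¬p)))
      case₄ : ∀ i j → j < n → get T (suc i) (suc j) ≤ get T i j
      case₄ i j j< with i <? M
      ... | yes p = d p j<
      ... | no ¬p = zero≤ (get-≥ t (suc j) (≤-trans (proj₁ (big ¬p)) (n≤1+n i)))
    from : GT n (part α) (part β) (get T) → _
    from g = ((λ {i} _ → start g i) , (λ {i} _ → end g i)) , (λ {i} _ {j} → mono g i j) , (λ {i} _ {j} → strict g i j)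

  Arr? : ∀ R n α β T → Dec (Arr R n α β T)
  Arr? R n α β T with length T ≟ R
  ... | no ¬l = no (¬l ∘ proj₁ ∘ proj₁)
  ... | yes l with All.all? (λ r → length r ≟ suc n) T
  ...   | no ¬a = no (¬a ∘ proj₂ ∘ proj₁)
  ...   | yes a with GT? R n α β T (l , a)
  ...     | no ¬g = no (¬g ∘ proj₂)
  ...     | yes g = yes ((l , a) , g)

  -- An entry of row i is at most the part i of α, hence at most `size α`; this bounds the alphabet
  -- to search.
  arrE : ∀ R n α β → Enum (Arr R n α β)
  arrE R n α β = mapE (filterE (seqsE R (seqs (suc n) (upTo (suc (size α)))) (unique rows)) (Arr? R n α β)) proj₂
    (λ {T} a → (proj₁ (proj₁ a) , All-rows T (proj₁ a) (λ i j → ≤-trans (below a i j) (part≤size α i))) , a)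
    where
    rows = seqsE (suc n) (upTo (suc (size α))) (Uₚ.upTo⁺ _)
    below : ∀ {T} → Arr R n α β T → ∀ i {j} → j < suc n → get T i j ≤ part α i
    below (_ , g) i (s≤s j≤) = GT-≤end g i j≤
    All-part : ∀ l {P : ℕ → Set} → (∀ j → j < length l → P (part l j)) → All P l
    All-part []      h = []
    All-part (x ∷ l) h = h 0 (s≤s z≤n) ∷ All-part l (λ j j< → h (suc j) (s≤s j<))
    All-rows : ∀ {R} T → IsTab R (suc n) T → (∀ i {j} → j < suc n → get T i j ≤ size α) →
      All (_∈ seqs (suc n) (upTo (suc (size α)))) T
    All-rows []      _                h = []
    All-rows {suc R} (r ∷ T) (l , p ∷ a) h =
      complete rows (p , All-part r (λ j j< → ∈ₚ.∈-upTo⁺ (s≤s (h 0 (subst (j <_) p j<)))))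
      ∷ All-rows T (suc-injective l , a) (λ i j< → h (suc i) j<)

  -- The number of letters k + 1 in row i of the tableau; `wt` below is its content.
  mult : (ℕ → ℕ → ℕ) → ℕ → ℕ → ℕ
  mult p k i = p i (suc k) ∸ p i k

  row-sum : ∀ {n α β p} → GT n α β p → ∀ i m → m ≤ n → β i + sumTo m (λ k → mult p k i) ≡ p i m
  row-sum g i zero    m≤ = trans (+-identityʳ _) (sym (start g i))
  row-sum {β = β} {p} g i (suc m) m≤ = trans (sym (+-assoc (β i) _ _)) (trans (cong (_+ mult p m i) (row-sum g i m (<⇒≤ m≤)))
    (m+[n∸m]≡n (mono g i m m≤)))

  wt : ℕ → ℕ → (ℕ → ℕ → ℕ) → List ℕ
  wt R n p = applyUpTo (λ k → sumTo R (mult p k)) n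

  wt-cong : ∀ R n {p q} → (∀ i j → i < R → j ≤ n → p i j ≡ q i j) → wt R n p ≡ wt R n q
  wt-cong R n e = applyUpTo-cong n (λ k k< → sumTo-cong R (λ i i< → cong₂ _∸_ (e i (suc k) i< k<) (e i k i< (<⇒≤ k<))))

  length-wt : ∀ R n p → length (wt R n p) ≡ n
  length-wt R n p = Lₚ.length-applyUpTo _ n

  _≟L_ : (u v : List ℕ) → Dec (u ≡ v)
  _≟L_ = Lₚ.≡-dec _≟_

  δ : List ℕ → List ℕ → ℤ
  δ u v = [ u ≟L v ]ᵈ

  -- The coefficient of x^e in the skew Schur polynomial s_{α/β}(x₁,...,xₙ), a skew Kostka number,
  -- provided that R is at least the length of α.
  K : ℕ → ℕ → List ℕ → List ℕ → List ℕ → ℤ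
  K R n α β e = ∑ (elems (arrE R n α β)) (λ T → δ (wt R n (get T)) e)

open Patterns
open GT

-- Bender-Knuth involutions and the symmetry of skew Schur polynomials

module BenderKnuth where

  -- The way linear consequences are drawn in this proof: the hypotheses are added up to one
  -- equation `x ≡ y`, and the identity that remains is left to the ring solver. `lelin` does the
  -- same for inequalities.
  eqlin : ∀ {a b x y : ℕ} → x ≡ y → a + y ≡ b + x → a ≡ b
  eqlin {a} {b} {x} refl e = +-cancelʳ-≡ x a b e

  lelin : ∀ {a b x y : ℕ} → x ≤ y → a + y ≡ b + x → a ≤ b
  lelin {a} {b} {x} {y} h e = +-cancelʳ-≤ y a b (≤-trans (≤-reflexive e) (+-monoʳ-≤ b h))

  sw : {A : Set} → ℕ → List A → List A
  sw zero    (x ∷ y ∷ l) = y ∷ x ∷ l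
  sw zero    l           = l
  sw (suc k) []          = []
  sw (suc k) (x ∷ l)     = x ∷ sw k l

  length-sw : {A : Set} → ∀ k (l : List A) → length (sw k l) ≡ length l
  length-sw zero    []          = refl
  length-sw zero    (x ∷ [])    = refl
  length-sw zero    (x ∷ y ∷ l) = refl
  length-sw (suc k) []          = refl
  length-sw (suc k) (x ∷ l)     = cong suc (length-sw k l)

  sw-sw : {A : Set} → ∀ k (l : List A) → sw k (sw k l) ≡ l
  sw-sw zero    []          = refl
  sw-sw zero    (x ∷ [])    = refl
  sw-sw zero    (x ∷ y ∷ l) = refl
  sw-sw (suc k) []          = refl
  sw-sw (suc k) (x ∷ l)     = cong (x ∷_) (sw-sw k l)

  sw-short : {A : Set} → ∀ k (l : List A) → length l ≤ suc k → sw k l ≡ l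
  sw-short zero    []          _       = refl
  sw-short zero    (x ∷ [])    _       = refl
  sw-short zero    (x ∷ y ∷ l) (s≤s ())
  sw-short (suc k) []          _       = refl
  sw-short (suc k) (x ∷ l)     (s≤s p) = cong (x ∷_) (sw-short k l p)

  part-sw-at : ∀ k l → suc k < length l → part (sw k l) k ≡ part l (suc k)
  part-sw-at zero    (x ∷ y ∷ l) _       = refl
  part-sw-at zero    (x ∷ [])    (s≤s ())
  part-sw-at (suc k) (x ∷ l)     (s≤s p) = part-sw-at k l p

  part-sw-suc : ∀ k l → suc k < length l → part (sw k l) (suc k) ≡ part l k
  part-sw-suc zero    (x ∷ y ∷ l) _       = refl
  part-sw-suc zero    (x ∷ [])    (s≤s ())
  part-sw-suc (suc k) (x ∷ l)     (s≤s p) = part-sw-suc k l p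

  part-sw-other : ∀ k l j → j ≢ k → j ≢ suc k → part (sw k l) j ≡ part l j
  part-sw-other zero    []          j             _ _ = refl
  part-sw-other zero    (x ∷ [])    j             _ _ = refl
  part-sw-other zero    (x ∷ y ∷ l) zero          a b = ⊥-elim (a refl)
  part-sw-other zero    (x ∷ y ∷ l) (suc zero)    a b = ⊥-elim (b refl)
  part-sw-other zero    (x ∷ y ∷ l) (suc (suc j)) a b = refl
  part-sw-other (suc k) []          j             _ _ = refl
  part-sw-other (suc k) (x ∷ l)     zero          _ _ = refl
  part-sw-other (suc k) (x ∷ l)     (suc j)       a b = part-sw-other k l j (a ∘ cong suc) (b ∘ cong suc)

  if-true : {A : Set} {b : Bool} {x y : A} → b ≡ true → (if b then x else y) ≡ x
  if-true refl = refl

  if-false : {A : Set} {b : Bool} {x y : A} → b ≡ false → (if b then x else y) ≡ y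
  if-false refl = refl

  if-yes : {P A : Set} (d : Dec P) {a b : A} → P → (if does d then a else b) ≡ a
  if-yes d p = if-true (dec-true d p)

  if-no : {P A : Set} (d : Dec P) {a b : A} → ¬ P → (if does d then a else b) ≡ b
  if-no d ¬p = if-false (dec-false d ¬p)

  -- Bender–Knuth involution on the letters k+1, k+2 (column k+1 of the pattern), restricted to the rows ≤ I:
  -- every entry is reflected in the interval left free by its neighbours, the interval of row I being cut off at C.
  module Reflect (k I C : ℕ) where

    lo : (ℕ → ℕ → ℕ) → ℕ → ℕ
    lo p i = if does (i ≟ I) then C else p i k ⊔ p (suc i) (suc (suc k))

    hi : (ℕ → ℕ → ℕ) → ℕ → ℕ
    hi p zero    = p zero (suc (suc k))
    hi p (suc i) = p (suc i) (suc (suc k)) ⊓ p i k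

    bk : (ℕ → ℕ → ℕ) → ℕ → ℕ → ℕ
    bk p i j = if does (j ≟ suc k) ∧ does (i ≤? I) then lo p i + hi p i ∸ p i (suc k) else p i j

    bk-in : ∀ p {i} → i ≤ I → bk p i (suc k) ≡ lo p i + hi p i ∸ p i (suc k)
    bk-in p {i} i≤ = if-true (cong₂ _∧_ (dec-true (suc k ≟ suc k) refl) (dec-true (i ≤? I) i≤))

    bk-col : ∀ p i {j} → j ≢ suc k → bk p i j ≡ p i j
    bk-col p i {j} j≢ = if-false (cong (_∧ does (i ≤? I)) (dec-false (j ≟ suc k) j≢))

    bk-row : ∀ p {i} j → I < i → bk p i j ≡ p i j
    bk-row p {i} j I< = if-false (trans (cong (does (j ≟ suc k) ∧_) (dec-false (i ≤? I) (<⇒≱ I<))) (∧-zeroʳ (does (j ≟ suc k))))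

    k≢ : k ≢ suc k
    k≢ ()

    kk≢ : suc (suc k) ≢ suc k
    kk≢ ()

    lo-bk : ∀ p i → lo (bk p) i ≡ lo p i
    lo-bk p i = cong (λ a → if does (i ≟ I) then C else a) (cong₂ _⊔_ (bk-col p i k≢) (bk-col p (suc i) kk≢))

    hi-bk : ∀ p i → hi (bk p) i ≡ hi p i
    hi-bk p zero    = bk-col p zero kk≢
    hi-bk p (suc i) = cong₂ _⊓_ (bk-col p (suc i) kk≢) (bk-col p i k≢)

    lo-I : ∀ p → lo p I ≡ C
    lo-I p = if-yes (I ≟ I) refl

    lo-< : ∀ p {i} → i < I → lo p i ≡ p i k ⊔ p (suc i) (suc (suc k))
    lo-< p {i} i< = if-no (i ≟ I) (λ { refl → <-irrefl refl i< })

    -- When C may serve as left end of the interval of row I: it respects the neighbours that bound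
    -- the entry from below, so that the reflected row still fits on the untouched row under it, and
    -- the entry itself lies in the interval.
    record Cut (p : ℕ → ℕ → ℕ) : Set where
      constructor cut
      field
        left  : p I k ≤ C
        below : p (suc I) (suc (suc k)) ≤ C
        free  : C ≤ p I (suc k)
    open Cut

    module _ {n α β p} (g : GT n α β p) (k< : suc k < n) (c : Cut p) where

      lo≥left : ∀ {i} → i ≤ I → p i k ≤ lo p i
      lo≥left {i} i≤ with m≤n⇒m<n∨m≡n i≤
      ... | inj₁ i< = ≤-trans (m≤m⊔n _ _) (≤-reflexive (sym (lo-< p i<)))
      ... | inj₂ refl = ≤-trans (left c) (≤-reflexive (sym (lo-I p)))

      lo≥below : ∀ {i} → i ≤ I → p (suc i) (suc (suc k)) ≤ lo p i
      lo≥below {i} i≤ with m≤n⇒m<n∨m≡n i≤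
      ... | inj₁ i< = ≤-trans (m≤n⊔m (p i k) _) (≤-reflexive (sym (lo-< p i<)))
      ... | inj₂ refl = ≤-trans (below c) (≤-reflexive (sym (lo-I p)))

      lo≤ : ∀ {i} → i ≤ I → lo p i ≤ p i (suc k)
      lo≤ {i} i≤ with m≤n⇒m<n∨m≡n i≤
      ... | inj₁ i< = ≤-trans (≤-reflexive (lo-< p i<))
        (⊔-lub (mono g i k (<⇒≤ k<)) (strict g i (suc k) k<))
      ... | inj₂ refl = ≤-trans (≤-reflexive (lo-I p)) (free c)

      ≤hi : ∀ i → p i (suc k) ≤ hi p i
      ≤hi zero    = mono g zero (suc k) k<
      ≤hi (suc i) = ⊓-glb (mono g (suc i) (suc k) k<) (strict g i k (<⇒≤ k<))

      hi≤ : ∀ i → hi p i ≤ p i (suc (suc k))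
      hi≤ zero    = ≤-refl
      hi≤ (suc i) = m⊓n≤m _ _

      bk-+ : ∀ {i} → i ≤ I → bk p i (suc k) + p i (suc k) ≡ lo p i + hi p i
      bk-+ {i} i≤ = trans (cong (_+ p i (suc k)) (bk-in p i≤)) (m∸n+n≡m (≤-trans (≤hi i) (m≤n+m _ (lo p i))))

      lo≤bk : ∀ {i} → i ≤ I → lo p i ≤ bk p i (suc k)
      lo≤bk {i} i≤ = lem (bk-+ i≤) (≤hi i)
        where
        lem : ∀ {q x l h} → q + x ≡ l + h → x ≤ h → l ≤ q
        lem {q} {x} {l} {h} e x≤ = +-cancelʳ-≤ x l q (≤-trans (+-monoʳ-≤ l x≤) (≤-reflexive (sym e)))

      bk≤hi : ∀ {i} → i ≤ I → bk p i (suc k) ≤ hi p i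
      bk≤hi {i} i≤ = lem (bk-+ i≤) (lo≤ i≤)
        where
        lem : ∀ {q x l h} → q + x ≡ l + h → l ≤ x → q ≤ h
        lem {q} {x} {l} {h} e l≤ = +-cancelˡ-≤ x q h
          (≤-trans (≤-reflexive (trans (+-comm x q) e)) (+-monoˡ-≤ h l≤))

      bk-≤kk : ∀ i → bk p i (suc k) ≤ p i (suc (suc k))
      bk-≤kk i with i ≤? I
      ... | yes i≤ = ≤-trans (bk≤hi i≤) (hi≤ i)
      ... | no ¬i≤ = ≤-trans (≤-reflexive (bk-row p (suc k) (≰⇒> ¬i≤))) (mono g i (suc k) k<)

      bk-≥k : ∀ i → p i k ≤ bk p i (suc k)
      bk-≥k i with i ≤? I
      ... | yes i≤ = ≤-trans (lo≥left i≤) (lo≤bk i≤)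
      ... | no ¬i≤ = ≤-trans (mono g i k (<⇒≤ k<)) (≤-reflexive (sym (bk-row p (suc k) (≰⇒> ¬i≤))))

      bk-≤above : ∀ i → bk p (suc i) (suc k) ≤ p i k
      bk-≤above i with suc i ≤? I
      ... | yes i≤ = ≤-trans (bk≤hi i≤) (m⊓n≤n (p (suc i) (suc (suc k))) (p i k))
      ... | no ¬i≤ = ≤-trans (≤-reflexive (bk-row p (suc k) (≰⇒> ¬i≤))) (strict g i k (<⇒≤ k<))

      bk-≥below : ∀ i → p (suc i) (suc (suc k)) ≤ bk p i (suc k)
      bk-≥below i with i ≤? I
      ... | yes i≤ = ≤-trans (lo≥below i≤) (lo≤bk i≤)
      ... | no ¬i≤ = ≤-trans (strict g i (suc k) k<) (≤-reflexive (sym (bk-row p (suc k) (≰⇒> ¬i≤))))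

      bk-GT : GT n α β (bk p)
      bk-GT = gt
        (λ i → trans (bk-col p i (λ ())) (start g i))
        (λ i → trans (bk-col p i (λ e → <-irrefl (sym e) k<)) (end g i))
        mono′ strict′
        where
        mono′ : ∀ i j → j < n → bk p i j ≤ bk p i (suc j)
        mono′ i j j< = go (j ≟ suc k) (suc j ≟ suc k)
          where
          go : Dec (j ≡ suc k) → Dec (suc j ≡ suc k) → bk p i j ≤ bk p i (suc j)
          go (yes refl) _          = ≤-trans (bk-≤kk i) (≤-reflexive (sym (bk-col p i kk≢)))
          go (no j≢)    (yes refl) = ≤-trans (≤-reflexive (bk-col p i k≢)) (bk-≥k i)
          go (no j≢)    (no sj≢)   = ≤-trans (≤-reflexive (bk-col p i j≢))
            (≤-trans (mono g i j j<) (≤-reflexive (sym (bk-col p i sj≢))))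
        strict′ : ∀ i j → j < n → bk p (suc i) (suc j) ≤ bk p i j
        strict′ i j j< = go (j ≟ suc k) (suc j ≟ suc k)
          where
          go : Dec (j ≡ suc k) → Dec (suc j ≡ suc k) → bk p (suc i) (suc j) ≤ bk p i j
          go (yes refl) _          = ≤-trans (≤-reflexive (bk-col p (suc i) kk≢)) (bk-≥below i)
          go (no j≢)    (yes refl) = ≤-trans (bk-≤above i) (≤-reflexive (sym (bk-col p i k≢)))
          go (no j≢)    (no sj≢)   = ≤-trans (≤-reflexive (bk-col p (suc i) sj≢))
            (≤-trans (strict g i j j<) (≤-reflexive (sym (bk-col p i j≢))))

      bk-Cut : Cut (bk p)
      bk-Cut = cut (≤-trans (≤-reflexive (bk-col p I k≢)) (left c))
                   (≤-trans (≤-reflexive (bk-col p (suc I) kk≢)) (below c))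
                   (≤-trans (≤-reflexive (sym (lo-I p))) (lo≤bk ≤-refl))

      -- The ends of the intervals depend on columns k and k + 2 and on C, all of which the
      -- reflection leaves alone; a reflection in a fixed interval is its own inverse.
      bk-bk : ∀ i j → bk (bk p) i j ≡ p i j
      bk-bk i j = go (j ≟ suc k) (i ≤? I)
        where
        go : Dec (j ≡ suc k) → Dec (i ≤ I) → bk (bk p) i j ≡ p i j
        go (no j≢)    _        = trans (bk-col (bk p) i j≢) (bk-col p i j≢)
        go (yes refl) (no ¬i≤) = trans (bk-row (bk p) j (≰⇒> ¬i≤)) (bk-row p j (≰⇒> ¬i≤))
        go (yes refl) (yes i≤) = trans (bk-in (bk p) i≤) (trans (cong₂ (λ a b → a ∸ b) (cong₂ _+_ (lo-bk p i) (hi-bk p i)) (bk-in p i≤))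
          (m∸[m∸n]≡n (≤-trans (≤hi i) (m≤n+m _ (lo p i)))))

      -- The maximum ending one interval and the minimum starting the next one are those of the same two numbers.
      sum-lo-hi : ∀ J → J ≤ I →
        sumTo J (lo p) + sumTo (suc J) (hi p) ≡ sumTo J (λ i → p i k) + sumTo (suc J) (λ i → p i (suc (suc k)))
      sum-lo-hi zero    J≤ = refl
      sum-lo-hi (suc J) J≤ = step (sumTo J (lo p)) (lo p J) (sumTo (suc J) (hi p)) (hi p (suc J))
          (sumTo J (λ i → p i k)) (p J k) (sumTo (suc J) (λ i → p i (suc (suc k)))) (p (suc J) (suc (suc k)))
        (sum-lo-hi J (<⇒≤ J≤))
        (trans (cong₂ _+_ (lo-< p J≤) (⊓-comm (p (suc J) (suc (suc k))) (p J k))) (⊔+⊓ (p J k) (p (suc J) (suc (suc k)))))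
        where
        ⊔+⊓ : ∀ a b → (a ⊔ b) + (a ⊓ b) ≡ a + b
        ⊔+⊓ a b with ≤-total a b
        ... | inj₁ a≤b = trans (cong₂ _+_ (m≤n⇒m⊔n≡n a≤b) (m≤n⇒m⊓n≡m a≤b)) (+-comm b a)
        ... | inj₂ b≤a = cong₂ _+_ (m≥n⇒m⊔n≡m b≤a) (m≥n⇒m⊓n≡n b≤a)
        step : ∀ a b c d x y z t → a + c ≡ x + z → b + d ≡ y + t → (a + b) + (c + d) ≡ (x + y) + (z + t)
        step a b c d x y z t e f = eqlin (cong₂ _+_ e f)
          (ℕ-solver.solve (a L.∷ b L.∷ c L.∷ d L.∷ x L.∷ y L.∷ z L.∷ t L.∷ L.[]))

      -- Old and new entry of a row add up to the two ends of its interval. Summed over the rows,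
      -- the ends regroup into the columns k and k + 2, except that C stands in for the left end of
      -- row I; this is how the cut enters the content.
      sum-bk : sumTo (suc I) (λ i → bk p i (suc k)) + sumTo (suc I) (λ i → p i (suc k))
             ≡ (sumTo I (λ i → p i k) + C) + sumTo (suc I) (λ i → p i (suc (suc k)))
      sum-bk = trans (sym (sumTo-+ (suc I) _ _))
        (trans (sumTo-cong (suc I) (λ i i< → bk-+ (≤-pred i<)))
        (trans (sumTo-+ (suc I) (lo p) (hi p))
          (step (sumTo I (lo p)) (lo p I) (sumTo (suc I) (hi p)) (sumTo I (λ i → p i k)) (sumTo (suc I) (λ i → p i (suc (suc k)))) C (lo-I p) (sum-lo-hi I ≤-refl))))
        where
        step : ∀ a b c x y z → b ≡ z → a + c ≡ x + y → (a + b) + c ≡ (x + z) + y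
        step a b c x y z e f = eqlin (cong₂ _+_ e f) (ℕ-solver.solve (a L.∷ b L.∷ c L.∷ x L.∷ y L.∷ z L.∷ L.[]))

  bk-cong : ∀ k I C {n p q} → suc k < n → (∀ i j → j ≤ n → p i j ≡ q i j) → ∀ i {j} → j ≤ n → Reflect.bk k I C p i j ≡ Reflect.bk k I C q i j
  bk-cong k I C {n} {p} {q} k< e i {j} j≤ = cong₂ (λ a b → if does (j ≟ suc k) ∧ does (i ≤? I) then a else b)
    (cong₂ _∸_ (cong₂ _+_ lo-cong (hi-cong i)) (e i (suc k) (<⇒≤ k<))) (e i j j≤)
    where
    k≤n : k ≤ n
    k≤n = <⇒≤ (<⇒≤ k<)
    lo-cong : Reflect.lo k I C p i ≡ Reflect.lo k I C q i
    lo-cong = cong (λ a → if does (i ≟ I) then C else a) (cong₂ _⊔_ (e i k k≤n) (e (suc i) (suc (suc k)) k<))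
    hi-cong : ∀ i → Reflect.hi k I C p i ≡ Reflect.hi k I C q i
    hi-cong zero    = e zero (suc (suc k)) k<
    hi-cong (suc i) = cong₂ _⊓_ (e (suc i) (suc (suc k)) k<) (e i k k≤n)

  sum-mult : ∀ {n α β p} → GT n α β p → ∀ R {k} → k < n →
    sumTo R (mult p k) + sumTo R (λ i → p i k) ≡ sumTo R (λ i → p i (suc k))
  sum-mult g R {k} k< = trans (sym (sumTo-+ R _ _)) (sumTo-cong R (λ i _ → m∸n+n≡m (mono g i k k<)))

  GT-vanish : ∀ {n α β p R} → GT n α β p → (∀ i → R ≤ i → α i ≡ 0) → ∀ i j → R ≤ i → j ≤ n → p i j ≡ 0
  GT-vanish g z i j R≤ j≤ = n≤0⇒n≡0 (≤-trans (GT-≤end g i j≤) (≤-reflexive (z i R≤)))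

  module _ {n α β p} (R k : ℕ) (g : GT n α β p) (k< : suc k < n) (z : ∀ i → R ≤ i → α i ≡ 0) where
    open Reflect k R 0

    -- Row R is empty, so I = R with C = 0 cuts nothing off: this is the ordinary involution on the
    -- whole tableau.
    full-Cut : Cut p
    full-Cut = cut (≤-reflexive (GT-vanish g z R k ≤-refl (<⇒≤ (<⇒≤ k<))))
                   (≤-reflexive (GT-vanish g z (suc R) (suc (suc k)) (n≤1+n R) k<)) z≤n

    private
      g′ = bk-GT g k< full-Cut

      columns : sumTo R (λ i → bk p i (suc k)) + sumTo R (λ i → p i (suc k)) ≡ sumTo R (λ i → p i k) + sumTo R (λ i → p i (suc (suc k)))
      columns = trans (sym (cong₂ _+_ (drop (GT-vanish g′ z R (suc k) ≤-refl (<⇒≤ k<)))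
                                      (drop (GT-vanish g z R (suc k) ≤-refl (<⇒≤ k<)))))
        (trans (sum-bk g k< full-Cut) (cong₂ _+_ (+-identityʳ _) (drop (GT-vanish g z R (suc (suc k)) ≤-refl k<))))
        where
        drop : ∀ {f} → f R ≡ 0 → sumTo (suc R) f ≡ sumTo R f
        drop {f} e = trans (cong (sumTo R f +_) e) (+-identityʳ _)

    full-wt-k : sumTo R (mult (bk p) k) ≡ sumTo R (mult p (suc k))
    full-wt-k = lem _ _ _ _ _ _ (trans (cong (sumTo R (mult (bk p) k) +_) (sumTo-cong R (λ i _ → sym (bk-col p i k≢)))) (sum-mult g′ R (<⇒≤ k<)))
      (sum-mult g R k<) columns
      where
      lem : ∀ x y a q b c → x + a ≡ q → y + b ≡ c → q + b ≡ a + c → x ≡ y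
      lem x y a q b c e f h = eqlin (cong₂ _+_ (cong₂ _+_ e (sym f)) h)
        (ℕ-solver.solve (x L.∷ y L.∷ a L.∷ q L.∷ b L.∷ c L.∷ L.[]))

    full-wt-suc : sumTo R (mult (bk p) (suc k)) ≡ sumTo R (mult p k)
    full-wt-suc = lem _ _ _ _ _ _ (trans (sum-mult g′ R k<) (sumTo-cong R (λ i _ → bk-col p i kk≢)))
      (sum-mult g R (<⇒≤ k<)) columns
      where
      lem : ∀ x y a q b c → x + q ≡ c → y + a ≡ b → q + b ≡ a + c → x ≡ y
      lem x y a q b c e f h = eqlin (cong₂ _+_ (cong₂ _+_ e (sym f)) (sym h))
        (ℕ-solver.solve (x L.∷ y L.∷ a L.∷ q L.∷ b L.∷ c L.∷ L.[]))

    bk-mult-other : ∀ j → j ≢ k → j ≢ suc k → ∀ i → mult (bk p) j i ≡ mult p j i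
    bk-mult-other j j≢ j≢′ i = cong₂ _∸_ (bk-col p i (j≢ ∘ suc-injective)) (bk-col p i j≢′)

    full-wt : wt R n (bk p) ≡ sw k (wt R n p)
    full-wt = part-ext (trans (length-wt R n (bk p)) (sym (trans (length-sw k (wt R n p)) (length-wt R n p)))) λ j j< → go j (subst (j <_) (length-wt R n (bk p)) j<)
      where
      k<l : suc k < length (wt R n p)
      k<l = subst (suc k <_) (sym (length-wt R n p)) k<
      go : ∀ j → j < n → part (wt R n (bk p)) j ≡ part (sw k (wt R n p)) j
      go j j< with j ≟ k | j ≟ suc k
      ... | yes refl | _ = trans (part-applyUpTo _ n j<) (trans full-wt-k
          (sym (trans (part-sw-at k (wt R n p) k<l) (part-applyUpTo _ n k<))))
      ... | no _ | yes refl = trans (part-applyUpTo _ n j<) (trans full-wt-suc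
          (sym (trans (part-sw-suc k (wt R n p) k<l) (part-applyUpTo _ n (<⇒≤ k<)))))
      ... | no j≢ | no j≢′ = trans (part-applyUpTo _ n j<) (trans (sumTo-cong R (λ i _ → bk-mult-other j j≢ j≢′ i))
          (sym (trans (part-sw-other k (wt R n p) j j≢ j≢′) (part-applyUpTo _ n j<))))

  Symmetric : (List ℕ → ℤ) → Set
  Symmetric f = ∀ k e → f (sw k e) ≡ f e

  -- The full involution exchanges the numbers of the letters k + 1 and k + 2. For lists of a length
  -- other than n both coefficients are 0, and for k + 1 ≥ n `sw k` changes nothing.
  K-symmetric : ∀ R n α β → length α ≤ R → Symmetric (K R n α β)
  K-symmetric R n α β α≤ k e with length e ≟ n
  ... | no e≢ = trans (zeros (sw k e) (e≢ ∘ trans (sym (length-sw k e)))) (sym (zeros e e≢))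
    where
    zeros : ∀ e → length e ≢ n → K R n α β e ≡ 0ℤ
    zeros e e≢ = ∑-zero (elems (arrE R n α β)) (λ T _ → [no] (wt R n (get T) ≟L e) (λ q → e≢ (trans (cong length (sym q)) (length-wt R n (get T)))))
  ... | yes e≡ with suc k <? n
  ...   | no k≮ = cong (K R n α β) (sw-short k e (≤-trans (≤-reflexive e≡) (≮⇒≥ k≮)))
  ...   | yes k< = ∑-bij (arrE R n α β) (arrE R n α β) τ τ τ-Arr τ-Arr τ-τ τ-τ
            (λ T → δ (wt R n (get T)) (sw k e)) (λ T → δ (wt R n (get T)) e) τ-wt
    where
    open Reflect k R 0
    τ : List (List ℕ) → List (List ℕ)
    τ T = tab R (suc n) (bk (get T))
    z : ∀ i → R ≤ i → part α i ≡ 0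
    z i R≤ = part-≥ α i (≤-trans α≤ R≤)
    τ-GT : ∀ T → Arr R n α β T → GT n (part α) (part β) (bk (get T))
    τ-GT T (_ , g) = bk-GT g k< (full-Cut R k g k< z)
    τ-Arr : ∀ T → Arr R n α β T → Arr R n α β (τ T)
    τ-Arr T a = Arr-tab {α = α} {β} α≤ (τ-GT T a)
    τ-τ : ∀ T → Arr R n α β T → τ (τ T) ≡ T
    τ-τ T a@(t , g) = trans (tab-cong R (suc n) (λ i j i< j< → trans (bk-cong k R 0 k< (get-tab-GT α α≤ (τ-GT T a)) i (≤-pred j<)) (bk-bk g k< (full-Cut R k g k< z) i j))) (tab-get t)
    τ-wt : ∀ T → Arr R n α β T → δ (wt R n (get T)) (sw k e) ≡ δ (wt R n (get (τ T))) e
    τ-wt T a@(t , g) = [⇔] (_ ≟L _) (_ ≟L _)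
      (λ q → trans eq (trans (cong (sw k) q) (sw-sw k e)))
      (λ q → trans (sym (sw-sw k _)) (cong (sw k) (trans (sym eq) q)))
      where
      eq : wt R n (get (τ T)) ≡ sw k (wt R n (get T))
      eq = trans (wt-cong R n (λ i j _ j≤ → get-tab-GT α α≤ (τ-GT T a) i j j≤)) (full-wt R k g k< z)

open BenderKnuth

-- Stembridge's sign-reversing involution

module Involution where

  least : ∀ {P : ℕ → Set} → (∀ k → Dec (P k)) → ∀ m →
    (∀ k → k < m → P k) ⊎ (∃ λ k → k < m × ¬ P k × (∀ j → j < k → P j))
  least P? zero    = inj₁ (λ _ ())
  least P? (suc m) with least P? m
  ... | inj₂ (k , k< , ¬p , q) = inj₂ (k , m<n⇒m<1+n k< , ¬p , q)
  ... | inj₁ q with P? m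
  ...   | no ¬p = inj₂ (m , ≤-refl , ¬p , q)
  ...   | yes p = inj₁ (λ k k< → below k (m≤n⇒m<n∨m≡n (≤-pred k<)))
    where
    below : ∀ k → k < m ⊎ k ≡ m → _
    below k (inj₁ k<) = q k k<
    below k (inj₂ refl) = p

  -- t′ arises from t by exchanging the parts k and k+1 of γ + ρ − t.
  record Exchange (γ : ℕ → ℕ) (k : ℕ) (t t′ : List ℕ) : Set where
    field
      at-k   : suc (γ k) + part t (suc k) ≡ γ (suc k) + part t′ k
      at-suc : γ (suc k) + part t k ≡ suc (γ k) + part t′ (suc k)
      other  : ∀ j → j ≢ k → j ≢ suc k → part t′ j ≡ part t j

  module Stembridge (R n : ℕ) (α β : List ℕ) (α≤ : length α ≤ R) (γ : ℕ → ℕ) (γ-anti : ∀ k → γ (suc k) ≤ γ k) where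

    tail : (ℕ → ℕ → ℕ) → ℕ → ℕ → ℕ
    tail p k i = tailTo R (mult p k) i

    -- Read the rows from the bottom up, each from left to right, and subtract from γ the content
    -- read. At the moment between the letters k + 1 and the letters k + 2 of row i, the parts k and
    -- k + 1 of the difference must be in order. Moving terms across avoids negative numbers.
    Ok : (ℕ → ℕ → ℕ) → ℕ → ℕ → Set
    Ok p k i = γ (suc k) + tail p k i ≤ γ k + tail p (suc k) (suc i)

    Good : (ℕ → ℕ → ℕ) → Set
    Good p = ∀ k i → suc k < n → i < R → Ok p k i

    -- The first failure in this reading: the rows with larger index pass, and so do the smaller
    -- letters of row I.
    record First (p : ℕ → ℕ → ℕ) (k I : ℕ) : Set where
      field
        I<     : I < R
        k<     : suc k < n
        fail   : ¬ Ok p k I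
        above  : ∀ k′ i → suc k′ < n → I < i → i < R → Ok p k′ i
        before : ∀ k′ → k′ < k → Ok p k′ I
    open First

    search : ∀ p → Good p ⊎ (∃ λ k → ∃ λ I → First p k I)
    search p = down R ≤-refl (λ k i _ R≤ i< → ⊥-elim (<⇒≱ i< R≤))
      where
      pred< : ∀ {k n} → k < pred n → suc k < n
      pred< {n = suc n} k< = s≤s k<
      <pred : ∀ {k n} → suc k < n → k < pred n
      <pred (s≤s k<) = k<
      down : ∀ r → r ≤ R → (∀ k i → suc k < n → r ≤ i → i < R → Ok p k i) → Good p ⊎ (∃ λ k → ∃ λ I → First p k I)
      down zero    _  h = inj₁ (λ k i k< i< → h k i k< z≤n i<)
      down (suc r) r≤ h with least (λ k → (γ (suc k) + tail p k r) ≤? (γ k + tail p (suc k) (suc r))) (pred n)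
      ... | inj₂ (k , k< , ¬ok , q) = inj₂ (k , r , record { I< = r≤ ; k< = pred< k< ; fail = ¬ok ; above = h ; before = q })
      ... | inj₁ q = down r (<⇒≤ r≤) λ k i k< r≤i i< → at k i k< i< (m≤n⇒m<n∨m≡n r≤i)
        where
        at : ∀ k i → suc k < n → i < R → r < i ⊎ r ≡ i → Ok p k i
        at k i k< i< (inj₁ r<) = h k i k< r< i<
        at k i k< i< (inj₂ refl) = q k (<pred k<)

    Good? : ∀ p → Dec (Good p)
    Good? p with search p
    ... | inj₁ g           = yes g
    ... | inj₂ (k , I , f) = no (λ g → fail f (g k I (k< f) (I< f)))

    First-unique : ∀ {p k I k′ I′} → First p k I → First p k′ I′ → k ≡ k′ × I ≡ I′
    First-unique {p} {k} {I} {k′} {I′} f f′ with <-cmp I I′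
    ... | tri< I<I′ _ _ = ⊥-elim (fail f′ (above f k′ I′ (k< f′) I<I′ (I< f′)))
    ... | tri> _ _ I′<I = ⊥-elim (fail f (above f′ k I (k< f) I′<I (I< f)))
    ... | tri≈ _ refl _ with <-cmp k k′
    ...   | tri< k<k′ _ _ = ⊥-elim (fail f (before f′ k k<k′))
    ...   | tri> _ _ k′<k = ⊥-elim (fail f′ (before f k′ k′<k))
    ...   | tri≈ _ refl _ = refl , refl

    tail-cong : ∀ p q k i → (∀ i′ → i ≤ i′ → p i′ k ≡ q i′ k) → (∀ i′ → i ≤ i′ → p i′ (suc k) ≡ q i′ (suc k)) → tail p k i ≡ tail q k i
    tail-cong p q k i e e′ = tailTo-cong R i (λ i′ i≤ → cong₂ _∸_ (e′ i′ i≤) (e i′ i≤))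

    Ok-cong : ∀ p q k i → tail p k i ≡ tail q k i → tail p (suc k) (suc i) ≡ tail q (suc k) (suc i) → Ok p k i → Ok q k i
    Ok-cong p q k i e e′ = subst (λ x → x) (cong₂ (λ a b → γ (suc k) + a ≤ γ k + b) e e′)

    -- The truncated difference is the slack between the parts k and k + 1 after the rows under I
    -- have been read. That many letters k + 1 of row I are harmless, the next one breaks the order,
    -- and the cutoff is the column just to the right of its box. What lies beyond it, and all
    -- higher rows, is still to be read.
    cutoff : (ℕ → ℕ → ℕ) → ℕ → ℕ → ℕ
    cutoff p k I = p I k + suc (γ k + tail p (suc k) (suc I) ∸ (γ (suc k) + tail p k (suc I)))

    tail-step : ∀ p k {i} → i < R → tail p k i ≡ mult p k i + tail p k (suc i)
    tail-step p k i< = tailTo-step R (mult p k) _ i<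

    module _ {p k I} (g : GT n (part α) (part β) p) (f : First p k I) where
      private
        C = cutoff p k I
        κ = k< f
        k<n : k < n
        k<n = <⇒≤ κ
        a = γ k + tail p (suc k) (suc I)
        b = γ (suc k) + tail p k (suc I)
        z : ∀ i → R ≤ i → part α i ≡ 0
        z i R≤ = part-≥ α i (≤-trans α≤ R≤)

      -- The slack is at least the number of letters k + 2 in row I + 1, because row I + 1 comes
      -- earlier in the reading and passes; if there is no such row, γ itself is weakly decreasing.
      -- This keeps row I + 1 to the left of the cutoff.
      next-ok : γ (suc k) + tail p k (suc I) + mult p (suc k) (suc I) ≤ γ k + tail p (suc k) (suc I)
      next-ok with suc I <? R
      ... | yes sI< = lem {γ (suc k)} {tail p k (suc I)} {γ k} (tail p (suc k) (suc I)) (mult p (suc k) (suc I)) _ (tail-step p (suc k) sI<) (above f k (suc I) κ ≤-refl sI<)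
        where
        lem : ∀ {u v w} t m r → t ≡ m + r → u + v ≤ w + r → u + v + m ≤ w + t
        lem {u} {v} {w} _ m r refl h = lelin h (ℕ-solver.solve (u L.∷ v L.∷ w L.∷ m L.∷ r L.∷ L.[]))
      ... | no sI≮ = ≤-trans (≤-reflexive (trans (cong₂ _+_ (cong (γ (suc k) +_) (tailTo-end R _ _ R≤)) m≡0) (lem (γ (suc k)))))
          (≤-trans (γ-anti k) (m≤m+n _ _))
        where
        R≤ : R ≤ suc I
        R≤ = ≮⇒≥ sI≮
        m≡0 : mult p (suc k) (suc I) ≡ 0
        m≡0 = trans (cong (_∸ p (suc I) (suc k)) (GT-vanish g z (suc I) (suc (suc k)) R≤ κ)) (0∸n≡0 (p (suc I) (suc k)))
        lem : ∀ x → x + 0 + 0 ≡ x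
        lem = ℕ-solver.solve-∀

      first-fail : a < b + mult p k I
      first-fail = subst (a <_) (trans (cong (γ (suc k) +_) (tail-step p k (I< f))) (lem (γ (suc k)) (mult p k I) (tail p k (suc I))))
        (≰⇒> (fail f))
        where
        lem : ∀ x m t → x + (m + t) ≡ x + t + m
        lem = ℕ-solver.solve-∀

      b≤a : b ≤ a
      b≤a = ≤-trans (m≤m+n b _) next-ok

      cutoff-+ : C + b ≡ p I k + suc a
      cutoff-+ = trans (+-assoc (p I k) _ b) (cong (λ x → p I k + suc x) (m∸n+n≡m b≤a))

      first-Cut : Reflect.Cut k I C p
      first-Cut = Reflect.cut (m≤m+n _ _)
        (lem₁ (m∸n+n≡m (mono g (suc I) (suc k) κ)) (strict g I k k<n) next-ok cutoff-+)
        (lem₂ (m∸n+n≡m (mono g I k k<n)) first-fail cutoff-+)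
        where
        lem₁ : ∀ {m x y u a b c} → m + x ≡ y → x ≤ u → b + m ≤ a → c + b ≡ u + suc a → y ≤ c
        lem₁ {m} {x} {_} {u} {a} {b} {c} refl x≤ h e = ≤-trans (n≤1+n _) (lelin (+-mono-≤ (+-mono-≤ x≤ h) (≤-reflexive (sym e)))
          (ℕ-solver.solve (m L.∷ x L.∷ u L.∷ a L.∷ b L.∷ c L.∷ L.[])))
        lem₂ : ∀ {m u y a b c} → m + u ≡ y → a < b + m → c + b ≡ u + suc a → c ≤ y
        lem₂ {m} {u} {_} {a} {b} {c} refl h e = lelin (+-mono-≤ h (≤-reflexive e))
          (ℕ-solver.solve (m L.∷ u L.∷ a L.∷ b L.∷ c L.∷ L.[]))

      open Reflect k I C

      private
        q = bk p
        g′ = bk-GT g κ first-Cut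

      tail-bk : ∀ k′ i → I < i → tail q k′ i ≡ tail p k′ i
      tail-bk k′ i I<i = tail-cong q p k′ i (λ i′ i≤ → bk-row p k′ (<-≤-trans I<i i≤)) (λ i′ i≤ → bk-row p (suc k′) (<-≤-trans I<i i≤))

      -- The rows under I and the columns up to k are untouched, and in row I the letters k + 1
      -- still reach the cutoff. So the reflected table fails first at the same place, and the same
      -- reflection undoes it.
      bk-First : First q k I
      bk-First = record
        { I< = I< f ; k< = κ
        ; fail = λ ok → <⇒≱ still (subst (λ x → x) (cong₂ (λ u v → γ (suc k) + u ≤ γ k + v) (tail-step q k (I< f)) (tail-bk (suc k) (suc I) ≤-refl)) ok)
        ; above = λ k′ i k′< I<i i< → Ok-cong p q k′ i (sym (tail-bk k′ i I<i)) (sym (tail-bk (suc k′) (suc i) (<-trans I<i (n<1+n i)))) (above f k′ i k′< I<i i<)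
        ; before = λ k′ k′<k → Ok-cong p q k′ I
            (sym (tail-cong q p k′ I (λ i′ _ → bk-col p i′ (λ { refl → <-irrefl refl (<-trans k′<k (n<1+n k)) }))
                                 (λ i′ _ → bk-col p i′ (λ { refl → <-irrefl refl k′<k }))))
            (sym (tail-bk (suc k′) (suc I) ≤-refl)) (before f k′ k′<k)
        }
        where
        still : γ k + tail p (suc k) (suc I) < γ (suc k) + (mult q k I + tail q k (suc I))
        still = subst (λ t → γ k + tail p (suc k) (suc I) < γ (suc k) + (mult q k I + t)) (sym (tail-bk k (suc I) ≤-refl))
          (lem {mult q k I} {q I k} {_} {p I k} {a} {γ (suc k)} {tail p k (suc I)} (m∸n+n≡m (mono g′ I k k<n)) (bk-col p I k≢) (Reflect.Cut.free (bk-Cut g κ first-Cut)) cutoff-+)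
          where
          lem : ∀ {m x y u a v t c} → m + x ≡ y → x ≡ u → c ≤ y → c + (v + t) ≡ u + suc a → a < v + (m + t)
          lem {m} {x} {_} {_} {a} {v} {t} {c} refl refl h e = lelin (+-mono-≤ h (≤-reflexive (sym e)))
            (ℕ-solver.solve (m L.∷ x L.∷ a L.∷ v L.∷ t L.∷ c L.∷ L.[]))

      cutoff-bk : cutoff q k I ≡ C
      cutoff-bk = cong₂ (λ x y → x + suc y) (bk-col p I k≢)
        (cong₂ (λ x y → γ k + x ∸ (γ (suc k) + y)) (tail-bk (suc k) (suc I) ≤-refl) (tail-bk k (suc I) ≤-refl))

      private
        split : ∀ p k → sumTo R (mult p k) ≡ sumTo (suc I) (mult p k) + tail p k (suc I)
        split p k = sym (sumTo+tailTo R (mult p k) (suc I) (I< f))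

        Wk  = sum-mult g (suc I) k<n
        Wκ  = sum-mult g (suc I) κ
        Wk′ : sumTo (suc I) (mult q k) + sumTo (suc I) (λ i → p i k) ≡ sumTo (suc I) (λ i → q i (suc k))
        Wk′ = trans (cong (sumTo (suc I) (mult q k) +_) (sumTo-cong (suc I) (λ i _ → sym (bk-col p i k≢)))) (sum-mult g′ (suc I) k<n)
        Wκ′ : sumTo (suc I) (mult q (suc k)) + sumTo (suc I) (λ i → q i (suc k)) ≡ sumTo (suc I) (λ i → p i (suc (suc k)))
        Wκ′ = trans (sum-mult g′ (suc I) κ) (sumTo-cong (suc I) (λ i _ → bk-col p i kk≢))

      -- At the cutoff the parts k and k + 1 of γ + ρ minus the content read coincide. The
      -- reflection exchanges the numbers of the letters k + 1 and k + 2 in the rest, so these two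
      -- parts of γ + ρ minus the whole content are exchanged.
      exchange-k : suc (γ k) + sumTo R (mult p (suc k)) ≡ γ (suc k) + sumTo R (mult q k)
      exchange-k = trans (cong (suc (γ k) +_) (split p (suc k)))
        (trans (lem (sumTo (suc I) (mult p (suc k))) (sumTo (suc I) (λ i → p i (suc k))) _ (sumTo (suc I) (mult q k)) (p I k) (sumTo I (λ i → p i k)) _ C
          (γ k) (tail p (suc k) (suc I)) (γ (suc k)) (tail p k (suc I)) Wκ Wk′ (sum-bk g κ first-Cut) cutoff-+)
          (cong (γ (suc k) +_) (sym (trans (split q k) (cong (sumTo (suc I) (mult q k) +_) (tail-bk k (suc I) ≤-refl))))))
        where
        lem : ∀ aκ pκ pκκ a′k pIk pk q′ c γk tκ γκ tk → aκ + pκ ≡ pκκ → a′k + (pk + pIk) ≡ q′ →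
          q′ + pκ ≡ (pk + c) + pκκ → c + (γκ + tk) ≡ pIk + suc (γk + tκ) → suc γk + (aκ + tκ) ≡ γκ + (a′k + tk)
        lem aκ pκ pκκ a′k pIk pk q′ c γk tκ γκ tk e₁ e₂ e₃ e₄ = eqlin (cong₂ _+_ (cong₂ _+_ e₁ (sym e₂)) (cong₂ _+_ (sym e₃) (sym e₄)))
          (ℕ-solver.solve (aκ L.∷ pκ L.∷ pκκ L.∷ a′k L.∷ pIk L.∷ pk L.∷ q′ L.∷ c L.∷ γk L.∷ tκ L.∷ γκ L.∷ tk L.∷ L.[]))

      exchange-suc : γ (suc k) + sumTo R (mult p k) ≡ suc (γ k) + sumTo R (mult q (suc k))
      exchange-suc = lem _ _ _ _ (γ k) (γ (suc k)) exchange-k total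
        where
        total : sumTo R (mult p k) + sumTo R (mult p (suc k)) ≡ sumTo R (mult q k) + sumTo R (mult q (suc k))
        total = trans (cong₂ _+_ (split p k) (split p (suc k))) (trans
          (lem′ (sumTo (suc I) (mult p k)) (sumTo (suc I) (mult p (suc k))) (sumTo (suc I) (λ i → p i k)) _ _ (sumTo (suc I) (mult q k)) _ {sumTo (suc I) (mult q (suc k))} (tail p k (suc I)) (tail p (suc k) (suc I)) Wk Wκ Wk′ Wκ′)
          (sym (cong₂ _+_ (trans (split q k) (cong (sumTo (suc I) (mult q k) +_) (tail-bk k (suc I) ≤-refl)))
                          (trans (split q (suc k)) (cong (sumTo (suc I) (mult q (suc k)) +_) (tail-bk (suc k) (suc I) ≤-refl))))))
          where
          lem′ : ∀ ak aκ pk pκ pκκ a′k q′ {a′κ} t t′ → ak + pk ≡ pκ → aκ + pκ ≡ pκκ → a′k + pk ≡ q′ → a′κ + q′ ≡ pκκ → (ak + t) + (aκ + t′) ≡ (a′k + t) + (a′κ + t′)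
          lem′ ak aκ pk pκ pκκ a′k q′ {a′κ} t t′ e₁ e₂ e₃ e₄ = eqlin (cong₂ _+_ (cong₂ _+_ e₁ e₂) (cong₂ _+_ (sym e₃) (sym e₄)))
            (ℕ-solver.solve (ak L.∷ aκ L.∷ pk L.∷ pκ L.∷ pκκ L.∷ a′k L.∷ q′ L.∷ a′κ L.∷ t L.∷ t′ L.∷ L.[]))
        lem : ∀ w w₁ w′ w₁′ x y → suc x + w₁ ≡ y + w′ → w + w₁ ≡ w′ + w₁′ → y + w ≡ suc x + w₁′
        lem w w₁ w′ w₁′ x y e f = eqlin (cong₂ _+_ (sym e) f) (ℕ-solver.solve (w L.∷ w₁ L.∷ w′ L.∷ w₁′ L.∷ x L.∷ y L.∷ L.[]))

      bk-exchange : Exchange γ k (wt R n p) (wt R n q)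
      bk-exchange = record
        { at-k   = trans (cong (suc (γ k) +_) (part-applyUpTo _ n κ)) (trans exchange-k (cong (γ (suc k) +_) (sym (part-applyUpTo _ n k<n))))
        ; at-suc = trans (cong (γ (suc k) +_) (part-applyUpTo _ n k<n)) (trans exchange-suc (cong (suc (γ k) +_) (sym (part-applyUpTo _ n κ))))
        ; other  = λ j j≢ j≢′ → same j j≢ j≢′ (j <? n)
        }
        where
        same : ∀ j → j ≢ k → j ≢ suc k → Dec (j < n) → part (wt R n q) j ≡ part (wt R n p) j
        same j j≢ j≢′ (yes j<) = trans (part-applyUpTo _ n j<) (trans (sumTo-cong R (λ i _ →
          cong₂ _∸_ (bk-col p i (j≢ ∘ suc-injective)) (bk-col p i j≢′))) (sym (part-applyUpTo _ n j<)))
        same j _ _ (no j≮) = trans (part-≥ (wt R n q) j (big q)) (sym (part-≥ (wt R n p) j (big p)))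
          where
          big : ∀ p → length (wt R n p) ≤ j
          big p = ≤-trans (≤-reflexive (length-wt R n p)) (≮⇒≥ j≮)

    cutoff-cong : ∀ p q k I → suc k < n → (∀ i j → j ≤ n → p i j ≡ q i j) → cutoff p k I ≡ cutoff q k I
    cutoff-cong p q k I k< e = cong₂ (λ x y → x + suc y) (e I k k≤)
      (cong₂ (λ x y → γ k + x ∸ (γ (suc k) + y))
        (tail-cong p q (suc k) (suc I) (λ i _ → e i (suc k) (<⇒≤ k<)) (λ i _ → e i (suc (suc k)) k<))
        (tail-cong p q k (suc I) (λ i _ → e i k k≤) (λ i _ → e i (suc k) (<⇒≤ k<))))
      where
      k≤ : k ≤ n
      k≤ = ≤-trans (n≤1+n k) (<⇒≤ k<)

    Ok-agree : ∀ p q k i → suc k < n → (∀ i j → j ≤ n → p i j ≡ q i j) → Ok p k i → Ok q k i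
    Ok-agree p q k i k< e = Ok-cong p q k i
      (tail-cong p q k i (λ i _ → e i k (≤-trans (n≤1+n k) (<⇒≤ k<))) (λ i _ → e i (suc k) (<⇒≤ k<)))
      (tail-cong p q (suc k) (suc i) (λ i _ → e i (suc k) (<⇒≤ k<)) (λ i _ → e i (suc (suc k)) k<))

    First-agree : ∀ p q {k I} → (∀ i j → j ≤ n → p i j ≡ q i j) → First p k I → First q k I
    First-agree p q {k} {I} e f = record
      { I< = I< f ; k< = k< f
      ; fail = λ ok → fail f (Ok-agree q p k I (k< f) (λ i j j≤ → sym (e i j j≤)) ok)
      ; above = λ k′ i k′< I<i i< → Ok-agree p q k′ i k′< e (above f k′ i k′< I<i i<)
      ; before = λ k′ k′<k → Ok-agree p q k′ I (<-trans (s≤s k′<k) (k< f)) e (before f k′ k′<k) }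

    flip : ℕ → ℕ → List (List ℕ) → List (List ℕ)
    flip k I T = tab R (suc n) (Reflect.bk k I (cutoff (get T) k I) (get T))

    step : ∀ T → Good (get T) ⊎ (∃ λ k → ∃ λ I → First (get T) k I) → List (List ℕ)
    step T (inj₁ _)           = T
    step T (inj₂ (k , I , _)) = flip k I T

    τ : List (List ℕ) → List (List ℕ)
    τ T = step T (search (get T))

    τ-flip : ∀ T {k I} → First (get T) k I → τ T ≡ flip k I T
    τ-flip T {k} {I} f = go (search (get T))
      where
      go : ∀ s → step T s ≡ flip k I T
      go (inj₁ g) = ⊥-elim (fail f (g k I (k< f) (I< f)))
      go (inj₂ (k′ , I′ , f′)) with refl , refl ← First-unique f f′ = refl

    first : ∀ T → ¬ Good (get T) → ∃ λ k → ∃ λ I → First (get T) k I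
    first T ¬g with search (get T)
    ... | inj₁ g = ⊥-elim (¬g g)
    ... | inj₂ f = f

    module _ {T k I} (a : Arr R n α β T) (f : First (get T) k I) where
      private
        g = proj₂ a
        C = cutoff (get T) k I
        q = Reflect.bk k I C (get T)
        q-GT : GT n (part α) (part β) q
        q-GT = Reflect.bk-GT k I C g (k< f) (first-Cut g f)
        agree : ∀ i j → j ≤ n → get (flip k I T) i j ≡ q i j
        agree = get-tab-GT α α≤ q-GT

      flip-Arr : Arr R n α β (flip k I T)
      flip-Arr = Arr-tab {α = α} {β} α≤ q-GT

      flip-First : First (get (flip k I T)) k I
      flip-First = First-agree q (get (flip k I T)) (λ i j j≤ → sym (agree i j j≤)) (bk-First g f)

      flip-flip : flip k I (flip k I T) ≡ T
      flip-flip = trans (tab-cong R (suc n) (λ i j i< j< → trans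
          (cong (λ c → Reflect.bk k I c (get (flip k I T)) i j) (trans (cutoff-cong _ q k I (k< f) agree) (cutoff-bk g f)))
          (trans (bk-cong k I C (k< f) agree i (≤-pred j<)) (Reflect.bk-bk k I C g (k< f) (first-Cut g f) i j))))
        (tab-get (proj₁ a))

      flip-exchange : Exchange γ k (wt R n (get T)) (wt R n (get (flip k I T)))
      flip-exchange = subst (Exchange γ k (wt R n (get T))) (sym (wt-cong R n (λ i j _ j≤ → agree i j j≤))) (bk-exchange g f)

    Bad : List (List ℕ) → Set
    Bad T = Arr R n α β T × ¬ Good (get T)

    badE : Enum Bad
    badE = filterE (arrE R n α β) (λ T → ¬? (Good? (get T)))

    goodE : Enum (λ T → Arr R n α β T × Good (get T))
    goodE = filterE (arrE R n α β) (λ T → Good? (get T))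

    τ-Bad : ∀ T → Bad T → Bad (τ T)
    τ-Bad T (a , ¬g) = let (k , I , f) = first T ¬g in subst Bad (sym (τ-flip T f))
      (flip-Arr a f , λ g → fail (flip-First a f) (g k I (k< f) (I< f)))

    τ-τ : ∀ T → Bad T → τ (τ T) ≡ T
    τ-τ T (a , ¬g) = let (k , I , f) = first T ¬g in
      trans (cong τ (τ-flip T f)) (trans (τ-flip (flip k I T) (flip-First a f)) (flip-flip a f))

    module _ (g : List ℕ → ℤ) (g-anti : ∀ k t t′ → suc k < n → length t ≡ n → length t′ ≡ n → Exchange γ k t t′ → g t′ ≡ ℤ.- g t) where

      -- Reindexing by `τ` turns the sum into its negative. Fixed points need no separate treatment,
      -- since the conclusion is drawn for the sum as a whole.
      bad-sum : ∑ (elems badE) (λ T → g (wt R n (get T))) ≡ 0ℤ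
      bad-sum = self-neg (trans (∑-bij badE badE τ τ τ-Bad τ-Bad τ-τ τ-τ _ (λ T → ℤ.- g (wt R n (get T))) negated) (∑-neg (elems badE) _))
        where
        self-neg : ∀ {i} → i ≡ ℤ.- i → i ≡ 0ℤ
        self-neg {pos zero} e = refl
        self-neg {pos (suc n)} ()
        self-neg {ℤ.-[1+ n ]} ()
        negated : ∀ T → Bad T → g (wt R n (get T)) ≡ ℤ.- g (wt R n (get (τ T)))
        negated T (a , ¬g) = let (k , I , f) = first T ¬g in
          trans (sym (ℤₚ.neg-involutive _)) (cong ℤ.-_ (sym (trans (cong (λ T′ → g (wt R n (get T′))) (τ-flip T f))
            (g-anti k _ _ (k< f) (length-wt R n (get T)) (length-wt R n (get (flip k I T))) (flip-exchange a f)))))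

      good-sum : ∑ (elems (arrE R n α β)) (λ T → g (wt R n (get T))) ≡ ∑ (elems goodE) (λ T → g (wt R n (get T)))
      good-sum = trans (∑-partition (λ T → Good? (get T)) (elems (arrE R n α β)) _)
        (trans (cong (∑ (elems goodE) (λ T → g (wt R n (get T))) ⊕_) bad-sum) (ℤₚ.+-identityʳ _))

open Involution

-- Multiplication by the product of differences, and coefficients at η + ρ

module Antisymmetrisation where

  -- Cofactor expansion: h is applied to each entry together with the list of the others in their
  -- order, with alternating signs.
  pick : (ℕ → List ℕ → ℤ) → List ℕ → ℤ
  pick h []       = 0ℤ
  pick h (x ∷ xs) = h x xs ⊕ ℤ.- pick (λ y ys → h y (x ∷ ys)) xs

  -- D n Φ v = ∑ sgn σ · Φ (σ v) over the rearrangements of a list v of length n.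
  D : ℕ → (List ℕ → ℤ) → List ℕ → ℤ
  D zero    Φ v = Φ []
  D (suc n) Φ v = pick (λ y ys → D n (λ u → Φ (y ∷ u)) ys) v

  pick-cong : ∀ {h h′} v → (∀ y ys → h y ys ≡ h′ y ys) → pick h v ≡ pick h′ v
  pick-cong []       e = refl
  pick-cong (x ∷ xs) e = cong₂ (λ a b → a ⊕ ℤ.- b) (e x xs) (pick-cong xs (λ y ys → e y (x ∷ ys)))

  pick-zero : ∀ {h} v → (∀ y ys → y ∈ v → h y ys ≡ 0ℤ) → pick h v ≡ 0ℤ
  pick-zero []       e = refl
  pick-zero (x ∷ xs) e = cong₂ (λ a b → a ⊕ ℤ.- b) (e x xs (here refl)) (pick-zero xs (λ y ys y∈ → e y (x ∷ ys) (there y∈)))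

  pick-+ : ∀ h h′ v → pick (λ y ys → h y ys ⊕ h′ y ys) v ≡ pick h v ⊕ pick h′ v
  pick-+ h h′ []       = refl
  pick-+ h h′ (x ∷ xs) = trans (cong (λ b → h x xs ⊕ h′ x xs ⊕ ℤ.- b) (pick-+ (λ y ys → h y (x ∷ ys)) _ xs)) (lem (h x xs) (h′ x xs) _ _)
    where
    lem : ∀ a b c d → a ⊕ b ⊕ ℤ.- (c ⊕ d) ≡ (a ⊕ ℤ.- c) ⊕ (b ⊕ ℤ.- d)
    lem = ℤ-solver.solve-∀

  pick-* : ∀ c h v → pick (λ y ys → c * h y ys) v ≡ c * pick h v
  pick-* c h []       = sym (ℤₚ.*-zeroʳ c)
  pick-* c h (x ∷ xs) = trans (cong (λ b → c * h x xs ⊕ ℤ.- b) (pick-* c (λ y ys → h y (x ∷ ys)) xs)) (lem c (h x xs) _)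
    where
    lem : ∀ c a b → c * a ⊕ ℤ.- (c * b) ≡ c * (a ⊕ ℤ.- b)
    lem = ℤ-solver.solve-∀

  -- Two entries taken out in the opposite order leave the same rest with the opposite sign. This is
  -- the whole source of antisymmetry; `D-anti` only moves it to position k.
  pick-swap : ∀ (H : ℕ → ℕ → List ℕ → ℤ) v →
    pick (λ y ys → pick (λ z zs → H z y zs) ys) v ≡ ℤ.- pick (λ y ys → pick (λ z zs → H y z zs) ys) v
  pick-swap H []       = refl
  pick-swap H (x ∷ xs) = trans (expand (λ y z → H z y)) (trans (cong (λ c → pick (λ z zs → H z x zs) xs ⊕ ℤ.- (pick (H x) xs ⊕ ℤ.- c)) (pick-swap (λ y z zs → H y z (x ∷ zs)) xs))
    (trans (lem (pick (λ z zs → H z x zs) xs) (pick (H x) xs) (pick (λ y ys → pick (λ z zs → H y z (x ∷ zs)) ys) xs)) (cong ℤ.-_ (sym (expand H)))))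
    where
    expand : ∀ (H : ℕ → ℕ → List ℕ → ℤ) → pick (λ y ys → pick (H y) ys) (x ∷ xs) ≡
      pick (H x) xs ⊕ ℤ.- (pick (λ y ys → H y x ys) xs ⊕ ℤ.- pick (λ y ys → pick (λ z zs → H y z (x ∷ zs)) ys) xs)
    expand H = cong (λ b → pick (H x) xs ⊕ ℤ.- b) (trans (pick-+ (λ y ys → H y x ys) _ xs)
      (cong (pick (λ y ys → H y x ys) xs ⊕_) (trans (trans (pick-cong xs (λ y ys → neg (pick (λ z zs → H y z (x ∷ zs)) ys))) (pick-* ℤ.-1ℤ _ xs)) (sym (neg _)))))
      where
      neg : ∀ a → ℤ.- a ≡ ℤ.-1ℤ * a
      neg a = sym (ℤₚ.-1*i≡-i a)
    lem : ∀ a b c → a ⊕ ℤ.- (b ⊕ ℤ.- (ℤ.- c)) ≡ ℤ.- (b ⊕ ℤ.- (a ⊕ ℤ.- c))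
    lem = ℤ-solver.solve-∀

  D-cong : ∀ n {Φ Ψ} v → (∀ u → length u ≡ n → Φ u ≡ Ψ u) → D n Φ v ≡ D n Ψ v
  D-cong zero    v e = e [] refl
  D-cong (suc n) v e = pick-cong v (λ y ys → D-cong n ys (λ u l → e (y ∷ u) (cong suc l)))

  D-zero : ∀ n {Φ} v → (∀ u → length u ≡ n → Φ u ≡ 0ℤ) → D n Φ v ≡ 0ℤ
  D-zero zero    v e = e [] refl
  D-zero (suc n) v e = pick-zero v (λ y ys _ → D-zero n ys (λ u l → e (y ∷ u) (cong suc l)))

  D-+ : ∀ n Φ Ψ v → D n (λ u → Φ u ⊕ Ψ u) v ≡ D n Φ v ⊕ D n Ψ v
  D-+ zero    Φ Ψ v = refl
  D-+ (suc n) Φ Ψ v = trans (pick-cong v (λ y ys → D-+ n _ _ ys)) (pick-+ (λ y ys → D n (λ u → Φ (y ∷ u)) ys) _ v)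

  D-* : ∀ n c Φ v → D n (λ u → c * Φ u) v ≡ c * D n Φ v
  D-* zero    c Φ v = refl
  D-* (suc n) c Φ v = trans (pick-cong v (λ y ys → D-* n c _ ys)) (pick-* c (λ y ys → D n (λ u → Φ (y ∷ u)) ys) v)

  D-∑ : ∀ n {A : Set} (xs : List A) (Φ : A → List ℕ → ℤ) v → D n (λ u → ∑ xs (λ x → Φ x u)) v ≡ ∑ xs (λ x → D n (Φ x) v)
  D-∑ n []       Φ v = D-zero n v (λ _ _ → refl)
  D-∑ n (x ∷ xs) Φ v = trans (D-+ n (Φ x) _ v) (cong (D n (Φ x) v ⊕_) (D-∑ n xs Φ v))

  D-anti : ∀ n k Φ v → suc k < n → D n (λ u → Φ (sw k u)) v ≡ ℤ.- D n Φ v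
  D-anti (suc (suc n)) zero    Φ v k< = pick-swap (λ y z zs → D n (λ u → Φ (y ∷ z ∷ u)) zs) v
  D-anti (suc n)       (suc k) Φ v (s≤s k<) = trans (pick-cong v (λ y ys → trans (D-anti n k (λ u → Φ (y ∷ u)) ys k<) (sym (ℤₚ.-1*i≡-i _))))
    (trans (pick-* ℤ.-1ℤ _ v) (ℤₚ.-1*i≡-i _))
  D-anti (suc zero)    zero    Φ v (s≤s ())

  *-zero : ∀ c {a} → a ≡ 0ℤ → c * a ≡ 0ℤ
  *-zero c refl = ℤₚ.*-zeroʳ c

  -- sub f v u is f (v − u), read as 0 when some part of v − u is negative.
  sub : (List ℕ → ℤ) → List ℕ → List ℕ → ℤ
  sub f (x ∷ v) (y ∷ u) = [ y ≤? x ]ᵈ * sub (λ e → f ((x ∸ y) ∷ e)) v u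
  sub f v       _       = f v

  sub-cong : ∀ {f h} v u → (∀ e → length e ≡ length v → f e ≡ h e) → sub f v u ≡ sub h v u
  sub-cong []      u       e = e [] refl
  sub-cong (x ∷ v) []      e = e (x ∷ v) refl
  sub-cong (x ∷ v) (y ∷ u) e = cong ([ y ≤? x ]ᵈ *_) (sub-cong v u (λ w l → e _ (cong suc l)))

  sub-zero : ∀ {f} v u → (∀ e → length e ≡ length v → f e ≡ 0ℤ) → sub f v u ≡ 0ℤ
  sub-zero []      u       e = e [] refl
  sub-zero (x ∷ v) []      e = e (x ∷ v) refl
  sub-zero (x ∷ v) (y ∷ u) e = *-zero [ y ≤? x ]ᵈ (sub-zero v u (λ w l → e _ (cong suc l)))

  sub-* : ∀ c f v u → sub (λ e → c * f e) v u ≡ c * sub f v u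
  sub-* c f []      u       = refl
  sub-* c f (x ∷ v) []      = refl
  sub-* c f (x ∷ v) (y ∷ u) = trans (cong ([ y ≤? x ]ᵈ *_) (sub-* c _ v u)) (lem [ y ≤? x ]ᵈ c _)
    where
    lem : ∀ a b c → a * (b * c) ≡ b * (a * c)
    lem = ℤ-solver.solve-∀

  sub-∑ : ∀ {A : Set} (xs : List A) (f : A → List ℕ → ℤ) v u → sub (λ e → ∑ xs (λ x → f x e)) v u ≡ ∑ xs (λ x → sub (f x) v u)
  sub-∑ xs f []      u       = refl
  sub-∑ xs f (x ∷ v) []      = refl
  sub-∑ xs f (x ∷ v) (y ∷ u) = trans (cong ([ y ≤? x ]ᵈ *_) (sub-∑ xs (λ z e → f z ((x ∸ y) ∷ e)) v u)) (sym (∑-*ˡ xs [ y ≤? x ]ᵈ (λ z → sub (λ e → f z ((x ∸ y) ∷ e)) v u)))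

  sub-sub : ∀ f v t u → length t ≡ length v → length u ≡ length v → sub (λ e → sub f e t) v u ≡ sub (λ e → sub f e u) v t
  sub-sub f []      []      []      _ _ = refl
  sub-sub f (x ∷ v) (a ∷ t) (b ∷ u) p q =
    trans (cong ([ b ≤? x ]ᵈ *_) (sub-* [ a ≤? x ∸ b ]ᵈ (λ e → sub (λ w → f ((x ∸ b ∸ a) ∷ w)) e t) v u))
    (trans (sym (ℤₚ.*-assoc [ b ≤? x ]ᵈ _ _))
    (trans (cong₂ _*_ (both a b) (trans (sub-cong v u (λ e l → cong (λ z → sub (λ w → f (z ∷ w)) e t) (∸-comm x b a)))
        (sub-sub (λ w → f ((x ∸ a ∸ b) ∷ w)) v t u (suc-injective p) (suc-injective q))))
    (trans (ℤₚ.*-assoc [ a ≤? x ]ᵈ _ _)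
      (cong ([ a ≤? x ]ᵈ *_) (sym (sub-* [ b ≤? x ∸ a ]ᵈ (λ e → sub (λ w → f ((x ∸ a ∸ b) ∷ w)) e u) v t))))))
    where
    ∸-comm : ∀ x b a → x ∸ b ∸ a ≡ x ∸ a ∸ b
    ∸-comm x b a = trans (∸-+-assoc x b a) (trans (cong (x ∸_) (+-comm b a)) (sym (∸-+-assoc x a b)))
    prod : ∀ {P Q : Set} (d : Dec P) (e : Dec Q) → [ d ]ᵈ * [ e ]ᵈ ≡ [ d ×-dec e ]ᵈ
    prod (yes _) (yes _) = refl
    prod (yes _) (no _)  = refl
    prod (no _)  (yes _) = refl
    prod (no _)  (no _)  = refl
    swap-≤ : ∀ a b → (b ≤ x) × (a ≤ x ∸ b) → (a ≤ x) × (b ≤ x ∸ a)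
    swap-≤ a b (p , q) = ≤-trans (m≤m+n a b) a+b , m+n≤o⇒m≤o∸n b (≤-trans (≤-reflexive (+-comm b a)) a+b)
      where
      a+b : a + b ≤ x
      a+b = ≤-trans (+-monoˡ-≤ b q) (≤-reflexive (m∸n+n≡m p))
    both : ∀ a b → [ b ≤? x ]ᵈ * [ a ≤? x ∸ b ]ᵈ ≡ [ a ≤? x ]ᵈ * [ b ≤? x ∸ a ]ᵈ
    both a b = trans (prod (b ≤? x) (a ≤? x ∸ b)) (trans ([⇔] ((b ≤? x) ×-dec (a ≤? x ∸ b)) ((a ≤? x) ×-dec (b ≤? x ∸ a)) (swap-≤ a b) (swap-≤ b a)) (sym (prod (a ≤? x) (b ≤? x ∸ a))))

  sub-D : ∀ n (F : List ℕ → List ℕ → ℤ) w v t → D n (λ u → sub (λ e → F e u) v t) w ≡ sub (λ e → D n (F e) w) v t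
  sub-D n F w []      t       = refl
  sub-D n F w (x ∷ v) []      = refl
  sub-D n F w (x ∷ v) (y ∷ t) = trans (D-* n [ y ≤? x ]ᵈ (λ u → sub (λ e → F ((x ∸ y) ∷ e) u) v t) w) (cong ([ y ≤? x ]ᵈ *_) (sub-D n _ w v t))

  sub-sw : ∀ k {f} v u → Symmetric f → length u ≡ length v → sub f (sw k v) (sw k u) ≡ sub f v u
  sub-sw zero    []          []          s l = refl
  sub-sw zero    (x ∷ [])    (a ∷ [])    s l = refl
  sub-sw zero    {f} (x ∷ y ∷ v) (a ∷ b ∷ u) s l = trans (lem [ b ≤? y ]ᵈ [ a ≤? x ]ᵈ _)
    (cong (λ z → [ a ≤? x ]ᵈ * ([ b ≤? y ]ᵈ * z)) (sub-cong v u (λ e _ → s 0 _)))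
    where
    lem : ∀ a b c → a * (b * c) ≡ b * (a * c)
    lem = ℤ-solver.solve-∀
  sub-sw (suc k) []      []      s l = refl
  sub-sw (suc k) (x ∷ v) (a ∷ u) s l = cong ([ a ≤? x ]ᵈ *_) (sub-sw k v u (λ k′ e → s (suc k′) _) (suc-injective l))

  staircase : ℕ → List ℕ
  staircase zero    = []
  staircase (suc n) = n ∷ staircase n

  length-staircase : ∀ n → length (staircase n) ≡ n
  length-staircase zero    = refl
  length-staircase (suc n) = cong suc (length-staircase n)

  ∈-staircase : ∀ {y} n → y ∈ staircase n → y < n
  ∈-staircase (suc n) (here refl) = ≤-refl
  ∈-staircase (suc n) (there y∈)  = m<n⇒m<1+n (∈-staircase n y∈)

  -- X n f v is the coefficient of x^v in f(x₁,…,xₙ) · ∏_{i<j} (xᵢ − xⱼ).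
  X : ℕ → (List ℕ → ℤ) → List ℕ → ℤ
  X n f v = D n (sub f v) (staircase n)

  X-cong : ∀ n {f h} v → length v ≡ n → (∀ e → length e ≡ n → f e ≡ h e) → X n f v ≡ X n h v
  X-cong n v l e = D-cong n (staircase n) (λ u _ → sub-cong v u (λ w l′ → e w (trans l′ l)))

  -- For symmetric f an exchange in v may be moved to the rearranged staircase that is subtracted
  -- from it, where `D` changes sign.
  X-anti : ∀ n k f v → suc k < n → Symmetric f → length v ≡ n → X n f (sw k v) ≡ ℤ.- X n f v
  X-anti n k f v k< s l = trans (D-cong n (staircase n) (λ u lu → trans (cong (sub f (sw k v)) (sym (sw-sw k u)))
      (sub-sw k v (sw k u) s (trans (length-sw k u) (trans lu (sym l))))))
    (D-anti n k (sub f v) (staircase n) k<)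

  -- Multiplication by monomials commutes with multiplication by the product of differences.
  X-sub : ∀ n {A : Set} (xs : List A) (t : A → List ℕ) f v → length v ≡ n → (∀ x → length (t x) ≡ n) →
    X n (λ e → ∑ xs (λ x → sub f e (t x))) v ≡ ∑ xs (λ x → sub (X n f) v (t x))
  X-sub n xs t f v l lt = trans (D-cong n (staircase n) (λ u lu → trans (sub-∑ xs (λ x e → sub f e (t x)) v u)
      (∑-cong′ xs (λ x → sub-sub f v (t x) u (trans (lt x) (sym l)) (trans lu (sym l))))))
    (trans (D-∑ n xs (λ x u → sub (λ e → sub f e u) v (t x)) (staircase n))
      (∑-cong′ xs (λ x → sub-D n (λ e u → sub f e u) (staircase n) v (t x))))

  plus : List ℕ → List ℕ → List ℕ
  plus (x ∷ u) (y ∷ v) = (x + y) ∷ plus u v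
  plus _       _       = []

  length-plus : ∀ u v → length u ≡ length v → length (plus u v) ≡ length v
  length-plus []      []      _ = refl
  length-plus (x ∷ u) (y ∷ v) l = cong suc (length-plus u v (suc-injective l))

  part-plus : ∀ u v k → length u ≡ length v → part (plus u v) k ≡ part u k + part v k
  part-plus []      []      k       _ = refl
  part-plus (x ∷ u) (y ∷ v) zero    _ = refl
  part-plus (x ∷ u) (y ∷ v) (suc k) l = part-plus u v k (suc-injective l)

  data _≻_ : List ℕ → List ℕ → Set where
    here  : ∀ {x y u v} → y < x → (x ∷ u) ≻ (y ∷ v)
    there : ∀ {x u v} → u ≻ v → (x ∷ u) ≻ (x ∷ v)

  -- Subtracting any other rearrangement of the staircase from η + ρ gives a lexicographically larger exponent than η.
  X-eval : ∀ n f η → length η ≡ n → (∀ e → length e ≡ n → e ≻ η → f e ≡ 0ℤ) → X n f (plus η (staircase n)) ≡ f η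
  X-eval zero    f []      l z = refl
  X-eval (suc n) f (h ∷ η) l z = trans (cong₂ (λ a b → a ⊕ ℤ.- b) main rest) (ℤₚ.+-identityʳ (f (h ∷ η)))
    where
    lη = suc-injective l
    v = plus η (staircase n)
    lv : length v ≡ n
    lv = trans (length-plus η (staircase n) (trans lη (sym (length-staircase n)))) (length-staircase n)
    main : D n (λ u → sub f ((h + n) ∷ v) (n ∷ u)) (staircase n) ≡ f (h ∷ η)
    main = trans (D-cong n (staircase n) (λ u _ → trans (cong₂ _*_ ([yes] (n ≤? h + n) (m≤n+m n h))
        (cong (λ x → sub (λ e → f (x ∷ e)) v u) (m+n∸n≡m h n))) (ℤₚ.*-identityˡ _)))
      (X-eval n (λ e → f (h ∷ e)) η lη (λ e le e≻ → z (h ∷ e) (cong suc le) (there e≻)))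
    rest : pick (λ y ys → D n (λ u → sub f ((h + n) ∷ v) (y ∷ u)) (n ∷ ys)) (staircase n) ≡ 0ℤ
    rest = pick-zero (staircase n) (λ y ys y∈ → D-zero n (n ∷ ys) (λ u _ → *-zero [ y ≤? h + n ]ᵈ
      (sub-zero v u (λ e le → z _ (cong suc (trans le lv)) (here (bigger (∈-staircase n y∈)))))))
      where
      bigger : ∀ {y} → y < n → h < h + n ∸ y
      bigger {y} y< = m+n≤o⇒m≤o∸n (suc h) (≤-trans (≤-reflexive (sym (+-suc h y))) (+-monoʳ-≤ h y<))

  Dominant : List ℕ → Set
  Dominant η = ∀ k → part η (suc k) ≤ part η k

  sw-≻ : ∀ k e → suc k < length e → part e k < part e (suc k) → sw k e ≻ e
  sw-≻ zero    (x ∷ y ∷ e) _        p = here p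
  sw-≻ zero    (x ∷ [])    (s≤s ()) p
  sw-≻ (suc k) (x ∷ e)     (s≤s k<) p = there (sw-≻ k e k< p)

  size-sw : ∀ k e → size (sw k e) ≡ size e
  size-sw zero    []          = refl
  size-sw zero    (x ∷ [])    = refl
  size-sw zero    (x ∷ y ∷ e) = lem y x (size e)
    where
    lem : ∀ a b c → a + (b + c) ≡ b + (a + c)
    lem = ℕ-solver.solve-∀
  size-sw (suc k) []          = refl
  size-sw (suc k) (x ∷ e)     = cong (x +_) (size-sw k e)

  -- The list read as a number in base B. On lists of one length with entries below B it is
  -- increasing for the lexicographic order, which turns an induction along that order into one on
  -- numbers.
  code : ℕ → List ℕ → ℕ
  code B []      = 0
  code B (x ∷ e) = x ℕ.* B ℕ.^ length e + code B e

  code-bound : ∀ B e → All (_< B) e → code B e < B ℕ.^ length e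
  code-bound B []      []      = s≤s z≤n
  code-bound B (x ∷ e) (p ∷ a) = <-≤-trans (+-monoʳ-< (x ℕ.* B ℕ.^ length e) (code-bound B e a))
    (≤-trans (≤-reflexive (+-comm (x ℕ.* B ℕ.^ length e) _)) (*-monoˡ-≤ (B ℕ.^ length e) p))

  code-≻ : ∀ B u v → length u ≡ length v → All (_< B) v → u ≻ v → code B v < code B u
  code-≻ B (x ∷ u) (y ∷ v) l (_ ∷ a) (here y<) = <-≤-trans (+-monoʳ-< (y ℕ.* B ℕ.^ length v) (code-bound B v a))
    (≤-trans (≤-reflexive (+-comm (y ℕ.* B ℕ.^ length v) _))
    (≤-trans (*-monoˡ-≤ (B ℕ.^ length v) y<)
    (≤-trans (≤-reflexive (cong (λ m → x ℕ.* B ℕ.^ m) (sym (suc-injective l)))) (m≤m+n _ (code B u)))))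
  code-≻ B (x ∷ u) (.x ∷ v) l (_ ∷ a) (there p) = ≤-trans (+-monoʳ-< (x ℕ.* B ℕ.^ length v) (code-≻ B u v (suc-injective l) a p))
    (≤-reflexive (cong (λ m → x ℕ.* B ℕ.^ m + code B u) (sym (suc-injective l))))

  All-<size : ∀ e → All (_< suc (size e)) e
  All-<size []      = []
  All-<size (x ∷ e) = s≤s (m≤m+n x _) ∷ All.map (λ p → <-≤-trans p (s≤s (m≤n+m _ x))) (All-<size e)

  -- Induction along the lexicographic order from above: a list with an ascent is smaller than the list with the ascent exchanged.
  symmetric-vanish : ∀ n d f → Symmetric f → (∀ e → length e ≡ n → size e ≢ d → f e ≡ 0ℤ) →
    (∀ η → length η ≡ n → Dominant η → X n f (plus η (staircase n)) ≡ 0ℤ) → ∀ e → length e ≡ n → f e ≡ 0ℤ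
  symmetric-vanish n d f s h x e le with size e ≟ d
  ... | no  d≢ = h e le d≢
  ... | yes d≡ = go (B ℕ.^ n) e le d≡ (m∸n≤m _ (code B e))
    where
    B = suc d
    small : ∀ e → size e ≡ d → All (_< B) e
    small e refl = All-<size e
    go : ∀ fuel e → length e ≡ n → size e ≡ d → B ℕ.^ n ∸ code B e ≤ fuel → f e ≡ 0ℤ
    go zero e le se q = ⊥-elim (<⇒≱ (subst (λ m → code B e < B ℕ.^ m) le (code-bound B e (small e se))) (m∸n≡0⇒m≤n (n≤0⇒n≡0 q)))
    go (suc fuel) e le se q with least (λ k → part e (suc k) ≤? part e k) n
    ... | inj₁ dom = trans (sym (X-eval n f e le bigger)) (x e le dominant)
      where
      dominant : Dominant e
      dominant k with k <? n
      ... | yes k< = dom k k<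
      ... | no k≮ = ≤-trans (≤-reflexive (part-≥ e (suc k) (≤-trans (≤-reflexive le) (≤-trans (≮⇒≥ k≮) (n≤1+n k))))) z≤n
      bigger : ∀ e′ → length e′ ≡ n → e′ ≻ e → f e′ ≡ 0ℤ
      bigger e′ le′ e≻ with size e′ ≟ d
      ... | no  d≢ = h e′ le′ d≢
      ... | yes d≡ = go fuel e′ le′ d≡ (≤-pred (≤-trans (∸-monoʳ-< (code-≻ B e′ e (trans le′ (sym le)) (small e se) e≻)
        (<⇒≤ (subst (λ m → code B e′ < B ℕ.^ m) le′ (code-bound B e′ (small e′ d≡))))) q))
    ... | inj₂ (k , k< , ¬p , _) = trans (sym (s k e)) (go fuel (sw k e) (trans (length-sw k e) le) (trans (size-sw k e) se)
        (≤-pred (≤-trans (∸-monoʳ-< (code-≻ B (sw k e) e (length-sw k e) (small e se) (sw-≻ k e sk< (≰⇒> ¬p)))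
          (<⇒≤ (subst (λ m → code B (sw k e) < B ℕ.^ m) (trans (length-sw k e) le) (code-bound B (sw k e) (small (sw k e) (trans (size-sw k e) se)))))) q)))
      where
      sk< : suc k < length e
      sk< = ≰⇒> (λ l≤ → ¬p (≤-trans (≤-reflexive (part-≥ e (suc k) l≤)) z≤n))

open Antisymmetrisation

-- The coefficient at η + ρ of a product with a skew Schur polynomial

module Extraction where

  conv : (List ℕ → ℤ) → (List ℕ → ℤ) → List ℕ → ℤ
  conv f h e = ∑ (splits e) (λ u → f u * h (minus e u))

  upToE : ∀ n → Enum (_< n)
  upToE n = record { elems = upTo n ; unique = Uₚ.upTo⁺ n ; sound = ∈ₚ.∈-upTo⁻ ; complete = ∈ₚ.∈-upTo⁺ }

  ∑-splits : ∀ x e f → ∑ (splits (x ∷ e)) f ≡ ∑ (upTo (suc x)) (λ k → ∑ (splits e) (λ u → f (k ∷ u)))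
  ∑-splits x e f = ∑-cons (upTo (suc x)) (λ _ → splits e) f

  splits-sound : ∀ e {u} → u ∈ splits e → length u ≡ length e × (∀ k → part u k ≤ part e k)
  splits-sound []      (here refl) = refl , λ _ → z≤n
  splits-sound (x ∷ e) u∈ with ∈-cons⁻ (upTo (suc x)) (λ _ → splits e) u∈
  ... | k , w , refl , k∈ , w∈ = let (l , le) = splits-sound e w∈ in
    cong suc l , λ { zero → ≤-pred (∈ₚ.∈-upTo⁻ k∈) ; (suc j) → le j }

  length-minus : ∀ v t → length t ≡ length v → length (minus v t) ≡ length v
  length-minus []      []      _ = refl
  length-minus (x ∷ v) (y ∷ t) l = cong suc (length-minus v t (suc-injective l))

  part-minus : ∀ v t k → length t ≡ length v → part (minus v t) k ≡ part v k ∸ part t k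
  part-minus []      []      k       _ = refl
  part-minus (x ∷ v) (y ∷ t) zero    _ = refl
  part-minus (x ∷ v) (y ∷ t) (suc k) l = part-minus v t k (suc-injective l)

  size-minus : ∀ v t → length t ≡ length v → (∀ k → part t k ≤ part v k) → size t + size (minus v t) ≡ size v
  size-minus []      []      _ _ = refl
  size-minus (x ∷ v) (y ∷ t) l h = trans (lem y (size t) (x ∸ y) _) (cong₂ _+_ (m+[n∸m]≡n (h 0)) (size-minus v t (suc-injective l) (h ∘ suc)))
    where
    lem : ∀ a b c d → a + b + (c + d) ≡ (a + c) + (b + d)
    lem = ℕ-solver.solve-∀

  sub-minus : ∀ f v t → length t ≡ length v → (∀ k → part t k ≤ part v k) → sub f v t ≡ f (minus v t)
  sub-minus f []      []      _ _ = refl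
  sub-minus f (x ∷ v) (y ∷ t) l h = trans (cong₂ _*_ ([yes] (y ≤? x) (h 0)) (sub-minus _ v t (suc-injective l) (h ∘ suc))) (ℤₚ.*-identityˡ _)

  sub-neg : ∀ f v t k → length t ≡ length v → part v k < part t k → sub f v t ≡ 0ℤ
  sub-neg f []      []      k       l ()
  sub-neg f (x ∷ v) (y ∷ t) zero    l p = cong (_* sub (λ e → f ((x ∸ y) ∷ e)) v t) ([no] (y ≤? x) (<⇒≱ p))
  sub-neg f (x ∷ v) (y ∷ t) (suc k) l p = *-zero [ y ≤? x ]ᵈ (sub-neg (λ e → f ((x ∸ y) ∷ e)) v t k (suc-injective l) p)

  𝟙-∧ : ∀ a b → 𝟙 (a ∧ b) ≡ 𝟙 a * 𝟙 b
  𝟙-∧ true  true  = refl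
  𝟙-∧ true  false = refl
  𝟙-∧ false b     = refl

  δ-cons : ∀ x y u v → δ (x ∷ u) (y ∷ v) ≡ [ x ≟ y ]ᵈ * δ u v
  δ-cons x y u v = 𝟙-∧ (does (x ≟ y)) (does (u ≟L v))

  -- Multiplication by the monomial x^t shifts the exponents by t.
  conv-δ : ∀ f e t → length t ≡ length e → conv f (δ t) e ≡ sub f e t
  conv-δ f []      []      _ = trans (ℤₚ.+-identityʳ _) (ℤₚ.*-identityʳ (f []))
  conv-δ f (x ∷ e) (y ∷ t) l = trans (∑-splits x e _) (trans (∑-cong′ (upTo (suc x)) inner) outer)
    where
    l′ = suc-injective l
    inner : ∀ k → ∑ (splits e) (λ u → f (k ∷ u) * δ (y ∷ t) ((x ∸ k) ∷ minus e u)) ≡ [ y ≟ x ∸ k ]ᵈ * sub (λ u → f (k ∷ u)) e t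
    inner k = trans (∑-cong′ (splits e) (λ u → trans (cong (f (k ∷ u) *_) (δ-cons y (x ∸ k) t (minus e u))) (lem (f (k ∷ u)) [ y ≟ x ∸ k ]ᵈ (δ t (minus e u)))))
      (trans (∑-*ˡ (splits e) [ y ≟ x ∸ k ]ᵈ (λ u → f (k ∷ u) * δ t (minus e u))) (cong ([ y ≟ x ∸ k ]ᵈ *_) (conv-δ (λ u → f (k ∷ u)) e t l′)))
      where
      lem : ∀ a b c → a * (b * c) ≡ b * (a * c)
      lem = ℤ-solver.solve-∀
    outer : ∑ (upTo (suc x)) (λ k → [ y ≟ x ∸ k ]ᵈ * sub (λ u → f (k ∷ u)) e t) ≡ sub f (x ∷ e) (y ∷ t)
    outer with y ≤? x
    ... | yes y≤ = trans (∑-single (upToE (suc x)) (x ∸ y) (s≤s (m∸n≤m x y)) _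
        (λ k k< k≢ → cong (_* sub (λ u → f (k ∷ u)) e t) ([no] (y ≟ x ∸ k) (λ { refl → k≢ (sym (m∸[m∸n]≡n (≤-pred k<))) }))))
        (cong₂ _*_ (trans ([yes] (y ≟ x ∸ (x ∸ y)) (sym (m∸[m∸n]≡n y≤))) (sym ([yes] (y ≤? x) y≤))) refl)
    ... | no y≰ = trans (∑-zero (upTo (suc x)) (λ k _ → cong (_* sub (λ u → f (k ∷ u)) e t) ([no] (y ≟ x ∸ k) (λ { refl → y≰ (m∸n≤m x k) }))))
        (sym (cong (_* sub (λ w → f ((x ∸ y) ∷ w)) e t) ([no] (y ≤? x) y≰)))

  conv-K : ∀ f R n α β e → length e ≡ n → conv f (K R n α β) e ≡ ∑ (elems (arrE R n α β)) (λ T → sub f e (wt R n (get T)))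
  conv-K f R n α β e l = trans (∑-cong′ (splits e) (λ u → sym (∑-*ˡ As (f u) (λ T → δ (wt R n (get T)) (minus e u)))))
    (trans (∑-swap (splits e) As _) (∑-cong′ As (λ T → conv-δ f e (wt R n (get T)) (trans (length-wt R n (get T)) (sym l)))))
    where As = elems (arrE R n α β)

  pointwise? : ∀ v t → length t ≡ length v → (∀ k → part t k ≤ part v k) ⊎ (∃ λ k → part v k < part t k)
  pointwise? v t l with least (λ k → part t k ≤? part v k) (length v)
  ... | inj₂ (k , _ , ¬p , _) = inj₂ (k , ≰⇒> ¬p)
  ... | inj₁ h = inj₁ λ k → go k (k <? length v)
    where
    go : ∀ k → Dec (k < length v) → part t k ≤ part v k
    go k (yes k<) = h k k<
    go k (no k≮)  = ≤-trans (≤-reflexive (part-≥ t k (≤-trans (≤-reflexive l) (≮⇒≥ k≮)))) z≤n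

  size-zero : ∀ l → size l ≡ 0 → ∀ k → part l k ≡ 0
  size-zero l e k = n≤0⇒n≡0 (≤-trans (part≤size l k) (≤-reflexive e))

  parts-zero : ∀ l → (∀ k → part l k ≡ 0) → size l ≡ 0
  parts-zero []      h = refl
  parts-zero (x ∷ l) h = cong₂ _+_ (h 0) (parts-zero l (h ∘ suc))

  -- The series 1. A condition on the size fits exponent lists of every length.
  δ₀ : List ℕ → ℤ
  δ₀ e = [ size e ≟ 0 ]ᵈ

  δ₀-symmetric : Symmetric δ₀
  δ₀-symmetric k e = cong (λ m → [ m ≟ 0 ]ᵈ) (size-sw k e)

  sub-δ₀ : ∀ e t → length t ≡ length e → sub δ₀ e t ≡ δ t e
  sub-δ₀ e t l with pointwise? e t l
  ... | inj₂ (k , p) = trans (sub-neg δ₀ e t k l p) (sym ([no] (t ≟L e) (λ { refl → <-irrefl refl p })))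
  ... | inj₁ h = trans (sub-minus δ₀ e t l h) ([⇔] (size (minus e t) ≟ 0) (t ≟L e)
    (λ z → part-ext l (λ k _ → ≤-antisym (h k) (m∸n≡0⇒m≤n (trans (sym (part-minus e t k l)) (size-zero (minus e t) z k)))))
    (λ { refl → parts-zero (minus t t) (λ k → trans (part-minus t t k refl) (n∸n≡0 (part t k))) }))

  zeros : ℕ → List ℕ
  zeros n = replicate n 0

  part-zeros : ∀ n k → part (zeros n) k ≡ 0
  part-zeros zero    k       = refl
  part-zeros (suc n) zero    = refl
  part-zeros (suc n) (suc k) = part-zeros n k

  length-zeros : ∀ n → length (zeros n) ≡ n
  length-zeros n = Lₚ.length-replicate n

  plus-zeros : ∀ n t → length t ≡ n → plus (zeros n) t ≡ t
  plus-zeros zero    []      _ = refl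
  plus-zeros (suc n) (x ∷ t) l = cong (x ∷_) (plus-zeros n t (suc-injective l))

  -- A list that is lexicographically above another has a positive entry, so the series 1 vanishes
  -- on it and `X-eval` applies to every ζ.
  X-δ₀ : ∀ n ζ → length ζ ≡ n → X n δ₀ (plus ζ (staircase n)) ≡ [ ζ ≟L zeros n ]ᵈ
  X-δ₀ n ζ l = trans (X-eval n δ₀ ζ l (λ e _ e≻ → [no] (size e ≟ 0) (positive e≻)))
    ([⇔] (size ζ ≟ 0) (ζ ≟L zeros n)
      (λ z → part-ext (trans l (sym (length-zeros n))) (λ k _ → trans (size-zero ζ z k) (sym (part-zeros n k))))
      (λ { refl → parts-zero (zeros n) (part-zeros n) }))
    where
    positive : ∀ {u v} → u ≻ v → size u ≢ 0
    positive {x ∷ u} (here y<)  e = <⇒≢ (<-≤-trans (≤-<-trans z≤n y<) (m≤m+n x (size u))) (sym e)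
    positive {x ∷ u} (there p) e = positive p (m+n≡0⇒n≡0 x e)

  part-staircase : ∀ n k → suc k < n → part (staircase n) k ≡ suc (part (staircase n) (suc k))
  part-staircase (suc (suc n)) zero    _        = refl
  part-staircase (suc n)       (suc k) (s≤s k<) = part-staircase n k k<
  part-staircase (suc zero)    zero    (s≤s ())

  part-staircase-last : ∀ n → part (staircase (suc n)) n ≡ 0
  part-staircase-last zero    = refl
  part-staircase-last (suc n) = part-staircase-last n

  -- The letter k+1 occurs no more often than the letter k, counted from the content l,
  -- at every stage of the reading of rows top to bottom, right to left.
  Lattice : ℕ → ℕ → List ℕ → (ℕ → ℕ → ℕ) → Set
  Lattice R n l p = ∀ k i → suc k < n → i < R → part l (suc k) + sumTo (suc i) (mult p (suc k)) ≤ part l k + sumTo i (mult p k)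

  Lattice? : ∀ R n l p → Dec (Lattice R n l p)
  Lattice? R n l p = map′ (λ h k i k< i< → h {k} (<⇒≤ k<) {i} i< k<) (λ h {k} _ {i} i< k< → h k i k< i<)
    (allUpTo? (λ k → allUpTo? (λ i → imp (suc k <? n) (_ ≤? _)) R) n)
    where
    imp : {P Q : Set} → Dec P → Dec Q → Dec (P → Q)
    imp (no ¬p) _       = yes (λ p → ⊥-elim (¬p p))
    imp (yes p) (yes q) = yes (λ _ → q)
    imp (yes p) (no ¬q) = no (λ f → ¬q (f p))

  LatticeArr : ℕ → ℕ → List ℕ → List ℕ → List ℕ → List ℕ → List (List ℕ) → Set
  LatticeArr R n α β l η T = (Arr R n α β T × Lattice R n l (get T)) × plus l (wt R n (get T)) ≡ η

  latticeE : ∀ R n α β l η → Enum (LatticeArr R n α β l η)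
  latticeE R n α β l η = filterE (filterE (arrE R n α β) (λ T → Lattice? R n l (get T))) (λ T → plus l (wt R n (get T)) ≟L η)

  -- The number L(α/β, η/l) of the overview, for tables with R rows and n letters.
  L# : ℕ → ℕ → List ℕ → List ℕ → List ℕ → List ℕ → ℤ
  L# R n α β l η = ∑ (elems (latticeE R n α β l η)) (λ _ → 1ℤ)

  -- `f-ev` says that f behaves at the dominant exponents like the Schur polynomial s_l.
  module _ (R n : ℕ) (α β : List ℕ) (α≤ : length α ≤ R) (0<R : 0 < R)
           (f : List ℕ → ℤ) (f-sym : Symmetric f) (l : List ℕ) (ll : length l ≡ n)
           (f-ev : ∀ ζ → length ζ ≡ n → Dominant ζ → X n f (plus ζ (staircase n)) ≡ [ ζ ≟L l ]ᵈ)
           (η : List ℕ) (lη : length η ≡ n) (dom : Dominant η) where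
    open Stembridge R n α β α≤ (part η) dom using (Ok; Good; goodE; good-sum; tail)
    private
      v = plus η (staircase n)
      lηρ : length η ≡ length (staircase n)
      lηρ = trans lη (sym (length-staircase n))
      lv : length v ≡ n
      lv = trans (length-plus η (staircase n) lηρ) (length-staircase n)

      G : List ℕ → ℤ
      G t = sub (X n f) v t

      -- The two equations say, without subtraction, that v - t′ is v - t with two adjacent entries
      -- exchanged. Negative entries are exchanged as well, so the brackets in `sub` match before
      -- the antisymmetry of F is applied.
      exchange : ∀ k v t t′ → suc k < length v → length t ≡ length v → length t′ ≡ length v →
        part v k + part t (suc k) ≡ part v (suc k) + part t′ k → part v (suc k) + part t k ≡ part v k + part t′ (suc k) →
        (∀ j → j ≢ k → j ≢ suc k → part t′ j ≡ part t j) →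
        (F : List ℕ → ℤ) → (∀ e → length e ≡ length v → F (sw k e) ≡ ℤ.- F e) → sub F v t′ ≡ ℤ.- sub F v t
      exchange zero (x ∷ y ∷ v) (a ∷ b ∷ t) (a′ ∷ b′ ∷ t′) _ lt lt′ e₁ e₂ oth F anti =
        trans (cong (λ z → [ a′ ≤? x ]ᵈ * ([ b′ ≤? y ]ᵈ * z)) inner)
        (trans (cong₂ (λ p q → p * (q * (ℤ.- S))) (≤-swap {x} {y} {a′} {b} e₁) (≤-swap {y} {x} {b′} {a} e₂)) (lem [ b ≤? y ]ᵈ [ a ≤? x ]ᵈ S))
        where
        S = sub (λ e → F ((x ∸ a) ∷ (y ∸ b) ∷ e)) v t
        ≤-swap : ∀ {x y a′ b} → x + b ≡ y + a′ → [ a′ ≤? x ]ᵈ ≡ [ b ≤? y ]ᵈ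
        ≤-swap {x} {y} {a′} {b} e = [⇔] (a′ ≤? x) (b ≤? y)
          (λ p → +-cancelˡ-≤ a′ b y (≤-trans (+-monoˡ-≤ b p) (≤-reflexive (trans e (+-comm y a′)))))
          (λ p → +-cancelˡ-≤ b a′ x (≤-trans (+-monoˡ-≤ a′ p) (≤-reflexive (trans (sym e) (+-comm x b)))))
        ∸-swap : ∀ {x y a′ b} → x + b ≡ y + a′ → x ∸ a′ ≡ y ∸ b
        ∸-swap {x} {y} {a′} {b} e = trans (sym ([m+n]∸[m+o]≡n∸o b x a′)) (trans (cong₂ _∸_ (trans (+-comm b x) (trans e (+-comm y a′))) (+-comm b a′))
          ([m+n]∸[m+o]≡n∸o a′ y b))
        t≡ : t′ ≡ t
        t≡ = part-ext (suc-injective (suc-injective (trans lt′ (sym lt)))) (λ i _ → oth (suc (suc i)) (λ ()) (λ ()))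
        inner : sub (λ e → F ((x ∸ a′) ∷ (y ∸ b′) ∷ e)) v t′ ≡ ℤ.- S
        inner = trans (cong (sub _ v) t≡) (trans (sub-cong v t (λ e le → trans
            (cong₂ (λ c d → F (c ∷ d ∷ e)) (∸-swap {x} {y} e₁) (∸-swap {y} {x} e₂))
            (trans (anti ((x ∸ a) ∷ (y ∸ b) ∷ e) (cong (suc ∘ suc) le)) (sym (ℤₚ.-1*i≡-i _)))))
          (trans (sub-* ℤ.-1ℤ (λ e → F ((x ∸ a) ∷ (y ∸ b) ∷ e)) v t) (ℤₚ.-1*i≡-i S)))
        lem : ∀ p q s → p * (q * (ℤ.- s)) ≡ ℤ.- (q * (p * s))
        lem = ℤ-solver.solve-∀
      exchange zero (x ∷ []) _ _ (s≤s ())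
      exchange (suc k) (x ∷ v) (a ∷ t) (a′ ∷ t′) (s≤s k<) lt lt′ e₁ e₂ oth F anti with refl ← oth 0 (λ ()) (λ ()) =
        trans (cong ([ a ≤? x ]ᵈ *_) (exchange k v t t′ k< (suc-injective lt) (suc-injective lt′) e₁ e₂
            (λ j j≢ j≢′ → oth (suc j) (j≢ ∘ suc-injective) (j≢′ ∘ suc-injective)) (λ e → F ((x ∸ a) ∷ e)) (λ e le → anti _ (cong suc le))))
          (sym (ℤₚ.neg-distribʳ-* [ a ≤? x ]ᵈ _))

      G-anti : ∀ k t t′ → suc k < n → length t ≡ n → length t′ ≡ n → Exchange (part η) k t t′ → G t′ ≡ ℤ.- G t
      G-anti k t t′ k< lt lt′ ex = exchange k v t t′ (subst (suc k <_) (sym lv) k<) (trans lt (sym lv)) (trans lt′ (sym lv))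
        (trans (cong (_+ part t (suc k)) (pv k)) (trans (cong (λ s → part η k + s + part t (suc k)) (part-staircase n k k<))
          (trans (lem₁ {part η k} {part η (suc k)} {part t (suc k)} {part t′ k} (Exchange.at-k ex)) (cong (_+ part t′ k) (sym (pv (suc k)))))))
        (trans (cong (_+ part t k) (pv (suc k))) (trans (lem₂ {part η k} {part η (suc k)} {part t k} {part t′ (suc k)} (Exchange.at-suc ex))
          (trans (cong (λ s → part η k + s + part t′ (suc k)) (sym (part-staircase n k k<))) (cong (_+ part t′ (suc k)) (sym (pv k))))))
        (Exchange.other ex) (X n f) (λ e le → X-anti n k f e k< f-sym (trans le lv))
        where
        pv : ∀ j → part v j ≡ part η j + part (staircase n) j
        pv j = part-plus η (staircase n) j lηρ
        r = part (staircase n) (suc k)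
        lem₁ : ∀ {x y a b} → suc x + a ≡ y + b → x + suc r + a ≡ y + r + b
        lem₁ {x} {y} {a} {b} e = step r x y a b e
          where
          step : ∀ r x y a b → suc x + a ≡ y + b → x + suc r + a ≡ y + r + b
          step r x y a b e = eqlin e (ℕ-solver.solve (r L.∷ x L.∷ y L.∷ a L.∷ b L.∷ L.[]))
        lem₂ : ∀ {x y a b} → y + a ≡ suc x + b → y + r + a ≡ x + suc r + b
        lem₂ {x} {y} {a} {b} e = step r x y a b e
          where
          step : ∀ r x y a b → y + a ≡ suc x + b → y + r + a ≡ x + suc r + b
          step r x y a b e = eqlin e (ℕ-solver.solve (r L.∷ x L.∷ y L.∷ a L.∷ b L.∷ L.[]))

      wt-part : ∀ T k → k < n → part (wt R n (get T)) k ≡ sumTo R (mult (get T) k)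
      wt-part T k k< = part-applyUpTo _ n k<

      -- Row 0 ends the reading, so there `Good` makes η minus the content weakly decreasing. The
      -- letters k + 2 of row 0, left out in `Ok`, only enlarge the right side.
      good-step : ∀ T → Good (get T) → ∀ k → suc k < n → part η (suc k) + part (wt R n (get T)) k ≤ part η k + part (wt R n (get T)) (suc k)
      good-step T g k k< = ≤-trans (+-monoʳ-≤ (part η (suc k)) (≤-reflexive (trans (wt-part T k (<⇒≤ k<)) (sym (sumTo+tailTo R _ 0 z≤n)))))
        (≤-trans (g k 0 k< 0<R) (+-monoʳ-≤ (part η k) (≤-trans (m≤n+m _ (sumTo 1 (mult (get T) (suc k))))
          (≤-reflexive (trans (sumTo+tailTo R (mult (get T) (suc k)) 1 0<R) (sym (wt-part T (suc k) k<)))))))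

      eval-good : ∀ T → Good (get T) → G (wt R n (get T)) ≡ [ plus l (wt R n (get T)) ≟L η ]ᵈ
      eval-good T g with pointwise? η (wt R n (get T)) (trans (length-wt R n (get T)) (sym lη))
      ... | inj₁ h = trans (sub-minus (X n f) v t lt (λ k → ≤-trans (h k) (≤-trans (m≤m+n _ _) (≤-reflexive (sym (part-plus η (staircase n) k lηρ))))))
          (trans (cong (X n f) shifted) (trans (f-ev (minus η t) lζ domζ) ([⇔] (minus η t ≟L l) (plus l t ≟L η)
            (λ { refl → part-ext (trans (length-plus (minus η t) t (trans lζ (sym ltn))) (trans ltn (sym lη)))
                 (λ k _ → trans (part-plus (minus η t) t k (trans lζ (sym ltn))) (trans (cong (_+ part t k) (part-minus η t k ltη)) (m∸n+n≡m (h k)))) })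
            (λ { refl → part-ext (trans lζ (sym ll)) (λ k _ → trans (part-minus η t k ltη) (trans (cong (_∸ part t k) (part-plus l t k (trans ll (sym ltn)))) (m+n∸n≡m (part l k) (part t k)))) }))))
        where
        t = wt R n (get T)
        ltn : length t ≡ n
        ltn = length-wt R n (get T)
        ltη = trans ltn (sym lη)
        lt : length t ≡ length v
        lt = trans ltn (sym lv)
        lζ : length (minus η t) ≡ n
        lζ = trans (length-minus η t ltη) lη
        lζρ = trans lζ (sym (length-staircase n))
        shifted : minus v t ≡ plus (minus η t) (staircase n)
        shifted = part-ext (trans (length-minus v t lt) (trans lv (sym (trans (length-plus (minus η t) (staircase n) lζρ) (length-staircase n)))))
          (λ k _ → trans (part-minus v t k lt) (trans (cong (_∸ part t k) (part-plus η (staircase n) k lηρ))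
            (trans (∸-+ (part η k) (part (staircase n) k) (part t k) (h k)) (trans (cong (_+ part (staircase n) k) (sym (part-minus η t k ltη)))
              (sym (part-plus (minus η t) (staircase n) k lζρ))))))
          where
          ∸-+ : ∀ a b c → c ≤ a → a + b ∸ c ≡ (a ∸ c) + b
          ∸-+ a b c c≤ = +-∸-comm b c≤
        domζ : Dominant (minus η t)
        domζ k with suc k <? n
        ... | no k≮ = ≤-trans (≤-reflexive (part-≥ (minus η t) (suc k) (≤-trans (≤-reflexive lζ) (≮⇒≥ k≮)))) z≤n
        ... | yes k< = ≤-trans (≤-reflexive (part-minus η t (suc k) ltη)) (≤-trans
            (lem (h (suc k)) (h k) (good-step T g k k<)) (≤-reflexive (sym (part-minus η t k ltη))))
          where
          lem : ∀ {a b c d} → b ≤ a → d ≤ c → a + d ≤ c + b → a ∸ b ≤ c ∸ d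
          lem {a} {b} {c} {d} b≤ d≤ q = m+n≤o⇒m≤o∸n (a ∸ b) (+-cancelʳ-≤ b _ _ (≤-trans (≤-reflexive (trans (step (a ∸ b) d b) (cong (_+ d) (m∸n+n≡m b≤)))) q))
            where
            step : ∀ x d b → x + d + b ≡ x + b + d
            step = ℕ-solver.solve-∀
      -- A negative entry of η - t could be lifted by ρ. But the entries of η - t weakly decrease,
      -- so the last one is negative too, and there ρ is 0.
      ... | inj₂ (k , k-neg) = trans (last (n ∸ suc k) k (m+[n∸m]≡n (k<n k k-neg)) k-neg)
          (sym ([no] (plus l t ≟L η) (λ e → <⇒≱ k-neg (≤-trans (m≤n+m (part t k) (part l k))
            (≤-reflexive (trans (sym (part-plus l t k (trans ll (sym (length-wt R n (get T)))))) (cong (λ w → part w k) e)))))))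
        where
        t = wt R n (get T)
        k<n : ∀ k → part η k < part t k → k < n
        k<n k p with k <? n
        ... | yes k< = k<
        ... | no k≮ = ⊥-elim (n≮0 (<-≤-trans p (≤-reflexive (part-≥ t k (≤-trans (≤-reflexive (length-wt R n (get T))) (≮⇒≥ k≮))))))
        last : ∀ d k → suc k + d ≡ n → part η k < part t k → sub (X n f) v t ≡ 0ℤ
        last zero k refl p = sub-neg (X n f) v t k (trans (length-wt R n (get T)) (sym lv))
          (≤-trans (s≤s (≤-reflexive (trans (part-plus η (staircase n) k lηρ) (trans (cong (part η k +_) (trans (cong (λ m → part (staircase m) k) (+-identityʳ (suc k))) (part-staircase-last k))) (+-identityʳ _))))) p)
        last (suc d) k e p = last d (suc k) (trans (sym (+-suc (suc k) d)) e)
          (lem p (good-step T g k (≤-trans (m≤m+n (suc (suc k)) d) (≤-reflexive (trans (sym (+-suc (suc k) d)) e)))))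
          where
          lem : ∀ {a b c d} → a < b → c + b ≤ a + d → c < d
          lem {a} {b} {c} {d} p q = +-cancelˡ-< a c d (<-≤-trans (+-monoˡ-< c p) (≤-trans (≤-reflexive (+-comm b c)) q))

      -- As η is l plus the whole content, η minus what is read from below equals l plus what is
      -- read from above. So the slack in `Ok` is the slack in `Lattice`; the equation states this
      -- with all terms moved to positive sides.
      Good⇔Lattice : ∀ T → plus l (wt R n (get T)) ≡ η → ∀ k i → suc k < n → i < R →
        part η (suc k) + tail (get T) k i + (part l k + sumTo i (mult (get T) k)) ≡
        part η k + tail (get T) (suc k) (suc i) + (part l (suc k) + sumTo (suc i) (mult (get T) (suc k)))
      Good⇔Lattice T refl k i k< i< = lem (part η k) (part η (suc k)) (part l k) (part l (suc k)) (sumTo i (mult p k)) (tail p k i) (sumTo (suc i) (mult p (suc k))) (tail p (suc k) (suc i))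
        (ηp k (<⇒≤ k<) i (<⇒≤ i<)) (ηp (suc k) k< (suc i) i<)
        where
        p = get T
        ηp : ∀ k → k < n → ∀ i → i ≤ R → part η k ≡ part l k + (sumTo i (mult p k) + tail p k i)
        ηp k k< i i≤ = trans (part-plus l (wt R n p) k (trans ll (sym (length-wt R n p)))) (cong (part l k +_) (trans (wt-part T k k<) (sym (sumTo+tailTo R (mult p k) i i≤))))
        lem : ∀ h h′ l l′ a t a′ t′ → h ≡ l + (a + t) → h′ ≡ l′ + (a′ + t′) → h′ + t + (l + a) ≡ h + t′ + (l′ + a′)
        lem h h′ l l′ a t a′ t′ refl refl = ℕ-solver.solve (l L.∷ l′ L.∷ a L.∷ t L.∷ a′ L.∷ t′ L.∷ L.[])

      ≤-transfer : ∀ {a b c d : ℕ} → a + b ≡ c + d → a ≤ c → d ≤ b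
      ≤-transfer {a} {b} {c} {d} e p = +-cancelˡ-≤ c d b (≤-trans (≤-reflexive (sym e)) (+-monoˡ-≤ b p))

    -- Each tableau contributes the coefficient of f at η + ρ minus its content. The bad ones
    -- cancel, and a good one contributes 1 exactly if its content leads from l to η.
    X-lattice : X n (λ e → ∑ (elems (arrE R n α β)) (λ T → sub f e (wt R n (get T)))) v ≡ L# R n α β l η
    X-lattice = trans (X-sub n (elems (arrE R n α β)) (λ T → wt R n (get T)) f v lv (λ T → length-wt R n (get T)))
      (trans (good-sum G G-anti)
      (trans (∑-cong (elems goodE) (λ T T∈ → trans (eval-good T (proj₂ (sound goodE T∈))) (sym (ℤₚ.*-identityʳ _))))
      (trans (sym (∑-filter (λ T → plus l (wt R n (get T)) ≟L η) (elems goodE) (λ _ → 1ℤ)))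
      (∑-same (filterE goodE (λ T → plus l (wt R n (get T)) ≟L η)) (latticeE R n α β l η)
        (λ T ((a , g) , e) → (a , λ k i k< i< → ≤-transfer (Good⇔Lattice T e k i k< i<) (g k i k< i<)) , e)
        (λ T ((a , g) , e) → (a , λ k i k< i< → ≤-transfer (trans (+-comm (part l (suc k) + _) _) (trans (sym (Good⇔Lattice T e k i k< i<)) (+-comm (part η (suc k) + _) _))) (g k i k< i<)) , e)
        (λ _ → 1ℤ)))))

open Extraction

-- Partitions, padding by zeros, and the unique lattice tableau of straight shape

module Partitions where

  ∈-range⁻ : ∀ a b {k} → k ∈ range a b → a ≤ k × k < b
  ∈-range⁻ a b k∈ with ∈ₚ.∈-applyUpTo⁻ (a +_) k∈
  ... | i , i< , refl = m≤m+n a i , ≤-trans (+-monoʳ-< a i<) (≤-reflexive (m+[n∸m]≡n (a≤b (a ≤? b))))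
    where
    a≤b : Dec (a ≤ b) → a ≤ b
    a≤b (yes p) = p
    a≤b (no ¬p) = ⊥-elim (n≮0 (subst (i <_) (m≤n⇒m∸n≡0 (<⇒≤ (≰⇒> ¬p))) i<))

  ∈-range⁺ : ∀ a b {k} → a ≤ k → k < b → k ∈ range a b
  ∈-range⁺ a b {k} a≤ k< = subst (_∈ range a b) (m+[n∸m]≡n a≤) (∈ₚ.∈-applyUpTo⁺ (a +_) (∸-monoˡ-< k< a≤))

  Unique-range : ∀ a b → Unique (range a b)
  Unique-range a b = Uₚ.applyUpTo⁺₁ (a +_) (b ∸ a) (λ i<j _ e → <⇒≢ i<j (+-cancelˡ-≡ a _ _ e))

  Linked-cons : ∀ {k z} → Linked _≥_ z → part z 0 ≤ k → Linked _≥_ (k ∷ z)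
  Linked-cons {z = []}    _ _ = [-]
  Linked-cons {z = y ∷ z} l p = p ∷ l

  Linked-head : ∀ {k z} → Linked _≥_ (k ∷ z) → part z 0 ≤ k
  Linked-head [-]     = z≤n
  Linked-head (p ∷ _) = p

  Linked-tail : ∀ {k z} → Linked _≥_ (k ∷ z) → Linked _≥_ z
  Linked-tail [-]     = []
  Linked-tail (_ ∷ l) = l

  partition-tail : ∀ {k z} → IsPartition (k ∷ z) → IsPartition z
  partition-tail (_ ∷ a , l) = a , Linked-tail l

  Dominant-partition : ∀ {z} → IsPartition z → Dominant z
  Dominant-partition {[]}    p       k       = z≤n
  Dominant-partition {x ∷ z} (_ , l) zero    = Linked-head l
  Dominant-partition {x ∷ z} p       (suc k) = Dominant-partition (partition-tail p) k

  Dominant-≤ : ∀ z → Dominant z → ∀ {i j} → i ≤ j → part z j ≤ part z i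
  Dominant-≤ z d {i} {zero}  z≤n = ≤-refl
  Dominant-≤ z d {i} {suc j} i≤ with m≤n⇒m<n∨m≡n i≤
  ... | inj₁ (s≤s q) = ≤-trans (d j) (Dominant-≤ z d q)
  ... | inj₂ refl    = ≤-refl

  partition-ext : ∀ {y z} → IsPartition y → IsPartition z → (∀ k → part y k ≡ part z k) → y ≡ z
  partition-ext {[]}    {[]}    _            _            h = refl
  partition-ext {[]}    {b ∷ z} _            (b> ∷ _ , _) h = ⊥-elim (<⇒≢ b> (h 0))
  partition-ext {a ∷ y} {[]}    (a> ∷ _ , _) _            h = ⊥-elim (<⇒≢ a> (sym (h 0)))
  partition-ext {a ∷ y} {b ∷ z} p            q            h = cong₂ _∷_ (h 0) (partition-ext (partition-tail p) (partition-tail q) (h ∘ suc))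

  length≤size : ∀ {z} → All (0 <_) z → length z ≤ size z
  length≤size []      = z≤n
  length≤size (p ∷ a) = +-mono-≤ p (length≤size a)

  strip : List ℕ → List ℕ
  strip []          = []
  strip (zero ∷ l)  = []
  strip (suc x ∷ l) = suc x ∷ strip l

  part-strip : ∀ l → Dominant l → ∀ k → part (strip l) k ≡ part l k
  part-strip []          d k       = refl
  part-strip (zero ∷ l)  d k       = sym (n≤0⇒n≡0 (Dominant-≤ (zero ∷ l) d {0} {k} z≤n))
  part-strip (suc x ∷ l) d zero    = refl
  part-strip (suc x ∷ l) d (suc k) = part-strip l (d ∘ suc) k

  strip-partition : ∀ l → Dominant l → IsPartition (strip l)
  strip-partition []          d = [] , []
  strip-partition (zero ∷ l)  d = [] , []
  strip-partition (suc x ∷ l) d = let (a , k) = strip-partition l (d ∘ suc) in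
    s≤s z≤n ∷ a , Linked-cons k (≤-trans (≤-reflexive (part-strip l (d ∘ suc) 0)) (d 0))

  length-strip : ∀ l → length (strip l) ≤ length l
  length-strip []          = z≤n
  length-strip (zero ∷ l)  = z≤n
  length-strip (suc x ∷ l) = s≤s (length-strip l)

  size-ext : ∀ y z → (∀ k → part y k ≡ part z k) → size y ≡ size z
  size-ext y z h = trans (size≡sumTo y n (m≤m+n _ _)) (trans (sumTo-cong n (λ i _ → h i)) (sym (size≡sumTo z n (m≤n+m _ _))))
    where n = length y + length z

  partsB-sound : ∀ f n m {z} → z ∈ partsB f n m → IsPartition z × size z ≡ n × part z 0 ≤ m
  partsB-sound f       zero    m (here refl) = ([] , []) , refl , z≤n
  partsB-sound (suc f) (suc n) m z∈ with ∈-cons⁻ (range 1 (suc (m ⊓ suc n))) (λ k → partsB f (suc n ∸ k) k) z∈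
  ... | k , u , refl , k∈ , u∈ =
    let (1≤k , k≤) = ∈-range⁻ 1 (suc (m ⊓ suc n)) k∈
        ((a , l) , s , h) = partsB-sound f (suc n ∸ k) k u∈ in
    (1≤k ∷ a , Linked-cons l h) ,
    trans (cong (k +_) s) (m+[n∸m]≡n (≤-trans (≤-pred k≤) (m⊓n≤n m (suc n)))) ,
    ≤-trans (≤-pred k≤) (m⊓n≤m m (suc n))

  partsB-complete : ∀ f n m {z} → n ≤ f → IsPartition z → size z ≡ n → part z 0 ≤ m → z ∈ partsB f n m
  partsB-complete f       zero    m {[]}        n≤ p s h = here refl
  partsB-complete f       zero    m {zero ∷ z}  n≤ (() ∷ _ , _) s h
  partsB-complete (suc f) (suc n) m {zero ∷ z}  n≤ (() ∷ _ , _) s h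
  partsB-complete (suc f) (suc n) m {suc k ∷ z} n≤ p@(_ , l) s h =
    ∈-cons⁺ (range 1 (suc (m ⊓ suc n))) (λ k → partsB f (suc n ∸ k) k)
      (∈-range⁺ 1 _ (s≤s z≤n) (s≤s (⊓-glb h (≤-trans (m≤m+n (suc k) (size z)) (≤-reflexive s)))))
      (partsB-complete f (n ∸ k) (suc k) (≤-trans (m∸n≤m n k) (≤-pred n≤)) (partition-tail p)
        (trans (sym (m+n∸m≡n k (size z))) (cong (_∸ k) (suc-injective s))) (Linked-head l))

  partsB-unique : ∀ f n m → Unique (partsB f n m)
  partsB-unique zero    zero    m = [] ∷ []
  partsB-unique (suc f) zero    m = [] ∷ []
  partsB-unique zero    (suc n) m = []
  partsB-unique (suc f) (suc n) m = Unique-cons (range 1 (suc (m ⊓ suc n))) (λ k → partsB f (suc n ∸ k) k)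
    (Unique-range 1 (suc (m ⊓ suc n))) (λ k → partsB-unique f (suc n ∸ k) k)

  Partition# : ℕ → List ℕ → Set
  Partition# n z = IsPartition z × size z ≡ n

  partitionsE : ∀ n → Enum (Partition# n)
  partitionsE n = record
    { elems    = partitions n
    ; unique   = partsB-unique n n n
    ; sound    = λ z∈ → let (p , s , _) = partsB-sound n n n z∈ in p , s
    ; complete = λ {z} (p , s) → partsB-complete n n n ≤-refl p s (≤-trans (part≤size z 0) (≤-reflexive s))
    }

  pad : ℕ → List ℕ → List ℕ
  pad n l = applyUpTo (part l) n

  length-pad : ∀ n l → length (pad n l) ≡ n
  length-pad n l = Lₚ.length-applyUpTo (part l) n

  part-pad : ∀ n l → length l ≤ n → ∀ k → part (pad n l) k ≡ part l k
  part-pad n l l≤ k with k <? n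
  ... | yes k< = part-applyUpTo (part l) n k<
  ... | no k≮ = trans (part-≥ (pad n l) k (≤-trans (≤-reflexive (length-pad n l)) (≮⇒≥ k≮))) (sym (part-≥ l k (≤-trans l≤ (≮⇒≥ k≮))))

  size-pad : ∀ n l → length l ≤ n → size (pad n l) ≡ size l
  size-pad n l l≤ = size-ext (pad n l) l (part-pad n l l≤)

  size-applyUpTo : ∀ f n → size (applyUpTo f n) ≡ sumTo n f
  size-applyUpTo f zero    = refl
  size-applyUpTo f (suc n) = trans (cong (f 0 +_) (size-applyUpTo (f ∘ suc) n)) (sym (sumTo-first n f))

  size-plus : ∀ u v → length u ≡ length v → size (plus u v) ≡ size u + size v
  size-plus []      []      _ = refl
  size-plus (x ∷ u) (y ∷ v) l = trans (cong ((x + y) +_) (size-plus u v (suc-injective l))) (lem x y (size u) (size v))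
    where
    lem : ∀ a b c d → (a + b) + (c + d) ≡ (a + c) + (b + d)
    lem = ℕ-solver.solve-∀

  size-wt : ∀ {R n α β p} → length α ≤ R → length β ≤ R → GT n (part α) (part β) p → size (wt R n p) + size β ≡ size α
  size-wt {R} {n} {α} {β} {p} α≤ β≤ g = trans (cong₂ _+_ (trans (size-applyUpTo _ n) (sumTo-swap n R (mult p))) (size≡sumTo β R β≤))
    (trans (sym (sumTo-+ R _ (part β))) (trans (sumTo-cong R (λ i _ → trans (+-comm (sumTo n (λ k → mult p k i)) (part β i)) (trans (row-sum g i n ≤-refl) (end g i)))) (sym (size≡sumTo α R α≤))))

  K-homogeneous : ∀ R n α β e → length α ≤ R → length β ≤ R → size e + size β ≢ size α → K R n α β e ≡ 0ℤ
  K-homogeneous R n α β e α≤ β≤ ≢ = ∑-zero (elems (arrE R n α β)) (λ T T∈ → [no] (wt R n (get T) ≟L e)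
    (λ { refl → ≢ (size-wt {α = α} {β} α≤ β≤ (proj₂ (sound (arrE R n α β) T∈))) }))

  -- Semistandard fillings of a straight shape whose reading word is a lattice word: row i contains only i+1.
  module _ (R n : ℕ) (ν : List ℕ) (ν-part : IsPartition ν) (ν≤R : length ν ≤ R) (ν≤n : length ν ≤ n) where
    private
      p₀ : ℕ → ℕ → ℕ
      p₀ i j = if does (i <? j) then part ν i else 0

      p₀-yes : ∀ {i j} → i < j → p₀ i j ≡ part ν i
      p₀-yes {i} {j} = if-yes (i <? j)

      p₀-no : ∀ {i j} → ¬ i < j → p₀ i j ≡ 0
      p₀-no {i} {j} = if-no (i <? j)

      p₀-n : ∀ i → p₀ i n ≡ part ν i
      p₀-n i = go (i <? n)
        where
        go : Dec (i < n) → p₀ i n ≡ part ν i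
        go (yes i<) = p₀-yes i<
        go (no i≮)  = trans (p₀-no i≮) (sym (part-≥ ν i (≤-trans ν≤n (≮⇒≥ i≮))))

      p₀-GT : GT n (part ν) (part []) p₀
      p₀-GT = gt (λ i → p₀-no {i} {0} (λ ())) p₀-n mono₀ strict₀
        where
        mono₀ : ∀ i j → j < n → p₀ i j ≤ p₀ i (suc j)
        mono₀ i j _ = go (i <? j)
          where
          go : Dec (i < j) → p₀ i j ≤ p₀ i (suc j)
          go (yes i<) = ≤-reflexive (trans (p₀-yes i<) (sym (p₀-yes (m<n⇒m<1+n i<))))
          go (no i≮)  = ≤-trans (≤-reflexive (p₀-no i≮)) z≤n
        strict₀ : ∀ i j → j < n → p₀ (suc i) (suc j) ≤ p₀ i j
        strict₀ i j _ = go (i <? j)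
          where
          go : Dec (i < j) → p₀ (suc i) (suc j) ≤ p₀ i j
          go (yes i<) = ≤-trans (≤-reflexive (p₀-yes (s≤s i<))) (≤-trans (Dominant-partition ν-part i) (≤-reflexive (sym (p₀-yes i<))))
          go (no i≮)  = ≤-trans (≤-reflexive (p₀-no (i≮ ∘ ≤-pred))) z≤n

      T₀ = tab R (suc n) p₀

      -- Strict columns keep letters up to i out of row i, and the hypothesis excludes those above i
      -- + 1. So row i jumps from 0 to its full length at column i + 1 of the pattern.
      diagonal : ∀ {p} → GT n (part ν) (part []) p → (∀ k i → k < n → i < k → i < R → mult p k i ≡ 0) → ∀ i j → i < R → j ≤ n → p i j ≡ p₀ i j
      diagonal {p} g m0 i j i< j≤ = go (i <? j)
        where
        below : ∀ i j → j ≤ i → j ≤ n → p i j ≡ 0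
        below i       zero    _        _  = start g i
        below (suc i) (suc j) (s≤s j≤) j< = n≤0⇒n≡0 (≤-trans (strict g i j j<) (≤-reflexive (below i j j≤ (<⇒≤ j<))))
        constant : ∀ d j → i < j → d + j ≡ n → p i j ≡ part ν i
        constant zero    j _   refl = end g i
        constant (suc d) j i<j e    = trans (≤-antisym (mono g i j j<n) (m∸n≡0⇒m≤n (m0 j i j<n i<j i<)))
          (constant d (suc j) (m<n⇒m<1+n i<j) (trans (+-suc d j) e))
          where
          j<n : j < n
          j<n = ≤-trans (s≤s (m≤n+m j d)) (≤-reflexive e)
        go : Dec (i < j) → p i j ≡ p₀ i j
        go (yes i<j) = trans (constant (n ∸ j) j i<j (m∸n+n≡m j≤)) (sym (p₀-yes i<j))
        go (no i≮j)  = trans (below i j (≮⇒≥ i≮j) j≤) (sym (p₀-no i≮j))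

      mult₀-off : ∀ k i → i ≢ k → mult p₀ k i ≡ 0
      mult₀-off k i i≢ = go (<-cmp i k)
        where
        go : _ → mult p₀ k i ≡ 0
        go (tri< i<k _ _) = trans (cong₂ _∸_ (p₀-yes (m<n⇒m<1+n i<k)) (p₀-yes i<k)) (n∸n≡0 (part ν i))
        go (tri≈ _ e _)   = ⊥-elim (i≢ e)
        go (tri> _ _ k<i) = trans (cong (_∸ p₀ i k) (p₀-no {i} {suc k} (≤⇒≯ k<i))) (0∸n≡0 (p₀ i k))

      mult₀-on : ∀ k → mult p₀ k k ≡ part ν k
      mult₀-on k = cong₂ _∸_ (p₀-yes {k} {suc k} ≤-refl) (p₀-no {k} {k} (<-irrefl refl))

      pre₀-low : ∀ k i → i ≤ k → sumTo i (mult p₀ k) ≡ 0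
      pre₀-low k i i≤ = sumTo-zero i (λ i′ i′< → mult₀-off k i′ (<⇒≢ (<-≤-trans i′< i≤)))

      pre₀-high : ∀ k i → k < i → sumTo i (mult p₀ k) ≡ part ν k
      pre₀-high k (suc i) k< with m≤n⇒m<n∨m≡n (≤-pred k<)
      ... | inj₁ k<i  = trans (cong₂ _+_ (pre₀-high k i k<i) (mult₀-off k i (λ e → <⇒≢ k<i (sym e)))) (+-identityʳ _)
      ... | inj₂ refl = cong₂ _+_ (pre₀-low k k ≤-refl) (mult₀-on k)

      wt₀ : wt R n p₀ ≡ pad n ν
      wt₀ = applyUpTo-cong n (λ k _ → go k (k <? R))
        where
        go : ∀ k → Dec (k < R) → sumTo R (mult p₀ k) ≡ part ν k
        go k (yes k<) = pre₀-high k R k<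
        go k (no k≮)  = trans (pre₀-low k R (≮⇒≥ k≮)) (sym (part-≥ ν k (≤-trans ν≤R (≮⇒≥ k≮))))

      agree₀ : ∀ i j → j ≤ n → get T₀ i j ≡ p₀ i j
      agree₀ = get-tab-GT ν ν≤R p₀-GT

      T₀-lattice : Lattice R n (zeros n) (get T₀)
      T₀-lattice k i k< i< = ≤-trans (≤-reflexive (cong₂ _+_ (part-zeros n (suc k)) (pre-eq (suc k) (suc i) k<)))
        (≤-trans (step (i ≤? k)) (≤-reflexive (sym (cong₂ _+_ (part-zeros n k) (pre-eq k i (<⇒≤ k<))))))
        where
        pre-eq : ∀ k i → k < n → sumTo i (mult (get T₀) k) ≡ sumTo i (mult p₀ k)
        pre-eq k i k< = sumTo-cong i (λ i′ _ → cong₂ _∸_ (agree₀ i′ (suc k) k<) (agree₀ i′ k (<⇒≤ k<)))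
        step : Dec (i ≤ k) → sumTo (suc i) (mult p₀ (suc k)) ≤ sumTo i (mult p₀ k)
        step (yes i≤) = ≤-trans (≤-reflexive (pre₀-low (suc k) (suc i) (s≤s i≤))) z≤n
        step (no i≰)  = ≤-trans (≤-reflexive (pre₀-high (suc k) (suc i) (s≤s (≰⇒> i≰))))
          (≤-trans (Dominant-partition ν-part k) (≤-reflexive (sym (pre₀-high k i (≰⇒> i≰)))))

      forced : ∀ {η T} → LatticeArr R n ν [] (zeros n) η T → T ≡ T₀
      forced {η} {T} (((t , g) , lat) , e) = tab-ext t (tab-isTab R (suc n) p₀) (λ i j i< j< →
        trans (diagonal g off i j i< (≤-pred j<)) (sym (get-tab R (suc n) p₀ i< j<)))
        where
        -- A letter k + 2 must be preceded by a letter k + 1 in a strictly higher row. By induction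
        -- the letter k + 1 is absent from the first k rows.
        pre-zero : ∀ i k → i ≤ k → k < n → i ≤ R → sumTo i (mult (get T) k) ≡ 0
        pre-zero zero    k       _        _  _  = refl
        pre-zero (suc i) (suc k) (s≤s i≤) k< i< = n≤0⇒n≡0 (≤-trans
          (≤-trans (≤-reflexive (cong (_+ sumTo (suc i) (mult (get T) (suc k))) (sym (part-zeros n (suc k))))) (lat k i k< i<))
          (≤-reflexive (cong₂ _+_ (part-zeros n k) (pre-zero i k i≤ (<⇒≤ k<) (<⇒≤ i<)))))
        off : ∀ k i → k < n → i < k → i < R → mult (get T) k i ≡ 0
        off k i k< i<k i< = m+n≡0⇒n≡0 (sumTo i (mult (get T) k)) (pre-zero (suc i) k i<k k< i<)

      T₀-good : LatticeArr R n ν [] (zeros n) (pad n ν) T₀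
      T₀-good = (Arr-tab {α = ν} {[]} ν≤R p₀-GT , T₀-lattice) ,
        trans (plus-zeros n (wt R n (get T₀)) (length-wt R n (get T₀))) (trans (wt-cong R n (λ i j _ → agree₀ i j)) wt₀)

    L#-straight : ∀ η → L# R n ν [] (zeros n) η ≡ [ η ≟L pad n ν ]ᵈ
    L#-straight η with η ≟L pad n ν
    ... | yes refl = ∑-single (latticeE R n ν [] (zeros n) (pad n ν)) T₀ T₀-good (λ _ → 1ℤ) (λ T a T≢ → ⊥-elim (T≢ (forced a)))
    ... | no η≢ = ∑-zero (elems (latticeE R n ν [] (zeros n) η)) (λ T T∈ →
        let a = sound (latticeE R n ν [] (zeros n) η) T∈ in
        ⊥-elim (η≢ (trans (sym (proj₂ a)) (trans (cong (λ T → plus (zeros n) (wt R n (get T))) (forced a)) (proj₂ T₀-good)))))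

open Partitions

-- Expansion of s_ν s_{α/β} in a fixed number of variables

module Products where

  conv-symmetric : ∀ f h → Symmetric f → Symmetric h → Symmetric (conv f h)
  conv-symmetric f h sf sh zero    []          = refl
  conv-symmetric f h sf sh zero    (x ∷ [])    = refl
  conv-symmetric f h sf sh zero    (x ∷ y ∷ e) = trans (two y x) (trans (∑-swap (upTo (suc y)) (upTo (suc x))
      (λ b a → ∑ (splits e) (λ u → f (b ∷ a ∷ u) * h ((y ∸ b) ∷ (x ∸ a) ∷ minus e u))))
    (trans (∑-cong′ (upTo (suc x)) (λ a → ∑-cong′ (upTo (suc y)) (λ b → ∑-cong′ (splits e) (λ u →
      cong₂ _*_ (sf 0 (a ∷ b ∷ u)) (sh 0 ((x ∸ a) ∷ (y ∸ b) ∷ minus e u)))))) (sym (two x y))))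
    where
    two : ∀ x y → conv f h (x ∷ y ∷ e) ≡ ∑ (upTo (suc x)) (λ a → ∑ (upTo (suc y)) (λ b → ∑ (splits e) (λ u →
      f (a ∷ b ∷ u) * h ((x ∸ a) ∷ (y ∸ b) ∷ minus e u))))
    two x y = trans (∑-splits x (y ∷ e) _) (∑-cong′ (upTo (suc x)) (λ a → ∑-splits y e _))
  conv-symmetric f h sf sh (suc k) []      = refl
  conv-symmetric f h sf sh (suc k) (x ∷ e) = trans (∑-splits x (sw k e) _) (trans (∑-cong′ (upTo (suc x)) (λ a →
      conv-symmetric (λ u → f (a ∷ u)) (λ u → h ((x ∸ a) ∷ u)) (λ j u → sf (suc j) (a ∷ u)) (λ j u → sh (suc j) ((x ∸ a) ∷ u)) k e))
    (sym (∑-splits x e _)))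

  sub-+ : ∀ f h v u → sub (λ e → f e ⊕ h e) v u ≡ sub f v u ⊕ sub h v u
  sub-+ f h []      u       = refl
  sub-+ f h (x ∷ v) []      = refl
  sub-+ f h (x ∷ v) (y ∷ u) = trans (cong ([ y ≤? x ]ᵈ *_) (sub-+ (λ e → f ((x ∸ y) ∷ e)) (λ e → h ((x ∸ y) ∷ e)) v u)) (ℤₚ.*-distribˡ-+ [ y ≤? x ]ᵈ _ _)

  X-+ : ∀ n f h v → X n (λ e → f e ⊕ h e) v ≡ X n f v ⊕ X n h v
  X-+ n f h v = trans (D-cong n (staircase n) (λ u _ → sub-+ f h v u)) (D-+ n (sub f v) (sub h v) (staircase n))

  X-* : ∀ n c f v → X n (λ e → c * f e) v ≡ c * X n f v
  X-* n c f v = trans (D-cong n (staircase n) (λ u _ → sub-* c f v u)) (D-* n c (sub f v) (staircase n))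

  X-∑ : ∀ n {A : Set} (xs : List A) (f : A → List ℕ → ℤ) v → X n (λ e → ∑ xs (λ x → f x e)) v ≡ ∑ xs (λ x → X n (f x) v)
  X-∑ n xs f v = trans (D-cong n (staircase n) (λ u _ → sub-∑ xs f v u)) (D-∑ n xs (λ x → sub (f x) v) (staircase n))

  -- The bialternant formula, read at the dominant exponents. It is the extraction for the series 1
  -- with l = 0, where only the tableau with i + 1 throughout row i survives.
  X-K : ∀ R n ν → IsPartition ν → length ν ≤ R → length ν ≤ n → 0 < R → ∀ η → length η ≡ n → Dominant η →
    X n (K R n ν []) (plus η (staircase n)) ≡ [ η ≟L pad n ν ]ᵈ
  X-K R n ν p ν≤R ν≤n 0<R η lη dom =
    trans (X-cong n (plus η (staircase n)) (trans (length-plus η (staircase n) (trans lη (sym (length-staircase n)))) (length-staircase n))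
      (λ e le → ∑-cong′ (elems (arrE R n ν [])) (λ T → sym (sub-δ₀ e (wt R n (get T)) (trans (length-wt R n (get T)) (sym le))))))
    (trans (X-lattice R n ν [] ν≤R 0<R δ₀ δ₀-symmetric (zeros n) (length-zeros n) (λ ζ lζ _ → X-δ₀ n ζ lζ) η lη dom)
      (L#-straight R n ν p ν≤R ν≤n η))

  module _ (R n : ℕ) (ν α β : List ℕ) (d : ℕ) (ν-part : IsPartition ν) (0<R : 0 < R) (ν≤R : length ν ≤ R) (ν≤n : length ν ≤ n)
           (α≤ : length α ≤ R) (β≤ : length β ≤ R) (d≤R : d ≤ R) (d≤n : d ≤ n) (sizes : size ν + size α ≡ d + size β) where
    private
      P = partitions d
      c : List ℕ → ℤ
      c γ = L# R n α β (pad n ν) (pad n γ)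
      -- The difference of the two sides. It is symmetric, homogeneous of degree d and has
      -- coefficient 0 at every η + ρ, so `symmetric-vanish` applies.
      Z : List ℕ → ℤ
      Z e = conv (K R n ν []) (K R n α β) e ⊕ ℤ.-1ℤ * ∑ P (λ γ → c γ * K R n γ [] e)

      γ≤ : ∀ {γ m} → γ ∈ P → d ≤ m → length γ ≤ m
      γ≤ γ∈ d≤ = let ((a , _) , s) = sound (partitionsE d) γ∈ in ≤-trans (length≤size a) (≤-trans (≤-reflexive s) d≤)

      Z-sym : Symmetric Z
      Z-sym k e = cong₂ (λ a b → a ⊕ ℤ.-1ℤ * b) (conv-symmetric _ _ (K-symmetric R n ν [] ν≤R) (K-symmetric R n α β α≤) k e)
        (∑-cong P (λ γ γ∈ → cong (c γ *_) (K-symmetric R n γ [] (γ≤ γ∈ d≤R) k e)))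

      Z-homogeneous : ∀ e → length e ≡ n → size e ≢ d → Z e ≡ 0ℤ
      Z-homogeneous e le e≢ = cong₂ (λ a b → a ⊕ ℤ.-1ℤ * b)
        (∑-zero (splits e) (λ u u∈ → product u (splits-sound e u∈) (size u ≟ size ν)))
        (∑-zero P (λ γ γ∈ → *-zero (c γ) (K-homogeneous R n γ [] e (γ≤ γ∈ d≤R) z≤n
          (λ q → e≢ (trans (sym (+-identityʳ _)) (trans q (proj₂ (sound (partitionsE d) γ∈))))))))
        where
        product : ∀ u → length u ≡ length e × (∀ k → part u k ≤ part e k) → Dec (size u ≡ size ν) → K R n ν [] u * K R n α β (minus e u) ≡ 0ℤ
        product u (lu , u≤) (no u≢) = cong (_* K R n α β (minus e u)) (K-homogeneous R n ν [] u ν≤R z≤n (λ q → u≢ (trans (sym (+-identityʳ _)) q)))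
        product u (lu , u≤) (yes u≡) = *-zero (K R n ν [] u) (K-homogeneous R n α β (minus e u) α≤ β≤
          (λ q → e≢ (lem (size u) (size (minus e u)) (size e) (size α) d (size β) (size-minus e u lu u≤) q (trans (cong (_+ size α) u≡) sizes))))
          where
          lem : ∀ u m e a d b → u + m ≡ e → m + b ≡ a → u + a ≡ d + b → e ≡ d
          lem u m e a d b refl refl q = eqlin q (ℕ-solver.solve (u L.∷ m L.∷ d L.∷ b L.∷ L.[]))

      Z-vanish : ∀ η → length η ≡ n → Dominant η → X n Z (plus η (staircase n)) ≡ 0ℤ
      Z-vanish η lη dom = trans (X-+ n _ _ v) (trans (cong₂ _⊕_ left (trans (X-* n ℤ.-1ℤ _ v) (cong (ℤ.-1ℤ *_) right))) (lem (L# R n α β (pad n ν) η)))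
        where
        v = plus η (staircase n)
        lv : length v ≡ n
        lv = trans (length-plus η (staircase n) (trans lη (sym (length-staircase n)))) (length-staircase n)
        lem : ∀ a → a ⊕ ℤ.-1ℤ * a ≡ 0ℤ
        lem a = trans (cong (a ⊕_) (ℤₚ.-1*i≡-i a)) (ℤₚ.+-inverseʳ a)
        left : X n (conv (K R n ν []) (K R n α β)) v ≡ L# R n α β (pad n ν) η
        left = trans (X-cong n v lv (λ e le → conv-K (K R n ν []) R n α β e le))
          (X-lattice R n α β α≤ 0<R (K R n ν []) (K-symmetric R n ν [] ν≤R) (pad n ν) (length-pad n ν)
            (X-K R n ν ν-part ν≤R ν≤n 0<R) η lη dom)
        coefficient : ∀ γ → γ ∈ P → X n (λ e → c γ * K R n γ [] e) v ≡ c γ * [ η ≟L pad n γ ]ᵈ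
        coefficient γ γ∈ = trans (X-* n (c γ) (K R n γ []) v) (cong (c γ *_)
          (X-K R n γ (proj₁ (sound (partitionsE d) γ∈)) (γ≤ γ∈ d≤R) (γ≤ γ∈ d≤n) 0<R η lη dom))
        right : X n (λ e → ∑ P (λ γ → c γ * K R n γ [] e)) v ≡ L# R n α β (pad n ν) η
        right = trans (X-∑ n P (λ γ e → c γ * K R n γ [] e) v) (trans (∑-cong P coefficient) (collect (size η ≟ d)))
          where
          -- Only the partition with padding η can contribute. If the size of η is not d there is
          -- none, and no tableau leads from ν to η either.
          collect : Dec (size η ≡ d) → ∑ P (λ γ → c γ * [ η ≟L pad n γ ]ᵈ) ≡ L# R n α β (pad n ν) η
          collect (yes s≡) = trans (∑-single (partitionsE d) γ₀ (strip-partition η dom , trans (size-ext γ₀ η (part-strip η dom)) s≡) _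
              (λ γ Pγ γ≢ → *-zero (c γ) ([no] (η ≟L pad n γ) (λ e → γ≢ (partition-ext (proj₁ Pγ) (strip-partition η dom)
                (λ k → trans (sym (part-pad n γ (γ≤ (complete (partitionsE d) Pγ) d≤n) k)) (trans (cong (λ l → part l k) (sym e)) (sym (part-strip η dom k)))))))))
            (trans (cong₂ _*_ (cong (L# R n α β (pad n ν)) (sym η≡)) ([yes] (η ≟L pad n γ₀) η≡)) (ℤₚ.*-identityʳ _))
            where
            γ₀ = strip η
            η≡ : η ≡ pad n γ₀
            η≡ = part-ext (trans lη (sym (length-pad n γ₀))) (λ k _ → sym (trans (part-pad n γ₀ (≤-trans (length-strip η) (≤-reflexive lη)) k) (part-strip η dom k)))
          collect (no s≢) = trans (∑-zero P (λ γ γ∈ → *-zero (c γ) ([no] (η ≟L pad n γ) (λ e → s≢ (trans (cong size e)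
                (trans (size-pad n γ (γ≤ γ∈ d≤n)) (proj₂ (sound (partitionsE d) γ∈))))))))
            (sym (∑-zero (elems (latticeE R n α β (pad n ν) η)) (λ T T∈ →
              let (((_ , g) , _) , e) = sound (latticeE R n α β (pad n ν) η) T∈ in
              ⊥-elim (s≢ (lem′ (size ν) (size (wt R n (get T))) (size η) (size α) d (size β)
                (trans (sym (trans (size-plus (pad n ν) (wt R n (get T)) (trans (length-pad n ν) (sym (length-wt R n (get T))))) (cong (_+ size (wt R n (get T))) (size-pad n ν ν≤n)))) (cong size e))
                (size-wt {α = α} {β} α≤ β≤ g) sizes)))))
            where
            lem′ : ∀ u m e a d b → u + m ≡ e → m + b ≡ a → u + a ≡ d + b → e ≡ d
            lem′ u m e a d b refl refl q = eqlin q (ℕ-solver.solve (u L.∷ m L.∷ d L.∷ b L.∷ L.[]))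

    conv-expand : ∀ e → length e ≡ n → conv (K R n ν []) (K R n α β) e ≡ ∑ (partitions d) (λ γ → L# R n α β (pad n ν) (pad n γ) * K R n γ [] e)
    conv-expand e le = trans (lem _ (∑ P (λ γ → c γ * K R n γ [] e))) (trans (cong (_⊕ ∑ P (λ γ → c γ * K R n γ [] e)) (symmetric-vanish n d Z Z-sym Z-homogeneous Z-vanish e le)) (ℤₚ.+-identityˡ _))
      where
      lem : ∀ a b → a ≡ (a ⊕ ℤ.-1ℤ * b) ⊕ b
      lem a b = sym (trans (cong (λ x → (a ⊕ x) ⊕ b) (ℤₚ.-1*i≡-i b)) (step a b))
        where
        step : ∀ a b → (a ⊕ ℤ.- b) ⊕ b ≡ a
        step = ℤ-solver.solve-∀

open Products

-- Exchange of rows and letters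

module Transposition where

  get-col-≥ : ∀ {R C T} → IsTab R C T → ∀ i {j} → C ≤ j → get T i j ≡ 0
  get-col-≥ {T = []}    _                 i       C≤ = refl
  get-col-≥ {T = r ∷ T} (_ , p ∷ _)       zero    C≤ = part-≥ r _ (≤-trans (≤-reflexive p) C≤)
  get-col-≥ {suc R} {T = r ∷ T} (l , _ ∷ all) (suc i) C≤ = get-col-≥ {R} {T = T} (suc-injective l , all) i C≤

  -- The companion tableau: row k records how the letter k + 1, counted from β, accumulates over the
  -- rows of p. It has the letter i + 1 in row k as often as p has the letter k + 1 in row i.
  transposed : List ℕ → (ℕ → ℕ → ℕ) → ℕ → ℕ → ℕ
  transposed β p k i = part β k + sumTo i (mult p k)

  mult-transposed : ∀ β p i k → mult (transposed β p) i k ≡ mult p k i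
  mult-transposed β p i k = trans (cong (_∸ (part β k + sumTo i (mult p k))) (sym (+-assoc (part β k) _ _)))
    (m+n∸m≡n (part β k + sumTo i (mult p k)) _)

  sumTo-stable : ∀ {a m n} f → a ≤ m → a ≤ n → (∀ i → a ≤ i → f i ≡ 0) → sumTo m f ≡ sumTo n f
  sumTo-stable f a≤m a≤n z = trans (sumTo-extend f a≤m z) (sym (sumTo-extend f a≤n z))

  -- R rows and n letters become N rows and M letters. With the four numbers kept apart, the same
  -- argument serves both directions of the bijection.
  module _ (R n N M : ℕ) (γ δ α β : List ℕ) (γ-dom : Dominant γ) (α-dom : Dominant α)
           (γ≤R : length γ ≤ R) (γ≤M : length γ ≤ M) (δ≤R : length δ ≤ R) (δ≤M : length δ ≤ M)
           (α≤n : length α ≤ n) (α≤N : length α ≤ N) (β≤n : length β ≤ n) (β≤N : length β ≤ N)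
           (T : List (List ℕ)) (T-lat : LatticeArr R n γ δ (pad n β) (pad n α) T) where
    private
      p = get T
      t = proj₁ (proj₁ (proj₁ T-lat))
      g = proj₂ (proj₁ (proj₁ T-lat))
      lat = proj₂ (proj₁ T-lat)
      q = transposed β p

      mult-high : ∀ k i → n ≤ k → mult p k i ≡ 0
      mult-high k i n≤ = trans (cong (_∸ p i k) (get-col-≥ t i (s≤s n≤))) (0∸n≡0 (p i k))

      mult-low : ∀ k i → length γ ≤ i → mult p k i ≡ 0
      mult-low k i γ≤ with k <? n
      ... | yes k< = trans (cong (_∸ p i k) (GT-vanish g (part-≥ γ) i (suc k) γ≤ k<)) (0∸n≡0 (p i k))
      ... | no k≮  = mult-high k i (≮⇒≥ k≮)

      content : ∀ k → part β k + sumTo R (mult p k) ≡ part α k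
      content k with k <? n
      ... | yes k< = trans (cong₂ _+_ (sym (part-pad n β β≤n k)) (sym (part-applyUpTo _ n k<)))
          (trans (sym (part-plus (pad n β) (wt R n p) k (trans (length-pad n β) (sym (length-wt R n p)))))
            (trans (cong (λ l → part l k) (proj₂ T-lat)) (part-pad n α α≤n k)))
      ... | no k≮  = trans (cong₂ _+_ (part-≥ β k (≤-trans β≤n n≤)) (sumTo-zero R (λ i _ → mult-high k i n≤))) (sym (part-≥ α k (≤-trans α≤n n≤)))
        where n≤ = ≮⇒≥ k≮

      mult-col : ∀ k i → length α ≤ k → mult p k i ≡ 0
      mult-col k i α≤ with i <? R
      ... | no i≮ = mult-low k i (≤-trans γ≤R (≮⇒≥ i≮))
      ... | yes i< = n≤0⇒n≡0 (≤-trans (m≤n+m _ (sumTo i (mult p k)))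
          (≤-trans (sumTo-≤ {suc i} {R} (mult p k) i<) (≤-trans (m≤n+m _ (part β k)) (≤-reflexive (trans (content k) (part-≥ α k α≤))))))

      -- `GT` asks for its inequalities in all rows, `Lattice` covers a finite range. Letters
      -- outside the range do not occur, and after the last row the comparison is between parts of
      -- α.
      lattice-all : ∀ k i → part β (suc k) + sumTo (suc i) (mult p (suc k)) ≤ part β k + sumTo i (mult p k)
      lattice-all k i with suc k <? n | i <? R
      ... | no k≮ | _ = ≤-trans (≤-reflexive (cong₂ _+_ (part-≥ β (suc k) (≤-trans β≤n (≮⇒≥ k≮)))
          (sumTo-zero (suc i) (λ i′ _ → mult-high (suc k) i′ (≮⇒≥ k≮))))) z≤n
      ... | yes k< | yes i< = ≤-trans (≤-reflexive (cong (_+ sumTo (suc i) (mult p (suc k))) (sym (part-pad n β β≤n (suc k)))))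
          (≤-trans (lat k i k< i<) (≤-reflexive (cong (_+ sumTo i (mult p k)) (part-pad n β β≤n k))))
      ... | yes k< | no i≮ = ≤-trans (≤-reflexive (trans (cong (part β (suc k) +_) (stable (suc k) (suc i) (m≤n⇒m≤1+n R≤))) (content (suc k))))
          (≤-trans (α-dom k) (≤-reflexive (sym (trans (cong (part β k +_) (stable k i R≤)) (content k)))))
        where
        R≤ = ≮⇒≥ i≮
        stable : ∀ k i → R ≤ i → sumTo i (mult p k) ≡ sumTo R (mult p k)
        stable k i R≤ = sumTo-extend (mult p k) R≤ (λ i′ le → mult-low k i′ (≤-trans γ≤R le))

      rows : ∀ i k → part δ (suc i) + sumTo (suc k) (λ k′ → mult p k′ (suc i)) ≤ part δ i + sumTo k (λ k′ → mult p k′ i)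
      rows i k with k <? n
      ... | yes k< = ≤-trans (≤-reflexive (row-sum g (suc i) (suc k) k<)) (≤-trans (strict g i k k<) (≤-reflexive (sym (row-sum g i k (<⇒≤ k<)))))
      ... | no k≮ = ≤-trans (≤-reflexive (total (suc i) (suc k) (m≤n⇒m≤1+n n≤))) (≤-trans (γ-dom i) (≤-reflexive (sym (total i k n≤))))
        where
        n≤ = ≮⇒≥ k≮
        total : ∀ i k → n ≤ k → part δ i + sumTo k (λ k′ → mult p k′ i) ≡ part γ i
        total i k n≤ = trans (cong (part δ i +_) (sumTo-extend _ n≤ (λ k′ le → mult-high k′ i le))) (trans (row-sum g i n ≤-refl) (end g i))

      -- Here the condition `strict` of q is the lattice condition of p. Conversely, in
      -- `transpose-lattice` the lattice condition of q is `strict` for p.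
      q-GT : GT M (part α) (part β) q
      q-GT = gt (λ k → +-identityʳ _)
        (λ k → trans (cong (part β k +_) (sumTo-stable (mult p k) γ≤M γ≤R (mult-low k))) (content k))
        (λ k i _ → +-monoʳ-≤ (part β k) (m≤m+n _ _))
        (λ k i _ → lattice-all k i)

    transpose-agree : ∀ k i → i ≤ M → get (tab N (suc M) q) k i ≡ q k i
    transpose-agree = get-tab-GT α α≤N q-GT

    transpose-lattice : LatticeArr N M α β (pad M δ) (pad M γ) (tab N (suc M) q)
    transpose-lattice = (Arr-tab {α = α} {β} α≤N q-GT , lat′) , part-ext (trans lplus (sym (length-pad M γ))) (λ i i< → content′ i (subst (i <_) lplus i<))
      where
      u = get (tab N (suc M) q)
      lplus : length (plus (pad M δ) (wt N M u)) ≡ M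
      lplus = trans (length-plus (pad M δ) (wt N M u) (trans (length-pad M δ) (sym (length-wt N M u)))) (length-wt N M u)
      mult-u : ∀ i k → i < M → mult u i k ≡ mult p k i
      mult-u i k i< = trans (cong₂ _∸_ (transpose-agree k (suc i) i<) (transpose-agree k i (<⇒≤ i<))) (mult-transposed β p i k)
      lat′ : Lattice N M (pad M δ) u
      lat′ i k i< k< = ≤-trans (≤-reflexive (cong₂ _+_ (part-pad M δ δ≤M (suc i)) (sumTo-cong (suc k) (λ k′ _ → mult-u (suc i) k′ i<))))
        (≤-trans (rows i k) (≤-reflexive (sym (cong₂ _+_ (part-pad M δ δ≤M i) (sumTo-cong k (λ k′ _ → mult-u i k′ (<⇒≤ i<)))))))
      content′ : ∀ i → i < M → part (plus (pad M δ) (wt N M u)) i ≡ part (pad M γ) i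
      content′ i i< = trans (part-plus (pad M δ) (wt N M u) i (trans (length-pad M δ) (sym (length-wt N M u))))
        (trans (cong₂ _+_ (part-pad M δ δ≤M i) (trans (part-applyUpTo _ M i<) (trans (sumTo-cong N (λ k _ → mult-u i k i<)) (sumTo-stable (λ k → mult p k i) α≤N α≤n (λ k → mult-col k i)))))
        (trans (row-sum g i n ≤-refl) (trans (end g i) (sym (part-pad M γ γ≤M i)))))

  L#-transpose : ∀ R n N γ δ α β → Dominant γ → Dominant α → length γ ≤ R → length δ ≤ R →
    length α ≤ n → length α ≤ N → length β ≤ n → length β ≤ N →
    L# R n γ δ (pad n β) (pad n α) ≡ L# N R α β (pad R δ) (pad R γ)
  L#-transpose R n N γ δ α β γd αd γ≤ δ≤ α≤n α≤N β≤n β≤N =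
    ∑-bij (latticeE R n γ δ (pad n β) (pad n α)) (latticeE N R α β (pad R δ) (pad R γ)) φ ψ φ-ok ψ-ok ψφ φψ (λ _ → 1ℤ) (λ _ → 1ℤ) (λ _ _ → refl)
    where
    φ ψ : List (List ℕ) → List (List ℕ)
    φ T = tab N (suc R) (transposed β (get T))
    ψ U = tab R (suc n) (transposed δ (get U))
    φ-ok : ∀ T → LatticeArr R n γ δ (pad n β) (pad n α) T → LatticeArr N R α β (pad R δ) (pad R γ) (φ T)
    φ-ok = transpose-lattice R n N R γ δ α β γd αd γ≤ γ≤ δ≤ δ≤ α≤n α≤N β≤n β≤N
    ψ-ok : ∀ U → LatticeArr N R α β (pad R δ) (pad R γ) U → LatticeArr R n γ δ (pad n β) (pad n α) (ψ U)
    ψ-ok = transpose-lattice N R R n α β γ δ αd γd α≤N α≤n β≤N β≤n γ≤ γ≤ δ≤ δ≤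
    ψφ : ∀ T → LatticeArr R n γ δ (pad n β) (pad n α) T → ψ (φ T) ≡ T
    ψφ T a@(((t , g) , _) , _) = trans (tab-cong R (suc n) (λ i k i< k< → trans
        (cong (part δ i +_) (sumTo-cong k (λ k′ _ → trans (cong₂ _∸_ (agree k′ (suc i) i<) (agree k′ i (<⇒≤ i<))) (mult-transposed β (get T) i k′))))
        (row-sum g i k (≤-pred k<)))) (tab-get t)
      where
      agree = transpose-agree R n N R γ δ α β γd αd γ≤ γ≤ δ≤ δ≤ α≤n α≤N β≤n β≤N T a
    φψ : ∀ U → LatticeArr N R α β (pad R δ) (pad R γ) U → φ (ψ U) ≡ U
    φψ U a@(((t , g) , _) , _) = trans (tab-cong N (suc R) (λ k i k< i< → go k i (≤-pred i<) (k <? n))) (tab-get t)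
      where
      agree = transpose-agree N R R n α β γ δ αd γd α≤N α≤n β≤N β≤n γ≤ γ≤ δ≤ δ≤ U a
      go : ∀ k i → i ≤ R → Dec (k < n) → part β k + sumTo i (mult (get (ψ U)) k) ≡ get U k i
      go k i i≤ (yes k<) = trans (cong (part β k +_) (sumTo-cong i (λ i′ _ → trans (cong₂ _∸_ (agree i′ (suc k) k<) (agree i′ k (<⇒≤ k<))) (mult-transposed δ (get U) k i′))))
        (row-sum g k i i≤)
      go k i i≤ (no k≮) = trans (cong₂ _+_ (part-≥ β k (≤-trans β≤n n≤)) (sumTo-zero i (λ i′ _ →
          trans (cong (_∸ get (ψ U) i′ k) (get-col-≥ (tab-isTab R (suc n) (transposed δ (get U))) i′ (s≤s n≤))) (0∸n≡0 (get (ψ U) i′ k)))))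
        (sym (GT-vanish g (part-≥ α) k i (≤-trans α≤n n≤) i≤))
        where n≤ = ≮⇒≥ k≮

open Transposition

-- Boolean tests, boxes of skew shapes, and fillings as functions on boxes

module Boxes where

  bit : Bool → ℕ
  bit true  = 1
  bit false = 0

  bit≤1 : ∀ b → bit b ≤ 1
  bit≤1 true  = ≤-refl
  bit≤1 false = z≤n

  N# : {A : Set} → (A → Bool) → List A → ℕ
  N# P []       = 0
  N# P (x ∷ xs) = bit (P x) + N# P xs

  length-filterᵇ : {A : Set} (P : A → Bool) (xs : List A) → length (filterᵇ P xs) ≡ N# P xs
  length-filterᵇ P []       = refl
  length-filterᵇ P (x ∷ xs) with P x
  ... | true  = cong suc (length-filterᵇ P xs)
  ... | false = length-filterᵇ P xs

  N#-++ : {A : Set} (P : A → Bool) (xs ys : List A) → N# P (xs ++ ys) ≡ N# P xs + N# P ys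
  N#-++ P []       ys = refl
  N#-++ P (x ∷ xs) ys = trans (cong (bit (P x) +_) (N#-++ P xs ys)) (sym (+-assoc (bit (P x)) _ _))

  N#-map : {A B : Set} (P : B → Bool) (f : A → B) (xs : List A) → N# P (map f xs) ≡ N# (P ∘ f) xs
  N#-map P f []       = refl
  N#-map P f (x ∷ xs) = cong (bit (P (f x)) +_) (N#-map P f xs)

  N#-cong : {A : Set} {P Q : A → Bool} (xs : List A) → (∀ x → x ∈ xs → P x ≡ Q x) → N# P xs ≡ N# Q xs
  N#-cong []       e = refl
  N#-cong (x ∷ xs) e = cong₂ (λ a b → bit a + b) (e x (here refl)) (N#-cong xs (λ y y∈ → e y (there y∈)))

  N#-zero : {A : Set} {P : A → Bool} (xs : List A) → (∀ x → x ∈ xs → P x ≡ false) → N# P xs ≡ 0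
  N#-zero []       e = refl
  N#-zero (x ∷ xs) e = cong₂ (λ a b → bit a + b) (e x (here refl)) (N#-zero xs (λ y y∈ → e y (there y∈)))

  N#-reverse : {A : Set} (P : A → Bool) (xs : List A) → N# P (reverse xs) ≡ N# P xs
  N#-reverse P []       = refl
  N#-reverse P (x ∷ xs) = trans (cong (N# P) (Lₚ.unfold-reverse x xs)) (trans (N#-++ P (reverse xs) (x ∷ []))
    (trans (+-comm (N# P (reverse xs)) _) (cong₂ _+_ (+-identityʳ (bit (P x))) (N#-reverse P xs))))

  N#-applyUpTo : {A : Set} (P : A → Bool) (f : ℕ → A) (n : ℕ) → N# P (applyUpTo f n) ≡ sumTo n (λ i → bit (P (f i)))
  N#-applyUpTo P f zero    = refl
  N#-applyUpTo P f (suc n) = trans (cong (bit (P (f 0)) +_) (N#-applyUpTo P (f ∘ suc) n)) (sym (sumTo-first n (λ i → bit (P (f i)))))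

  N#-concatMap : {A : Set} (P : A → Bool) (g : ℕ → List A) (f : ℕ → ℕ) (n : ℕ) → N# P (concatMap g (applyUpTo f n)) ≡ sumTo n (λ i → N# P (g (f i)))
  N#-concatMap P g f zero    = refl
  N#-concatMap P g f (suc n) = trans (N#-++ P (g (f 0)) _) (trans (cong (N# P (g (f 0)) +_) (N#-concatMap P g (f ∘ suc) n))
    (sym (sumTo-first n (λ i → N# P (g (f i))))))

  T∧⁺ : ∀ {a b} → T a → T b → T (a ∧ b)
  T∧⁺ {true} _ q = q

  T∧⁻ : ∀ {a b} → T (a ∧ b) → T a × T b
  T∧⁻ {true} q = tt , q

  T-true : ∀ {b} → T b → b ≡ true
  T-true {true} _ = refl

  true-T : ∀ {b} → b ≡ true → T b
  true-T refl = tt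

  ¬T-false : ∀ {b} → ¬ T b → b ≡ false
  ¬T-false {true}  h = ⊥-elim (h tt)
  ¬T-false {false} _ = refl

  T-if⁺ : ∀ {b c} → (T b → T c) → T (if b then c else true)
  T-if⁺ {true}  h = h tt
  T-if⁺ {false} h = tt

  T-if⁻ : ∀ {b c} → T (if b then c else true) → T b → T c
  T-if⁻ {true} h _ = h

  all⁺ : {A : Set} (p : A → Bool) (xs : List A) → (∀ x → x ∈ xs → T (p x)) → T (all p xs)
  all⁺ p []       h = tt
  all⁺ p (x ∷ xs) h = T∧⁺ (h x (here refl)) (all⁺ p xs (λ y y∈ → h y (there y∈)))

  all⁻ : {A : Set} (p : A → Bool) (xs : List A) → T (all p xs) → ∀ {x} → x ∈ xs → T (p x)
  all⁻ p (x ∷ xs) h (here refl) = proj₁ (T∧⁻ h)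
  all⁻ p (x ∷ xs) h (there x∈)  = all⁻ p xs (proj₂ (T∧⁻ {p x} h)) x∈

  ≡ᵇ-refl : ∀ n → T (n ≡ᵇ n)
  ≡ᵇ-refl n = ≡⇒≡ᵇ n n refl

  contained⁻ : ∀ β α → T (contained β α) → ∀ i → part β i ≤ part α i
  contained⁻ β α h i with i <? length β
  ... | yes i< = ≤ᵇ⇒≤ _ _ (all⁻ _ (upTo (length β)) h (∈ₚ.∈-upTo⁺ i<))
  ... | no i≮  = ≤-trans (≤-reflexive (part-≥ β i (≮⇒≥ i≮))) z≤n

  contained⁺ : ∀ β α → (∀ i → part β i ≤ part α i) → T (contained β α)
  contained⁺ β α h = all⁺ _ (upTo (length β)) (λ i _ → ≤⇒≤ᵇ (h i))

  InShape : List ℕ → List ℕ → Cell → Set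
  InShape α β (i , c) = part β i ≤ c × c < part α i

  ∈-rowCells⁺ : ∀ α β {i c} → InShape α β (i , c) → (i , c) ∈ rowCells α β i
  ∈-rowCells⁺ α β {i} (p , q) = ∈ₚ.∈-map⁺ (i ,_) (∈-range⁺ _ _ p q)

  ∈-rowCells⁻ : ∀ α β i {x} → x ∈ rowCells α β i → proj₁ x ≡ i × InShape α β x
  ∈-rowCells⁻ α β i x∈ with ∈ₚ.∈-map⁻ (i ,_) x∈
  ... | c , c∈ , refl = refl , ∈-range⁻ _ _ c∈

  row<length : ∀ α β {i c} → InShape α β (i , c) → i < length α
  row<length α β {i} (_ , q) with i <? length α
  ... | yes p = p
  ... | no ¬p = ⊥-elim (n≮0 (<-≤-trans q (≤-reflexive (part-≥ α i (≮⇒≥ ¬p)))))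

  ∈-skewCells⁺ : ∀ α β {x} → InShape α β x → x ∈ skewCells α β
  ∈-skewCells⁺ α β {i , c} s = ∈-concatMap⁺ (rowCells α β) (upTo (length α)) (∈ₚ.∈-upTo⁺ (row<length α β s)) (∈-rowCells⁺ α β s)

  ∈-skewCells⁻ : ∀ α β {x} → x ∈ skewCells α β → InShape α β x
  ∈-skewCells⁻ α β x∈ = let (i , _ , p) = ∈-concatMap⁻ (rowCells α β) (upTo (length α)) x∈ in proj₂ (∈-rowCells⁻ α β i p)

  Unique-skewCells : ∀ α β → Unique (skewCells α β)
  Unique-skewCells α β = Unique-concatMap (rowCells α β) (upTo (length α)) (Uₚ.upTo⁺ _)
    (λ i _ → Uₚ.map⁺ (cong proj₂) (Unique-range _ _))
    (λ {i} {j} _ _ p q → trans (sym (proj₁ (∈-rowCells⁻ α β i p))) (proj₁ (∈-rowCells⁻ α β j q)))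

  rowCount : List ℕ → List ℕ → (Cell → Bool) → ℕ → ℕ
  rowCount α β P i = sumTo (part α i ∸ part β i) (λ x → bit (P (i , part β i + x)))

  N#-rowCells : ∀ α β P i → N# P (rowCells α β i) ≡ rowCount α β P i
  N#-rowCells α β P i = trans (N#-map P (i ,_) (range (part β i) (part α i))) (N#-applyUpTo (P ∘ (i ,_)) (part β i +_) (part α i ∸ part β i))

  rowCount-beyond : ∀ α β P i → length α ≤ i → rowCount α β P i ≡ 0
  rowCount-beyond α β P i l≤ = cong (λ m → sumTo m (λ x → bit (P (i , part β i + x))))
    (trans (cong (_∸ part β i) (part-≥ α i l≤)) (0∸n≡0 (part β i)))

  N#-skewCells : ∀ α β P R → length α ≤ R → N# P (skewCells α β) ≡ sumTo R (rowCount α β P)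
  N#-skewCells α β P R α≤ = trans (N#-concatMap P (rowCells α β) id (length α)) (trans (sumTo-cong (length α) (λ i _ → N#-rowCells α β P i))
    (sym (sumTo-extend (rowCount α β P) α≤ (rowCount-beyond α β P))))

  eqCell⁻ : ∀ x y → T (eqCell x y) → x ≡ y
  eqCell⁻ (a , b) (c , d) h = let (p , q) = T∧⁻ h in cong₂ _,_ (≡ᵇ⇒≡ a c p) (≡ᵇ⇒≡ b d q)

  eqCell⁺ : ∀ x → T (eqCell x x)
  eqCell⁺ (a , b) = T∧⁺ (≡ᵇ-refl a) (≡ᵇ-refl b)

  val : Filling → Cell → ℕ
  val []            c = 0
  val ((d , v) ∷ F) c = if eqCell c d then v else val F c

  fill : (Cell → ℕ) → List Cell → Filling
  fill f cs = map (λ c → (c , f c)) cs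

  val-fill : ∀ f cs {c} → c ∈ cs → val (fill f cs) c ≡ f c
  val-fill f (d ∷ cs) {c} c∈ with eqCell c d in e
  ... | true = cong f (sym (eqCell⁻ c d (true-T e)))
  val-fill f (d ∷ cs) {c} (here refl) | false = ⊥-elim (subst T e (eqCell⁺ c))
  val-fill f (d ∷ cs) {c} (there c∈)  | false = val-fill f cs c∈

  fill-cong : ∀ {f g} cs → (∀ c → c ∈ cs → f c ≡ g c) → fill f cs ≡ fill g cs
  fill-cong []       e = refl
  fill-cong (c ∷ cs) e = cong₂ _∷_ (cong (c ,_) (e c (here refl))) (fill-cong cs (λ d d∈ → e d (there d∈)))

  fill-val : ∀ F → Unique (map proj₁ F) → F ≡ fill (val F) (map proj₁ F)
  fill-val []            _       = refl
  fill-val ((d , v) ∷ F) (p ∷ u) = cong₂ _∷_ (cong (d ,_) (sym (if-true (T-true (eqCell⁺ d)))))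
    (trans (fill-val F u) (fill-cong (map proj₁ F) (λ c c∈ → sym (if-false (¬T-false (λ t → All.lookup p c∈ (sym (eqCell⁻ c d t))))))))

  map-proj₁-fill : ∀ f cs → map proj₁ (fill f cs) ≡ cs
  map-proj₁-fill f []       = refl
  map-proj₁-fill f (c ∷ cs) = cong (c ∷_) (map-proj₁-fill f cs)

  ∈-fill : ∀ {f cs c} → c ∈ cs → (c , f c) ∈ fill f cs
  ∈-fill {f} c∈ = ∈ₚ.∈-map⁺ (λ c → (c , f c)) c∈

  FillingOf : List Cell → List ℕ → Filling → Set
  FillingOf cs vs F = map proj₁ F ≡ cs × All (λ e → proj₂ e ∈ vs) F

  fillingsE : ∀ cs vs → Unique vs → Enum (FillingOf cs vs)
  fillingsE cs vs u = record
    { elems    = fillings cs vs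
    ; unique   = Unique-map (zip cs) (words (length cs) vs)
        (λ {x} {y} x∈ y∈ e → trans (sym (proj₂-zip cs x (proj₁ (wordsound x∈)))) (trans (cong (map proj₂) e) (proj₂-zip cs y (proj₁ (wordsound y∈)))))
        (subst Unique (sym (words≡seqs (length cs) vs)) (unique W))
    ; sound    = λ F∈ → let (w , w∈ , e) = ∈ₚ.∈-map⁻ (zip cs) F∈ ; (l , a) = wordsound w∈ in
        subst (FillingOf cs vs) (sym e) (proj₁-zip cs w l , All-zip cs w l a)
    ; complete = λ {F} (p , a) → subst (_∈ fillings cs vs) (trans (cong (λ cs → zip cs (map proj₂ F)) (sym p)) (zip-proj F))
        (∈ₚ.∈-map⁺ (zip cs) (subst (map proj₂ F ∈_) (sym (words≡seqs (length cs) vs))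
          (complete W (trans (Lₚ.length-map proj₂ F) (trans (sym (Lₚ.length-map proj₁ F)) (cong length p)) , Allₚ.map⁺ a))))
    }
    where
    W = seqsE (length cs) vs u
    wordsound : ∀ {w} → w ∈ words (length cs) vs → length w ≡ length cs × All (_∈ vs) w
    wordsound w∈ = sound W (subst (_ ∈_) (words≡seqs (length cs) vs) w∈)
    proj₁-zip : ∀ (cs : List Cell) (w : List ℕ) → length w ≡ length cs → map proj₁ (zip cs w) ≡ cs
    proj₁-zip []       []      _ = refl
    proj₁-zip (c ∷ cs) (x ∷ w) l = cong (c ∷_) (proj₁-zip cs w (suc-injective l))
    proj₂-zip : ∀ (cs : List Cell) (w : List ℕ) → length w ≡ length cs → map proj₂ (zip cs w) ≡ w
    proj₂-zip []       []      _ = refl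
    proj₂-zip (c ∷ cs) (x ∷ w) l = cong (x ∷_) (proj₂-zip cs w (suc-injective l))
    All-zip : ∀ (cs : List Cell) (w : List ℕ) → length w ≡ length cs → All (_∈ vs) w → All (λ e → proj₂ e ∈ vs) (zip cs w)
    All-zip []       []      _ _       = []
    All-zip (c ∷ cs) (x ∷ w) l (p ∷ a) = p ∷ All-zip cs w (suc-injective l) a
    zip-proj : ∀ (F : Filling) → zip (map proj₁ F) (map proj₂ F) ≡ F
    zip-proj []      = refl
    zip-proj (e ∷ F) = cong (e ∷_) (zip-proj F)

  filterᵇE : {A : Set} {P : A → Set} → Enum P → (q : A → Bool) → Enum (λ x → P x × T (q x))
  filterᵇE d q = filterE d (λ x → T? (q x))

  count-fill : ∀ v f cs → count v (fill f cs) ≡ N# (λ c → f c ≡ᵇ v) cs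
  count-fill v f cs = trans (length-filterᵇ (λ e → proj₂ e ≡ᵇ v) (fill f cs)) (N#-map _ (λ c → (c , f c)) cs)

  rowColOK-row : ∀ st F {r c v v′} → T (rowColOK st F) → ((r , c) , v) ∈ F → ((r , suc c) , v′) ∈ F → T (if st then v <ᵇ v′ else v ≤ᵇ v′)
  rowColOK-row st F {r} {c} h e∈ f∈ = T-if⁻ (proj₁ (T∧⁻ (all⁻ _ F (all⁻ _ F h e∈) f∈))) (T∧⁺ (≡ᵇ-refl r) (≡ᵇ-refl (suc c)))

  rowColOK-col : ∀ st F {r c v v′} → T (rowColOK st F) → ((r , c) , v) ∈ F → ((suc r , c) , v′) ∈ F → v < v′
  rowColOK-col st F {r} {c} {v} {v′} h e∈ f∈ = <ᵇ⇒< v v′ (T-if⁻ (proj₂ (T∧⁻ {if (r ≡ᵇ suc r) ∧ (c ≡ᵇ suc c) then _ else true} (all⁻ _ F (all⁻ _ F h e∈) f∈))) (T∧⁺ (≡ᵇ-refl c) (≡ᵇ-refl (suc r))))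

  rowColOK⁺ : ∀ st F → (∀ {r c v v′} → ((r , c) , v) ∈ F → ((r , suc c) , v′) ∈ F → T (if st then v <ᵇ v′ else v ≤ᵇ v′)) →
    (∀ {r c v v′} → ((r , c) , v) ∈ F → ((suc r , c) , v′) ∈ F → v < v′) → T (rowColOK st F)
  rowColOK⁺ st F hr hc = all⁺ _ F (λ { ((r , c) , v) e∈ → all⁺ _ F (λ { ((r′ , c′) , v′) f∈ → T∧⁺
    (T-if⁺ (λ t → let (p , q) = T∧⁻ t in hr e∈ (subst (λ x → ((proj₁ x , proj₂ x) , v′) ∈ F) (cong₂ _,_ (sym (≡ᵇ⇒≡ r r′ p)) (≡ᵇ⇒≡ c′ (suc c) q)) f∈)))
    (T-if⁺ (λ t → let (p , q) = T∧⁻ t in <⇒<ᵇ (hc e∈ (subst (λ x → ((proj₁ x , proj₂ x) , v′) ∈ F) (cong₂ _,_ (≡ᵇ⇒≡ r′ (suc r) q) (sym (≡ᵇ⇒≡ c c′ p))) f∈)))) }) })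

open Boxes

-- Semistandard fillings and their patterns

module Tableaux where

  sumTo-bits-≤ : ∀ m (Q : ℕ → Bool) → sumTo m (λ i → bit (Q i)) ≤ m
  sumTo-bits-≤ zero    Q = z≤n
  sumTo-bits-≤ (suc m) Q = ≤-trans (+-mono-≤ (sumTo-bits-≤ m Q) (bit≤1 (Q m))) (≤-reflexive (+-comm m 1))

  sumTo-bits-full : ∀ m (Q : ℕ → Bool) → (∀ i → i < m → T (Q i)) → sumTo m (λ i → bit (Q i)) ≡ m
  sumTo-bits-full zero    Q h = refl
  sumTo-bits-full (suc m) Q h = trans (cong₂ (λ a b → a + bit b) (sumTo-bits-full m Q (λ i i< → h i (m<n⇒m<1+n i<))) (T-true (h m ≤-refl))) (+-comm m 1)

  -- The number of elements of an initial segment is the threshold of its membership predicate.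
  module _ (Q : ℕ → Bool) where
    initial⁺ : ∀ m → (∀ i j → i ≤ j → j < m → T (Q j) → T (Q i)) → ∀ i → i < m → T (Q i) → i < sumTo m (λ i → bit (Q i))
    initial⁺ (suc m) down i i< q with Q m in e
    ... | true  = <-≤-trans i< (≤-reflexive (sym (trans (cong (_+ 1) (sumTo-bits-full m Q (λ j j< → down j m (<⇒≤ j<) ≤-refl (true-T e)))) (+-comm m 1))))
    ... | false with m≤n⇒m<n∨m≡n (≤-pred i<)
    ...   | inj₁ i<m  = <-≤-trans (initial⁺ m (λ a b a≤ b< → down a b a≤ (m<n⇒m<1+n b<)) i i<m q) (m≤m+n _ 0)
    ...   | inj₂ refl = ⊥-elim (subst T e q)

    initial⁻ : ∀ m → (∀ i j → i ≤ j → j < m → T (Q j) → T (Q i)) → ∀ i → i < sumTo m (λ i → bit (Q i)) → T (Q i)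
    initial⁻ (suc m) down i i< with Q m in e
    ... | true  = down i m (≤-pred (<-≤-trans i< (≤-trans (+-monoˡ-≤ 1 (sumTo-bits-≤ m Q)) (≤-reflexive (+-comm m 1))))) ≤-refl (true-T e)
    ... | false = initial⁻ m (λ a b a≤ b< → down a b a≤ (m<n⇒m<1+n b<)) i (<-≤-trans i< (≤-reflexive (+-identityʳ _)))

  threshold-unique : ∀ {lo hi x y} → lo ≤ x → x ≤ hi → lo ≤ y → y ≤ hi →
    (∀ c → lo ≤ c → c < hi → c < x → c < y) → (∀ c → lo ≤ c → c < hi → c < y → c < x) → x ≡ y
  threshold-unique {x = x} {y} lx xh ly yh f g with <-cmp x y
  ... | tri< x<y _ _ = ⊥-elim (<-irrefl refl (g x lx (<-≤-trans x<y yh) x<y))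
  ... | tri≈ _ e _   = e
  ... | tri> _ _ y<x = ⊥-elim (<-irrefl refl (f y ly (<-≤-trans y<x xh) y<x))

  record Semistandard (n : ℕ) (α β : List ℕ) (f : Cell → ℕ) : Set where
    field
      positive : ∀ {x} → InShape α β x → 1 ≤ f x
      bounded  : ∀ {x} → InShape α β x → f x ≤ n
      weak     : ∀ {i c} → InShape α β (i , c) → InShape α β (i , suc c) → f (i , c) ≤ f (i , suc c)
      columns  : ∀ {i c} → InShape α β (i , c) → InShape α β (suc i , c) → f (i , c) < f (suc i , c)

  pattern-of : List ℕ → List ℕ → (Cell → ℕ) → ℕ → ℕ → ℕ
  pattern-of α β f i j = part β i + rowCount α β (λ x → f x ≤ᵇ j) i

  -- The values p i 0 ≤ p i 1 ≤ ... that do not exceed c form an initial segment; their number is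
  -- the least j with c < p i j, which is the entry of the box in column c.
  filling-of : ℕ → (ℕ → ℕ → ℕ) → Cell → ℕ
  filling-of n p (i , c) = sumTo n (λ j → bit (p i j ≤ᵇ c))

  mult-pattern : ∀ α β f i k → mult (pattern-of α β f) k i ≡ rowCount α β (λ x → f x ≡ᵇ suc k) i
  mult-pattern α β f i k = trans ([m+n]∸[m+o]≡n∸o (part β i) _ _) (trans (cong (_∸ rowCount α β (λ x → f x ≤ᵇ k) i)
    (trans (sumTo-cong m (λ x _ → bit-split (f (i , part β i + x)) k)) (sumTo-+ m (λ x → bit (f (i , part β i + x) ≤ᵇ k)) (λ x → bit (f (i , part β i + x) ≡ᵇ suc k))))) (m+n∸m≡n (rowCount α β (λ x → f x ≤ᵇ k) i) _))
    where
    m = part α i ∸ part β i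
    bit-split : ∀ v k → bit (v ≤ᵇ suc k) ≡ bit (v ≤ᵇ k) + bit (v ≡ᵇ suc k)
    bit-split v k = go (<-cmp v (suc k))
      where
      T≤ : ∀ {a b} → a ≤ b → bit (a ≤ᵇ b) ≡ 1
      T≤ p = cong bit (T-true (≤⇒≤ᵇ p))
      F≤ : ∀ {a b} → b < a → bit (a ≤ᵇ b) ≡ 0
      F≤ {a} {b} p = cong bit (¬T-false (λ t → <⇒≱ p (≤ᵇ⇒≤ a b t)))
      F≡ : ∀ {a b} → a ≢ b → bit (a ≡ᵇ b) ≡ 0
      F≡ {a} {b} p = cong bit (¬T-false (λ t → p (≡ᵇ⇒≡ a b t)))
      go : _ → bit (v ≤ᵇ suc k) ≡ bit (v ≤ᵇ k) + bit (v ≡ᵇ suc k)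
      go (tri< v< v≢ _)   = trans (T≤ (<⇒≤ v<)) (sym (cong₂ _+_ (T≤ (≤-pred v<)) (F≡ v≢)))
      go (tri≈ _ refl _)  = trans (T≤ {v} ≤-refl) (sym (cong₂ _+_ (F≤ {v} {k} ≤-refl) (cong bit (T-true (≡ᵇ-refl v)))))
      go (tri> _ v≢ <v)   = trans (F≤ <v) (sym (cong₂ _+_ (F≤ (<⇒≤ <v)) (F≡ v≢)))

  module _ {n : ℕ} {α β : List ℕ} (β⊆α : ∀ i → part β i ≤ part α i) {f : Cell → ℕ} (ss : Semistandard n α β f) where
    open Semistandard ss
    private
      p = pattern-of α β f

      weak-≤ : ∀ {i} d c → InShape α β (i , c) → c + d < part α i → f (i , c) ≤ f (i , c + d)
      weak-≤ {i} zero    c s _ = ≤-reflexive (cong (λ x → f (i , x)) (sym (+-identityʳ c)))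
      weak-≤ {i} (suc d) c (lo , hi) h = ≤-trans (weak-≤ d c (lo , hi) h′)
        (≤-trans (weak {i} {c + d} (lo′ , h′) (≤-trans lo′ (n≤1+n _) , subst (_< part α i) (+-suc c d) h))
          (≤-reflexive (cong (λ x → f (i , x)) (sym (+-suc c d)))))
        where
        h′ : c + d < part α i
        h′ = <-trans (≤-reflexive (sym (+-suc c d))) h
        lo′ = ≤-trans lo (m≤m+n c d)

      down : ∀ i j x y → x ≤ y → y < part α i ∸ part β i → T (f (i , part β i + y) ≤ᵇ j) → T (f (i , part β i + x) ≤ᵇ j)
      down i j x y x≤y y< t = ≤⇒≤ᵇ (≤-trans (≤-trans (weak-≤ {i} (y ∸ x) (part β i + x) (m≤m+n _ x , ≤-<-trans (+-monoʳ-≤ (part β i) x≤y) y<α) (subst (_< part α i) (sym e) y<α))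
          (≤-reflexive (cong (λ z → f (i , z)) e))) (≤ᵇ⇒≤ _ j t))
        where
        e : part β i + x + (y ∸ x) ≡ part β i + y
        e = trans (+-assoc (part β i) x _) (cong (part β i +_) (m+[n∸m]≡n x≤y))
        y<α : part β i + y < part α i
        y<α = <-≤-trans (+-monoʳ-< (part β i) y<) (≤-reflexive (m+[n∸m]≡n (β⊆α i)))

    pattern-≤⁺ : ∀ {i c} j → InShape α β (i , c) → f (i , c) ≤ j → c < p i j
    pattern-≤⁺ {i} {c} j (lo , hi) f≤ = subst (_< p i j) (m+[n∸m]≡n lo) (+-monoʳ-< (part β i)
      (initial⁺ (λ x → f (i , part β i + x) ≤ᵇ j) (part α i ∸ part β i) (down i j) (c ∸ part β i) (∸-monoˡ-< hi lo)
        (≤⇒≤ᵇ (subst (λ z → f (i , z) ≤ j) (sym (m+[n∸m]≡n lo)) f≤))))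

    pattern-≤⁻ : ∀ {i c} j → InShape α β (i , c) → c < p i j → f (i , c) ≤ j
    pattern-≤⁻ {i} {c} j (lo , hi) c< = subst (λ z → f (i , z) ≤ j) (m+[n∸m]≡n lo) (≤ᵇ⇒≤ _ j
      (initial⁻ (λ x → f (i , part β i + x) ≤ᵇ j) (part α i ∸ part β i) (down i j) (c ∸ part β i)
        (+-cancelˡ-< (part β i) _ _ (subst (_< p i j) (sym (m+[n∸m]≡n lo)) c<))))

    private
      in-row : ∀ i x → x < part α i ∸ part β i → InShape α β (i , part β i + x)
      in-row i x x< = m≤m+n _ x , <-≤-trans (+-monoʳ-< (part β i) x<) (≤-reflexive (m+[n∸m]≡n (β⊆α i)))

    pattern-bounds : ∀ i j → part β i ≤ p i j × p i j ≤ part α i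
    pattern-bounds i j = m≤m+n _ _ , ≤-trans (+-monoʳ-≤ (part β i) (sumTo-bits-≤ (part α i ∸ part β i) _)) (≤-reflexive (m+[n∸m]≡n (β⊆α i)))

    pattern-GT : Dominant α → Dominant β → GT n (part α) (part β) p
    pattern-GT αd βd = gt
      (λ i → trans (cong (part β i +_) (sumTo-zero _ (λ x x< → cong bit (¬T-false (λ t → <⇒≱ (positive (in-row i x x<)) (≤ᵇ⇒≤ _ 0 t)))))) (+-identityʳ _))
      (λ i → trans (cong (part β i +_) (sumTo-bits-full _ _ (λ x x< → ≤⇒≤ᵇ (bounded (in-row i x x<))))) (m+[n∸m]≡n (β⊆α i)))
      (λ i j _ → +-monoʳ-≤ (part β i) (sumTo-mono (part α i ∸ part β i) (λ x _ → bit-mono (f (i , part β i + x)) j)))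
      (λ i j _ → ≮⇒≥ (crossing i j))
      where
      bit-mono : ∀ v j → bit (v ≤ᵇ j) ≤ bit (v ≤ᵇ suc j)
      bit-mono v j with v ≤ᵇ j in e
      ... | false = z≤n
      ... | true  = ≤-reflexive (sym (cong bit (T-true (≤⇒≤ᵇ (m≤n⇒m≤1+n (≤ᵇ⇒≤ v j (true-T e)))))))
      -- In row i the box in column `p i j` is the first with an entry above j. The box under it
      -- would have an entry of at most j + 1, against the strict increase down columns.
      crossing : ∀ i j → ¬ p i j < p (suc i) (suc j)
      crossing i j lt = <⇒≱ (≤-trans (columns above here′) (pattern-≤⁻ (suc j) here′ lt))
          (≰⇒> (λ f≤ → <-irrefl refl (pattern-≤⁺ j above f≤)))
        where
        c<α = <-≤-trans lt (proj₂ (pattern-bounds (suc i) (suc j)))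
        above : InShape α β (i , p i j)
        above = proj₁ (pattern-bounds i j) , <-≤-trans c<α (αd i)
        here′ : InShape α β (suc i , p i j)
        here′ = ≤-trans (βd i) (proj₁ (pattern-bounds i j)) , c<α

  module _ {n : ℕ} {α β : List ℕ} {p : ℕ → ℕ → ℕ} (g : GT n (part α) (part β) p) where
    private
      f = filling-of n p
      down : ∀ i c x y → x ≤ y → y < n → T (p i y ≤ᵇ c) → T (p i x ≤ᵇ c)
      down i c x y x≤y y< t = ≤⇒≤ᵇ (≤-trans (GT-mono g i x≤y (<⇒≤ y<)) (≤ᵇ⇒≤ _ c t))

    filling-<⁺ : ∀ {i c j} → j < n → p i j ≤ c → j < f (i , c)
    filling-<⁺ {i} {c} {j} j< p≤ = initial⁺ (λ j → p i j ≤ᵇ c) n (down i c) j j< (≤⇒≤ᵇ p≤)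

    filling-<⁻ : ∀ {i c j} → j < f (i , c) → p i j ≤ c
    filling-<⁻ {i} {c} {j} j< = ≤ᵇ⇒≤ _ c (initial⁻ (λ j → p i j ≤ᵇ c) n (down i c) j j<)

    filling-bounded : ∀ x → f x ≤ n
    filling-bounded (i , c) = sumTo-bits-≤ n _

    filling-≤⁺ : ∀ {i c j} → j ≤ n → c < p i j → f (i , c) ≤ j
    filling-≤⁺ {i} {c} {j} j≤ c< = ≮⇒≥ (λ j< → <⇒≱ c< (filling-<⁻ {i} {c} {j} j<))

    filling-≤⁻ : ∀ {i c j} → InShape α β (i , c) → j ≤ n → f (i , c) ≤ j → c < p i j
    filling-≤⁻ {i} {c} {j} (lo , hi) j≤ f≤ with m≤n⇒m<n∨m≡n j≤
    ... | inj₁ j<   = ≰⇒> (λ p≤ → <⇒≱ (filling-<⁺ {i} {c} j< p≤) f≤)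
    ... | inj₂ refl = <-≤-trans hi (≤-reflexive (sym (end g i)))

    filling-positive : ∀ {x} → InShape α β x → 1 ≤ f x
    filling-positive {i , c} (lo , hi) = filling-<⁺ {i} {c} (0<n g) (≤-trans (≤-reflexive (start g i)) lo)
      where
      0<n : ∀ {m} → GT m (part α) (part β) p → 0 < m
      0<n {zero}  g = ⊥-elim (<⇒≱ hi (≤-trans (≤-reflexive (trans (sym (end g i)) (start g i))) lo))
      0<n {suc m} g = s≤s z≤n

    filling-Semistandard : Semistandard n α β f
    filling-Semistandard = record
      { positive = filling-positive
      ; bounded  = λ {x} _ → filling-bounded x
      ; weak     = λ {i} {c} _ _ → sumTo-mono n (λ j _ → bit-mono (p i j) c)
      ; columns  = λ {i} {c} s s′ → cols s s′ (f (suc i , c)) refl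
      }
      where
      bit-mono : ∀ v c → bit (v ≤ᵇ c) ≤ bit (v ≤ᵇ suc c)
      bit-mono v c with v ≤ᵇ c in e
      ... | false = z≤n
      ... | true  = ≤-reflexive (sym (cong bit (T-true (≤⇒≤ᵇ (m≤n⇒m≤1+n (≤ᵇ⇒≤ v c (true-T e)))))))
      cols : ∀ {i c} → InShape α β (i , c) → InShape α β (suc i , c) → ∀ v → f (suc i , c) ≡ v → f (i , c) < v
      cols {i} {c} s s′ zero    e = ⊥-elim (<⇒≢ (filling-positive s′) (sym e))
      cols {i} {c} s s′ (suc v) e = s≤s (filling-≤⁺ {i} {c} (<⇒≤ v<) (<-≤-trans (filling-≤⁻ s′ v< (≤-reflexive e)) (strict g i v v<)))
        where
        v< : v < n
        v< = ≤-trans (≤-reflexive (sym e)) (filling-bounded (suc i , c))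

    pattern-filling : ∀ i j → j ≤ n → (β⊆α : ∀ i → part β i ≤ part α i) → pattern-of α β f i j ≡ p i j
    pattern-filling i j j≤ β⊆α = threshold-unique (proj₁ b) (proj₂ b) (GT-≥start g i j≤) (GT-≤end g i j≤)
      (λ c lo hi c< → filling-≤⁻ (lo , hi) j≤ (pattern-≤⁻ β⊆α filling-Semistandard j (lo , hi) c<))
      (λ c lo hi c< → pattern-≤⁺ β⊆α filling-Semistandard j (lo , hi) (filling-≤⁺ {i} {c} j≤ c<))
      where b = pattern-bounds β⊆α filling-Semistandard i j

  filling-pattern : ∀ {n α β f} → (∀ i → part β i ≤ part α i) → Dominant α → Dominant β → Semistandard n α β f →
    ∀ {p} → (∀ i j → j ≤ n → p i j ≡ pattern-of α β f i j) → ∀ x → InShape α β x → filling-of n p x ≡ f x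
  filling-pattern {n} {α} {β} {f} β⊆α αd βd ss {p} e (i , c) s = ≤-antisym
    (filling-≤⁺ {n} {α} {β} {p} g {i} {c} (Semistandard.bounded ss s) (subst (c <_) (sym (e i _ (Semistandard.bounded ss s))) (pattern-≤⁺ {n} {α} {β} β⊆α ss (f (i , c)) s ≤-refl)))
    (pattern-≤⁻ {n} {α} {β} β⊆α ss (filling-of n p (i , c)) s (subst (c <_) (e i _ (filling-bounded {n} {α} {β} {p} g (i , c))) (filling-≤⁻ {n} {α} {β} {p} g s (filling-bounded {n} {α} {β} {p} g (i , c)) ≤-refl)))
    where
    g : GT n (part α) (part β) p
    g = GT-cong e (pattern-GT β⊆α ss αd βd)

open Tableaux

-- Lists of tableaux as pattern counts, and lattice words

module LittlewoodRichardson where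

  ifE : {A : Set} {P : A → Set} (b : Bool) → Enum P → Enum (λ x → T b × P x)
  ifE b d = record
    { elems = if b then elems d else [] ; unique = uniq b ; sound = λ x∈ → snd b x∈ ; complete = λ (t , p) → cmp b t p }
    where
    uniq : ∀ b → Unique (if b then elems d else [])
    uniq true  = unique d
    uniq false = []
    snd : ∀ b {x} → x ∈ (if b then elems d else []) → T b × _
    snd true x∈ = tt , sound d x∈
    cmp : ∀ b {x} → T b → _ → x ∈ (if b then elems d else [])
    cmp true _ p = complete d p

  contents : List ℕ → Filling → Bool
  contents a F = all (λ i → count (suc i) F ≡ᵇ part a i) (upTo (length a))

  IsSSYT : List ℕ → List ℕ → List ℕ → Filling → Set
  IsSSYT α β a F = T (contained β α) × (FillingOf (skewCells α β) (range 1 (suc (length a))) F × T (rowColOK false F ∧ contents a F))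

  ssytE : ∀ α β a → Enum (IsSSYT α β a)
  ssytE α β a = ifE (contained β α) (filterᵇE (fillingsE (skewCells α β) (range 1 (suc (length a))) (Unique-range 1 (suc (length a)))) _)

  filling-is-fill : ∀ {α β vs F} → FillingOf (skewCells α β) vs F → F ≡ fill (val F) (skewCells α β)
  filling-is-fill {α} {β} {vs} {F} (p , _) = trans (fill-val F (subst Unique (sym p) (Unique-skewCells α β))) (cong (fill (val F)) p)

  ∈-filling : ∀ {α β vs F x} → FillingOf (skewCells α β) vs F → InShape α β x → (x , val F x) ∈ F
  ∈-filling {α} {β} {F = F} {x} ff s = subst ((x , val F x) ∈_) (sym (filling-is-fill {α} {β} ff)) (∈-fill {val F} (∈-skewCells⁺ α β s))

  ∈-fill⁻ : ∀ {f α β x v} → (x , v) ∈ fill f (skewCells α β) → InShape α β x × v ≡ f x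
  ∈-fill⁻ {f} {α} {β} e∈ with ∈ₚ.∈-map⁻ (λ c → (c , f c)) e∈
  ... | c , c∈ , refl = ∈-skewCells⁻ α β c∈ , refl

  ssyt-Semistandard : ∀ {α β a F} → IsSSYT α β a F → Semistandard (length a) α β (val F)
  ssyt-Semistandard {α} {β} {a} {F} (_ , (ff@(_ , vs) , t)) = record
    { positive = λ s → proj₁ (bounds s)
    ; bounded  = λ s → ≤-pred (proj₂ (bounds s))
    ; weak     = λ s s′ → ≤ᵇ⇒≤ _ _ (rowColOK-row false F ok (∈-filling {α} {β} ff s) (∈-filling {α} {β} ff s′))
    ; columns  = λ s s′ → rowColOK-col false F ok (∈-filling {α} {β} ff s) (∈-filling {α} {β} ff s′)
    }
    where
    ok : T (rowColOK false F)
    ok = proj₁ (T∧⁻ t)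
    bounds : ∀ {x} → InShape α β x → 1 ≤ val F x × val F x < suc (length a)
    bounds s = ∈-range⁻ 1 (suc (length a)) (All.lookup vs (∈-filling {α} {β} ff s))

  ssyt-contents : ∀ {α β a F} → IsSSYT α β a F → ∀ k → k < length a → N# (λ c → val F c ≡ᵇ suc k) (skewCells α β) ≡ part a k
  ssyt-contents {α} {β} {a} {F} (_ , (ff , t)) k k< = trans (sym (count-fill (suc k) (val F) (skewCells α β)))
    (trans (cong (count (suc k)) (sym (filling-is-fill {α} {β} ff)))
      (≡ᵇ⇒≡ _ _ (all⁻ _ (upTo (length a)) (proj₂ (T∧⁻ {rowColOK false F} t)) (∈ₚ.∈-upTo⁺ k<))))

  fill-SSYT : ∀ {α β a f} → (∀ i → part β i ≤ part α i) → Semistandard (length a) α β f →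
    (∀ k → k < length a → N# (λ c → f c ≡ᵇ suc k) (skewCells α β) ≡ part a k) → IsSSYT α β a (fill f (skewCells α β))
  fill-SSYT {α} {β} {a} {f} β⊆α ss h = contained⁺ β α β⊆α ,
    ((map-proj₁-fill f cs , Allₚ.map⁺ (All.tabulate (λ c∈ → let s = ∈-skewCells⁻ α β c∈ in
        ∈-range⁺ 1 (suc (length a)) (positive s) (s≤s (bounded s))))) ,
     T∧⁺ (rowColOK⁺ false (fill f cs)
        (λ e∈ e∈′ → let (s , e) = ∈-fill⁻ {f} {α} {β} e∈ ; (s′ , e′) = ∈-fill⁻ {f} {α} {β} e∈′ in
          ≤⇒≤ᵇ (subst₂ (λ a b → a ≤ b) (sym e) (sym e′) (weak s s′)))
        (λ e∈ e∈′ → let (s , e) = ∈-fill⁻ {f} {α} {β} e∈ ; (s′ , e′) = ∈-fill⁻ {f} {α} {β} e∈′ in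
          subst₂ (λ a b → a < b) (sym e) (sym e′) (columns s s′)))
      (all⁺ _ (upTo (length a)) (λ k k∈ → ≡⇒≡ᵇ _ _ (trans (count-fill (suc k) f cs) (h k (∈ₚ.∈-upTo⁻ k∈))))))
    where
    open Semistandard ss
    cs = skewCells α β

  module _ (R : ℕ) (α β a : List ℕ) (α≤ : length α ≤ R) (αd : Dominant α) (βd : Dominant β) where
    private
      n = length a
      cs = skewCells α β

    to-table : Filling → List (List ℕ)
    to-table F = tab R (suc n) (pattern-of α β (val F))

    weightE : Enum (λ T → Arr R n α β T × wt R n (get T) ≡ a)
    weightE = filterE (arrE R n α β) (λ T → wt R n (get T) ≟L a)

    private
      from-table : List (List ℕ) → Filling
      from-table T = fill (filling-of n (get T)) cs

      sub-shape : ∀ {p} → GT n (part α) (part β) p → ∀ i → part β i ≤ part α i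
      sub-shape g i = ≤-trans (GT-≥start g i z≤n) (GT-≤end g i z≤n)

    module _ {F : Filling} (y : IsSSYT α β a F) where
      private
        β⊆α = contained⁻ β α (proj₁ y)
        ss = ssyt-Semistandard {α} {β} {a} {F} y
        g : GT n (part α) (part β) (pattern-of α β (val F))
        g = pattern-GT β⊆α ss αd βd

      table-agree : ∀ i j → j ≤ n → get (to-table F) i j ≡ pattern-of α β (val F) i j
      table-agree = get-tab-GT α α≤ g

      table-mult : ∀ k i → k < n → mult (get (to-table F)) k i ≡ rowCount α β (λ x → val F x ≡ᵇ suc k) i
      table-mult k i k< = trans (cong₂ _∸_ (table-agree i (suc k) k<) (table-agree i k (<⇒≤ k<))) (mult-pattern α β (val F) i k)

      to-table-ok : Arr R n α β (to-table F) × wt R n (get (to-table F)) ≡ a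
      to-table-ok = Arr-tab {α = α} {β} α≤ g , part-ext (length-wt R n (get (to-table F))) (λ k k< → let k<n = subst (k <_) (length-wt R n (get (to-table F))) k< in
        trans (part-applyUpTo _ n k<n) (trans (sumTo-cong R (λ i _ → table-mult k i k<n))
          (trans (sym (N#-skewCells α β (λ c → val F c ≡ᵇ suc k) R α≤)) (ssyt-contents {α} {β} {a} {F} y k k<n))))

      from-to : from-table (to-table F) ≡ F
      from-to = trans (fill-cong cs (λ c c∈ → filling-pattern β⊆α αd βd ss table-agree c (∈-skewCells⁻ α β c∈)))
        (sym (filling-is-fill {α} {β} (proj₁ (proj₂ y))))

    private
      module _ {T : List (List ℕ)} (z : Arr R n α β T × wt R n (get T) ≡ a) where
        g = proj₂ (proj₁ z)
        β⊆α = sub-shape g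

        pattern-agree : ∀ i j → j ≤ n → pattern-of α β (val (from-table T)) i j ≡ get T i j
        pattern-agree i j j≤ = trans (cong (part β i +_) (sumTo-cong _ (λ x x< → cong (λ v → bit (v ≤ᵇ j))
            (val-fill (filling-of n (get T)) cs (∈-skewCells⁺ α β (m≤m+n _ x , <-≤-trans (+-monoʳ-< (part β i) x<) (≤-reflexive (m+[n∸m]≡n (β⊆α i)))))))))
          (pattern-filling {n} {α} {β} g i j j≤ β⊆α)

        from-table-ok : IsSSYT α β a (from-table T)
        from-table-ok = fill-SSYT {α} {β} {a} {filling-of n (get T)} β⊆α (filling-Semistandard {n} {α} {β} g) (λ k k< → trans (N#-skewCells α β _ R α≤)
          (trans (sumTo-cong R (λ i _ → trans (sym (mult-pattern α β (filling-of n (get T)) i k))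
            (cong₂ _∸_ (pattern-filling {n} {α} {β} g i (suc k) k< β⊆α) (pattern-filling {n} {α} {β} g i k (<⇒≤ k<) β⊆α))))
          (trans (sym (part-applyUpTo _ n k<)) (cong (λ l → part l k) (proj₂ z)))))

        to-from : to-table (from-table T) ≡ T
        to-from = trans (tab-cong R (suc n) (λ i j _ j< → pattern-agree i j (≤-pred j<))) (tab-get (proj₁ (proj₁ z)))

    ∑-ssyt : (h : Filling → ℤ) (k : List (List ℕ) → ℤ) → (∀ F → IsSSYT α β a F → h F ≡ k (to-table F)) →
      ∑ (ssyt α β a) h ≡ ∑ (elems weightE) k
    ∑-ssyt h k e = ∑-bij (ssytE α β a) weightE to-table from-table (λ _ → to-table-ok) (λ _ → from-table-ok) (λ _ → from-to) (λ _ → to-from) h k e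

    length-ssyt : pos (length (ssyt α β a)) ≡ K R n α β a
    length-ssyt = trans (∑-length (ssyt α β a)) (trans (∑-ssyt (λ _ → 1ℤ) (λ _ → 1ℤ) (λ _ _ → refl))
      (trans (∑-filter (λ T → wt R n (get T) ≟L a) (elems (arrE R n α β)) (λ _ → 1ℤ)) (∑-cong′ (elems (arrE R n α β)) (λ T → ℤₚ.*-identityʳ _))))

  -- The local function entryAt of readingWord cannot be named from here: entryAt′ is the solution of an
  -- equation, stated with the first argument F₀ and the current suffix of the filling kept apart.
  mutual
    entryAt′ : List ℕ → List ℕ → Filling → Cell → Filling → ℕ
    entryAt′ γ ν F₀ c G = _

    entryAt′-spec : ∀ γ ν d v (G : Filling) →
      readingWord γ ν ((d , v) ∷ G) ≡ map (λ c → if eqCell c d then v else entryAt′ γ ν ((d , v) ∷ G) c G) (rlCells γ ν)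
    entryAt′-spec γ ν d v G with (d , v) ∷ G
    ... | F₀ = refl

  entryAt′≡val : ∀ γ ν F₀ c G → entryAt′ γ ν F₀ c G ≡ val G c
  entryAt′≡val γ ν F₀ c []            = refl
  entryAt′≡val γ ν F₀ c ((d , v) ∷ G) = cong (λ z → if eqCell c d then v else z) (entryAt′≡val γ ν F₀ c G)

  readingWord≡ : ∀ γ ν F → readingWord γ ν F ≡ map (val F) (rlCells γ ν)
  readingWord≡ γ ν F = Lₚ.map-cong (λ c → entryAt′≡val γ ν F c F) (rlCells γ ν)

  ∈-prefixes⁺ : ∀ q r → q ∈ prefixes (q ++ r)
  ∈-prefixes⁺ []      []      = here refl
  ∈-prefixes⁺ []      (x ∷ r) = here refl
  ∈-prefixes⁺ (x ∷ q) r       = there (∈ₚ.∈-map⁺ (x ∷_) (∈-prefixes⁺ q r))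

  ∈-prefixes⁻ : ∀ w {q} → q ∈ prefixes w → ∃ λ r → w ≡ q ++ r
  ∈-prefixes⁻ []      (here refl) = [] , refl
  ∈-prefixes⁻ (x ∷ w) (here refl) = x ∷ w , refl
  ∈-prefixes⁻ (x ∷ w) (there q∈) with ∈ₚ.∈-map⁻ (x ∷_) q∈
  ... | q , q∈′ , refl = let (r , e) = ∈-prefixes⁻ w q∈′ in r , cong (x ∷_) e

  map-split : {A B : Set} (f : A → B) (xs : List A) (q r : List B) → map f xs ≡ q ++ r → ∃ λ q₀ → ∃ λ r₀ → xs ≡ q₀ ++ r₀ × q ≡ map f q₀
  map-split f xs       []      r e = [] , xs , refl , refl
  map-split f (x ∷ xs) (y ∷ q) r e with Lₚ.∷-injective e
  ... | refl , e′ = let (q₀ , r₀ , p , s) = map-split f xs q r e′ in x ∷ q₀ , r₀ , cong (x ∷_) p , cong (f x ∷_) s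

  ++-split : {A : Set} (xs ys q r : List A) → xs ++ ys ≡ q ++ r →
    (∃ λ z → q ≡ xs ++ z × ys ≡ z ++ r) ⊎ (∃ λ z → xs ≡ q ++ z)
  ++-split []       ys q       r e = inj₁ (q , refl , e)
  ++-split (x ∷ xs) ys []      r e = inj₂ (x ∷ xs , refl)
  ++-split (x ∷ xs) ys (y ∷ q) r e with Lₚ.∷-injective e
  ... | refl , e′ with ++-split xs ys q r e′
  ...   | inj₁ (z , p , s) = inj₁ (z , cong (x ∷_) p , s)
  ...   | inj₂ (z , p)     = inj₂ (z , cong (x ∷_) p)

  -- Locates an arbitrary prefix of the reading word relative to the rows, so that it can be
  -- compared with the row boundaries on which `Lattice` is stated.
  concatMap-prefix : {A : Set} (g : ℕ → List A) (h : ℕ → ℕ) (R : ℕ) (q r : List A) → concatMap g (applyUpTo h R) ≡ q ++ r →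
    ∃ λ i → ∃ λ q′ → q ≡ concatMap g (applyUpTo h i) ++ q′ × ((i < R × ∃ λ r′ → g (h i) ≡ q′ ++ r′) ⊎ (i ≡ R × q′ ≡ []))
  concatMap-prefix g h zero    []      r e = 0 , [] , refl , inj₂ (refl , refl)
  concatMap-prefix g h (suc R) q       r e with ++-split (g (h 0)) (concatMap g (applyUpTo (h ∘ suc) R)) q r e
  ... | inj₂ (z , p) = 0 , q , refl , inj₁ (s≤s z≤n , z , p)
  ... | inj₁ (z , refl , e′) with concatMap-prefix g (h ∘ suc) R z r e′
  ...   | i , q′ , refl , inj₁ (i< , r′ , e″)  = suc i , q′ , sym (Lₚ.++-assoc (g (h 0)) _ q′) , inj₁ (s≤s i< , r′ , e″)
  ...   | i , q′ , refl , inj₂ (refl , refl) = suc i , [] , sym (Lₚ.++-assoc (g (h 0)) _ []) , inj₂ (refl , refl)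

  concatMap-at : {A : Set} (g : ℕ → List A) (h : ℕ → ℕ) (R i : ℕ) → i < R →
    ∃ λ r → concatMap g (applyUpTo h R) ≡ concatMap g (applyUpTo h i) ++ (g (h i) ++ r)
  concatMap-at g h (suc R) zero    _        = _ , refl
  concatMap-at g h (suc R) (suc i) (s≤s i<) = let (r , e) = concatMap-at g (h ∘ suc) R i i< in
    r , trans (cong (g (h 0) ++_) e) (sym (Lₚ.++-assoc (g (h 0)) _ _))

  concatMap-extend : {A : Set} (g : ℕ → List A) (h : ℕ → ℕ) {m R : ℕ} → m ≤ R → (∀ i → m ≤ i → g (h i) ≡ []) →
    concatMap g (applyUpTo h R) ≡ concatMap g (applyUpTo h m)
  concatMap-extend g h {R = zero}  z≤n e = refl
  concatMap-extend g h {R = suc R} z≤n e = trans (cong (_++ concatMap g (applyUpTo (h ∘ suc) R)) (e 0 z≤n)) (concatMap-extend g (h ∘ suc) {R = R} z≤n (λ i _ → e (suc i) z≤n))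
  concatMap-extend g h (s≤s m≤)    e = cong (g (h 0) ++_) (concatMap-extend g (h ∘ suc) m≤ (λ i i≤ → e (suc i) (s≤s i≤)))

  range-split : ∀ {lo x hi} → lo ≤ x → x ≤ hi → range lo hi ≡ range lo x ++ range x hi
  range-split {lo} {x} {hi} lo≤ x≤ = trans (cong (applyUpTo (lo +_)) (trans (cong (_∸ lo) (sym (m+[n∸m]≡n x≤))) (+-∸-comm (hi ∸ x) lo≤)))
    (trans (applyUpTo-++ (lo +_) (x ∸ lo) (hi ∸ x)) (cong (range lo x ++_) (applyUpTo-cong (hi ∸ x) (λ j _ →
      trans (sym (+-assoc lo (x ∸ lo) j)) (cong (_+ j) (m+[n∸m]≡n lo≤))))))

  module _ (R : ℕ) (γ ν μ : List ℕ) (γ≤ : length γ ≤ R) (γd : Dominant γ) (νd : Dominant ν) {F : Filling} (y : IsSSYT γ ν μ F) where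
    private
      n = length μ
      f = val F
      ss = ssyt-Semistandard {γ} {ν} {μ} {F} y
      open Semistandard ss
      ν⊆γ = contained⁻ ν γ (proj₁ y)
      T₀ = to-table R γ ν μ γ≤ γd νd F
      p = get T₀

      rl : ℕ → List Cell
      rl i = reverse (rowCells γ ν i)

      rlCells≡ : rlCells γ ν ≡ concatMap rl (upTo R)
      rlCells≡ = sym (concatMap-extend rl id γ≤ (λ i γ≤i → cong reverse (empty i γ≤i)))
        where
        empty : ∀ i → length γ ≤ i → rowCells γ ν i ≡ []
        empty i γ≤i = cong (λ m → map (i ,_) (applyUpTo (part ν i +_) m)) (trans (cong (_∸ part ν i) (part-≥ γ i γ≤i)) (0∸n≡0 (part ν i)))

      C : ℕ → List Cell → ℕ
      C k = N# (λ c → f c ≡ᵇ suc k)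

      cnt≡C : ∀ k q → cnt (suc k) (map f q) ≡ C k q
      cnt≡C k q = trans (length-filterᵇ (suc k ≡ᵇ_) (map f q)) (trans (N#-map (suc k ≡ᵇ_) f q) (N#-cong q (λ c _ → ≡ᵇ-sym (suc k) (f c))))
        where
        ≡ᵇ-sym : ∀ a b → (a ≡ᵇ b) ≡ (b ≡ᵇ a)
        ≡ᵇ-sym zero    zero    = refl
        ≡ᵇ-sym zero    (suc b) = refl
        ≡ᵇ-sym (suc a) zero    = refl
        ≡ᵇ-sym (suc a) (suc b) = ≡ᵇ-sym a b

      rowC : ∀ k i → k < n → C k (rl i) ≡ mult p k i
      rowC k i k< = trans (N#-reverse _ (rowCells γ ν i)) (trans (N#-rowCells γ ν (λ c → f c ≡ᵇ suc k) i) (sym (table-mult R γ ν μ γ≤ γd νd y k i k<)))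

      blocks : ∀ k i q → k < n → C k (concatMap rl (upTo i) ++ q) ≡ sumTo i (mult p k) + C k q
      blocks k i q k< = trans (N#-++ _ (concatMap rl (upTo i)) q) (cong (_+ C k q) (trans (N#-concatMap _ rl id i) (sumTo-cong i (λ j _ → rowC k j k<))))

      ∈-rl : ∀ {x} → x ∈ rlCells γ ν → InShape γ ν x
      ∈-rl x∈ = let (i , _ , x∈r) = ∈-concatMap⁻ rl (upTo (length γ)) x∈ in
        proj₂ (∈-rowCells⁻ γ ν i (Anyₚ.reverse⁻ x∈r))

    lattice⁺ : Lattice R n (pad n []) p → T (lattice n (readingWord γ ν F))
    lattice⁺ lat = subst (λ w → T (lattice n w)) (sym (readingWord≡ γ ν F)) (all⁺ _ (prefixes (map f (rlCells γ ν))) (λ q q∈ →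
        let (r , e) = ∈-prefixes⁻ _ q∈ ; (q₀ , r₀ , e₀ , eq) = map-split f (rlCells γ ν) q r e in
        all⁺ _ (upTo n) (λ k k∈ → ≤⇒≤ᵇ (subst₂ (λ a b → a ≤ b)
          (sym (trans (cong (cnt (suc (suc k))) eq) (cnt≡C (suc k) q₀))) (sym (trans (cong (cnt (suc k)) eq) (cnt≡C k q₀)))
          (at q₀ r₀ e₀ k (suc k <? n))))))
      where
      lat′ : ∀ k i → suc k < n → i < R → sumTo (suc i) (mult p (suc k)) ≤ sumTo i (mult p k)
      lat′ k i k< i< = ≤-trans (m≤n+m _ (part (pad n []) (suc k))) (≤-trans (lat k i k< i<) (≤-reflexive (cong (_+ sumTo i (mult p k)) (part-pad n [] z≤n k))))
      whole : ∀ R′ k → R′ ≤ R → suc k < n → sumTo R′ (mult p (suc k)) ≤ sumTo R′ (mult p k)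
      whole zero     k _  _  = z≤n
      whole (suc R′) k R< k< = ≤-trans (lat′ k R′ k< R<) (m≤m+n _ _)
      at : ∀ q r → rlCells γ ν ≡ q ++ r → ∀ k → Dec (suc k < n) → C (suc k) q ≤ C k q
      -- `lattice` also tests the letter n + 1, which does not occur in the word.
      at q r e k (no k≮) = ≤-trans (≤-reflexive (N#-zero q (λ x x∈ → ¬T-false (λ t →
        <⇒≱ (s≤s (≮⇒≥ k≮)) (≤-trans (≤-reflexive (sym (≡ᵇ⇒≡ (f x) (suc (suc k)) t))) (bounded (∈-rl (subst (x ∈_) (sym e) (∈ₚ.∈-++⁺ˡ x∈))))))))) z≤n
      at q r e k (yes k<) with concatMap-prefix rl id R q r (trans (sym rlCells≡) e)
      -- A prefix that ends in row i has at most the letters k + 2 of rows up to i and at least the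
      -- letters k + 1 of rows before i, so the inequality at row boundaries suffices.
      ... | i , q′ , refl , inj₁ (i< , r′ , e′) = ≤-trans (≤-reflexive (blocks (suc k) i q′ k<))
          (≤-trans (+-monoʳ-≤ (sumTo i (mult p (suc k))) (≤-trans (m≤m+n _ (C (suc k) r′)) (≤-reflexive (trans (sym (N#-++ _ q′ r′)) (trans (cong (C (suc k)) (sym e′)) (rowC (suc k) i k<))))))
          (≤-trans (lat′ k i k< i<) (≤-trans (m≤m+n _ (C k q′)) (≤-reflexive (sym (blocks k i q′ (<⇒≤ k<)))))))
      ... | i , q′ , refl , inj₂ (refl , refl) = ≤-trans (≤-reflexive (blocks (suc k) R [] k<))
          (≤-trans (+-monoˡ-≤ 0 (whole R k ≤-refl k<)) (≤-reflexive (sym (blocks k R [] (<⇒≤ k<)))))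

    lattice⁻ : T (lattice n (readingWord γ ν F)) → Lattice R n (pad n []) p
    lattice⁻ t k i k< i< = ≤-trans (≤-reflexive (cong (_+ sumTo (suc i) (mult p (suc k))) (part-pad n [] z≤n (suc k))))
      (≤-trans step (m≤n+m _ (part (pad n []) k)))
      where
      -- The prefix to test ends inside row i, at the boundary between entries above k + 1 and the
      -- others. Read from the right, it contains all letters k + 2 of this row and none of its
      -- letters k + 1.
      x = pattern-of γ ν f i (suc k)
      b = pattern-bounds ν⊆γ ss i (suc k)
      lowCells highCells : List Cell
      lowCells = map (i ,_) (range (part ν i) x)
      highCells = map (i ,_) (range x (part γ i))
      row≡ : rowCells γ ν i ≡ lowCells ++ highCells
      row≡ = trans (cong (map (i ,_)) (range-split (proj₁ b) (proj₂ b))) (Lₚ.map-++ (i ,_) (range (part ν i) x) _)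
      q = concatMap rl (upTo i) ++ reverse highCells
      decompose : ∃ λ r → rlCells γ ν ≡ q ++ r
      decompose = let (r , e) = concatMap-at rl id R i i< in
        reverse lowCells ++ r , trans rlCells≡ (trans e (trans (cong (λ z → concatMap rl (upTo i) ++ (z ++ r)) (trans (cong reverse row≡) (Lₚ.reverse-++ lowCells highCells)))
          (trans (cong (concatMap rl (upTo i) ++_) (Lₚ.++-assoc (reverse highCells) (reverse lowCells) r)) (sym (Lₚ.++-assoc (concatMap rl (upTo i)) (reverse highCells) _)))))
      word≡ : map f (rlCells γ ν) ≡ map f q ++ map f (proj₁ decompose)
      word≡ = trans (cong (map f) (proj₂ decompose)) (Lₚ.map-++ f q _)
      C≤ : C (suc k) q ≤ C k q
      C≤ = subst₂ (λ a b → a ≤ b) (cnt≡C (suc k) q) (cnt≡C k q) (≤ᵇ⇒≤ _ _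
        (all⁻ _ (upTo n) (all⁻ _ (prefixes (map f (rlCells γ ν))) (subst (λ w → T (lattice n w)) (readingWord≡ γ ν F) t)
          (subst (λ w → map f q ∈ prefixes w) (sym word≡) (∈-prefixes⁺ (map f q) _))) (∈ₚ.∈-upTo⁺ {i = k} (<⇒≤ k<))))
      high-suc : C (suc k) (reverse highCells) ≡ mult p (suc k) i
      high-suc = trans (N#-reverse _ highCells) (trans (sym (cong (_+ C (suc k) highCells) (N#-zero lowCells (λ c c∈ → ¬T-false (low c∈)))))
        (trans (sym (N#-++ _ lowCells highCells)) (trans (cong (C (suc k)) (sym row≡)) (trans (sym (N#-reverse _ (rowCells γ ν i))) (rowC (suc k) i k<)))))
        where
        low : ∀ {c} → c ∈ lowCells → ¬ T (f c ≡ᵇ suc (suc k))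
        low c∈ t with ∈ₚ.∈-map⁻ (i ,_) c∈
        ... | j , j∈ , refl = let (lo , hi) = ∈-range⁻ (part ν i) x j∈ in
          <-irrefl refl (≤-trans (≤-reflexive (sym (≡ᵇ⇒≡ (f (i , j)) (suc (suc k)) t))) (pattern-≤⁻ ν⊆γ ss (suc k) (lo , <-≤-trans hi (proj₂ b)) hi))
      high-k : C k (reverse highCells) ≡ 0
      high-k = trans (N#-reverse _ highCells) (N#-zero highCells (λ c c∈ → ¬T-false (high c∈)))
        where
        high : ∀ {c} → c ∈ highCells → ¬ T (f c ≡ᵇ suc k)
        high c∈ t with ∈ₚ.∈-map⁻ (i ,_) c∈
        ... | j , j∈ , refl = let (lo , hi) = ∈-range⁻ x (part γ i) j∈ in
          <⇒≱ (pattern-≤⁺ ν⊆γ ss (suc k) (≤-trans (proj₁ b) lo , hi) (≤-reflexive (≡ᵇ⇒≡ (f (i , j)) (suc k) t))) lo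
      step : sumTo (suc i) (mult p (suc k)) ≤ sumTo i (mult p k)
      step = ≤-trans (≤-reflexive (sym (trans (blocks (suc k) i (reverse highCells) k<) (cong (sumTo i (mult p (suc k)) +_) high-suc))))
        (≤-trans C≤ (≤-reflexive (trans (blocks k i (reverse highCells) (<⇒≤ k<)) (trans (cong (sumTo i (mult p k) +_) high-k) (+-identityʳ _)))))

  LR≡L# : ∀ R γ ν μ → length γ ≤ R → Dominant γ → Dominant ν →
    pos (LR γ ν μ) ≡ L# R (length μ) γ ν (pad (length μ) []) (pad (length μ) μ)
  LR≡L# R γ ν μ γ≤ γd νd = trans (∑-length (filterᵇ latt (ssyt γ ν μ))) (trans (∑-filter (λ F → T? (latt F)) (ssyt γ ν μ) (λ _ → 1ℤ))
    (trans (∑-ssyt R γ ν μ γ≤ γd νd _ (λ T → [ Lattice? R n (pad n []) (get T) ]ᵈ * 1ℤ)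
        (λ F y → cong (_* 1ℤ) ([⇔] (T? (latt F)) (Lattice? R n (pad n []) (get (to-table R γ ν μ γ≤ γd νd F))) (lattice⁻ R γ ν μ γ≤ γd νd y) (lattice⁺ R γ ν μ γ≤ γd νd y))))
    (trans (sym (∑-filter (λ T → Lattice? R n (pad n []) (get T)) (elems W) (λ _ → 1ℤ)))
      (∑-same (filterE W (λ T → Lattice? R n (pad n []) (get T))) (latticeE R n γ ν (pad n []) (pad n μ))
        (λ T ((a , e) , l) → (a , l) , trans (same T) (trans e (sym (applyUpTo-part μ))))
        (λ T ((a , l) , e) → (a , trans (sym (same T)) (trans e (applyUpTo-part μ))) , l) (λ _ → 1ℤ)))))
    where
    n = length μ
    latt : Filling → Bool
    latt F = lattice n (readingWord γ ν F)
    W = weightE R γ ν μ γ≤ γd νd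
    same : ∀ T → plus (pad n []) (wt R n (get T)) ≡ wt R n (get T)
    same T = part-ext (length-plus (pad n []) _ (trans (length-pad n []) (sym (length-wt R n (get T)))))
      (λ k _ → trans (part-plus (pad n []) (wt R n (get T)) k (trans (length-pad n []) (sym (length-wt R n (get T))))) (cong (_+ part (wt R n (get T)) k) (part-pad n [] z≤n k)))

open LittlewoodRichardson

-- Positions in the reverse lexicographic filling

module ReverseLexicographic where

  nth : List Cell → ℕ → Cell
  nth []       k       = (0 , 0)
  nth (c ∷ cs) zero    = c
  nth (c ∷ cs) (suc k) = nth cs k

  -- One unfolding of `go` at an index of at least 2, with f in the place of the recursive call.
  peel : (List Cell → Cell) → List Cell → Cell
  peel f []       = (0 , 0)
  peel f (c ∷ cs) = f cs

  -- As for entryAt′: the local function go of rlPos, obtained by solving an equation.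
  mutual
    go′ : List ℕ → List ℕ → ℕ → ℕ → List Cell → Cell
    go′ α β k₀ k cs = _

    go′-spec : ∀ α β k → rlPos α β (suc (suc k)) ≡ peel (go′ α β (suc (suc k)) (suc k)) (rlCells α β)
    go′-spec α β k with rlCells α β
    ... | []     = refl
    ... | c ∷ cs with suc (suc k)
    ...   | k₀ with suc k
    ...     | k′ = refl

  go′≡nth : ∀ α β k₀ k cs → go′ α β k₀ (suc k) cs ≡ nth cs k
  go′≡nth α β k₀ k       []       = refl
  go′≡nth α β k₀ zero    (c ∷ cs) = refl
  go′≡nth α β k₀ (suc k) (c ∷ cs) = go′≡nth α β k₀ k cs

  rlPos≡nth : ∀ α β k → rlPos α β (suc k) ≡ nth (rlCells α β) k
  rlPos≡nth α β k = go′≡nth α β (suc k) k (rlCells α β)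

  nth-++ˡ : ∀ xs ys k → k < length xs → nth (xs ++ ys) k ≡ nth xs k
  nth-++ˡ (x ∷ xs) ys zero    _        = refl
  nth-++ˡ (x ∷ xs) ys (suc k) (s≤s k<) = nth-++ˡ xs ys k k<

  nth-++ʳ : ∀ xs ys k → nth (xs ++ ys) (length xs + k) ≡ nth ys k
  nth-++ʳ []       ys k = refl
  nth-++ʳ (x ∷ xs) ys k = nth-++ʳ xs ys k

  nth-concatMap : ∀ (g : ℕ → List Cell) (h : ℕ → ℕ) ℓ r x → r < ℓ → x < length (g (h r)) →
    nth (concatMap g (applyUpTo h ℓ)) (sumTo r (λ i → length (g (h i))) + x) ≡ nth (g (h r)) x
  nth-concatMap g h (suc ℓ) zero    x _        x< = nth-++ˡ (g (h 0)) _ x x<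
  nth-concatMap g h (suc ℓ) (suc r) x (s≤s r<) x< =
    trans (cong (nth (concatMap g (applyUpTo h (suc ℓ)))) (trans (cong (_+ x) (sumTo-first r (λ i → length (g (h i))))) (+-assoc (length (g (h 0))) _ x)))
    (trans (nth-++ʳ (g (h 0)) _ _) (nth-concatMap g (h ∘ suc) ℓ r x r< x<))

  nth-reverse-applyUpTo : ∀ (f : ℕ → Cell) m x → x < m → nth (reverse (applyUpTo f m)) x ≡ f (m ∸ suc x)
  nth-reverse-applyUpTo f (suc m) x x< = trans (cong (λ l → nth l x) unfold) (at x x<)
    where
    unfold : reverse (applyUpTo f (suc m)) ≡ f m ∷ reverse (applyUpTo f m)
    unfold = trans (cong reverse (sym (Lₚ.applyUpTo-∷ʳ f m))) (Lₚ.reverse-++ (applyUpTo f m) (f m ∷ []))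
    at : ∀ x → x < suc m → nth (f m ∷ reverse (applyUpTo f m)) x ≡ f (suc m ∸ suc x)
    at zero    _        = refl
    at (suc x) (s≤s x<) = nth-reverse-applyUpTo f m x x<

  N#-true : {A : Set} (xs : List A) → length xs ≡ N# (λ _ → true) xs
  N#-true []       = refl
  N#-true (x ∷ xs) = cong suc (N#-true xs)

  length-rowCells : ∀ α β i → length (rowCells α β i) ≡ part α i ∸ part β i
  length-rowCells α β i = trans (Lₚ.length-map (i ,_) (range (part β i) (part α i))) (Lₚ.length-applyUpTo _ (part α i ∸ part β i))

  length-skewCells : ∀ α β R → length α ≤ R → length (skewCells α β) ≡ sumTo R (λ i → part α i ∸ part β i)
  length-skewCells α β R α≤ = trans (N#-true (skewCells α β)) (trans (N#-skewCells α β (λ _ → true) R α≤)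
    (sumTo-cong R (λ i _ → sumTo-bits-full (part α i ∸ part β i) (λ _ → true) (λ _ _ → tt))))

  N#-none : {A : Set} {P : A → Bool} (xs : List A) → N# P xs ≡ 0 → ∀ {y} → y ∈ xs → ¬ T (P y)
  N#-none {P = P} (z ∷ xs) e (here refl) py = 1+n≢0 (trans (sym (cong (λ b → bit b + N# P xs) (T-true py))) e)
  N#-none {P = P} (z ∷ xs) e (there y∈)  py = N#-none xs (m+n≡0⇒n≡0 (bit (P z)) e) y∈ py

  N#-unique : {A : Set} {P : A → Bool} (xs : List A) → N# P xs ≡ 1 → ∀ {x y} → x ∈ xs → y ∈ xs → T (P x) → T (P y) → x ≡ y
  N#-unique {P = P} (z ∷ xs) e x∈ y∈ px py = go (P z) refl x∈ y∈
    where
    rest : ∀ b → P z ≡ b → N# P xs ≡ 1 ∸ bit b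
    rest b ez = trans (sym (m+n∸m≡n (bit b) (N# P xs))) (cong (_∸ bit b) (trans (cong (λ b → bit b + N# P xs) (sym ez)) e))
    go : ∀ b → P z ≡ b → _ ∈ z ∷ xs → _ ∈ z ∷ xs → _ ≡ _
    go _     ez (here refl) (here refl) = refl
    go true  ez (here refl) (there y∈)  = ⊥-elim (N#-none xs (rest true ez) y∈ py)
    go true  ez (there x∈)  _           = ⊥-elim (N#-none xs (rest true ez) x∈ px)
    go false ez (here refl) _           = ⊥-elim (subst T ez px)
    go false ez (there x∈)  (here refl) = ⊥-elim (subst T ez py)
    go false ez (there x∈)  (there y∈)  = N#-unique xs (rest false ez) x∈ y∈ px py

  N#-exists : {A : Set} {P : A → Bool} (xs : List A) → N# P xs ≢ 0 → ∃ λ x → x ∈ xs × T (P x)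
  N#-exists []       e = ⊥-elim (e refl)
  N#-exists {P = P} (z ∷ xs) e with P z in ez
  ... | true  = z , here refl , true-T ez
  ... | false = let (x , x∈ , px) = N#-exists xs e in x , there x∈ , px

  N#-one : {A : Set} {P : A → Bool} (xs : List A) → Unique xs → ∀ {x} → x ∈ xs → T (P x) → (∀ y → y ∈ xs → T (P y) → y ≡ x) → N# P xs ≡ 1
  N#-one {P = P} (z ∷ xs) (p ∷ u) (here refl) px h = cong₂ (λ b m → bit b + m) (T-true px)
    (N#-zero xs (λ y y∈ → ¬T-false (λ py → All.lookup p y∈ (sym (h y (there y∈) py)))))
  N#-one {P = P} (z ∷ xs) (p ∷ u) (there x∈) px h = cong₂ (λ b m → bit b + m) (¬T-false (λ pz → All.lookup p x∈ (h z (here refl) pz)))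
    (N#-one xs u x∈ px (λ y y∈ → h y (there y∈)))

  posOf-fill : ∀ {t : Cell → ℕ} {k} cs {c} → c ∈ cs → t c ≡ k → (∀ d → d ∈ cs → t d ≡ k → d ≡ c) → posOf k (fill t cs) ≡ c
  posOf-fill {t} {k} (d ∷ cs) {c} c∈ e h with t d ≟ k
  ... | yes q = trans (if-true (T-true (≡⇒≡ᵇ (t d) k q))) (h d (here refl) q)
  ... | no ¬q = trans (if-false (¬T-false (¬q ∘ ≡ᵇ⇒≡ (t d) k))) (later c∈)
    where
    later : c ∈ d ∷ cs → posOf k (fill t cs) ≡ c
    later (here refl) = ⊥-elim (¬q e)
    later (there c∈)  = posOf-fill cs c∈ e (λ d d∈ → h d (there d∈))

  module Labels (α β : List ℕ) where

    ℓ : ℕ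
    ℓ = length α

    rowLen : ℕ → ℕ
    rowLen r = part α r ∸ part β r

    offset : ℕ → ℕ
    offset r = sumTo r rowLen

    -- The entry of rl(α/β) in the box of row r with x boxes to its right.
    enc : ℕ → ℕ → ℕ
    enc r x = suc (offset r + x)

    enc-< : ∀ {r r′ x x′} → r < r′ → x < rowLen r → enc r x < enc r′ x′
    enc-< {r} {r′} {x} {x′} r< x< = s≤s (<-≤-trans (+-monoʳ-< (offset r) x<) (≤-trans (sumTo-≤ rowLen r<) (m≤m+n (offset r′) x′)))

    enc-<⁻ : ∀ {r r′ x x′} → x′ < rowLen r′ → enc r x < enc r′ x′ → r < r′ ⊎ (r ≡ r′ × x < x′)
    enc-<⁻ {r} {r′} {x} {x′} x′< e< with <-cmp r r′
    ... | tri< r< _ _    = inj₁ r<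
    ... | tri≈ _ refl _  = inj₂ (refl , +-cancelˡ-< (offset r) x x′ (≤-pred e<))
    ... | tri> _ _ r′<r  = ⊥-elim (<-asym e< (enc-< r′<r x′<))

    enc-injective : ∀ {r r′ x x′} → x < rowLen r → x′ < rowLen r′ → enc r x ≡ enc r′ x′ → r ≡ r′ × x ≡ x′
    enc-injective {r} {r′} {x} {x′} x< x′< e with <-cmp r r′
    ... | tri< r< _ _   = ⊥-elim (<-irrefl e (enc-< r< x<))
    ... | tri≈ _ refl _ = refl , +-cancelˡ-≡ (offset r) x x′ (suc-injective e)
    ... | tri> _ _ r′<r = ⊥-elim (<-irrefl (sym e) (enc-< r′<r x′<))

    enc-≤ : ∀ {r x} → r < ℓ → x < rowLen r → enc r x ≤ offset ℓ
    enc-≤ {r} r< x< = ≤-trans (+-monoʳ-< (offset r) x<) (sumTo-≤ rowLen r<)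

    decode : ∀ {v} → 1 ≤ v → v ≤ offset ℓ → ∃ λ r → ∃ λ x → r < ℓ × x < rowLen r × v ≡ enc r x
    decode {suc v} _ v≤ = go ℓ v≤
      where
      go : ∀ m → v < offset m → ∃ λ r → ∃ λ x → r < m × x < rowLen r × suc v ≡ enc r x
      go (suc m) v< with v <? offset m
      ... | yes p = let (r , x , r< , x< , e) = go m p in r , x , m<n⇒m<1+n r< , x< , e
      ... | no ¬p = m , v ∸ offset m , ≤-refl ,
        +-cancelˡ-< (offset m) _ _ (subst (_< offset m + rowLen m) (sym (m+[n∸m]≡n (≮⇒≥ ¬p))) v<) ,
        cong suc (sym (m+[n∸m]≡n (≮⇒≥ ¬p)))

    size-offset : length (skewCells α β) ≡ offset ℓ
    size-offset = length-skewCells α β ℓ ≤-refl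

    rlPos-enc : ∀ {r x} → r < ℓ → x < rowLen r → rlPos α β (enc r x) ≡ (r , part β r + (rowLen r ∸ suc x))
    rlPos-enc {r} {x} r< x< = trans (rlPos≡nth α β (offset r + x)) (trans
      (cong (λ m → nth (rlCells α β) (m + x)) (sumTo-cong r (λ i _ → sym (length-rl i))))
      (trans (nth-concatMap (λ i → reverse (rowCells α β i)) id ℓ r x r< (subst (x <_) (sym (length-rl r)) x<))
      (trans (cong (λ l → nth (reverse l) x) (Lₚ.map-applyUpTo (part β r +_) (r ,_) (rowLen r))) (nth-reverse-applyUpTo _ (rowLen r) x x<))))
      where
      length-rl : ∀ i → length (reverse (rowCells α β i)) ≡ rowLen i
      length-rl i = trans (Lₚ.length-reverse (rowCells α β i)) (length-rowCells α β i)

open ReverseLexicographic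

-- Remmel-Whitney tableaux as functions on boxes

module RemmelWhitney where

  module RWFillings (α β γ δ : List ℕ) (same-size : length (skewCells γ δ) ≡ length (skewCells α β))
                    (β⊆α : ∀ i → part β i ≤ part α i) (δ⊆γ : ∀ i → part δ i ≤ part γ i) where
    open Labels α β public

    cs : List Cell
    cs = skewCells γ δ

    In : Cell → Set
    In = InShape γ δ

    IsRW : Filling → Set
    IsRW F = T ((length (skewCells γ δ) ≡ᵇ length (skewCells α β)) ∧ contained β α) ×
      ((T (contained δ γ) × (FillingOf cs (range 1 (suc (length cs))) F ×
        T (rowColOK true F ∧ all (λ v → count v F ≡ᵇ 1) (range 1 (suc (length cs)))))) × T (rwCond α β F))

    rwE : Enum IsRW
    rwE = ifE _ (filterᵇE (ifE (contained δ γ) (filterᵇE (fillingsE cs (range 1 (suc (length cs))) (Unique-range 1 (suc (length cs)))) _)) (rwCond α β))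

    -- Entries are named by their place in rl(α/β). The box of row r with x boxes to its right is in
    -- column α_r - 1 - x, so the equation in `cond-ii` says that the two boxes are in one column.
    record RWFilling (t : Cell → ℕ) : Set where
      field
        lower  : ∀ {c} → In c → 1 ≤ t c
        upper  : ∀ {c} → In c → t c ≤ offset ℓ
        rows   : ∀ {i j} → In (i , j) → In (i , suc j) → t (i , j) < t (i , suc j)
        cols   : ∀ {i j} → In (i , j) → In (suc i , j) → t (i , j) < t (suc i , j)
        once   : ∀ v → 1 ≤ v → v ≤ offset ℓ → N# (λ c → t c ≡ᵇ v) cs ≡ 1
        cond-i  : ∀ {r x c d} → r < ℓ → suc x < rowLen r → In c → In d → t c ≡ enc r x → t d ≡ enc r (suc x) →
          proj₂ c < proj₂ d × proj₁ d ≤ proj₁ c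
        cond-ii : ∀ {r x x′ c d} → suc r < ℓ → x < rowLen r → x′ < rowLen (suc r) → x′ + part α r ≡ x + part α (suc r) →
          In c → In d → t c ≡ enc r x → t d ≡ enc (suc r) x′ → proj₁ c < proj₁ d × proj₂ d ≤ proj₂ c

    private
      n≡ : length cs ≡ offset ℓ
      n≡ = trans same-size size-offset

      once⇒unique : ∀ {t : Cell → ℕ} {v c d} → N# (λ c → t c ≡ᵇ v) cs ≡ 1 → In c → In d → t c ≡ v → t d ≡ v → c ≡ d
      once⇒unique {t} {v} {c} {d} o ic id e e′ = N#-unique cs o (∈-skewCells⁺ γ δ ic) (∈-skewCells⁺ γ δ id) (≡⇒≡ᵇ (t c) v e) (≡⇒≡ᵇ (t d) v e′)

      posOf-at : ∀ {t : Cell → ℕ} {v c} → N# (λ c → t c ≡ᵇ v) cs ≡ 1 → In c → t c ≡ v → posOf v (fill t cs) ≡ c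
      posOf-at {t} {v} o ic e = posOf-fill cs (∈-skewCells⁺ γ δ ic) e (λ d d∈ e′ → once⇒unique {t} o (∈-skewCells⁻ γ δ d∈) ic e′ e)

      col-+ : ∀ {r x} → x < rowLen r → part β r + (rowLen r ∸ suc x) + suc x ≡ part α r
      col-+ {r} {x} x< = trans (+-assoc (part β r) _ (suc x)) (trans (cong (part β r +_) (m∸n+n≡m x<)) (m+[n∸m]≡n (β⊆α r)))

      enc-suc : ∀ r x → enc r (suc x) ≡ suc (enc r x)
      enc-suc r x = cong suc (+-suc (offset r) x)

    RW⇒filling : ∀ {F} → IsRW F → RWFilling (val F)
    RW⇒filling {F} (_ , ((_ , (ff , st)) , rw)) = record
      { lower = λ i → proj₁ (bounds i)
      ; upper = λ i → ≤-trans (≤-pred (proj₂ (bounds i))) (≤-reflexive n≡)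
      ; rows  = λ i i′ → <ᵇ⇒< _ _ (rowColOK-row true F ok (∈-filling {γ} {δ} ff i) (∈-filling {γ} {δ} ff i′))
      ; cols  = λ i i′ → rowColOK-col true F ok (∈-filling {γ} {δ} ff i) (∈-filling {γ} {δ} ff i′)
      ; once  = once
      ; cond-i = cond-i
      ; cond-ii = cond-ii
      }
      where
      t = val F
      F≡ : F ≡ fill t cs
      F≡ = filling-is-fill {γ} {δ} ff
      ok : T (rowColOK true F)
      ok = proj₁ (T∧⁻ st)
      bounds : ∀ {c} → In c → 1 ≤ t c × t c < suc (length cs)
      bounds i = ∈-range⁻ 1 (suc (length cs)) (All.lookup (proj₂ ff) (∈-filling {γ} {δ} ff i))
      once : ∀ v → 1 ≤ v → v ≤ offset ℓ → N# (λ c → t c ≡ᵇ v) cs ≡ 1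
      once v 1≤ v≤ = trans (sym (count-fill v t cs)) (trans (cong (count v) (sym F≡)) (≡ᵇ⇒≡ _ 1
        (all⁻ _ (range 1 (suc (length cs))) (proj₂ (T∧⁻ {rowColOK true F} st)) (∈-range⁺ 1 _ 1≤ (s≤s (≤-trans v≤ (≤-reflexive (sym n≡))))))))
      pos-at : ∀ {r x c} → r < ℓ → x < rowLen r → In c → t c ≡ enc r x → posOf (enc r x) F ≡ c
      pos-at r< x< i e = trans (cong (posOf _) F≡) (posOf-at {t} (once _ (s≤s z≤n) (enc-≤ r< x<)) i e)
      label∈ : ∀ {r x} → r < ℓ → x < rowLen r → enc r x ∈ range 1 (suc (length (skewCells α β)))
      label∈ r< x< = ∈-range⁺ 1 _ (s≤s z≤n) (s≤s (≤-trans (enc-≤ r< x<) (≤-reflexive (sym size-offset))))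
      cond-i : ∀ {r x c d} → r < ℓ → suc x < rowLen r → In c → In d → t c ≡ enc r x → t d ≡ enc r (suc x) → proj₂ c < proj₂ d × proj₁ d ≤ proj₁ c
      cond-i {r} {x} {c} {d} r< x< ic id e e′ =
        let (p , q) = T∧⁻ (T-if⁻ (all⁻ _ (range 1 (length (skewCells α β))) (proj₁ (T∧⁻ rw))
                        (∈-range⁺ 1 _ (s≤s z≤n) (≤-trans (≤-reflexive (sym (enc-suc r x))) (≤-trans (enc-≤ r< x<) (≤-reflexive (sym size-offset))))))
                      (≡⇒≡ᵇ _ _ (trans (cong proj₁ (rlPos-enc r< x<′)) (sym (trans (cong (λ v → proj₁ (rlPos α β v)) (sym (enc-suc r x))) (cong proj₁ (rlPos-enc r< x<)))))))
        in subst₂ _<_ (cong proj₂ pc) (cong proj₂ pd) (<ᵇ⇒< (proj₂ (posOf (enc r x) F)) _ p) ,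
           subst₂ _≤_ (cong proj₁ pd) (cong proj₁ pc) (≤ᵇ⇒≤ (proj₁ (posOf (suc (enc r x)) F)) _ q)
        where
        x<′ = <⇒≤ x<
        pc : posOf (enc r x) F ≡ c
        pc = pos-at r< x<′ ic e
        pd : posOf (suc (enc r x)) F ≡ d
        pd = trans (cong (λ v → posOf v F) (sym (enc-suc r x))) (pos-at r< x< id e′)
      cond-ii : ∀ {r x x′ c d} → suc r < ℓ → x < rowLen r → x′ < rowLen (suc r) → x′ + part α r ≡ x + part α (suc r) →
        In c → In d → t c ≡ enc r x → t d ≡ enc (suc r) x′ → proj₁ c < proj₁ d × proj₂ d ≤ proj₂ c
      cond-ii {r} {x} {x′} {c} {d} r< x< x′< col≡ ic id e e′ =
        let (p , q) = T∧⁻ (T-if⁻ (all⁻ _ _ (all⁻ _ _ (proj₂ (T∧⁻ {all _ (range 1 (length (skewCells α β)))} rw)) (label∈ r<′ x<)) (label∈ r< x′<))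
                      (T∧⁺ (≡⇒≡ᵇ _ _ (trans (cong proj₂ (rlPos-enc r<′ x<)) (trans same-col (sym (cong proj₂ (rlPos-enc r< x′<))))))
                           (≡⇒≡ᵇ _ _ (trans (cong proj₁ (rlPos-enc r< x′<)) (cong suc (sym (cong proj₁ (rlPos-enc r<′ x<))))))))
        in subst₂ _<_ (cong proj₁ pc) (cong proj₁ pd) (<ᵇ⇒< (proj₁ (posOf (enc r x) F)) _ p) ,
           subst₂ _≤_ (cong proj₂ pd) (cong proj₂ pc) (≤ᵇ⇒≤ (proj₂ (posOf (enc (suc r) x′) F)) _ q)
        where
        r<′ = <⇒≤ r<
        pc : posOf (enc r x) F ≡ c
        pc = pos-at r<′ x< ic e
        pd : posOf (enc (suc r) x′) F ≡ d
        pd = pos-at r< x′< id e′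
        same-col : part β r + (rowLen r ∸ suc x) ≡ part β (suc r) + (rowLen (suc r) ∸ suc x′)
        same-col = lem _ _ x x′ (part α r) (part α (suc r)) (col-+ x<) (col-+ x′<) col≡
          where
          lem : ∀ k k′ x x′ a a′ → k + suc x ≡ a → k′ + suc x′ ≡ a′ → x′ + a ≡ x + a′ → k ≡ k′
          lem k k′ x x′ a a′ refl refl h = eqlin h (ℕ-solver.solve (k L.∷ k′ L.∷ x L.∷ x′ L.∷ L.[]))

    filling⇒RW : ∀ {t} → RWFilling t → IsRW (fill t cs)
    filling⇒RW {t} f = T∧⁺ (≡⇒≡ᵇ _ _ same-size) (contained⁺ β α β⊆α) ,
      ((contained⁺ δ γ δ⊆γ , ((map-proj₁-fill t cs , Allₚ.map⁺ (All.tabulate (λ c∈ → let i = ∈-skewCells⁻ γ δ c∈ in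
          ∈-range⁺ 1 _ (lower i) (s≤s (≤-trans (upper i) (≤-reflexive (sym n≡))))))) ,
        T∧⁺ (rowColOK⁺ true (fill t cs)
          (λ e∈ e∈′ → let (s , e) = ∈-fill⁻ {t} {γ} {δ} e∈ ; (s′ , e′) = ∈-fill⁻ {t} {γ} {δ} e∈′ in <⇒<ᵇ (subst₂ _<_ (sym e) (sym e′) (rows s s′)))
          (λ e∈ e∈′ → let (s , e) = ∈-fill⁻ {t} {γ} {δ} e∈ ; (s′ , e′) = ∈-fill⁻ {t} {γ} {δ} e∈′ in subst₂ _<_ (sym e) (sym e′) (cols s s′)))
          (all⁺ _ (range 1 (suc (length cs))) (λ v v∈ → let (1≤ , v≤) = ∈-range⁻ 1 _ v∈ in
            ≡⇒≡ᵇ _ 1 (trans (count-fill v t cs) (once v 1≤ (≤-trans (≤-pred v≤) (≤-reflexive n≡)))))))) ,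
       T∧⁺ (all⁺ _ (range 1 (length (skewCells α β))) (λ v v∈ → let (1≤ , v<) = ∈-range⁻ 1 _ v∈ in
              check-i v 1≤ (≤-trans v< (≤-reflexive size-offset))))
           (all⁺ _ (range 1 (suc (length (skewCells α β)))) (λ v v∈ → all⁺ _ (range 1 (suc (length (skewCells α β)))) (λ w w∈ →
              let (1≤v , v≤) = ∈-range⁻ 1 _ v∈ ; (1≤w , w≤) = ∈-range⁻ 1 _ w∈ in
              check-ii v w 1≤v (≤-trans (≤-pred v≤) (≤-reflexive size-offset)) 1≤w (≤-trans (≤-pred w≤) (≤-reflexive size-offset))))))
      where
      open RWFilling f
      cell : ∀ {v} → 1 ≤ v → v ≤ offset ℓ → ∃ λ c → In c × t c ≡ v × posOf v (fill t cs) ≡ c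
      cell {v} 1≤ v≤ = let o = once v 1≤ v≤ ; (c , c∈ , e) = N#-exists {P = λ c → t c ≡ᵇ v} cs (λ z → 1+n≢0 (trans (sym o) z)) in
        c , ∈-skewCells⁻ γ δ c∈ , ≡ᵇ⇒≡ (t c) v e , posOf-at {t} o (∈-skewCells⁻ γ δ c∈) (≡ᵇ⇒≡ (t c) v e)
      P : ℕ → Cell
      P v = posOf v (fill t cs)
      check-i : ∀ v → 1 ≤ v → suc v ≤ offset ℓ → T (if proj₁ (rlPos α β v) ≡ᵇ proj₁ (rlPos α β (suc v)) then (proj₂ (P v) <ᵇ proj₂ (P (suc v))) ∧ (proj₁ (P (suc v)) ≤ᵇ proj₁ (P v)) else true)
      check-i v 1≤ v≤ = T-if⁺ (λ same-row → go (decode 1≤ (<⇒≤ v≤)) (decode (s≤s z≤n) v≤) (≡ᵇ⇒≡ _ _ same-row))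
        where
        go : (∃ λ r → ∃ λ x → r < ℓ × x < rowLen r × v ≡ enc r x) → (∃ λ r → ∃ λ x → r < ℓ × x < rowLen r × suc v ≡ enc r x) →
          proj₁ (rlPos α β v) ≡ proj₁ (rlPos α β (suc v)) → T ((proj₂ (P v) <ᵇ proj₂ (P (suc v))) ∧ (proj₁ (P (suc v)) ≤ᵇ proj₁ (P v)))
        go (r , x , r< , x< , e) (r′ , x′ , r′< , x′< , e′) q =
          let (c , ic , tc , pc) = cell 1≤ (<⇒≤ v≤) ; (d , id , td , pd) = cell (s≤s z≤n) v≤ ; (p , q) = cond-i r< sx< ic id (trans tc e) (trans td e″) in
          T∧⁺ (<⇒<ᵇ (subst₂ _<_ (cong proj₂ (sym pc)) (cong proj₂ (sym pd)) p)) (≤⇒≤ᵇ (subst₂ _≤_ (cong proj₁ (sym pd)) (cong proj₁ (sym pc)) q))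
          where
          r≡ : r ≡ r′
          r≡ = trans (sym (trans (cong (λ v → proj₁ (rlPos α β v)) e) (cong proj₁ (rlPos-enc r< x<)))) (trans q (trans (cong (λ v → proj₁ (rlPos α β v)) e′) (cong proj₁ (rlPos-enc r′< x′<))))
          e″ : suc v ≡ enc r (suc x)
          e″ = trans (cong suc e) (sym (enc-suc r x))
          x≡ : suc x ≡ x′
          x≡ = +-cancelˡ-≡ (offset r) (suc x) x′ (suc-injective (trans (sym e″) (trans e′ (cong (λ r → enc r x′) (sym r≡)))))
          sx< : suc x < rowLen r
          sx< = subst₂ (λ y r → y < rowLen r) (sym x≡) (sym r≡) x′<
      check-ii : ∀ v w → 1 ≤ v → v ≤ offset ℓ → 1 ≤ w → w ≤ offset ℓ →
        T (if (proj₂ (rlPos α β v) ≡ᵇ proj₂ (rlPos α β w)) ∧ (proj₁ (rlPos α β w) ≡ᵇ suc (proj₁ (rlPos α β v)))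
           then (proj₁ (P v) <ᵇ proj₁ (P w)) ∧ (proj₂ (P w) ≤ᵇ proj₂ (P v)) else true)
      check-ii v w 1≤v v≤ 1≤w w≤ = T-if⁺ (λ h → let (p , q) = T∧⁻ h in go (decode 1≤v v≤) (decode 1≤w w≤) (≡ᵇ⇒≡ _ _ p) (≡ᵇ⇒≡ _ _ q))
        where
        go : (∃ λ r → ∃ λ x → r < ℓ × x < rowLen r × v ≡ enc r x) → (∃ λ r → ∃ λ x → r < ℓ × x < rowLen r × w ≡ enc r x) →
          proj₂ (rlPos α β v) ≡ proj₂ (rlPos α β w) → proj₁ (rlPos α β w) ≡ suc (proj₁ (rlPos α β v)) →
          T ((proj₁ (P v) <ᵇ proj₁ (P w)) ∧ (proj₂ (P w) ≤ᵇ proj₂ (P v)))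
        go (r , x , r< , x< , e) (r′ , x′ , r′< , x′< , e′) qc qr =
          let (c , ic , tc , pc) = cell 1≤v v≤ ; (d , id , td , pd) = cell 1≤w w≤
              (p , q) = cond-ii (subst (_< ℓ) r≡ r′<) x< (subst (λ r → x′ < rowLen r) r≡ x′<) col≡ ic id (trans tc e) (trans td (trans e′ (cong (λ r → enc r x′) r≡))) in
          T∧⁺ (<⇒<ᵇ (subst₂ _<_ (cong proj₁ (sym pc)) (cong proj₁ (sym pd)) p)) (≤⇒≤ᵇ (subst₂ _≤_ (cong proj₂ (sym pd)) (cong proj₂ (sym pc)) q))
          where
          at-v : rlPos α β v ≡ (r , part β r + (rowLen r ∸ suc x))
          at-v = trans (cong (rlPos α β) e) (rlPos-enc r< x<)
          at-w : rlPos α β w ≡ (r′ , part β r′ + (rowLen r′ ∸ suc x′))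
          at-w = trans (cong (rlPos α β) e′) (rlPos-enc r′< x′<)
          r≡ : r′ ≡ suc r
          r≡ = trans (sym (cong proj₁ at-w)) (trans qr (cong suc (cong proj₁ at-v)))
          col≡ : x′ + part α r ≡ x + part α (suc r)
          col≡ = lem _ _ x x′ (part α r) (part α (suc r)) (col-+ x<) (trans (col-+ x′<) (cong (part α) r≡)) (trans (sym (cong proj₂ at-v)) (trans qc (cong proj₂ at-w)))
            where
            lem : ∀ k k′ x x′ a a′ → k + suc x ≡ a → k′ + suc x′ ≡ a′ → k ≡ k′ → x′ + a ≡ x + a′
            lem k k′ x x′ a a′ refl refl refl = ℕ-solver.solve (k L.∷ x L.∷ x′ L.∷ L.[])

open RemmelWhitney

-- The bijection between Remmel-Whitney tableaux and lattice tableaux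

module Pictures where

  tailTo-anti : ∀ R f {i j} → i ≤ j → tailTo R f j ≤ tailTo R f i
  tailTo-anti R f {i} {zero}  z≤n = ≤-refl
  tailTo-anti R f {i} {suc j} i≤ with m≤n⇒m<n∨m≡n i≤
  ... | inj₂ refl    = ≤-refl
  ... | inj₁ (s≤s q) with j <? R
  ...   | yes j< = ≤-trans (≤-trans (m≤n+m _ (f j)) (≤-reflexive (sym (tailTo-step R f j j<)))) (tailTo-anti R f q)
  ...   | no j≮  = ≤-trans (≤-reflexive (tailTo-end R f (suc j) (≤-trans (≮⇒≥ j≮) (n≤1+n j)))) z≤n

  tailTo≡sumTo : ∀ R f → tailTo R f 0 ≡ sumTo R f
  tailTo≡sumTo R f = sumTo+tailTo R f 0 z≤n

  tailTo-locate : ∀ R f x → x < tailTo R f 0 → ∃ λ j → j < R × tailTo R f (suc j) ≤ x × x < tailTo R f j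
  tailTo-locate R f x x< = go R 0 refl x<
    where
    go : ∀ d j → j + d ≡ R → x < tailTo R f j → ∃ λ j → j < R × tailTo R f (suc j) ≤ x × x < tailTo R f j
    go zero    j e x< = ⊥-elim (n≮0 (subst (x <_) (tailTo-end R f j (≤-reflexive (sym (trans (sym (+-identityʳ j)) e)))) x<))
    go (suc d) j e x< with tailTo R f (suc j) ≤? x
    ... | yes p = j , ≤-trans (m≤m+n (suc j) d) (≤-reflexive (trans (sym (+-suc j d)) e)) , p , x<
    ... | no ¬p = go d (suc j) (trans (sym (+-suc j d)) e) (≰⇒> ¬p)

  sumTo-interval : ∀ m (Q : ℕ → Bool) a b → a ≤ b → b ≤ m → (∀ i → i < m → T (Q i) → a ≤ i × i < b) → (∀ i → a ≤ i → i < b → T (Q i)) →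
    sumTo m (λ i → bit (Q i)) ≡ b ∸ a
  sumTo-interval zero    Q a b a≤b z≤n f h = sym (0∸n≡0 a)
  sumTo-interval (suc m) Q a b a≤b b≤m f h with m≤n⇒m<n∨m≡n b≤m
  ... | inj₁ b< = trans (cong₂ _+_ (sumTo-interval m Q a b a≤b (≤-pred b<) (λ i i< → f i (m<n⇒m<1+n i<)) h)
      (cong bit (¬T-false (λ q → <⇒≱ (proj₂ (f m ≤-refl q)) (≤-pred b<))))) (+-identityʳ _)
  ... | inj₂ refl with a ≟ suc m
  ...   | yes refl = trans (sumTo-zero (suc m) (λ i i< → cong bit (¬T-false (λ q → <⇒≱ i< (proj₁ (f i i< q)))))) (sym (n∸n≡0 m))
  ...   | no a≢ = trans (cong₂ _+_ (sumTo-interval m Q a m a≤m ≤-refl (λ i i< q → proj₁ (f i (m<n⇒m<1+n i<) q) , i<) (λ i a≤ i< → h i a≤ (m<n⇒m<1+n i<)))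
      (cong bit (T-true (h m a≤m ≤-refl)))) (trans (+-comm (m ∸ a) 1) (sym (+-∸-assoc 1 a≤m)))
    where
    a≤m : a ≤ m
    a≤m = ≤-pred (≤∧≢⇒< a≤b a≢)

  N#-sumTo : {A : Set} {P : A → Bool} (Q : ℕ → A → Bool) (m : ℕ) (xs : List A) → (∀ x → x ∈ xs → bit (P x) ≡ sumTo m (λ i → bit (Q i x))) →
    N# P xs ≡ sumTo m (λ i → N# (Q i) xs)
  N#-sumTo Q m []       h = sym (sumTo-zero m (λ _ _ → refl))
  N#-sumTo Q m (x ∷ xs) h = trans (cong₂ _+_ (h x (here refl)) (N#-sumTo Q m xs (λ y y∈ → h y (there y∈)))) (sym (sumTo-+ m _ _))

  sumTo-ones : ∀ m {f} → (∀ i → i < m → f i ≡ 1) → sumTo m f ≡ m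
  sumTo-ones zero    h = refl
  sumTo-ones (suc m) h = trans (cong₂ _+_ (sumTo-ones m (λ i i< → h i (m<n⇒m<1+n i<))) (h m ≤-refl)) (+-comm m 1)

  module RWBijection (R : ℕ) (α β γ δ : List ℕ) (αd : Dominant α) (βd : Dominant β) (γd : Dominant γ) (δd : Dominant δ) (γ≤ : length γ ≤ R) (β≤ℓ : length β ≤ length α)
                     (same-size : length (skewCells γ δ) ≡ length (skewCells α β)) (β⊆α : ∀ i → part β i ≤ part α i) (δ⊆γ : ∀ i → part δ i ≤ part γ i) where
    open RWFillings α β γ δ same-size β⊆α δ⊆γ

    -- Destandardisation: an entry is replaced by the number, counted from 1, of its row in rl(α/β).
    strip-letter : (Cell → ℕ) → Cell → ℕ
    strip-letter t c = suc (proj₁ (rlPos α β (t c)))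

    module Forward {t : Cell → ℕ} (f : RWFilling t) where
      open RWFilling f

      L : Cell → ℕ
      L = strip-letter t

      p : ℕ → ℕ → ℕ
      p = pattern-of γ δ L

      label : ∀ {c} → In c → ∃ λ r → ∃ λ x → r < ℓ × x < rowLen r × t c ≡ enc r x × L c ≡ suc r
      label ic = let (r , x , r< , x< , e) = decode (lower ic) (upper ic) in r , x , r< , x< , e , cong suc (trans (cong (λ v → proj₁ (rlPos α β v)) e) (cong proj₁ (rlPos-enc r< x<)))

      L-enc : ∀ {c r x} → r < ℓ → x < rowLen r → t c ≡ enc r x → L c ≡ suc r
      L-enc r< x< e = cong suc (trans (cong (λ v → proj₁ (rlPos α β v)) e) (cong proj₁ (rlPos-enc r< x<)))

      cell : ∀ {r x} → r < ℓ → x < rowLen r → ∃ λ c → In c × t c ≡ enc r x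
      cell {r} {x} r< x< = let (c , c∈ , e) = N#-exists {P = λ c → t c ≡ᵇ enc r x} cs (λ z → 1+n≢0 (trans (sym (once (enc r x) (s≤s z≤n) (enc-≤ r< x<))) z)) in
        c , ∈-skewCells⁻ γ δ c∈ , ≡ᵇ⇒≡ (t c) (enc r x) e

      same-cell : ∀ {c d} → In c → In d → t c ≡ t d → c ≡ d
      same-cell {c} {d} ic id e = N#-unique {P = λ b → t b ≡ᵇ t d} cs (once (t d) (lower id) (upper id)) (∈-skewCells⁺ γ δ ic) (∈-skewCells⁺ γ δ id) (≡⇒≡ᵇ (t c) (t d) e) (≡ᵇ-refl (t d))

      -- Condition (i), iterated along a row of rl(α/β): its entries move strictly right and weakly
      -- up, hence occupy a horizontal strip.
      strip-order : ∀ {r x y c d} → r < ℓ → x < y → y < rowLen r → In c → In d → t c ≡ enc r x → t d ≡ enc r y → proj₂ c < proj₂ d × proj₁ d ≤ proj₁ c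
      strip-order {r} {x} {suc y} {c} {d} r< x<y y< ic id e e′ with m≤n⇒m<n∨m≡n (≤-pred x<y)
      ... | inj₂ refl = cond-i r< y< ic id e e′
      ... | inj₁ x<y′ = let y<′ = <⇒≤ y< ; (b , ib , e″) = cell r< y<′
                            (p , q) = strip-order r< x<y′ y<′ ic ib e e″ ; (p′ , q′) = cond-i r< y< ib id e″ e′ in
          <-trans p p′ , ≤-trans q′ q

      ss : Semistandard ℓ γ δ L
      ss = record
        { positive = λ _ → s≤s z≤n
        ; bounded  = λ ic → let (r , x , r< , _ , _ , e) = label ic in ≤-trans (≤-reflexive e) r<
        ; weak     = λ ic id → weak (label ic) (label id) (rows ic id)
        ; columns  = λ ic id → columns ic id (label ic) (label id) (cols ic id)
        }
        where
        Label : Cell → Set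
        Label c = ∃ λ r → ∃ λ x → r < ℓ × x < rowLen r × t c ≡ enc r x × L c ≡ suc r
        weak : ∀ {c d} → Label c → Label d → t c < t d → L c ≤ L d
        weak (r , x , _ , _ , e , l) (r′ , x′ , _ , x′< , e′ , l′) lt with enc-<⁻ {r} {r′} {x} {x′} x′< (subst₂ _<_ e e′ lt)
        ... | inj₁ r<r′       = ≤-trans (≤-reflexive l) (≤-trans (s≤s (<⇒≤ r<r′)) (≤-reflexive (sym l′)))
        ... | inj₂ (refl , _) = ≤-reflexive (trans l (sym l′))
        columns : ∀ {i j} → In (i , j) → In (suc i , j) → Label (i , j) → Label (suc i , j) → t (i , j) < t (suc i , j) → L (i , j) < L (suc i , j)
        columns ic id (r , x , r< , _ , e , l) (r′ , x′ , _ , x′< , e′ , l′) lt with enc-<⁻ {r} {r′} {x} {x′} x′< (subst₂ _<_ e e′ lt)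
        ... | inj₁ r<r′         = subst₂ _<_ (sym l) (sym l′) (s≤s r<r′)
        -- Two entries of one strip cannot share a column, as the larger one is strictly to the
        -- right.
        ... | inj₂ (refl , x<x′) = ⊥-elim (<-irrefl refl (proj₁ (strip-order r< x<x′ x′< ic id e e′)))

      g : GT ℓ (part γ) (part δ) p
      g = pattern-GT δ⊆γ ss γd δd

      count-labels : ∀ {r m} → r < ℓ → m ≤ rowLen r → (P : Cell → Bool) →
        (∀ {c x} → In c → x < rowLen r → t c ≡ enc r x → x < m → T (P c)) →
        (∀ {c} → In c → T (P c) → ∃ λ x → x < m × t c ≡ enc r x) → N# P cs ≡ m
      count-labels {r} {m} r< m≤ P to from = trans (N#-sumTo (λ x c → t c ≡ᵇ enc r x) m cs (λ c c∈ → pointwise c (∈-skewCells⁻ γ δ c∈)))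
        (sumTo-ones m (λ x x< → once (enc r x) (s≤s z≤n) (enc-≤ r< (<-≤-trans x< m≤))))
        where
        pointwise : ∀ c → In c → bit (P c) ≡ sumTo m (λ x → bit (t c ≡ᵇ enc r x))
        pointwise c ic with P c in e
        ... | true  = let (x , x< , e′) = from ic (true-T e) in sym (trans (sumTo-interval m (λ x → t c ≡ᵇ enc r x) x (suc x) (n≤1+n x) x<
            (λ i i< q → let i≡ = proj₂ (enc-injective {r} {r} {i} {x} (<-≤-trans i< m≤) (<-≤-trans x< m≤) (trans (sym (≡ᵇ⇒≡ (t c) _ q)) e′)) in
              ≤-reflexive (sym i≡) , s≤s (≤-reflexive i≡))
            (λ i x≤ i< → ≡⇒≡ᵇ (t c) _ (trans e′ (cong (enc r) (≤-antisym x≤ (≤-pred i<)))))) (trans (+-∸-assoc 1 (≤-refl {x})) (cong suc (n∸n≡0 x))))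
        ... | false = sym (sumTo-zero m (λ x x< → cong bit (¬T-false (λ q → subst T e (to ic (<-≤-trans x< m≤) (≡ᵇ⇒≡ (t c) _ q) x<)))))

      content : ∀ r → r < ℓ → sumTo R (mult p r) ≡ rowLen r
      content r r< = trans (sumTo-cong R (λ i _ → mult-pattern γ δ L i r)) (trans (sym (N#-skewCells γ δ (λ c → L c ≡ᵇ suc r) R γ≤))
        (count-labels r< ≤-refl (λ c → L c ≡ᵇ suc r)
          (λ {c} _ x< e _ → ≡⇒≡ᵇ (L c) (suc r) (L-enc r< x< e))
          (λ {c} ic q → from (label ic) (≡ᵇ⇒≡ (L c) (suc r) q))))
        where
        from : ∀ {c} → (∃ λ r → ∃ λ x → r < ℓ × x < rowLen r × t c ≡ enc r x × L c ≡ suc r) → L c ≡ suc r → ∃ λ x → x < rowLen r × t c ≡ enc r x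
        from (r′ , x , _ , x< , e , l) q with refl ← suc-injective (trans (sym l) q) = x , x< , e

      strip-bounds : ∀ {i j r x} → In (i , j) → r < ℓ → x < rowLen r → t (i , j) ≡ enc r x → p i r ≤ j × j < p i (suc r)
      strip-bounds {i} {j} {r} ic r< x< e = ≮⇒≥ (λ j< → <-irrefl refl (≤-trans (≤-reflexive (sym (L-enc r< x< e))) (pattern-≤⁻ δ⊆γ ss r ic j<))) ,
        pattern-≤⁺ δ⊆γ ss (suc r) ic (≤-reflexive (L-enc r< x< e))

      -- The labels of row r increase from left to right and from bottom to top along their strip,
      -- so the position of a label is the number of boxes of the strip further down or further left.
      rank : ∀ {i j r x} → In (i , j) → r < ℓ → x < rowLen r → t (i , j) ≡ enc r x → x ≡ tailTo R (mult p r) (suc i) + (j ∸ p i r)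
      rank {i} {j} {r} {x} ic r< x< e = trans (sym counted) (trans (N#-skewCells γ δ P R γ≤) (trans (sym (sumTo+tailTo R (rowCount γ δ P) i (<⇒≤ i<R)))
          (trans (cong₂ _+_ (sumTo-zero i above) (trans (tailTo-step R (rowCount γ δ P) i i<R) (cong₂ _+_ here′ (tailTo-cong R (suc i) below)))) (+-comm (j ∸ p i r) _))))
        where
        P : Cell → Bool
        P c = (L c ≡ᵇ suc r) ∧ (t c <ᵇ t (i , j))
        i<R : i < R
        i<R = <-≤-trans (row<length γ δ ic) γ≤
        P⁻ : ∀ {c} → In c → T (P c) → ∃ λ y → y < x × t c ≡ enc r y
        P⁻ {c} ic′ q = go (label ic′)
          where
          go : (∃ λ r → ∃ λ x → r < ℓ × x < rowLen r × t c ≡ enc r x × L c ≡ suc r) → ∃ λ y → y < x × t c ≡ enc r y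
          go (r′ , y , _ , y< , e′ , l) with refl ← suc-injective (trans (sym l) (≡ᵇ⇒≡ (L c) (suc r) (proj₁ (T∧⁻ q))))
            with enc-<⁻ {r′} {r′} {y} {x} x< (subst₂ _<_ e′ e (<ᵇ⇒< (t c) _ (proj₂ (T∧⁻ {L c ≡ᵇ suc r} q))))
          ... | inj₁ bad = ⊥-elim (<-irrefl refl bad)
          ... | inj₂ (_ , y<x) = y , y<x , e′
        P⁺ : ∀ {c y} → y < rowLen r → t c ≡ enc r y → y < x → T (P c)
        P⁺ {c} {y} y< e′ y<x = T∧⁺ (≡⇒≡ᵇ (L c) (suc r) (L-enc r< y< e′)) (<⇒<ᵇ (subst₂ _<_ (sym e′) (sym e) (s≤s (+-monoʳ-< (offset r) y<x))))
        counted : N# P cs ≡ x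
        counted = count-labels r< (<⇒≤ x<) P (λ _ y< e′ y<x → P⁺ y< e′ y<x) P⁻
        earlier : ∀ {c} → In c → L c ≡ suc r → c ≢ (i , j) → ¬ (j < proj₂ c × proj₁ c ≤ i) → T (P c)
        earlier {c} ic′ l c≢ ¬later = go (label ic′)
          where
          go : (∃ λ r → ∃ λ x → r < ℓ × x < rowLen r × t c ≡ enc r x × L c ≡ suc r) → T (P c)
          go (r′ , y , _ , y< , e′ , l′) with refl ← suc-injective (trans (sym l′) l) with <-cmp y x
          ... | tri< y<x _ _  = P⁺ y< e′ y<x
          ... | tri≈ _ refl _ = ⊥-elim (c≢ (same-cell ic′ ic (trans e′ (sym e))))
          ... | tri> _ _ x<y  = ⊥-elim (¬later (strip-order r< x<y y< ic ic′ e e′))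
        in-row : ∀ i′ z → z < part γ i′ ∸ part δ i′ → In (i′ , part δ i′ + z)
        in-row i′ z z< = m≤m+n _ z , <-≤-trans (+-monoʳ-< (part δ i′) z<) (≤-reflexive (m+[n∸m]≡n (δ⊆γ i′)))
        above : ∀ i′ → i′ < i → rowCount γ δ P i′ ≡ 0
        above i′ i′< = sumTo-zero (part γ i′ ∸ part δ i′) (λ z z< → cong bit (¬T-false (λ q → let ic′ = in-row i′ z z< ; (y , y<x , e′) = P⁻ ic′ q in
          <⇒≱ i′< (proj₂ (strip-order r< y<x x< ic′ ic e′ e)))))
        below : ∀ i′ → suc i ≤ i′ → rowCount γ δ P i′ ≡ mult p r i′
        below i′ i< = trans (sumTo-cong (part γ i′ ∸ part δ i′) (λ z z< → cong bit (same z (in-row i′ z z<)))) (sym (mult-pattern γ δ L i′ r))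
          where
          same : ∀ z → In (i′ , part δ i′ + z) → P (i′ , part δ i′ + z) ≡ (L (i′ , part δ i′ + z) ≡ᵇ suc r)
          same z ic′ with L (i′ , part δ i′ + z) ≡ᵇ suc r in q
          ... | false = refl
          ... | true  = T-true (proj₂ (T∧⁻ {L (i′ , part δ i′ + z) ≡ᵇ suc r} (earlier ic′ (≡ᵇ⇒≡ _ (suc r) (true-T q)) (λ eq → <-irrefl (sym (cong proj₁ eq)) i<) (λ (_ , le) → <⇒≱ i< le))))
        bounds = strip-bounds ic r< x< e
        here′ : rowCount γ δ P i ≡ j ∸ p i r
        here′ = trans (sumTo-interval (part γ i ∸ part δ i) (λ z → P (i , part δ i + z)) (p i r ∸ part δ i) (j ∸ part δ i)
            (∸-monoˡ-≤ (part δ i) (proj₁ bounds)) (∸-monoˡ-≤ (part δ i) (<⇒≤ (proj₂ ic)))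
            (λ z z< q → let ic′ = in-row i z z< ; (y , y<x , e′) = P⁻ ic′ q in
               m≤n+o⇒m∸n≤o (p i r) (part δ i) (proj₁ (strip-bounds ic′ r< (<-trans y<x x<) e′)) ,
               +-cancelˡ-< (part δ i) z _ (subst (part δ i + z <_) (sym (m+[n∸m]≡n (proj₁ ic))) (proj₁ (strip-order r< y<x x< ic′ ic e′ e))))
            (λ z lo hi → inside z (≤-trans (m≤n+m∸n (p i r) (part δ i)) (+-monoʳ-≤ (part δ i) lo))
               (subst (part δ i + z <_) (m+[n∸m]≡n (proj₁ ic)) (+-monoʳ-< (part δ i) hi))))
          (trans (cong (_∸ (p i r ∸ part δ i)) refl) (∸-∸ (proj₁ (pattern-bounds δ⊆γ ss i r)) (proj₁ ic)))
          where
          ∸-∸ : ∀ {a b c} → a ≤ b → a ≤ c → (c ∸ a) ∸ (b ∸ a) ≡ c ∸ b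
          ∸-∸ {a} {b} {c} a≤b a≤c = trans (∸-+-assoc c a (b ∸ a)) (cong (c ∸_) (m+[n∸m]≡n a≤b))
          inside : ∀ z → p i r ≤ part δ i + z → part δ i + z < j → T (P (i , part δ i + z))
          inside z lo hi = earlier ic′ (≤-antisym (pattern-≤⁻ δ⊆γ ss (suc r) ic′ (<-trans hi (proj₂ bounds))) (≰⇒> (λ l≤ → <⇒≱ (pattern-≤⁺ δ⊆γ ss r ic′ l≤) lo)))
              (λ eq → <-irrefl (cong proj₂ eq) hi) (λ (lt , _) → <-asym lt hi)
            where
            ic′ : In (i , part δ i + z)
            ic′ = m≤m+n _ z , <-trans hi (proj₂ ic)

      below-tail : ∀ {i j r x} → In (i , j) → r < ℓ → x < rowLen r → t (i , j) ≡ enc r x → x < tailTo R (mult p r) i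
      below-tail {i} {j} {r} ic r< x< e = subst₂ _<_ (sym (rank ic r< x< e)) (trans (+-comm _ (mult p r i)) (sym (tailTo-step R (mult p r) i (<-≤-trans (row<length γ δ ic) γ≤))))
        (+-monoʳ-< (tailTo R (mult p r) (suc i)) (∸-monoˡ-< (proj₂ b) (proj₁ b)))
        where b = strip-bounds ic r< x< e

      -- Let x be the largest label of strip r in the rows from i on, so that the tail is x + 1. If
      -- rl(α/β) has a box under that of x, condition (ii) puts its label x′ strictly lower, and by
      -- the ranks more than x′ labels of strip r + 1 lie under row i. If there is no such box, then
      -- α_r > x + α_{r+1} and the claim is immediate.
      tail-lattice : ∀ r i → suc r < ℓ → tailTo R (mult p r) i + part α (suc r) ≤ part α r + tailTo R (mult p (suc r)) (suc i)
      tail-lattice r i r< = go (tailTo R (mult p r) i) refl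
        where
        r<′ = <⇒≤ r<
        tail≤ : tailTo R (mult p r) i ≤ rowLen r
        tail≤ = ≤-trans (tailTo-anti R (mult p r) z≤n) (≤-reflexive (trans (tailTo≡sumTo R (mult p r)) (content r r<′)))
        go : ∀ y → tailTo R (mult p r) i ≡ y → y + part α (suc r) ≤ part α r + tailTo R (mult p (suc r)) (suc i)
        go zero    _ = ≤-trans (αd r) (m≤m+n _ _)
        go (suc x) e with part α r ≤? x + part α (suc r)
        ... | no ¬p = ≤-trans (≰⇒> ¬p) (m≤m+n _ _)
        ... | yes p′ = later (cell r<′ x<) (cell r< x′<)
          where
          x< : x < rowLen r
          x< = ≤-trans (≤-reflexive (sym e)) tail≤
          x′ = x + part α (suc r) ∸ part α r
          x′≡ : x′ + part α r ≡ x + part α (suc r)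
          x′≡ = m∸n+n≡m p′
          -- The box under that of x lies outside β because β_{r+1} ≤ β_r.
          x′< : x′ < rowLen (suc r)
          x′< = m+n≤o⇒m≤o∸n (suc x′) (lem x x′ (part α r) (part α (suc r)) (part β r) (part β (suc r)) x′≡
            (≤-trans (+-monoˡ-≤ (part β r) x<) (≤-reflexive (m∸n+n≡m (β⊆α r)))) (βd r))
            where
            lem : ∀ x x′ a a′ b b′ → x′ + a ≡ x + a′ → suc x + b ≤ a → b′ ≤ b → suc x′ + b′ ≤ a′
            lem x x′ a a′ b b′ e₁ e₂ e₃ = lelin (+-mono-≤ (≤-reflexive e₁) (+-mono-≤ e₂ e₃))
              (ℕ-solver.solve (x L.∷ x′ L.∷ a L.∷ a′ L.∷ b L.∷ b′ L.∷ L.[]))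
          later : (∃ λ c → In c × t c ≡ enc r x) → (∃ λ d → In d × t d ≡ enc (suc r) x′) → suc x + part α (suc r) ≤ part α r + tailTo R (mult p (suc r)) (suc i)
          later (c , ic , tc) (d , id , td) = lem x x′ (part α r) (part α (suc r)) _ x′≡
              (<-≤-trans (below-tail id r< x′< td) (tailTo-anti R (mult p (suc r)) (≤-trans (s≤s i≤) (proj₁ (cond-ii r< x< x′< x′≡ ic id tc td)))))
            where
            i≤ : i ≤ proj₁ c
            i≤ = ≮⇒≥ (λ c<i → <⇒≱ (≤-reflexive (sym e)) (≤-trans (tailTo-anti R (mult p r) c<i)
              (≤-trans (m≤m+n _ _) (≤-reflexive (sym (rank ic r<′ x< tc))))))
            lem : ∀ x x′ a a′ s → x′ + a ≡ x + a′ → x′ < s → suc x + a′ ≤ a + s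
            lem x x′ a a′ s e₁ e₂ = lelin (+-mono-≤ (≤-reflexive (sym e₁)) e₂) (ℕ-solver.solve (x L.∷ x′ L.∷ a L.∷ a′ L.∷ s L.∷ L.[]))

      table : List (List ℕ)
      table = tab R (suc ℓ) p

      agree : ∀ i j → j ≤ ℓ → get table i j ≡ p i j
      agree = get-tab-GT γ γ≤ g

      mult-agree : ∀ k i → k < ℓ → mult (get table) k i ≡ mult p k i
      mult-agree k i k< = cong₂ _∸_ (agree i (suc k) k<) (agree i k (<⇒≤ k<))

      table-lattice : LatticeArr R ℓ γ δ (pad ℓ β) (pad ℓ α) table
      table-lattice = (Arr-tab {α = γ} {δ} γ≤ g , lat) , part-ext (trans lplus (sym (length-pad ℓ α))) (λ k k< → parts k (subst (k <_) lplus k<))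
        where
        lw = trans (length-pad ℓ β) (sym (length-wt R ℓ (get table)))
        lplus : length (plus (pad ℓ β) (wt R ℓ (get table))) ≡ ℓ
        lplus = trans (length-plus (pad ℓ β) _ lw) (length-wt R ℓ (get table))
        total : ∀ k → k < ℓ → part β k + sumTo R (mult p k) ≡ part α k
        total k k< = trans (cong (part β k +_) (content k k<)) (m+[n∸m]≡n (β⊆α k))
        parts : ∀ k → k < ℓ → part (plus (pad ℓ β) (wt R ℓ (get table))) k ≡ part (pad ℓ α) k
        parts k k< = trans (part-plus (pad ℓ β) _ k lw) (trans (cong₂ _+_ (part-pad ℓ β β≤ℓ k) (trans (part-applyUpTo _ ℓ k<) (sumTo-cong R (λ i _ → mult-agree k i k<))))
          (trans (total k k<) (sym (part-pad ℓ α ≤-refl k))))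
        lat : Lattice R ℓ (pad ℓ β) (get table)
        lat k i k< i< = subst₂ _≤_ (sym (cong₂ _+_ (part-pad ℓ β β≤ℓ (suc k)) (sumTo-cong (suc i) (λ i′ _ → mult-agree (suc k) i′ k<))))
            (sym (cong₂ _+_ (part-pad ℓ β β≤ℓ k) (sumTo-cong i (λ i′ _ → mult-agree k i′ k<′))))
            (lem (part β k) (part β (suc k)) (sumTo i (mult p k)) (sumTo (suc i) (mult p (suc k))) (tailTo R (mult p k) i) (tailTo R (mult p (suc k)) (suc i)) (part α k) (part α (suc k))
              (trans (cong (part β k +_) (sumTo+tailTo R (mult p k) i (<⇒≤ i<))) (total k k<′))
              (trans (cong (part β (suc k) +_) (sumTo+tailTo R (mult p (suc k)) (suc i) i<)) (total (suc k) k<))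
              (tail-lattice k i k<))
          where
          k<′ = <⇒≤ k<
          lem : ∀ b b′ s s′ u u′ a a′ → b + (s + u) ≡ a → b′ + (s′ + u′) ≡ a′ → u + a′ ≤ a + u′ → b′ + s′ ≤ b + s
          lem b b′ s s′ u u′ a a′ refl refl h = lelin h (ℕ-solver.solve (b L.∷ b′ L.∷ s L.∷ s′ L.∷ u L.∷ u′ L.∷ L.[]))

    module Backward {U : List (List ℕ)} (lat : LatticeArr R ℓ γ δ (pad ℓ β) (pad ℓ α) U) where
      private
        p = get U
        g : GT ℓ (part γ) (part δ) p
        g = proj₂ (proj₁ (proj₁ lat))
        f = filling-of ℓ p

        tail : ℕ → ℕ → ℕ
        tail r = tailTo R (mult p r)

      total : ∀ r → r < ℓ → part β r + sumTo R (mult p r) ≡ part α r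
      total r r< = trans (cong₂ _+_ (sym (part-pad ℓ β β≤ℓ r)) (sym (part-applyUpTo _ ℓ r<)))
        (trans (sym (part-plus (pad ℓ β) (wt R ℓ p) r (trans (length-pad ℓ β) (sym (length-wt R ℓ p)))))
          (trans (cong (λ l → part l r) (proj₂ lat)) (part-pad ℓ α ≤-refl r)))

      tail-total : ∀ r → r < ℓ → tail r 0 ≡ rowLen r
      tail-total r r< = trans (tailTo≡sumTo R (mult p r)) (trans (sym (m+n∸m≡n (part β r) _)) (cong (_∸ part β r) (total r r<)))

      tail-lattice : ∀ r i → suc r < ℓ → i < R → tail r i + part α (suc r) ≤ part α r + tail (suc r) (suc i)
      tail-lattice r i r< i< = lem (part β r) (part β (suc r)) (sumTo i (mult p r)) (sumTo (suc i) (mult p (suc r))) (tail r i) (tail (suc r) (suc i)) (part α r) (part α (suc r))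
        (trans (cong (part β r +_) (sumTo+tailTo R (mult p r) i (<⇒≤ i<))) (total r (<⇒≤ r<)))
        (trans (cong (part β (suc r) +_) (sumTo+tailTo R (mult p (suc r)) (suc i) i<)) (total (suc r) r<))
        (subst₂ _≤_ (cong (_+ sumTo (suc i) (mult p (suc r))) (part-pad ℓ β β≤ℓ (suc r))) (cong (_+ sumTo i (mult p r)) (part-pad ℓ β β≤ℓ r)) (proj₂ (proj₁ lat) r i r< i<))
        where
        lem : ∀ b b′ s s′ u u′ a a′ → b + (s + u) ≡ a → b′ + (s′ + u′) ≡ a′ → b′ + s′ ≤ b + s → u + a′ ≤ a + u′
        lem b b′ s s′ u u′ a a′ refl refl h = lelin h (ℕ-solver.solve (b L.∷ b′ L.∷ s L.∷ s′ L.∷ u L.∷ u′ L.∷ L.[]))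

      record Strip (r : ℕ) (c : Cell) : Set where
        constructor strip-at
        field
          r<ℓ : r < ℓ
          lo  : p (proj₁ c) r ≤ proj₂ c
          hi  : proj₂ c < p (proj₁ c) (suc r)
      open Strip

      strip⇒In : ∀ {r c} → Strip r c → In c
      strip⇒In {r} {i , j} s = ≤-trans (GT-≥start g i (<⇒≤ (r<ℓ s))) (lo s) , <-≤-trans (hi s) (GT-≤end g i (r<ℓ s))

      strip-of : ∀ {c} → In c → ∃ λ r → f c ≡ suc r × Strip r c
      strip-of {i , j} ic = go (f (i , j)) refl
        where
        go : ∀ v → f (i , j) ≡ v → ∃ λ r → f (i , j) ≡ suc r × Strip r (i , j)
        go zero    e = ⊥-elim (<⇒≢ (filling-positive {ℓ} {γ} {δ} g ic) (sym e))
        go (suc r) e = r , e , strip-at r< (filling-<⁻ {ℓ} {γ} {δ} g {i} {j} (≤-reflexive (sym e))) (filling-≤⁻ {ℓ} {γ} {δ} g ic r< (≤-reflexive e))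
          where
          r< : r < ℓ
          r< = ≤-trans (≤-reflexive (sym e)) (filling-bounded {ℓ} {γ} {δ} g (i , j))

      strip-letter≡ : ∀ {r c} → Strip r c → f c ≡ suc r
      strip-letter≡ {r} {i , j} s = ≤-antisym (filling-≤⁺ {ℓ} {γ} {δ} g {i} {j} (r<ℓ s) (hi s)) (filling-<⁺ {ℓ} {γ} {δ} g {i} {j} (r<ℓ s) (lo s))

      -- Standardisation: the boxes of a strip are numbered from the bottom row up, each row from
      -- left to right. This is the order that `rank` finds on a Remmel-Whitney tableau.
      position : ℕ → Cell → ℕ
      position r (i , j) = tail r (suc i) + (j ∸ p i r)

      t : Cell → ℕ
      t c = enc (pred (f c)) (position (pred (f c)) c)

      t-strip : ∀ {r c} → Strip r c → t c ≡ enc r (position r c)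
      t-strip {r} {c} s = cong (λ v → enc (pred v) (position (pred v) c)) (strip-letter≡ s)

      position< : ∀ {r c} → Strip r c → position r c < tail r (proj₁ c)
      position< {r} {i , j} s = <-≤-trans (+-monoʳ-< (tail r (suc i)) (∸-monoˡ-< (hi s) (lo s)))
        (≤-reflexive (trans (+-comm _ (mult p r i)) (sym (tailTo-step R (mult p r) i (<-≤-trans (row<length γ δ (strip⇒In s)) γ≤)))))

      position<rowLen : ∀ {r c} → Strip r c → position r c < rowLen r
      position<rowLen {r} {c} s = <-≤-trans (position< s) (≤-trans (tailTo-anti R (mult p r) z≤n) (≤-reflexive (tail-total r (r<ℓ s))))

      above-right : ∀ i j r → r < ℓ → i < j → p j (suc r) ≤ p i r
      above-right i (suc j) r r< i<j with m≤n⇒m<n∨m≡n (≤-pred i<j)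
      ... | inj₂ refl = strict g i r r<
      ... | inj₁ i<j′ = ≤-trans (strict g j r r<) (≤-trans (mono g j r r<) (above-right i j r r< i<j′))

      position-order : ∀ {r c d} → Strip r c → Strip r d → position r c < position r d → proj₂ c < proj₂ d × proj₁ d ≤ proj₁ c
      position-order {r} {i , j} {i′ , j′} s s′ lt = go (<-cmp i i′)
        where
        go : _ → j < j′ × i′ ≤ i
        go (tri< i<i′ _ _) = ⊥-elim (<⇒≱ (position< s′) (≤-trans (tailTo-anti R (mult p r) i<i′) (≤-trans (m≤m+n _ _) (<⇒≤ lt))))
        go (tri≈ _ refl _) = ≰⇒> (λ j′≤ → <⇒≱ lt (+-monoʳ-≤ (tail r (suc i)) (∸-monoˡ-≤ (p i r) j′≤))) , ≤-refl
        go (tri> _ _ i′<i) = <-≤-trans (hi s) (≤-trans (above-right i′ i r (r<ℓ s) i′<i) (lo s′)) , <⇒≤ i′<i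

      position-injective : ∀ {r c d} → Strip r c → Strip r d → position r c ≡ position r d → c ≡ d
      position-injective {r} {i , j} {i′ , j′} s s′ e = go (<-cmp i i′)
        where
        go : _ → (i , j) ≡ (i′ , j′)
        go (tri< i<i′ _ _) = ⊥-elim (<⇒≱ (position< s′) (≤-trans (tailTo-anti R (mult p r) i<i′) (≤-trans (m≤m+n _ _) (≤-reflexive e))))
        go (tri> _ _ i′<i) = ⊥-elim (<⇒≱ (position< s) (≤-trans (tailTo-anti R (mult p r) i′<i) (≤-trans (m≤m+n _ _) (≤-reflexive (sym e)))))
        go (tri≈ _ refl _) = cong (i ,_) (trans (sym (m∸n+n≡m (lo s))) (trans (cong (_+ p i r) (+-cancelˡ-≡ (tail r (suc i)) _ _ e)) (m∸n+n≡m (lo s′))))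

      cell-at : ∀ {r x} → r < ℓ → x < rowLen r → ∃ λ c → Strip r c × position r c ≡ x
      cell-at {r} {x} r< x< =
        let (i , i< , lo′ , hi′) = tailTo-locate R (mult p r) x (subst (x <_) (sym (tail-total r r<)) x<)
            y = x ∸ tail r (suc i)
            x≡ = m+[n∸m]≡n lo′
            y< : y < mult p r i
            y< = +-cancelˡ-< (tail r (suc i)) y _ (subst₂ _<_ (sym x≡) (trans (tailTo-step R (mult p r) i i<) (+-comm (mult p r i) _)) hi′)
        in (i , p i r + y) , strip-at r< (m≤m+n _ _) (<-≤-trans (+-monoʳ-< (p i r) y<) (≤-reflexive (m+[n∸m]≡n (mono g i r r<)))) ,
           trans (cong (tail r (suc i) +_) (m+n∸m≡n (p i r) y)) x≡

      decode-cell : ∀ {c r x} → x < rowLen r → In c → t c ≡ enc r x → Strip r c × position r c ≡ x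
      decode-cell {c} {r} {x} x< ic e = go (strip-of ic)
        where
        go : (∃ λ r → f c ≡ suc r × Strip r c) → Strip r c × position r c ≡ x
        go (r′ , _ , s) with refl , q ← enc-injective {r′} {r} {position r′ c} {x} (position<rowLen s) x< (trans (sym (t-strip s)) e) = s , q

      filling : RWFilling t
      filling = record
        { lower  = λ _ → s≤s z≤n
        ; upper  = λ ic → let (r , _ , s) = strip-of ic in ≤-trans (≤-reflexive (t-strip s)) (enc-≤ (r<ℓ s) (position<rowLen s))
        ; rows   = λ {i} {j} ic id → rows′ (strip-of ic) (strip-of id) (Semistandard.weak SS ic id)
        ; cols   = λ {i} {j} ic id → cols′ (strip-of ic) (strip-of id) (Semistandard.columns SS ic id)
        ; once   = λ v 1≤ v≤ → once′ (decode 1≤ v≤)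
        ; cond-i = λ {r} {x} r< x< ic id e e′ →
            let (s , q) = decode-cell (<⇒≤ x<) ic e ; (s′ , q′) = decode-cell x< id e′ in
            position-order s s′ (subst₂ _<_ (sym q) (sym q′) ≤-refl)
        ; cond-ii = λ {r} {x} {x′} {c} {d} r< x< x′< col≡ ic id e e′ →
            let (s , q) = decode-cell x< ic e ; (s′ , q′) = decode-cell x′< id e′ in
            cond-ii′ c d r< s s′ (trans (cong (_+ part α r) q′) (trans col≡ (cong (_+ part α (suc r)) (sym q))))
        }
        where
        SS : Semistandard ℓ γ δ f
        SS = filling-Semistandard {ℓ} {γ} {δ} g
        rows′ : ∀ {i j} → (∃ λ r → f (i , j) ≡ suc r × Strip r (i , j)) → (∃ λ r → f (i , suc j) ≡ suc r × Strip r (i , suc j)) → f (i , j) ≤ f (i , suc j) → t (i , j) < t (i , suc j)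
        rows′ {i} {j} (r , e , s) (r′ , e′ , s′) le with m≤n⇒m<n∨m≡n (≤-pred (subst₂ _≤_ e e′ le))
        ... | inj₁ r<r′ = subst₂ _<_ (sym (t-strip s)) (sym (t-strip s′)) (enc-< r<r′ (position<rowLen s))
        ... | inj₂ refl = subst₂ _<_ (sym (t-strip s)) (sym (t-strip s′)) (s≤s (+-monoʳ-< (offset r) (+-monoʳ-< (tail r (suc i)) (∸-monoˡ-< ≤-refl (lo s)))))
        cols′ : ∀ {i j} → (∃ λ r → f (i , j) ≡ suc r × Strip r (i , j)) → (∃ λ r → f (suc i , j) ≡ suc r × Strip r (suc i , j)) → f (i , j) < f (suc i , j) → t (i , j) < t (suc i , j)
        cols′ (r , e , s) (r′ , e′ , s′) lt = subst₂ _<_ (sym (t-strip s)) (sym (t-strip s′)) (enc-< (≤-pred (subst₂ _<_ e e′ lt)) (position<rowLen s))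
        once′ : ∀ {v} → (∃ λ r → ∃ λ x → r < ℓ × x < rowLen r × v ≡ enc r x) → N# (λ c → t c ≡ᵇ v) cs ≡ 1
        once′ (r , x , r< , x< , refl) = let (c , s , q) = cell-at r< x< in
          N#-one cs (Unique-skewCells γ δ) (∈-skewCells⁺ γ δ (strip⇒In s)) (≡⇒≡ᵇ (t c) _ (trans (t-strip s) (cong (enc r) q)))
            (λ d d∈ e → let (s′ , q′) = decode-cell x< (∈-skewCells⁻ γ δ d∈) (≡ᵇ⇒≡ (t d) _ e) in position-injective s′ s (trans q′ (sym q)))
        cond-ii′ : ∀ {r} c d → suc r < ℓ → Strip r c → Strip (suc r) d → position (suc r) d + part α r ≡ position r c + part α (suc r) →
          proj₁ c < proj₁ d × proj₂ d ≤ proj₂ c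
        cond-ii′ {r} (i , j) (i′ , j′) r< s s′ col≡ = i<i′ , go (m≤n⇒m<n∨m≡n i<i′)
          where
          row-bound : ∀ {c} {r} → Strip r c → proj₁ c < R
          row-bound s = <-≤-trans (row<length γ δ (strip⇒In s)) γ≤
          x = position r (i , j)
          x′ = position (suc r) (i′ , j′)
          -- The box of x lies in row i, so x is below the tail of strip r at i. The lattice
          -- condition carries this over to x′ and the tail of strip r + 1 at i + 1, which means a
          -- row under i.
          x′< : x′ < tail (suc r) (suc i)
          x′< = lem x x′ (part α r) (part α (suc r)) (tail r i) (tail (suc r) (suc i)) col≡ (position< s) (tail-lattice r i r< (row-bound s))
            where
            lem : ∀ x x′ a a′ u u′ → x′ + a ≡ x + a′ → x < u → u + a′ ≤ a + u′ → x′ < u′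
            lem x x′ a a′ u u′ e₁ e₂ e₃ = lelin (+-mono-≤ (≤-reflexive e₁) (+-mono-≤ e₂ e₃))
              (ℕ-solver.solve (x L.∷ x′ L.∷ a L.∷ a′ L.∷ u L.∷ u′ L.∷ L.[]))
          i<i′ : i < i′
          i<i′ = ≰⇒> (λ i′≤i → <⇒≱ x′< (≤-trans (tailTo-anti R (mult p (suc r)) (s≤s i′≤i)) (m≤m+n _ _)))
          r<′ : r < ℓ
          r<′ = r<ℓ s
          go : suc i < i′ ⊎ suc i ≡ i′ → j′ ≤ j
          go (inj₁ si<i′) = ≤-trans (<⇒≤ (hi s′)) (≤-trans (above-right (suc i) i′ (suc r) r< si<i′) (≤-trans (strict g i r r<′) (lo s)))
          -- In adjacent rows the lattice condition one row lower shows that the offset of the lower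
          -- box from the start of its strip in that row is at most the offset of the upper box, and
          -- by strictness the lower strip starts no further right.
          go (inj₂ refl)  = lem (tail (suc r) (suc (suc i))) (j′ ∸ p (suc i) (suc r)) (part α r) (tail r (suc i)) (j ∸ p i r) (part α (suc r)) (p (suc i) (suc r)) (p i r)
              col≡ (tail-lattice r (suc i) r< (row-bound s′)) (strict g i r r<′) (m∸n+n≡m (lo s′)) (m∸n+n≡m (lo s))
            where
            lem : ∀ u′ y′ a u y a′ p′ p₀ {j j′} → u′ + y′ + a ≡ u + y + a′ → u + a′ ≤ a + u′ → p′ ≤ p₀ → y′ + p′ ≡ j′ → y + p₀ ≡ j → j′ ≤ j
            lem u′ y′ a u y a′ p′ p₀ e₁ e₂ e₃ refl refl = lelin (+-mono-≤ (≤-reflexive e₁) (+-mono-≤ e₂ e₃))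
              (ℕ-solver.solve (u′ L.∷ y′ L.∷ a L.∷ u L.∷ y L.∷ a′ L.∷ p′ L.∷ p₀ L.∷ L.[]))

      letter≡ : ∀ {c} → In c → strip-letter t c ≡ f c
      letter≡ {c} ic = let (r , e , s) = strip-of ic in
        trans (cong suc (trans (cong (λ v → proj₁ (rlPos α β v)) (t-strip s)) (cong proj₁ (rlPos-enc (r<ℓ s) (position<rowLen s))))) (sym e)

      label≡ : ∀ {c r x} → r < ℓ → f c ≡ suc r → x ≡ position r c → t c ≡ enc r x
      label≡ {c} r< e refl = cong (λ v → enc (pred v) (position (pred v) c)) e

    φ : Filling → List (List ℕ)
    φ F = tab R (suc ℓ) (pattern-of γ δ (strip-letter (val F)))

    ψ : List (List ℕ) → Filling
    ψ U = fill label cs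
      where
      label : Cell → ℕ
      label (i , j) = let r = pred (filling-of ℓ (get U) (i , j)) in enc r (tailTo R (mult (get U) r) (suc i) + (j ∸ get U i r))

    length-RW : pos (length (RW γ δ α β)) ≡ L# R ℓ γ δ (pad ℓ β) (pad ℓ α)
    length-RW = trans (∑-length (RW γ δ α β)) (∑-bij rwE (latticeE R ℓ γ δ (pad ℓ β) (pad ℓ α)) φ ψ
      (λ F y → Forward.table-lattice (RW⇒filling y)) (λ U lat → filling⇒RW (Backward.filling lat)) ψφ φψ (λ _ → 1ℤ) (λ _ → 1ℤ) (λ _ _ → refl))
      where
      ψφ : ∀ F → IsRW F → ψ (φ F) ≡ F
      ψφ F y = trans (fill-cong cs (λ c c∈ → same c (∈-skewCells⁻ γ δ c∈))) (sym (filling-is-fill {γ} {δ} (proj₁ (proj₂ (proj₁ (proj₂ y))))))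
        where
        open Forward (RW⇒filling y)
        same : ∀ c → In c → _ ≡ val F c
        same (i , j) ic = go (label ic)
          where
          go : (∃ λ r → ∃ λ x → r < ℓ × x < rowLen r × val F (i , j) ≡ enc r x × L (i , j) ≡ suc r) → _ ≡ val F (i , j)
          go (r , x , r< , x< , e , l) = trans (Backward.label≡ table-lattice {i , j} r< (trans (filling-pattern δ⊆γ γd δd ss agree (i , j) ic) l)
              (trans (rank ic r< x< e) (cong₂ _+_ (tailTo-cong R (suc i) (λ i′ _ → sym (mult-agree r i′ r<))) (cong (j ∸_) (sym (agree i r (<⇒≤ r<))))))) (sym e)
      φψ : ∀ U → LatticeArr R ℓ γ δ (pad ℓ β) (pad ℓ α) U → φ (ψ U) ≡ U
      φψ U lat = trans (tab-cong R (suc ℓ) (λ i j _ j< → trans (cong (part δ i +_) (sumTo-cong (part γ i ∸ part δ i) (λ z z< → cong (λ v → bit (v ≤ᵇ j))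
          (letter i z (m≤m+n _ z , <-≤-trans (+-monoʳ-< (part δ i) z<) (≤-reflexive (m+[n∸m]≡n (δ⊆γ i))))))))
          (pattern-filling {ℓ} {γ} {δ} (proj₂ (proj₁ (proj₁ lat))) i j (≤-pred j<) δ⊆γ))) (tab-get (proj₁ (proj₁ (proj₁ lat))))
        where
        letter : ∀ i z → In (i , part δ i + z) → strip-letter (val (ψ U)) (i , part δ i + z) ≡ filling-of ℓ (get U) (i , part δ i + z)
        letter i z ic = trans (cong (λ v → suc (proj₁ (rlPos α β v))) (val-fill _ cs (∈-skewCells⁺ γ δ ic))) (Backward.letter≡ lat ic)

open Pictures

-- Skew Schur series in any number of variables, and the two product rules

module SchurSeries where

  S : List ℕ → List ℕ → List ℕ → ℤ
  S α β a = pos (length (ssyt α β a))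

  S≡K : ∀ R n α β a → length α ≤ R → Dominant α → Dominant β → length a ≡ n → S α β a ≡ K R n α β a
  S≡K R n α β a α≤ αd βd refl = length-ssyt R α β a α≤ αd βd

  S-symmetric : ∀ α β → Dominant α → Dominant β → Symmetric (S α β)
  S-symmetric α β αd βd k a = trans (S≡K (length α) (length a) α β (sw k a) ≤-refl αd βd (length-sw k a))
    (trans (K-symmetric (length α) (length a) α β ≤-refl k a) (sym (S≡K (length α) (length a) α β a ≤-refl αd βd refl)))

  Symmetric-↭ : ∀ f → Symmetric f → ∀ {xs ys} → xs ↭ ys → f xs ≡ f ys
  Symmetric-↭ f s Perm.refl         = refl
  Symmetric-↭ f s (Perm.prep x p)   = Symmetric-↭ (λ l → f (x ∷ l)) (λ k l → s (suc k) (x ∷ l)) p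
  Symmetric-↭ f s {xs = x ∷ y ∷ xs} (Perm.swap x y p) = trans (s 0 (y ∷ x ∷ xs)) (Symmetric-↭ (λ l → f (y ∷ x ∷ l)) (λ k l → s (suc (suc k)) (y ∷ x ∷ l)) p)
  Symmetric-↭ f s (Perm.trans p q)  = trans (Symmetric-↭ f s p) (Symmetric-↭ f s q)

  mult-zero : ∀ {n α β p} → GT n α β p → ∀ R k → k < n → sumTo R (mult p k) ≡ 0 → ∀ i → i < R → p i (suc k) ≡ p i k
  mult-zero {p = p} g R k k< e i i< = ≤-antisym (m∸n≡0⇒m≤n (n≤0⇒n≡0 (≤-trans (m≤n+m (mult p k i) (sumTo i (mult p k)))
    (≤-trans (sumTo-≤ {suc i} {R} (mult p k) i<) (≤-reflexive e))))) (mono g i k k<)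

  -- Without the letter 1 the first two columns of the pattern agree. Dropping one of them lowers
  -- all letters by 1.
  K-stable : ∀ R n α β a → length α ≤ R → Dominant β → K R (suc n) α β (0 ∷ a) ≡ K R n α β a
  K-stable R n α β a α≤ βd = trans (sym (filtered (suc n) (0 ∷ a))) (trans
    (∑-bij (E (suc n) (0 ∷ a)) (E n a) φ ψ φ-ok ψ-ok ψφ φψ (λ _ → 1ℤ) (λ _ → 1ℤ) (λ _ _ → refl)) (filtered n a))
    where
    E : ∀ m a → Enum (λ T → Arr R m α β T × wt R m (get T) ≡ a)
    E m a = filterE (arrE R m α β) (λ T → wt R m (get T) ≟L a)
    filtered : ∀ m a → ∑ (elems (E m a)) (λ _ → 1ℤ) ≡ K R m α β a
    filtered m a = trans (∑-filter (λ T → wt R m (get T) ≟L a) (elems (arrE R m α β)) (λ _ → 1ℤ)) (∑-cong′ (elems (arrE R m α β)) (λ T → ℤₚ.*-identityʳ _))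
    drop-col dup-col : (ℕ → ℕ → ℕ) → ℕ → ℕ → ℕ
    drop-col p i j = p i (suc j)
    dup-col p i zero    = p i 0
    dup-col p i (suc j) = p i j
    φ ψ : List (List ℕ) → List (List ℕ)
    φ T = tab R (suc n) (drop-col (get T))
    ψ T = tab R (suc (suc n)) (dup-col (get T))
    first-zero : ∀ T → Arr R (suc n) α β T × wt R (suc n) (get T) ≡ 0 ∷ a → ∀ i → get T i 1 ≡ get T i 0
    first-zero T ((t , g) , e) i with i <? R
    ... | yes i< = mult-zero g R 0 (s≤s z≤n) (Lₚ.∷-injectiveˡ e) i i<
    ... | no i≮ = trans (get-≥ t 1 (≮⇒≥ i≮)) (sym (get-≥ t 0 (≮⇒≥ i≮)))
    φ-GT : ∀ T → Arr R (suc n) α β T × wt R (suc n) (get T) ≡ 0 ∷ a → GT n (part α) (part β) (drop-col (get T))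
    φ-GT T y@((t , g) , e) = gt (λ i → trans (first-zero T y i) (start g i)) (end g) (λ i j j< → mono g i (suc j) (s≤s j<)) (λ i j j< → strict g i (suc j) (s≤s j<))
    ψ-GT : ∀ T → Arr R n α β T × wt R n (get T) ≡ a → GT (suc n) (part α) (part β) (dup-col (get T))
    ψ-GT T ((t , g) , e) = gt (start g) (end g) mono′ strict′
      where
      mono′ : ∀ i j → j < suc n → dup-col (get T) i j ≤ dup-col (get T) i (suc j)
      mono′ i zero    _        = ≤-refl
      mono′ i (suc j) (s≤s j<) = mono g i j j<
      strict′ : ∀ i j → j < suc n → dup-col (get T) (suc i) (suc j) ≤ dup-col (get T) i j
      strict′ i zero    _        = ≤-trans (≤-reflexive (start g (suc i))) (≤-trans (βd i) (≤-reflexive (sym (start g i))))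
      strict′ i (suc j) (s≤s j<) = strict g i j j<
    φ-agree : ∀ T → Arr R (suc n) α β T × wt R (suc n) (get T) ≡ 0 ∷ a → ∀ i j → j ≤ n → get (φ T) i j ≡ get T i (suc j)
    φ-agree T y = get-tab-GT α α≤ (φ-GT T y)
    ψ-agree : ∀ T → Arr R n α β T × wt R n (get T) ≡ a → ∀ i j → j ≤ suc n → get (ψ T) i j ≡ dup-col (get T) i j
    ψ-agree T y = get-tab-GT α α≤ (ψ-GT T y)
    φ-ok : ∀ T → Arr R (suc n) α β T × wt R (suc n) (get T) ≡ 0 ∷ a → Arr R n α β (φ T) × wt R n (get (φ T)) ≡ a
    φ-ok T y@(_ , e) = Arr-tab {α = α} {β} α≤ (φ-GT T y) , trans (wt-cong R n (λ i j _ → φ-agree T y i j)) (Lₚ.∷-injectiveʳ e)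
    ψ-ok : ∀ T → Arr R n α β T × wt R n (get T) ≡ a → Arr R (suc n) α β (ψ T) × wt R (suc n) (get (ψ T)) ≡ 0 ∷ a
    ψ-ok T y@(_ , e) = Arr-tab {α = α} {β} α≤ (ψ-GT T y) , trans (wt-cong R (suc n) (λ i j _ → ψ-agree T y i j))
      (cong₂ _∷_ (sumTo-zero R (λ i _ → n∸n≡0 (get T i 0))) e)
    ψφ : ∀ T → Arr R (suc n) α β T × wt R (suc n) (get T) ≡ 0 ∷ a → ψ (φ T) ≡ T
    ψφ T y@((t , _) , _) = trans (tab-cong R (suc (suc n)) (λ i j _ j< → at i j (≤-pred j<))) (tab-get t)
      where
      at : ∀ i j → j ≤ suc n → dup-col (get (φ T)) i j ≡ get T i j
      at i zero    _        = trans (φ-agree T y i 0 z≤n) (first-zero T y i)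
      at i (suc j) (s≤s j≤) = φ-agree T y i j j≤
    φψ : ∀ T → Arr R n α β T × wt R n (get T) ≡ a → φ (ψ T) ≡ T
    φψ T y@((t , _) , _) = trans (tab-cong R (suc n) (λ i j _ j< → ψ-agree T y i (suc j) j<)) (tab-get t)

  S-stable : ∀ α β a → Dominant α → Dominant β → S α β (0 ∷ a) ≡ S α β a
  S-stable α β a αd βd = trans (S≡K (length α) (suc (length a)) α β (0 ∷ a) ≤-refl αd βd refl)
    (trans (K-stable (length α) (length a) α β a ≤-refl βd) (sym (S≡K (length α) (length a) α β a ≤-refl αd βd refl)))

  conv-cong : ∀ {f f′ h h′} e → (∀ u → length u ≡ length e → f u ≡ f′ u) → (∀ u → length u ≡ length e → h u ≡ h′ u) → conv f h e ≡ conv f′ h′ e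
  conv-cong e ef eh = ∑-cong (splits e) (λ u u∈ → let (l , _) = splits-sound e u∈ in cong₂ _*_ (ef u l) (eh (minus e u) (length-minus e u l)))

  conv-0 : ∀ f h e → conv f h (0 ∷ e) ≡ conv (λ u → f (0 ∷ u)) (λ u → h (0 ∷ u)) e
  conv-0 f h e = trans (∑-splits 0 e _) (ℤₚ.+-identityʳ _)

  -- c is any function that agrees with the lattice count on γ/ν, so `LR` and `RW-count` are both
  -- covered. `conv-expand` yields the count on α/β, and transposition connects the two.
  module _ (ν α β : List ℕ) (ν-part : IsPartition ν) (αd : Dominant α) (βd : Dominant β) (d : ℕ) (sizes : size ν + size α ≡ d + size β)
           (c : List ℕ → ℤ)
           (c≡ : ∀ R γ → Partition# d γ → length γ ≤ R → length ν ≤ R → c γ ≡ L# R (length α) γ ν (pad (length α) β) (pad (length α) α))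
           (β≤α : length β ≤ length α) where
    private
      νd = Dominant-partition ν-part
      RHS : List ℕ → ℤ
      RHS e = ∑ (partitions d) (λ γ → c γ * S γ [] e)

      γ-dom : ∀ {γ} → γ ∈ partitions d → Dominant γ
      γ-dom γ∈ = Dominant-partition (proj₁ (sound (partitionsE d) γ∈))

      nil-dom : Dominant []
      nil-dom _ = z≤n

      -- With at least this many variables, one number n exceeds the lengths of ν, of α and of every
      -- partition of d, is positive, and serves both as number of rows and as number of letters.
      N = suc (d + (length ν + length α))

      large : ∀ n e → length e ≡ n → N ≤ n → conv (S ν []) (S α β) e ≡ RHS e
      large n e le N≤ = trans (conv-cong e (λ u lu → S≡K n n ν [] u ν≤ νd nil-dom (trans lu le)) (λ u lu → S≡K n n α β u α≤ αd βd (trans lu le)))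
        (trans (conv-expand n n ν α β d ν-part (≤-trans (s≤s z≤n) N≤) ν≤ ν≤ α≤ (≤-trans β≤α α≤) d≤ d≤ sizes e le)
        (∑-cong (partitions d) (λ γ γ∈ → let γ≤ = γ-len γ∈ in cong₂ _*_
          (sym (trans (c≡ n γ (sound (partitionsE d) γ∈) γ≤ ν≤) (L#-transpose n (length α) n γ ν α β (γ-dom γ∈) αd γ≤ ν≤ ≤-refl α≤ β≤α (≤-trans β≤α α≤))))
          (sym (S≡K n n γ [] e γ≤ (γ-dom γ∈) nil-dom le)))))
        where
        d≤ : d ≤ n
        d≤ = ≤-trans (≤-trans (m≤m+n d _) (n≤1+n _)) N≤
        ν≤ : length ν ≤ n
        ν≤ = ≤-trans (≤-trans (≤-trans (m≤m+n (length ν) _) (m≤n+m _ d)) (n≤1+n _)) N≤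
        α≤ : length α ≤ n
        α≤ = ≤-trans (≤-trans (≤-trans (m≤n+m (length α) (length ν)) (m≤n+m _ d)) (n≤1+n _)) N≤
        γ-len : ∀ {γ} → γ ∈ partitions d → length γ ≤ n
        γ-len γ∈ = let ((a , _) , s) = sound (partitionsE d) γ∈ in ≤-trans (length≤size a) (≤-trans (≤-reflexive s) d≤)

      -- The expansion holds in many variables; variables with exponent 0 can be removed on both sides.
      descend : ∀ m e → N ≤ m + length e → conv (S ν []) (S α β) e ≡ RHS e
      descend zero    e N≤ = large (length e) e refl N≤
      descend (suc m) e N≤ = trans (conv-cong e (λ u _ → sym (S-stable ν [] u νd nil-dom)) (λ u _ → sym (S-stable α β u αd βd)))
        (trans (sym (conv-0 (S ν []) (S α β) e)) (trans (descend m (0 ∷ e) (≤-trans N≤ (≤-reflexive (sym (+-suc m (length e))))))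
          (∑-cong (partitions d) (λ γ γ∈ → cong (c γ *_) (S-stable γ [] e (γ-dom γ∈) nil-dom)))))

    schur-expand : ∀ e → conv (S ν []) (S α β) e ≡ ∑ (partitions d) (λ γ → c γ * S γ [] e)
    schur-expand e = descend N e (m≤m+n N (length e))

  littlewood-richardson : ∀ ν μ → IsPartition ν → IsPartition μ → ∀ e →
    conv (S ν []) (S μ []) e ≡ ∑ (partitions (size ν + size μ)) (λ γ → pos (LR γ ν μ) * S γ [] e)
  littlewood-richardson ν μ νp μp = schur-expand ν μ [] νp (Dominant-partition μp) (λ _ → z≤n) (size ν + size μ) (sym (+-identityʳ _)) (λ γ → pos (LR γ ν μ))
    (λ R γ (γp , _) γ≤ _ → LR≡L# R γ ν μ γ≤ (Dominant-partition γp) (Dominant-partition νp)) z≤n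

  -- The indicator repeats the containment test of `arrowTargets`, so that terms of the product rule
  -- and arrows can be matched one by one.
  RW-count : List ℕ → List ℕ → List ℕ → List ℕ → ℤ
  RW-count γ ν α β = 𝟙 (contained ν γ) * pos (length (RW γ ν α β))

  skew-size : ∀ α β R → length α ≤ R → length β ≤ R → (∀ i → part β i ≤ part α i) → length (skewCells α β) + size β ≡ size α
  skew-size α β R α≤ β≤ β⊆α = trans (cong₂ _+_ (length-skewCells α β R α≤) (size≡sumTo β R β≤)) (trans (sym (sumTo-+ R _ (part β)))
    (trans (sumTo-cong R (λ i _ → m∸n+n≡m (β⊆α i))) (sym (size≡sumTo α R α≤))))

  length-⊆ : ∀ α β → IsPartition β → (∀ i → part β i ≤ part α i) → length β ≤ length α
  length-⊆ α       []      p h = z≤n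
  length-⊆ []      (y ∷ β) (y> ∷ _ , _) h = ⊥-elim (<⇒≱ y> (h 0))
  length-⊆ (x ∷ α) (y ∷ β) p h = s≤s (length-⊆ α β (partition-tail p) (h ∘ suc))

  size-⊆ : ∀ α β → IsPartition β → (∀ i → part β i ≤ part α i) → size β ≤ size α
  size-⊆ α β p h = ≤-trans (≤-reflexive (size≡sumTo β (length α) (length-⊆ α β p h))) (≤-trans (sumTo-mono (length α) (λ i _ → h i)) (≤-reflexive (sym (size≡sumTo α (length α) ≤-refl))))

  GT-⊆ : ∀ {n α β p} → GT n (part α) (part β) p → ∀ i → part β i ≤ part α i
  GT-⊆ g i = ≤-trans (≤-reflexive (sym (start g i))) (GT-≤end g i z≤n)

  S*S-skew : ∀ ν α β → IsPartition ν → IsPartition α → IsPartition β → (∀ i → part β i ≤ part α i) → ∀ e →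
    conv (S ν []) (S α β) e ≡ ∑ (partitions (size ν + (size α ∸ size β))) (λ γ → RW-count γ ν α β * S γ [] e)
  S*S-skew ν α β νp αp βp β⊆α = schur-expand ν α β νp αd βd d sizes (λ γ → RW-count γ ν α β) counted (length-⊆ α β βp β⊆α)
    where
    αd = Dominant-partition αp
    βd = Dominant-partition βp
    d = size ν + (size α ∸ size β)
    sizes : size ν + size α ≡ d + size β
    sizes = sym (trans (+-assoc (size ν) _ (size β)) (cong (size ν +_) (m∸n+n≡m (size-⊆ α β βp β⊆α))))
    counted : ∀ R γ → Partition# d γ → length γ ≤ R → length ν ≤ R → RW-count γ ν α β ≡ L# R (length α) γ ν (pad (length α) β) (pad (length α) α)
    counted R γ (γp , γs) γ≤ ν≤ = go (contained ν γ) refl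
      where
      rhs = L# R (length α) γ ν (pad (length α) β) (pad (length α) α)
      E = latticeE R (length α) γ ν (pad (length α) β) (pad (length α) α)
      go : ∀ b → contained ν γ ≡ b → RW-count γ ν α β ≡ rhs
      go true e = trans (cong (λ b → 𝟙 b * pos (length (RW γ ν α β))) e) (trans (ℤₚ.*-identityˡ _)
        (RWBijection.length-RW R α β γ ν αd βd (Dominant-partition γp) (Dominant-partition νp) γ≤ (length-⊆ α β βp β⊆α) same-size β⊆α ν⊆γ))
        where
        ν⊆γ = contained⁻ ν γ (true-T e)
        same-size : length (skewCells γ ν) ≡ length (skewCells α β)
        same-size = lem (length (skewCells γ ν)) (length (skewCells α β)) (size ν) (size β) (size α ∸ size β) (trans (skew-size γ ν R γ≤ ν≤ ν⊆γ) γs)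
          (skew-size α β (length α) ≤-refl (length-⊆ α β βp β⊆α) β⊆α) (m∸n+n≡m (size-⊆ α β βp β⊆α))
          where
          lem : ∀ x y n b m {a} → x + n ≡ n + m → y + b ≡ a → m + b ≡ a → x ≡ y
          lem x y n b m e₁ e₂ e₃ = trans (+-cancelʳ-≡ n x m (trans e₁ (+-comm n m))) (+-cancelʳ-≡ b m y (trans e₃ (sym e₂)))
      go false e = trans (cong (λ b → 𝟙 b * pos (length (RW γ ν α β))) e) (sym (∑-zero (elems E) (λ U U∈ → let g = proj₂ (proj₁ (proj₁ (sound E U∈))) in
        ⊥-elim (subst T e (contained⁺ ν γ (GT-⊆ {length α} {γ} {ν} g))))))

open SchurSeries

-- Schur functions in two sets of variables

module Concatenation where

  subE : ∀ α → Enum (λ κ → IsPartition κ × T (contained κ α))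
  subE α = record
    { elems    = subpartitions α
    ; unique   = Unique-concatMap ofSize (upTo (suc (size α))) (Uₚ.upTo⁺ _) (λ k _ → unique (E k))
        (λ {k} {l} _ _ x∈ y∈ → trans (sym (proj₂ (proj₁ (sound (E k) x∈)))) (proj₂ (proj₁ (sound (E l) y∈))))
    ; sound    = λ κ∈ → let (k , _ , p) = ∈-concatMap⁻ ofSize (upTo (suc (size α))) κ∈ ; ((π , _) , t) = sound (E k) p in π , t
    ; complete = λ {κ} (π , t) → ∈-concatMap⁺ ofSize (upTo (suc (size α))) (∈ₚ.∈-upTo⁺ (s≤s (size-⊆ α κ π (contained⁻ κ α t)))) (complete (E (size κ)) ((π , refl) , t))
    }
    where
    ofSize : ℕ → List (List ℕ)
    ofSize k = filterᵇ (λ κ → contained κ α) (partitions k)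
    E : ∀ k → Enum (λ κ → Partition# k κ × T (contained κ α))
    E k = filterᵇE (partitionsE k) (λ κ → contained κ α)

  δ-++ : ∀ u v c a → length u ≡ length c → δ (u ++ v) (c ++ a) ≡ δ u c * δ v a
  δ-++ []      v []      a l = sym (ℤₚ.*-identityˡ (δ v a))
  δ-++ (x ∷ u) v (y ∷ c) a l = trans (δ-cons x y (u ++ v) (c ++ a)) (trans (cong ([ x ≟ y ]ᵈ *_) (δ-++ u v c a (suc-injective l)))
    (trans (sym (ℤₚ.*-assoc [ x ≟ y ]ᵈ (δ u c) (δ v a))) (cong (_* δ v a) (sym (δ-cons x y u c)))))

  ∑-product : {A B : Set} (xs : List A) (ys : List B) (f : A → ℤ) (g : B → ℤ) → ∑ xs f * ∑ ys g ≡ ∑ xs (λ x → ∑ ys (λ y → f x * g y))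
  ∑-product xs ys f g = trans (sym (∑-*ʳ xs (∑ ys g) f)) (∑-cong′ xs (λ x → sym (∑-*ˡ ys (f x) g)))

  module _ (R n₁ n₂ : ℕ) (α : List ℕ) (αp : IsPartition α) (α≤ : length α ≤ R) where
    private
      n = n₁ + n₂

      column : List (List ℕ) → List ℕ
      column U = applyUpTo (λ i → get U i n₁) R

      middle : List (List ℕ) → List ℕ
      middle U = strip (column U)

      wt-++ : ∀ p → wt R n p ≡ wt R n₁ p ++ wt R n₂ (λ i j → p i (n₁ + j))
      wt-++ p = trans (applyUpTo-++ _ n₁ n₂) (cong (wt R n₁ p ++_) (applyUpTo-cong n₂ (λ k _ → sumTo-cong R (λ i _ →
        cong (λ m → p i m ∸ p i (n₁ + k)) (sym (+-suc n₁ k))))))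

      module _ {U : List (List ℕ)} (a : Arr R n α [] U) where
        g = proj₂ a
        t = proj₁ a

        column≡ : ∀ i → part (column U) i ≡ get U i n₁
        column≡ i = go (i <? R)
          where
          go : Dec (i < R) → part (column U) i ≡ get U i n₁
          go (yes i<) = part-applyUpTo _ R i<
          go (no i≮)  = trans (part-≥ (column U) i (≤-trans (≤-reflexive (Lₚ.length-applyUpTo _ R)) (≮⇒≥ i≮))) (sym (get-≥ t n₁ (≮⇒≥ i≮)))

        column-dom : Dominant (column U)
        column-dom i = ≤-trans (≤-reflexive (column≡ (suc i))) (≤-trans (go n₁ (m≤m+n n₁ n₂)) (≤-reflexive (sym (column≡ i))))
          where
          go : ∀ j → j ≤ n → get U (suc i) j ≤ get U i j
          go zero    _  = ≤-reflexive (trans (start g (suc i)) (sym (start g i)))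
          go (suc j) j< = ≤-trans (strict g i j j<) (mono g i j j<)

        middle≡ : ∀ i → part (middle U) i ≡ get U i n₁
        middle≡ i = trans (part-strip (column U) column-dom i) (column≡ i)

        middle-partition : IsPartition (middle U)
        middle-partition = strip-partition (column U) column-dom

        middle-⊆ : T (contained (middle U) α)
        middle-⊆ = contained⁺ (middle U) α (λ i → ≤-trans (≤-reflexive (middle≡ i)) (GT-≤end g i (m≤m+n n₁ n₂)))

      module _ (κ : List ℕ) (κp : IsPartition κ) (κ⊆ : T (contained κ α)) where
        κ≤ : length κ ≤ R
        κ≤ = ≤-trans (length-⊆ α κ κp (contained⁻ κ α κ⊆)) α≤

        lower upper : List (List ℕ) → List (List ℕ)
        lower U = tab R (suc n₁) (get U)
        upper U = tab R (suc n₂) (λ i j → get U i (n₁ + j))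

        -- Column n₁ belongs to both halves, as the end of p and the start of q; both equal κ there,
        -- so the overlap is consistent.
        join : (ℕ → ℕ → ℕ) → (ℕ → ℕ → ℕ) → ℕ → ℕ → ℕ
        join p q i j = if does (j ≤? n₁) then p i j else q i (j ∸ n₁)

        module _ {p q : ℕ → ℕ → ℕ} (gp : GT n₁ (part κ) (part []) p) (gq : GT n₂ (part α) (part κ) q) where
          join-lower : ∀ i j → j ≤ n₁ → join p q i j ≡ p i j
          join-lower i j j≤ = if-yes (j ≤? n₁) j≤

          join-upper : ∀ i j → join p q i (n₁ + j) ≡ q i j
          join-upper i zero    = trans (join-lower i (n₁ + 0) (≤-reflexive (+-identityʳ n₁)))
            (trans (cong (p i) (+-identityʳ n₁)) (trans (end gp i) (sym (start gq i))))
          join-upper i (suc j) = trans (if-no (n₁ + suc j ≤? n₁) (<⇒≱ (m<m+n n₁ (s≤s z≤n)))) (cong (q i) (m+n∸m≡n n₁ (suc j)))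

          join-GT : GT n (part α) (part []) (join p q)
          join-GT = gt (λ i → trans (join-lower i 0 z≤n) (start gp i)) (λ i → trans (join-upper i n₂) (end gq i))
            (λ i j j< → mono′ i j j< (j <? n₁)) (λ i j j< → strict′ i j j< (j <? n₁))
            where
            offset-at : ∀ {j} → ¬ j < n₁ → n₁ + (j ∸ n₁) ≡ j
            offset-at j≮ = m+[n∸m]≡n (≮⇒≥ j≮)
            offset-< : ∀ {j} → j < n → ¬ j < n₁ → j ∸ n₁ < n₂
            offset-< j< j≮ = +-cancelˡ-< n₁ _ _ (subst (_< n) (sym (offset-at j≮)) j<)
            at : ∀ {j} i → ¬ j < n₁ → join p q i j ≡ q i (j ∸ n₁)
            at i j≮ = trans (cong (join p q i) (sym (offset-at j≮))) (join-upper i _)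
            at-suc : ∀ {j} i → ¬ j < n₁ → join p q i (suc j) ≡ q i (suc (j ∸ n₁))
            at-suc i j≮ = trans (cong (join p q i) (trans (cong suc (sym (offset-at j≮))) (sym (+-suc n₁ _)))) (join-upper i _)
            mono′ : ∀ i j → j < n → Dec (j < n₁) → join p q i j ≤ join p q i (suc j)
            mono′ i j j< (yes j<₁) = subst₂ _≤_ (sym (join-lower i j (<⇒≤ j<₁))) (sym (join-lower i (suc j) j<₁)) (mono gp i j j<₁)
            mono′ i j j< (no j≮)   = subst₂ _≤_ (sym (at i j≮)) (sym (at-suc i j≮)) (mono gq i _ (offset-< j< j≮))
            strict′ : ∀ i j → j < n → Dec (j < n₁) → join p q (suc i) (suc j) ≤ join p q i j
            strict′ i j j< (yes j<₁) = subst₂ _≤_ (sym (join-lower (suc i) (suc j) j<₁)) (sym (join-lower i j (<⇒≤ j<₁))) (strict gp i j j<₁)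
            strict′ i j j< (no j≮)   = subst₂ _≤_ (sym (at-suc (suc i) j≮)) (sym (at i j≮)) (strict gq i _ (offset-< j< j≮))

        Through : List (List ℕ) → Set
        Through U = Arr R n α [] U × middle U ≡ κ

        Pair : List (List ℕ) × List (List ℕ) → Set
        Pair (U , V) = Arr R n₁ κ [] U × Arr R n₂ α κ V

        split : List (List ℕ) → List (List ℕ) × List (List ℕ)
        split U = lower U , upper U

        merge : List (List ℕ) × List (List ℕ) → List (List ℕ)
        merge (U , V) = tab R (suc n) (join (get U) (get V))

        at-middle : ∀ {U} → Through U → ∀ i → get U i n₁ ≡ part κ i
        at-middle (a , e) i = trans (sym (middle≡ a i)) (cong (λ l → part l i) e)

        lower-GT : ∀ {U} → Through U → GT n₁ (part κ) (part []) (get U)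
        lower-GT y@((_ , g) , _) = gt (start g) (at-middle y) (λ i j j< → mono g i j (<-≤-trans j< (m≤m+n n₁ n₂))) (λ i j j< → strict g i j (<-≤-trans j< (m≤m+n n₁ n₂)))

        upper-GT : ∀ {U} → Through U → GT n₂ (part α) (part κ) (λ i j → get U i (n₁ + j))
        upper-GT {U} y@((_ , g) , _) = gt (λ i → trans (cong (get U i) (+-identityʳ n₁)) (at-middle y i)) (end g)
          (λ i j j< → ≤-trans (mono g i (n₁ + j) (+-monoʳ-< n₁ j<)) (≤-reflexive (cong (get U i) (sym (+-suc n₁ j)))))
          (λ i j j< → ≤-trans (≤-reflexive (cong (get U (suc i)) (+-suc n₁ j))) (strict g i (n₁ + j) (+-monoʳ-< n₁ j<)))

        split-ok : ∀ U → Through U → Pair (split U)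
        split-ok U y = Arr-tab {α = κ} {[]} κ≤ (lower-GT y) , Arr-tab {α = α} {κ} α≤ (upper-GT y)

        merge-agree : ∀ U V → Pair (U , V) → ∀ i j → j ≤ n → get (merge (U , V)) i j ≡ join (get U) (get V) i j
        merge-agree U V ((_ , gp) , (_ , gq)) = get-tab-GT α α≤ (join-GT gp gq)

        merge-ok : ∀ UV → Pair UV → Through (merge UV)
        merge-ok (U , V) y@((_ , gp) , (_ , gq)) = a , partition-ext (middle-partition a) κp (λ i → trans (middle≡ a i)
            (trans (merge-agree U V y i n₁ (m≤m+n n₁ n₂)) (trans (join-lower gp gq i n₁ ≤-refl) (end gp i))))
          where
          a : Arr R n α [] (merge (U , V))
          a = Arr-tab {α = α} {[]} α≤ (join-GT gp gq)

        merge-split : ∀ U → Through U → merge (split U) ≡ U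
        merge-split U y@((t , g) , _) = trans (tab-cong R (suc n) (λ i j _ j< → go i j (≤-pred j<) (j ≤? n₁))) (tab-get t)
          where
          ok = split-ok U y
          go : ∀ i j → j ≤ n → Dec (j ≤ n₁) → join (get (lower U)) (get (upper U)) i j ≡ get U i j
          go i j j≤ (yes j≤₁) = trans (join-lower (proj₂ (proj₁ ok)) (proj₂ (proj₂ ok)) i j j≤₁) (get-tab-GT κ κ≤ (lower-GT y) i j j≤₁)
          go i j j≤ (no j≰)   = trans (cong (join (get (lower U)) (get (upper U)) i) (sym e)) (trans (join-upper (proj₂ (proj₁ ok)) (proj₂ (proj₂ ok)) i (j ∸ n₁))
              (trans (get-tab-GT α α≤ (upper-GT y) i (j ∸ n₁) (+-cancelˡ-≤ n₁ _ _ (subst (_≤ n) (sym e) j≤))) (cong (get U i) e)))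
            where
            e : n₁ + (j ∸ n₁) ≡ j
            e = m+[n∸m]≡n (<⇒≤ (≰⇒> j≰))

        split-merge : ∀ UV → Pair UV → split (merge UV) ≡ UV
        split-merge (U , V) y@((tU , gp) , (tV , gq)) = cong₂ _,_
          (trans (tab-cong R (suc n₁) (λ i j _ j< → trans (merge-agree U V y i j (≤-trans (≤-pred j<) (m≤m+n n₁ n₂))) (join-lower gp gq i j (≤-pred j<)))) (tab-get tU))
          (trans (tab-cong R (suc n₂) (λ i j _ j< → trans (merge-agree U V y i (n₁ + j) (+-monoʳ-≤ n₁ (≤-pred j<))) (join-upper gp gq i j))) (tab-get tV))

        through-sum : ∀ c a → length c ≡ n₁ → ∑ (filter (λ U → middle U ≟L κ) (elems (arrE R n α []))) (λ U → δ (wt R n (get U)) (c ++ a)) ≡ K R n₁ κ [] c * K R n₂ α κ a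
        through-sum c a lc = trans (∑-bij (filterE (arrE R n α []) (λ U → middle U ≟L κ)) (pairE (arrE R n₁ κ []) (arrE R n₂ α κ))
            split merge split-ok merge-ok merge-split split-merge _ (λ (U , V) → δ (wt R n₁ (get U)) c * δ (wt R n₂ (get V)) a) weight)
          (trans (∑-pair (arrE R n₁ κ []) (arrE R n₂ α κ) (λ (U , V) → δ (wt R n₁ (get U)) c * δ (wt R n₂ (get V)) a))
            (sym (∑-product (elems (arrE R n₁ κ [])) (elems (arrE R n₂ α κ)) (λ U → δ (wt R n₁ (get U)) c) (λ V → δ (wt R n₂ (get V)) a))))
          where
          weight : ∀ U → Through U → δ (wt R n (get U)) (c ++ a) ≡ δ (wt R n₁ (get (lower U))) c * δ (wt R n₂ (get (upper U))) a
          weight U y = trans (cong (λ w → δ w (c ++ a)) (wt-++ (get U))) (trans (δ-++ (wt R n₁ (get U)) (wt R n₂ (λ i j → get U i (n₁ + j))) c a (trans (length-wt R n₁ (get U)) (sym lc)))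
            (cong₂ (λ u v → δ u c * δ v a) (wt-cong R n₁ (λ i j _ j≤ → sym (get-tab-GT κ κ≤ (lower-GT y) i j j≤)))
              (wt-cong R n₂ (λ i j _ j≤ → sym (get-tab-GT α α≤ (upper-GT y) i j j≤)))))

    -- Patterns are sorted by their column n₁, the shape κ formed by the letters up to n₁. For a
    -- given κ the parts on either side of this column vary independently.
    K-concat : ∀ c a → length c ≡ n₁ → K R (n₁ + n₂) α [] (c ++ a) ≡ ∑ (subpartitions α) (λ κ → K R n₁ κ [] c * K R n₂ α κ a)
    K-concat c a lc = trans (∑-cong As (λ U U∈ → sym (trans (∑-single (subE α) (middle U) (middle-partition (sound (arrE R n α []) U∈) , middle-⊆ (sound (arrE R n α []) U∈)) _
        (λ κ _ κ≢ → cong (_* h U) ([no] (middle U ≟L κ) (λ e → κ≢ (sym e))))) (trans (cong (_* h U) ([yes] (middle U ≟L middle U) refl)) (ℤₚ.*-identityˡ (h U))))))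
      (trans (∑-swap As (subpartitions α) (λ U κ → [ middle U ≟L κ ]ᵈ * h U))
      (∑-cong (subpartitions α) (λ κ κ∈ → let (κp , κ⊆) = sound (subE α) κ∈ in
        trans (sym (∑-filter (λ U → middle U ≟L κ) As h)) (through-sum κ κp κ⊆ c a lc))))
      where
      As = elems (arrE R n α [])
      h : List (List ℕ) → ℤ
      h U = δ (wt R n (get U)) (c ++ a)

  -- The coproduct formula s_α(x, y) = ∑_κ s_κ(x) s_{α/κ}(y), where c is the exponent of x and a
  -- that of y.
  S-concat : ∀ α → IsPartition α → ∀ c a → S α [] (c ++ a) ≡ ∑ (subpartitions α) (λ κ → S κ [] c * S α κ a)
  S-concat α αp c a = trans (S≡K R (length c + length a) α [] (c ++ a) ≤-refl αd (λ _ → z≤n) (Lₚ.length-++ c))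
    (trans (K-concat R (length c) (length a) α αp ≤-refl c a refl)
    (∑-cong (subpartitions α) (λ κ κ∈ → let (κp , κ⊆) = sound (subE α) κ∈ in
      sym (cong₂ _*_ (S≡K R (length c) κ [] c (length-⊆ α κ κp (contained⁻ κ α κ⊆)) (Dominant-partition κp) (λ _ → z≤n) refl)
        (S≡K R (length a) α κ a ≤-refl αd (Dominant-partition κp) refl)))))
    where
    R = length α
    αd = Dominant-partition αp

open Concatenation

-- The substitution Φ, the Remmel-Whitney basis and its products

module RemmelWhitneyBasis where

  ∑-applyUpTo : ∀ (h : ℕ → ℕ) n (f : ℕ → ℤ) → ∑ (applyUpTo h n) f ≡ ∑ (upTo n) (f ∘ h)
  ∑-applyUpTo h n f = trans (cong (λ l → ∑ l f) (sym (Lₚ.map-upTo h n))) (∑-map h (upTo n) f)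

  Δ : ℕ → (ℕ → ℕ → ℤ) → ℤ
  Δ x f = ∑ (upTo (suc x)) (λ k → f k (x ∸ k))

  Δ-cong : ∀ x {f g} → (∀ k l → f k l ≡ g k l) → Δ x f ≡ Δ x g
  Δ-cong x e = ∑-cong′ (upTo (suc x)) (λ k → e k (x ∸ k))

  Δ-suc : ∀ x f → Δ (suc x) f ≡ f 0 (suc x) ⊕ Δ x (λ k l → f (suc k) l)
  Δ-suc x f = cong (f 0 (suc x) ⊕_) (∑-applyUpTo suc (suc x) (λ k → f k (suc x ∸ k)))

  Δ-+ : ∀ x f g → Δ x (λ k l → f k l ⊕ g k l) ≡ Δ x f ⊕ Δ x g
  Δ-+ x f g = ∑-+ (upTo (suc x)) (λ k → f k (x ∸ k)) (λ k → g k (x ∸ k))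

  Δ-assoc : ∀ x (f : ℕ → ℕ → ℕ → ℤ) → Δ x (λ k l → Δ k (λ i j → f i j l)) ≡ Δ x (λ i m → Δ m (λ j l → f i j l))
  Δ-assoc zero    f = refl
  Δ-assoc (suc x) f = trans (Δ-suc x (λ k l → Δ k (λ i j → f i j l))) (trans (cong (Δ 0 (λ i j → f i j (suc x)) ⊕_) (trans (Δ-cong x (λ k l → Δ-suc k (λ i j → f i j l)))
      (trans (Δ-+ x (λ k l → f 0 (suc k) l) (λ k l → Δ k (λ i j → f (suc i) j l))) (cong (Δ x (λ k l → f 0 (suc k) l) ⊕_) (Δ-assoc x (λ i → f (suc i)))))))
    (trans (lem (f 0 0 (suc x)) (Δ x (λ k l → f 0 (suc k) l)) (Δ x (λ i m → Δ m (f (suc i)))))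
    (trans (cong (_⊕ Δ x (λ i m → Δ m (f (suc i)))) (sym (Δ-suc x (f 0)))) (sym (Δ-suc x (λ i m → Δ m (f i)))))))
    where
    lem : ∀ a b c → (a ⊕ 0ℤ) ⊕ (b ⊕ c) ≡ (a ⊕ b) ⊕ c
    lem = ℤ-solver.solve-∀

  Δ-comm : ∀ x f → Δ x f ≡ Δ x (λ k l → f l k)
  Δ-comm x f = ∑-bij (upToE (suc x)) (upToE (suc x)) (x ∸_) (x ∸_) (λ k _ → s≤s (m∸n≤m x k)) (λ k _ → s≤s (m∸n≤m x k))
    (λ k k< → m∸[m∸n]≡n (≤-pred k<)) (λ k k< → m∸[m∸n]≡n (≤-pred k<)) _ (λ k → f (x ∸ k) k)
    (λ k k< → cong (λ z → f z (x ∸ k)) (sym (m∸[m∸n]≡n (≤-pred k<))))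

  -- The sum over all ways of writing the exponent a as u + v. Both the product in `Sym2` and Φ are
  -- of this form; its laws come entry by entry from those of `Δ`, the same sum for one exponent.
  ∑₂ : List ℕ → (List ℕ → List ℕ → ℤ) → ℤ
  ∑₂ a h = ∑ (splits a) (λ u → h u (minus a u))

  ∑₂-cong : ∀ a {f g} → (∀ u v → f u v ≡ g u v) → ∑₂ a f ≡ ∑₂ a g
  ∑₂-cong a e = ∑-cong′ (splits a) (λ u → e u (minus a u))

  ∑₂-cons : ∀ x a h → ∑₂ (x ∷ a) h ≡ Δ x (λ k l → ∑₂ a (λ u v → h (k ∷ u) (l ∷ v)))
  ∑₂-cons x a h = ∑-splits x a (λ u → h u (minus (x ∷ a) u))

  ∑₂-Δ : ∀ a x (f : ℕ → ℕ → List ℕ → List ℕ → ℤ) → ∑₂ a (λ u v → Δ x (λ k l → f k l u v)) ≡ Δ x (λ k l → ∑₂ a (f k l))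
  ∑₂-Δ a x f = ∑-swap (splits a) (upTo (suc x)) (λ u k → f k (x ∸ k) u (minus a u))

  ∑₂-swap : ∀ a c (f : List ℕ → List ℕ → List ℕ → List ℕ → ℤ) → ∑₂ a (λ u v → ∑₂ c (f u v)) ≡ ∑₂ c (λ y z → ∑₂ a (λ u v → f u v y z))
  ∑₂-swap a c f = ∑-swap (splits a) (splits c) (λ u y → f u (minus a u) y (minus c y))

  ∑₂-∑ : ∀ {A : Set} a (xs : List A) (f : A → List ℕ → List ℕ → ℤ) → ∑₂ a (λ u v → ∑ xs (λ x → f x u v)) ≡ ∑ xs (λ x → ∑₂ a (f x))
  ∑₂-∑ a xs f = ∑-swap (splits a) xs (λ u x → f x u (minus a u))

  ∑₂-*ˡ : ∀ a k f → ∑₂ a (λ u v → k * f u v) ≡ k * ∑₂ a f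
  ∑₂-*ˡ a k f = ∑-*ˡ (splits a) k (λ u → f u (minus a u))

  ∑₂-product : ∀ a c f g → ∑₂ a f * ∑₂ c g ≡ ∑₂ a (λ u v → ∑₂ c (λ y z → f u v * g y z))
  ∑₂-product a c f g = ∑-product (splits a) (splits c) (λ u → f u (minus a u)) (λ y → g y (minus c y))

  ∑₂-comm : ∀ a h → ∑₂ a h ≡ ∑₂ a (λ u v → h v u)
  ∑₂-comm []      h = refl
  ∑₂-comm (x ∷ a) h = trans (∑₂-cons x a h) (trans (Δ-comm x (λ k l → ∑₂ a (λ u v → h (k ∷ u) (l ∷ v)))) (trans (Δ-cong x (λ k l → ∑₂-comm a (λ u v → h (l ∷ u) (k ∷ v)))) (sym (∑₂-cons x a (λ u v → h v u)))))

  ∑₂-assoc : ∀ a (h : List ℕ → List ℕ → List ℕ → ℤ) →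
    ∑₂ a (λ u v → ∑₂ u (λ p q → h p q v)) ≡ ∑₂ a (λ p w → ∑₂ w (λ q v → h p q v))
  ∑₂-assoc []      h = refl
  ∑₂-assoc (x ∷ a) h = trans (∑₂-cons x a (λ u v → ∑₂ u (λ p q → h p q v)))
    (trans (Δ-cong x (λ k l → trans (∑₂-cong a (λ u v → ∑₂-cons k u (λ p q → h p q (l ∷ v)))) (trans (∑₂-Δ a k (λ i j u v → ∑₂ u (λ p q → h (i ∷ p) (j ∷ q) (l ∷ v))))
      (Δ-cong k (λ i j → ∑₂-assoc a (λ p q v → h (i ∷ p) (j ∷ q) (l ∷ v)))))))
    (trans (Δ-assoc x (λ i j l → ∑₂ a (λ p w → ∑₂ w (λ q v → h (i ∷ p) (j ∷ q) (l ∷ v)))))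
    (trans (Δ-cong x (λ i m → trans (sym (∑₂-Δ a m (λ j l p w → ∑₂ w (λ q v → h (i ∷ p) (j ∷ q) (l ∷ v))))) (∑₂-cong a (λ p w → sym (∑₂-cons m w (h (i ∷ p)))))))
      (sym (∑₂-cons x a (λ p w → ∑₂ w (h p)))))))

  -- Both sides run over all a = p + p′ + x + x′; only the grouping differs.
  ∑₂-interchange : ∀ a (N : List ℕ → List ℕ → List ℕ → List ℕ → ℤ) →
    ∑₂ a (λ u v → ∑₂ u (λ p p′ → ∑₂ v (λ x x′ → N p p′ x x′))) ≡ ∑₂ a (λ u v → ∑₂ u (λ p x → ∑₂ v (λ p′ x′ → N p p′ x x′)))
  ∑₂-interchange a N = trans (∑₂-assoc a (λ p p′ v → ∑₂ v (N p p′))) (trans (∑₂-cong a (λ p w →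
      trans (sym (∑₂-assoc w (N p))) (trans (∑₂-cong w (λ z x′ → ∑₂-comm z (λ p′ x → N p p′ x x′))) (∑₂-assoc w (λ x p′ x′ → N p p′ x x′)))))
    (sym (∑₂-assoc a (λ p x v → ∑₂ v (λ p′ x′ → N p p′ x x′)))))

  ∑₂-++ : ∀ v c h → ∑₂ (v ++ c) h ≡ ∑₂ v (λ x x′ → ∑₂ c (λ y y′ → h (x ++ y) (x′ ++ y′)))
  ∑₂-++ []      c h = sym (ℤₚ.+-identityʳ _)
  ∑₂-++ (k ∷ v) c h = trans (∑₂-cons k (v ++ c) h) (trans (Δ-cong k (λ i j → ∑₂-++ v c (λ u w → h (i ∷ u) (j ∷ w)))) (sym (∑₂-cons k v (λ x x′ → ∑₂ c (λ y y′ → h (x ++ y) (x′ ++ y′))))))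

  sumℤ-∑ : ∀ xs → sumℤ xs ≡ ∑ xs id
  sumℤ-∑ []       = refl
  sumℤ-∑ (x ∷ xs) = cong (x ⊕_) (sumℤ-∑ xs)

  *S-∑₂ : ∀ f g a b → (f *S g) a b ≡ ∑₂ a (λ a′ a″ → ∑₂ b (λ b′ b″ → f a′ b′ * g a″ b″))
  *S-∑₂ f g a b = trans (sumℤ-∑ (concatMap rowOf (splits a))) (trans (∑-concatMap rowOf (splits a) id)
    (∑-cong′ (splits a) (λ a′ → ∑-map (λ b′ → f a′ b′ * g (minus a a′) (minus b b′)) (splits b) id)))
    where
    rowOf : List ℕ → List ℤ
    rowOf a′ = map (λ b′ → f a′ b′ * g (minus a a′) (minus b b′)) (splits b)

  sumS-∑ : ∀ fs a b → sumS fs a b ≡ ∑ fs (λ f → f a b)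
  sumS-∑ []       a b = refl
  sumS-∑ (f ∷ fs) a b = cong (f a b ⊕_) (sumS-∑ fs a b)

  -- Φ substitutes the union of both sets of variables for the second set: (Φ f)(x; y) = f(x; x, y).
  Φ : Sym2 → Sym2
  Φ f a c = ∑₂ a (λ u v → f u (v ++ c))

  -- A coefficient on either side is a sum over four shares of a: each factor receives one as its
  -- own x and one as the x among its second variables. The two sides group these shares
  -- differently.
  Φ-* : ∀ f g a c → Φ (f *S g) a c ≡ (Φ f *S Φ g) a c
  Φ-* f g a c = trans (∑₂-cong a (λ u v → trans (*S-∑₂ f g u (v ++ c)) (∑₂-cong u (λ p p′ → ∑₂-++ v c (λ q q′ → f p q * g p′ q′)))))
    (trans (∑₂-interchange a (λ p p′ x x′ → ∑₂ c (λ y y′ → f p (x ++ y) * g p′ (x′ ++ y′))))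
    (trans (∑₂-cong a (λ u v → trans (∑₂-cong u (λ p x → ∑₂-swap v c (λ p′ x′ y y′ → f p (x ++ y) * g p′ (x′ ++ y′))))
        (trans (∑₂-swap u c (λ p x y y′ → ∑₂ v (λ p′ x′ → f p (x ++ y) * g p′ (x′ ++ y′))))
          (∑₂-cong c (λ y y′ → sym (∑₂-product u v (λ p x → f p (x ++ y)) (λ p′ x′ → g p′ (x′ ++ y′))))))))
      (sym (*S-∑₂ (Φ f) (Φ g) a c))))

  Stable : Sym2 → Set
  Stable f = ∀ a b → f a (0 ∷ b) ≡ f a b

  Stable-zeros : ∀ f → Stable f → ∀ a m c → f a (zeros m ++ c) ≡ f a c
  Stable-zeros f s a zero    c = refl
  Stable-zeros f s a (suc m) c = trans (s a (zeros m ++ c)) (Stable-zeros f s a m c)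

  splitsE : ∀ a → Enum (λ u → length u ≡ length a × (∀ k → part u k ≤ part a k))
  splitsE a = record { elems = splits a ; unique = uniq a ; sound = splits-sound a ; complete = λ {u} (l , h) → cmp a u l h }
    where
    uniq : ∀ a → Unique (splits a)
    uniq []      = [] ∷ []
    uniq (x ∷ a) = Unique-cons (upTo (suc x)) (λ _ → splits a) (Uₚ.upTo⁺ _) (λ _ → uniq a)
    cmp : ∀ a u → length u ≡ length a → (∀ k → part u k ≤ part a k) → u ∈ splits a
    cmp []      []      l h = here refl
    cmp (x ∷ a) (y ∷ u) l h = ∈-cons⁺ (upTo (suc x)) (λ _ → splits a) (∈ₚ.∈-upTo⁺ (s≤s (h 0))) (cmp a u (suc-injective l) (h ∘ suc))

  minus-self : ∀ a → minus a a ≡ zeros (length a)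
  minus-self []      = refl
  minus-self (x ∷ a) = cong₂ _∷_ (n∸n≡0 x) (minus-self a)

  -- The term u = a of (Φ f) a c is f a c; the others involve smaller first exponents.
  Φ-injective : ∀ f g → Stable f → Stable g → (∀ a c → Φ f a c ≡ Φ g a c) → ∀ a c → f a c ≡ g a c
  Φ-injective f g sf sg e a c = go (suc (size a)) a c ≤-refl
    where
    go : ∀ m a c → size a < m → f a c ≡ g a c
    go (suc m) a c (s≤s a≤) = cancel (trans (sym difference) (trans (∑-+ (splits a) F (λ u → ℤ.- G u)) (trans (cong (∑ (splits a) F ⊕_) (∑-neg (splits a) G))
        (trans (cong (λ z → z ⊕ ℤ.- ∑ (splits a) G) (e a c)) (ℤₚ.+-inverseʳ (∑ (splits a) G))))))
      where
      F G : List ℕ → ℤ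
      F u = f u (minus a u ++ c)
      G u = g u (minus a u ++ c)
      smaller : ∀ u → length u ≡ length a × (∀ k → part u k ≤ part a k) → u ≢ a → size u < size a
      smaller u (l , h) u≢ = ≤∧≢⇒< (≤-trans (m≤m+n _ _) (≤-reflexive sz)) (λ s≡ → u≢ (part-ext l (λ k _ →
          ≤-antisym (h k) (m∸n≡0⇒m≤n (trans (sym (part-minus a u k l)) (size-zero (minus a u) (+-cancelˡ-≡ (size u) _ 0 (trans sz (trans (sym s≡) (sym (+-identityʳ _))))) k))))))
        where
        sz : size u + size (minus a u) ≡ size a
        sz = size-minus a u l h
      at-a : ∀ f → Stable f → f a (minus a a ++ c) ≡ f a c
      at-a f s = trans (cong (λ z → f a (z ++ c)) (minus-self a)) (Stable-zeros f s a (length a) c)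
      difference : ∑ (splits a) (λ u → F u ⊕ ℤ.- G u) ≡ f a c ⊕ ℤ.- g a c
      difference = trans (∑-single (splitsE a) a (refl , λ _ → ≤-refl) _ (λ u y u≢ →
          trans (cong (_⊕ ℤ.- G u) (go m u (minus a u ++ c) (<-≤-trans (smaller u y u≢) a≤))) (ℤₚ.+-inverseʳ (G u))))
        (cong₂ (λ x y → x ⊕ ℤ.- y) (at-a f sf) (at-a g sg))
      cancel : ∀ {x y} → x ⊕ ℤ.- y ≡ 0ℤ → x ≡ y
      cancel {x} {y} h = ℤₚ.i-j≡0⇒i≡j x y h

  eqList⁻ : ∀ x y → T (eqList x y) → x ≡ y
  eqList⁻ []      []      _ = refl
  eqList⁻ (a ∷ x) (b ∷ y) h = let (p , q) = T∧⁻ h in cong₂ _∷_ (≡ᵇ⇒≡ a b p) (eqList⁻ x y q)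

  eqList⁺ : ∀ x → T (eqList x x)
  eqList⁺ []      = tt
  eqList⁺ (a ∷ x) = T∧⁺ (≡ᵇ-refl a) (eqList⁺ x)

  -- The empty tableau. It accounts for the term s_α in Φ s_α, as the quiver has no loops.
  RW-diagonal : ∀ ν α → RW-count ν ν α α ≡ 1ℤ
  RW-diagonal ν α = cong₂ (λ b n → 𝟙 b * pos n) (T-true (contained⁺ ν ν (λ _ → ≤-refl))) length-RW
    where
    empty-row : ∀ ν i → rowCells ν ν i ≡ []
    empty-row ν i = cong (λ m → map (i ,_) (applyUpTo (part ν i +_) m)) (n∸n≡0 (part ν i))
    empty : ∀ ν → skewCells ν ν ≡ []
    empty ν = go id (length ν)
      where
      go : ∀ h n → concatMap (rowCells ν ν) (applyUpTo h n) ≡ []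
      go h zero    = refl
      go h (suc n) = trans (cong (_++ concatMap (rowCells ν ν) (applyUpTo (h ∘ suc) n)) (empty-row ν (h 0))) (go (h ∘ suc) n)
    length-RW : length (RW ν ν α α) ≡ 1
    length-RW rewrite empty ν | empty α | T-true (contained⁺ α α (λ _ → ≤-refl)) | T-true (contained⁺ ν ν (λ _ → ≤-refl)) = refl

  s-Stable : ∀ α₁ α₂ → IsPartition α₂ → Stable (s α₁ α₂)
  s-Stable α₁ α₂ p a b = cong (S α₁ [] a *_) (S-stable α₂ [] b (Dominant-partition p) (λ _ → z≤n))

  isEqual : List ℕ → List ℕ → List ℕ → List ℕ → Bool
  isEqual α₁ α₂ β₁ β₂ = eqList β₁ α₁ ∧ eqList β₂ α₂

  module Arrows (α₁ α₂ : List ℕ) (p₁ : IsPartition α₁) (p₂ : IsPartition α₂) where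

    degree : List ℕ → ℕ
    degree β₂ = size α₁ + (size α₂ ∸ size β₂)

    arrows : List ℕ → List ℕ → List (List ℕ × List ℕ)
    arrows β₂ β₁ = if contained α₁ β₁ ∧ not (isEqual α₁ α₂ β₁ β₂) then map (λ _ → (β₁ , β₂)) (RW β₁ α₁ α₂ β₂) else []

    ∑-arrows : ∀ h → ∑ (arrowTargets α₁ α₂) h ≡ ∑ (subpartitions α₂) (λ β₂ → ∑ (partitions (degree β₂)) (λ β₁ → ∑ (arrows β₂ β₁) h))
    ∑-arrows h = trans (∑-concatMap (λ β₂ → concatMap (arrows β₂) (partitions (degree β₂))) (subpartitions α₂) h) (∑-cong′ (subpartitions α₂) (λ β₂ → ∑-concatMap (arrows β₂) (partitions (degree β₂)) h))

    -- There is one arrow for each tableau except when the target would be the source; the second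
    -- summand restores that case.
    ∑-parallel : ∀ β₂ β₁ h → RW-count β₁ α₁ α₂ β₂ * h (β₁ , β₂) ≡ ∑ (arrows β₂ β₁) h ⊕ 𝟙 (isEqual α₁ α₂ β₁ β₂) * (RW-count β₁ α₁ α₂ β₂ * h (β₁ , β₂))
    ∑-parallel β₂ β₁ h = go (contained α₁ β₁) (isEqual α₁ α₂ β₁ β₂) (RW β₁ α₁ α₂ β₂) (β₁ , β₂)
      where
      go : ∀ b b′ (Ts : List Filling) t → (𝟙 b * pos (length Ts)) * h t ≡
        ∑ (if b ∧ not b′ then map (λ _ → t) Ts else []) h ⊕ 𝟙 b′ * ((𝟙 b * pos (length Ts)) * h t)
      go false b′    Ts t = sym (trans (ℤₚ.+-identityˡ _) (ℤₚ.*-zeroʳ (𝟙 b′)))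
      go true  true  Ts t = sym (trans (ℤₚ.+-identityˡ _) (ℤₚ.*-identityˡ _))
      go true  false Ts t = trans (cong (_* h t) (ℤₚ.*-identityˡ (pos (length Ts)))) (trans (sym repeated) (sym (ℤₚ.+-identityʳ _)))
        where
        repeated : ∑ (map (λ _ → t) Ts) h ≡ pos (length Ts) * h t
        repeated = trans (∑-map (λ _ → t) Ts h) (trans (trans (∑-cong′ Ts (λ _ → sym (ℤₚ.*-identityˡ _))) (∑-*ʳ Ts (h t) (λ _ → 1ℤ))) (cong (_* h t) (sym (∑-length Ts))))

    -- If β₂ ⊆ α₂ had the same size it would be α₂; then β₁ ⊇ α₁ would also have the size of α₁ and
    -- be equal to it, which the quiver excludes.
    target : ∀ {t} → t ∈ arrowTargets α₁ α₂ → IsPartition (proj₁ t) × IsPartition (proj₂ t) × size (proj₂ t) < size α₂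
    target {t} t∈ = go (∈-concatMap⁻ (λ β₂ → concatMap (arrows β₂) (partitions (degree β₂))) (subpartitions α₂) t∈)
      where
      go : (∃ λ β₂ → β₂ ∈ subpartitions α₂ × t ∈ concatMap (arrows β₂) (partitions (degree β₂))) → _
      go (β₂ , β₂∈ , t∈′) with ∈-concatMap⁻ (arrows β₂) (partitions (degree β₂)) t∈′
      ... | β₁ , β₁∈ , t∈″ = at (contained α₁ β₁) (isEqual α₁ α₂ β₁ β₂) refl refl t∈″
        where
        q₂ = sound (subE α₂) β₂∈
        q₁ = sound (partitionsE (degree β₂)) β₁∈
        β₂⊆ = contained⁻ β₂ α₂ (proj₂ q₂)
        equal-parts : ∀ {x y} → IsPartition x → IsPartition y → (∀ i → part x i ≤ part y i) → size x ≡ size y → x ≡ y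
        equal-parts {x} {y} px py h s = partition-ext px py (pointwise (length y) (length-⊆ y x px h) s)
          where
          pointwise : ∀ n → length x ≤ n → size x ≡ size y → ∀ i → part x i ≡ part y i
          pointwise n x≤ s i = ≤-antisym (h i) (m∸n≡0⇒m≤n (gap i (i <? length y)))
            where
            gaps : sumTo (length y) (λ i → part y i ∸ part x i) ≡ 0
            gaps = +-cancelʳ-≡ (size x) _ 0 (trans (cong (sumTo (length y) (λ i → part y i ∸ part x i) +_) (size≡sumTo x (length y) (length-⊆ y x px h)))
              (trans (sym (sumTo-+ (length y) _ _)) (trans (sumTo-cong (length y) (λ i _ → m∸n+n≡m (h i))) (trans (sym (size≡sumTo y (length y) ≤-refl)) (sym s)))))
            gap : ∀ i → Dec (i < length y) → part y i ∸ part x i ≡ 0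
            gap i (yes i<) = n≤0⇒n≡0 (≤-trans (m≤n+m _ (sumTo i (λ i → part y i ∸ part x i))) (≤-trans (sumTo-≤ {suc i} {length y} (λ i → part y i ∸ part x i) i<) (≤-reflexive gaps)))
            gap i (no i≮)  = trans (cong (_∸ part x i) (part-≥ y i (≮⇒≥ i≮))) (0∸n≡0 (part x i))
        at : ∀ b b′ → contained α₁ β₁ ≡ b → isEqual α₁ α₂ β₁ β₂ ≡ b′ → t ∈ (if b ∧ not b′ then map (λ _ → (β₁ , β₂)) (RW β₁ α₁ α₂ β₂) else []) →
          IsPartition (proj₁ t) × IsPartition (proj₂ t) × size (proj₂ t) < size α₂
        at true false e e′ t∈ with ∈ₚ.∈-map⁻ (λ _ → (β₁ , β₂)) t∈
        ... | _ , _ , refl = proj₁ q₁ , proj₁ q₂ , ≤∧≢⇒< (size-⊆ α₂ β₂ (proj₁ q₂) β₂⊆) (λ s≡ → subst T e′ (equal s≡))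
          where
          equal : size β₂ ≡ size α₂ → T (isEqual α₁ α₂ β₁ β₂)
          equal s≡ with refl ← equal-parts (proj₁ q₂) p₂ β₂⊆ s≡
                   with refl ← equal-parts p₁ (proj₁ q₁) (contained⁻ α₁ β₁ (true-T e)) (sym (trans (proj₂ q₁) (trans (cong (size α₁ +_) (n∸n≡0 (size β₂))) (+-identityʳ _))))
            = T∧⁺ (eqList⁺ α₁) (eqList⁺ β₂)

    -- Symmetry of s_{α₂} lets the exponents v of x and c of y trade places, so that the coproduct
    -- formula leaves s_κ in y and s_{α₂/κ} in x, ready to be multiplied by s_{α₁}(x). The term κ =
    -- α₂, γ = α₁ is s_α; all others are arrows.
    Φ-s : ∀ a c → Φ (s α₁ α₂) a c ≡ s α₁ α₂ a c ⊕ ∑ (arrowTargets α₁ α₂) (λ t → s (proj₁ t) (proj₂ t) a c)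
    Φ-s a c = trans (∑₂-cong a (λ u v → cong (S α₁ [] u *_) (trans (Symmetric-↭ (S α₂ []) (S-symmetric α₂ [] (Dominant-partition p₂) (λ _ → z≤n)) (Permₚ.++-comm v c)) (S-concat α₂ p₂ c v))))
      (trans (∑₂-cong a (λ u v → trans (sym (∑-*ˡ Sub (S α₁ [] u) (λ κ → S κ [] c * S α₂ κ v))) (∑-cong′ Sub (λ κ → lem (S α₁ [] u) (S κ [] c) (S α₂ κ v)))))
      (trans (∑₂-∑ a Sub (λ κ u v → S κ [] c * (S α₁ [] u * S α₂ κ v)))
      (trans (∑-cong Sub (λ κ κ∈ → let (κp , κ⊆) = sound (subE α₂) κ∈ in trans (∑₂-*ˡ a (S κ [] c) (λ u v → S α₁ [] u * S α₂ κ v))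
          (trans (cong (S κ [] c *_) (S*S-skew α₁ α₂ κ p₁ p₂ κp (contained⁻ κ α₂ κ⊆) a))
          (trans (sym (∑-*ˡ (partitions (degree κ)) (S κ [] c) (λ γ → RW-count γ α₁ α₂ κ * S γ [] a)))
            (∑-cong′ (partitions (degree κ)) (λ γ → trans (lem₂ (S κ [] c) (RW-count γ α₁ α₂ κ) (S γ [] a)) (∑-parallel κ γ (λ t → s (proj₁ t) (proj₂ t) a c))))))))
      (trans (∑-cong′ Sub (λ κ → ∑-+ (partitions (degree κ)) (λ γ → ∑ (arrows κ γ) h) (diag κ)))
      (trans (∑-+ Sub (λ κ → ∑ (partitions (degree κ)) (λ γ → ∑ (arrows κ γ) h)) (λ κ → ∑ (partitions (degree κ)) (diag κ)))
      (trans (cong₂ _⊕_ (sym (∑-arrows h)) diagonal-term) (ℤₚ.+-comm (∑ (arrowTargets α₁ α₂) h) (s α₁ α₂ a c))))))))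
      where
      Sub = subpartitions α₂
      h : List ℕ × List ℕ → ℤ
      h t = s (proj₁ t) (proj₂ t) a c
      diag : List ℕ → List ℕ → ℤ
      diag κ γ = 𝟙 (isEqual α₁ α₂ γ κ) * (RW-count γ α₁ α₂ κ * s γ κ a c)
      lem : ∀ x y z → x * (y * z) ≡ y * (x * z)
      lem = ℤ-solver.solve-∀
      lem₂ : ∀ x y z → x * (y * z) ≡ y * (z * x)
      lem₂ = ℤ-solver.solve-∀
      off : ∀ κ γ → ¬ T (isEqual α₁ α₂ γ κ) → diag κ γ ≡ 0ℤ
      off κ γ ¬e = cong (λ b → 𝟙 b * (RW-count γ α₁ α₂ κ * s γ κ a c)) (¬T-false ¬e)
      diagonal-term : ∑ Sub (λ κ → ∑ (partitions (degree κ)) (diag κ)) ≡ s α₁ α₂ a c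
      diagonal-term = trans (∑-single (subE α₂) α₂ (p₂ , contained⁺ α₂ α₂ (λ _ → ≤-refl)) _
          (λ κ _ κ≢ → ∑-zero (partitions (degree κ)) (λ γ _ → off κ γ (λ e → κ≢ (eqList⁻ κ α₂ (proj₂ (T∧⁻ {eqList γ α₁} e)))))))
        (trans (∑-single (partitionsE (degree α₂)) α₁ (p₁ , sym (trans (cong (size α₁ +_) (n∸n≡0 (size α₂))) (+-identityʳ _))) _
          (λ γ _ γ≢ → off α₂ γ (λ e → γ≢ (eqList⁻ γ α₁ (proj₁ (T∧⁻ e))))))
        (trans (cong₂ (λ b k → 𝟙 b * (k * s α₁ α₂ a c)) (T-true (T∧⁺ (eqList⁺ α₁) (eqList⁺ α₂))) (RW-diagonal α₁ α₂))
          (trans (ℤₚ.*-identityˡ _) (ℤₚ.*-identityˡ _))))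

  sum-targets : ∀ k α₁ α₂ a b → wF (suc k) α₁ α₂ a b ≡ s α₁ α₂ a b ⊕ ℤ.- ∑ (arrowTargets α₁ α₂) (λ t → wF k (proj₁ t) (proj₂ t) a b)
  sum-targets k α₁ α₂ a b = cong (λ z → s α₁ α₂ a b ⊕ ℤ.- z) (trans (sumS-∑ (map (λ t → wF k (proj₁ t) (proj₂ t)) (arrowTargets α₁ α₂)) a b) (∑-map (λ t → wF k (proj₁ t) (proj₂ t)) (arrowTargets α₁ α₂) (λ f → f a b)))

  wF-Stable : ∀ k α₁ α₂ → IsPartition α₁ → IsPartition α₂ → Stable (wF k α₁ α₂)
  wF-Stable zero    α₁ α₂ p₁ p₂ a b = s-Stable α₁ α₂ p₂ a b
  wF-Stable (suc k) α₁ α₂ p₁ p₂ a b = trans (sum-targets k α₁ α₂ a (0 ∷ b)) (trans (cong₂ (λ x y → x ⊕ ℤ.- y) (s-Stable α₁ α₂ p₂ a b)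
    (∑-cong (arrowTargets α₁ α₂) (λ t t∈ → let (q₁ , q₂ , _) = Arrows.target α₁ α₂ p₁ p₂ t∈ in wF-Stable k (proj₁ t) (proj₂ t) q₁ q₂ a b))) (sym (sum-targets k α₁ α₂ a b)))

  -- The sum over arrows in Φ s_α is what the recursion subtracts, once Φ w is known at the targets.
  -- Any fuel k ≥ |α₂| is allowed because a target inherits k - 1, which may exceed the size of its
  -- second partition.
  Φ-wF : ∀ k α₁ α₂ → IsPartition α₁ → IsPartition α₂ → size α₂ ≤ k → ∀ a c → Φ (wF k α₁ α₂) a c ≡ s α₁ α₂ a c
  -- When α₂ has size 0 no arrow leaves, since its target would have a smaller second partition.
  Φ-wF zero    α₁ α₂ p₁ p₂ α₂≤ a c = trans (Arrows.Φ-s α₁ α₂ p₁ p₂ a c) (trans (cong (s α₁ α₂ a c ⊕_) (∑-zero (arrowTargets α₁ α₂) (λ t t∈ →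
    let (_ , _ , lt) = Arrows.target α₁ α₂ p₁ p₂ t∈ in ⊥-elim (n≮0 (<-≤-trans lt α₂≤))))) (ℤₚ.+-identityʳ _))
  Φ-wF (suc k) α₁ α₂ p₁ p₂ α₂≤ a c = trans (∑₂-cong a (λ u v → sum-targets k α₁ α₂ u (v ++ c)))
    (trans (∑-+ (splits a) (λ u → s α₁ α₂ u (minus a u ++ c)) _)
    (trans (cong₂ _⊕_ (Arrows.Φ-s α₁ α₂ p₁ p₂ a c) (trans (∑-neg (splits a) _) (cong ℤ.-_ (trans (∑₂-∑ a (arrowTargets α₁ α₂) (λ t u v → wF k (proj₁ t) (proj₂ t) u (v ++ c)))
        (∑-cong (arrowTargets α₁ α₂) (λ t t∈ → let (q₁ , q₂ , lt) = Arrows.target α₁ α₂ p₁ p₂ t∈ in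
          Φ-wF k (proj₁ t) (proj₂ t) q₁ q₂ (≤-pred (≤-trans lt α₂≤)) a c))))))
      (lem (s α₁ α₂ a c) (∑ (arrowTargets α₁ α₂) (λ t → s (proj₁ t) (proj₂ t) a c)))))
    where
    lem : ∀ x y → (x ⊕ y) ⊕ ℤ.- y ≡ x
    lem = ℤ-solver.solve-∀

  Φ-w : ∀ α₁ α₂ → IsPartition α₁ → IsPartition α₂ → ∀ a c → Φ (w α₁ α₂) a c ≡ s α₁ α₂ a c
  Φ-w α₁ α₂ p₁ p₂ = Φ-wF (size α₂) α₁ α₂ p₁ p₂ ≤-refl

  w-Stable : ∀ α₁ α₂ → IsPartition α₁ → IsPartition α₂ → Stable (w α₁ α₂)
  w-Stable α₁ α₂ = wF-Stable (size α₂) α₁ α₂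

  *S-Stable : ∀ f g → Stable f → Stable g → Stable (f *S g)
  *S-Stable f g sf sg a b = trans (*S-∑₂ f g a (0 ∷ b)) (trans (∑₂-cong a (λ a′ a″ → trans (∑₂-cons 0 b (λ b′ b″ → f a′ b′ * g a″ b″))
    (trans (ℤₚ.+-identityʳ _) (∑₂-cong b (λ b′ b″ → cong₂ _*_ (sf a′ b′) (sg a″ b″)))))) (sym (*S-∑₂ f g a b)))

  *S-cong : ∀ {f f′ g g′} → (∀ a b → f a b ≡ f′ a b) → (∀ a b → g a b ≡ g′ a b) → ∀ a b → (f *S g) a b ≡ (f′ *S g′) a b
  *S-cong {f} {f′} {g} {g′} ef eg a b = trans (*S-∑₂ f g a b) (trans (∑₂-cong a (λ a′ a″ → ∑₂-cong b (λ b′ b″ → cong₂ _*_ (ef a′ b′) (eg a″ b″)))) (sym (*S-∑₂ f′ g′ a b)))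

  module Product (λ₁ λ₂ μ₁ μ₂ : List ℕ) (pλ₁ : IsPartition λ₁) (pλ₂ : IsPartition λ₂) (pμ₁ : IsPartition μ₁) (pμ₂ : IsPartition μ₂) where

    Γ₁ Γ₂ : List (List ℕ)
    Γ₁ = partitions (size λ₁ + size μ₁)
    Γ₂ = partitions (size λ₂ + size μ₂)

    coeff : List ℕ → List ℕ → ℤ
    coeff γ₁ γ₂ = pos (LR γ₁ λ₁ μ₁) * pos (LR γ₂ λ₂ μ₂)

    combine : (List ℕ → List ℕ → Sym2) → Sym2
    combine f = sumS (concatMap (λ γ₁ → map (λ γ₂ → coeff γ₁ γ₂ ·S f γ₁ γ₂) Γ₂) Γ₁)

    combine-∑ : ∀ f a b → combine f a b ≡ ∑ Γ₁ (λ γ₁ → ∑ Γ₂ (λ γ₂ → coeff γ₁ γ₂ * f γ₁ γ₂ a b))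
    combine-∑ f a b = trans (sumS-∑ (concatMap (λ γ₁ → map (λ γ₂ → coeff γ₁ γ₂ ·S f γ₁ γ₂) Γ₂) Γ₁) a b) (trans (∑-concatMap (λ γ₁ → map (λ γ₂ → coeff γ₁ γ₂ ·S f γ₁ γ₂) Γ₂) Γ₁ (λ g → g a b))
      (∑-cong′ Γ₁ (λ γ₁ → ∑-map (λ γ₂ → coeff γ₁ γ₂ ·S f γ₁ γ₂) Γ₂ (λ g → g a b))))

    s*s : ∀ a b → (s λ₁ λ₂ *S s μ₁ μ₂) a b ≡ combine s a b
    s*s a b = trans (*S-∑₂ (s λ₁ λ₂) (s μ₁ μ₂) a b) (trans (∑₂-cong a (λ a′ a″ → ∑₂-cong b (λ b′ b″ → lem (S λ₁ [] a′) (S λ₂ [] b′) (S μ₁ [] a″) (S μ₂ [] b″))))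
      (trans (sym (∑₂-product a b (λ a′ a″ → S λ₁ [] a′ * S μ₁ [] a″) (λ b′ b″ → S λ₂ [] b′ * S μ₂ [] b″)))
      (trans (cong₂ _*_ (littlewood-richardson λ₁ μ₁ pλ₁ pμ₁ a) (littlewood-richardson λ₂ μ₂ pλ₂ pμ₂ b))
      (trans (∑-product Γ₁ Γ₂ (λ γ₁ → pos (LR γ₁ λ₁ μ₁) * S γ₁ [] a) (λ γ₂ → pos (LR γ₂ λ₂ μ₂) * S γ₂ [] b))
      (trans (∑-cong′ Γ₁ (λ γ₁ → ∑-cong′ Γ₂ (λ γ₂ → lem (pos (LR γ₁ λ₁ μ₁)) (S γ₁ [] a) (pos (LR γ₂ λ₂ μ₂)) (S γ₂ [] b))))
        (sym (combine-∑ s a b)))))))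
      where
      lem : ∀ x y z t → (x * y) * (z * t) ≡ (x * z) * (y * t)
      lem = ℤ-solver.solve-∀

    combine-cong : ∀ {f g a b a′ b′} → (∀ γ₁ γ₂ → IsPartition γ₁ → IsPartition γ₂ → f γ₁ γ₂ a b ≡ g γ₁ γ₂ a′ b′) → combine f a b ≡ combine g a′ b′
    combine-cong {f} {g} {a} {b} {a′} {b′} e = trans (combine-∑ f a b) (trans (∑-cong Γ₁ (λ γ₁ γ₁∈ → ∑-cong Γ₂ (λ γ₂ γ₂∈ → cong (coeff γ₁ γ₂ *_)
      (e γ₁ γ₂ (proj₁ (sound (partitionsE (size λ₁ + size μ₁)) γ₁∈)) (proj₁ (sound (partitionsE (size λ₂ + size μ₂)) γ₂∈)))))) (sym (combine-∑ g a′ b′)))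

    Φ-combine : ∀ f a c → Φ (combine f) a c ≡ combine (λ γ₁ γ₂ → Φ (f γ₁ γ₂)) a c
    Φ-combine f a c = trans (∑₂-cong a (λ u v → combine-∑ f u (v ++ c))) (trans (∑₂-∑ a Γ₁ (λ γ₁ u v → ∑ Γ₂ (λ γ₂ → coeff γ₁ γ₂ * f γ₁ γ₂ u (v ++ c))))
      (trans (∑-cong′ Γ₁ (λ γ₁ → trans (∑₂-∑ a Γ₂ (λ γ₂ u v → coeff γ₁ γ₂ * f γ₁ γ₂ u (v ++ c))) (∑-cong′ Γ₂ (λ γ₂ → ∑₂-*ˡ a (coeff γ₁ γ₂) (λ u v → f γ₁ γ₂ u (v ++ c))))))
        (sym (combine-∑ (λ γ₁ γ₂ → Φ (f γ₁ γ₂)) a c))))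

    w*w : ∀ a b → (w λ₁ λ₂ *S w μ₁ μ₂) a b ≡ combine w a b
    w*w = Φ-injective (w λ₁ λ₂ *S w μ₁ μ₂) (combine w) (*S-Stable _ _ (w-Stable λ₁ λ₂ pλ₁ pλ₂) (w-Stable μ₁ μ₂ pμ₁ pμ₂))
      (λ a b → combine-cong {w} {w} (λ γ₁ γ₂ q₁ q₂ → w-Stable γ₁ γ₂ q₁ q₂ a b))
      (λ a c → trans (Φ-* (w λ₁ λ₂) (w μ₁ μ₂) a c) (trans (*S-cong (Φ-w λ₁ λ₂ pλ₁ pλ₂) (Φ-w μ₁ μ₂ pμ₁ pμ₂) a c)
        (trans (s*s a c) (sym (trans (Φ-combine w a c) (combine-cong {λ γ₁ γ₂ → Φ (w γ₁ γ₂)} {s} (λ γ₁ γ₂ q₁ q₂ → Φ-w γ₁ γ₂ q₁ q₂ a c)))))))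

open RemmelWhitneyBasis

open import Data.Integer using (+_)

mainTheorem1 : ∀ (λ₁ λ₂ μ₁ μ₂ : List _) →
    IsPartition λ₁ → IsPartition λ₂ → IsPartition μ₁ → IsPartition μ₂ →
    (w λ₁ λ₂ *S w μ₁ μ₂)
    ≈S sumS (concatMap (λ γ₁ → map (λ γ₂ →
    (+ (LR γ₁ λ₁ μ₁) * + (LR γ₂ λ₂ μ₂)) ·S w γ₁ γ₂)
    (partitions (size λ₂ + size μ₂)))
    (partitions (size λ₁ + size μ₁)))
mainTheorem1 λ₁ λ₂ μ₁ μ₂ pλ₁ pλ₂ pμ₁ pμ₂ = Product.w*w λ₁ λ₂ μ₁ μ₂ pλ₁ pλ₂ pμ₁ pμ₂
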